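{- Let $p$ be a prime. The group $\mathbb{Z}_2^3\times\mathbb{Z}_p$ is a CI-group with respect to color ternary relational structures if and only if $p\neq 3$ and $p\neq 7$.
   Context: A color $k$-ary relational structure is a pair $X=(V,(E_1,\ldots,E_c))$ with $V$ a set and $E_1,\ldots,E_c$ pairwise disjoint subsets of $V^k$; its automorphisms are the permutations of $V$ mapping each $E_i$ onto itself; "ternary" means $k=3$. For a group $G$, $g_L:G\to G$ is $h\mapsto gh$ and $G_L=\{g_L:g\in G\}$ (left regular representation). A (color) $k$-ary relational structure $X$ is a Cayley object of $G$ if $V=G$ and $G_L\le \mathrm{Aut}(X)$. $G$ is a CI-group with respect to a class $\mathcal{C}$ of Cayley objects of $G$ if any two $X,Y\in\mathcal{C}$ are isomorphic if and only if they are isomorphic via a group automorphism of $G$. -}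

module Defs where

open import Data.Nat using (ℕ; zero; suc)
import Data.Nat as ℕ
open import Data.Nat.DivMod using (_mod_)
open import Data.Fin using (Fin; toℕ)
open import Data.Product using (_×_; _,_; Σ; ∃)
open import Function using (_↔_; Inverse)
open import Relation.Binary.PropositionalEquality using (_≡_)

_+ₙ_ : {n : ℕ} → Fin n → Fin n → Fin n
_+ₙ_ {suc m} a b = (toℕ a ℕ.+ toℕ b) mod (suc m)

G : ℕ → Set
G p = Fin 2 × Fin 2 × Fin 2 × Fin p

_·_ : {p : ℕ} → G p → G p → G p
(a₁ , a₂ , a₃ , a) · (b₁ , b₂ , b₃ , b) =
  (a₁ +ₙ b₁ , a₂ +ₙ b₂ , a₃ +ₙ b₃ , a +ₙ b)

record ColorTernary (V : Set) (c : ℕ) : Set₁ where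
  field
    E        : Fin c → V × V × V → Set
    disjoint : ∀ i j t → E i t → E j t → i ≡ j
open ColorTernary public

act : {V : Set} → (V → V) → V × V × V → V × V × V
act f (x , y , z) = (f x , f y , f z)

IsIso : {V : Set} {c : ℕ} → ColorTernary V c → ColorTernary V c → V ↔ V → Set
IsIso X Y φ = ∀ i t → (E X i t → E Y i (act (Inverse.to φ) t))
                    × (E Y i (act (Inverse.to φ) t) → E X i t)

Isomorphic : {V : Set} {c : ℕ} → ColorTernary V c → ColorTernary V c → Set
Isomorphic {V} X Y = Σ (V ↔ V) (IsIso X Y)

IsCayley : {p c : ℕ} → ColorTernary (G p) c → Set
IsCayley {p} X = ∀ (g : G p) i t →
  (E X i t → E X i (act (g ·_) t)) × (E X i (act (g ·_) t) → E X i t)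

IsGroupAut : {p : ℕ} → G p ↔ G p → Set
IsGroupAut {p} α = ∀ (x y : G p) → Inverse.to α (x · y) ≡ Inverse.to α x · Inverse.to α y

IsCI-ColorTernary : ℕ → Set₁
IsCI-ColorTernary p = ∀ (c : ℕ) (X Y : ColorTernary (G p) c) → IsCayley X → IsCayley Y →
  (Isomorphic X Y → Σ (G p ↔ G p) (λ α → IsGroupAut α × IsIso X Y α))
  × (Σ (G p ↔ G p) (λ α → IsGroupAut α × IsIso X Y α) → Isomorphic X Y)

{-# OPTIONS --safe #-}
module Submission where

open import Defs
open import Data.Nat using (ℕ)
open import Data.Nat.Primality using (Prime)
open import Data.Product using (_×_)
open import Function.Bundles using (_⇔_)
open import Relation.Binary.PropositionalEquality using (_≢_)

-- Two Cayley structures isomorphic via φ have a common 3-closed group A of automorphisms containing the regular group G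
-- and φ⁻¹ G φ, and it suffices to correct φ by an element of A to an element of the holomorph of G. Let z generate the
-- factor of order p; its orbits are the eight rows. Letting an element of order p act on the cosets of A modulo the
-- permutations that are affine on rows, one finds k ∈ A such that φ k is affine on rows, unless A contains a conjugate
-- of z that moves rows, which forces p ≤ 7. The same counting for elementary abelian groups makes the row permutation
-- commute with a translation, which leaves the normal form (a , x) ↦ (a + f x , x). Since A is 3-closed, the shifts
-- along rows contained in A are exactly the functions respecting an equivalence of rows, and this determines enough
-- of A to match φ⁻¹ on every triple with an element of the form (element of A)(element of the holomorph).
--
-- If p = 5 and a conjugate of z moves rows, it acts on them as a five-cycle. Then either A is the symmetric group, or
-- the row shifts in A are constant, all row permutations lie in A, and an involution commuting with the conjugate of z
-- acts differently on different levels B × {y}; commutators then put all level-preserving permutations into A, and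
-- counting cosets modulo the permutations affine on levels aligns φ.
--
-- For p = 7 and p = 3, multiplication by a generator of F₈ (of F₄) acting on level l by its l-th power carries one
-- structure to another, but no automorphism of G does.

module Count where

  open import Data.Nat hiding (_≟_)
  open import Data.Nat.Properties hiding (_≟_)
  open import Data.Nat.Divisibility
  open import Data.Nat.Primality
  open import Data.Nat.Coprimality using (Coprime; prime⇒coprime; coprime-Bézout)
  open import Data.Nat.GCD using (module Bézout)
  open import Data.List hiding (find)
  open import Data.List.Properties
  open import Data.List.Relation.Unary.Any as Any using (Any; here; there)
  open import Data.List.Relation.Unary.All as All using (All; []; _∷_)
  open import Data.List.Relation.Unary.AllPairs using ([]; _∷_)
  import Data.List.Relation.Unary.Unique.Setoid.Properties as UniqueP
  import Data.List.Membership.Setoid.Properties as MemP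
  open import Data.Product hiding (map)
  open import Data.Empty
  open import Function using (_∘_)
  open import Relation.Nullary
  open import Relation.Binary
  open import Relation.Binary.PropositionalEquality as ≡ using (_≡_; _≢_; cong; subst)
  open import Relation.Nullary.Decidable using (¬?)
  open import Level using (0ℓ)

  iter : ∀ {a} {X : Set a} → (X → X) → ℕ → X → X
  iter f zero    x = x
  iter f (suc n) x = f (iter f n x)

  length-split : ∀ {a} {X : Set a} {P : X → Set} (P? : ∀ x → Dec (P x)) xs →
                 length xs ≡ length (filter (¬? ∘ P?) xs) + length (filter P? xs)
  length-split P? [] = ≡.refl
  length-split P? (x ∷ xs) with P? x
  ... | yes _ = ≡.trans (cong suc (length-split P? xs)) (≡.sym (+-suc _ _))
  ... | no  _ = cong suc (length-split P? xs)

  filter-filter : ∀ {a} {X : Set a} {P Q : X → Set} (P? : ∀ x → Dec (P x)) (Q? : ∀ x → Dec (Q x)) →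
                  (∀ {x} → Q x → P x) → ∀ xs → filter Q? (filter P? xs) ≡ filter Q? xs
  filter-filter P? Q? imp [] = ≡.refl
  filter-filter P? Q? imp (x ∷ xs) with P? x
  ... | no ¬p = ≡.trans (filter-filter P? Q? imp xs) (≡.sym (filter-reject Q? (¬p ∘ imp)))
  ... | yes _ with Q? x
  ...   | yes _ = cong (x ∷_) (filter-filter P? Q? imp xs)
  ...   | no  _ = filter-filter P? Q? imp xs

  module Counting (DS : DecSetoid 0ℓ 0ℓ) where
    open DecSetoid DS renaming (Carrier to S)
    open import Data.List.Membership.Setoid setoid public using (_∈_)
    open import Data.List.Relation.Unary.Unique.Setoid setoid public using (Unique)

    _⊆_ : List S → List S → Set
    xs ⊆ ys = ∀ {x} → x ∈ xs → x ∈ ys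

    All⇒∉ : ∀ {x xs} → All (λ y → ¬ x ≈ y) xs → ¬ x ∈ xs
    All⇒∉ (p ∷ ps) (here q)  = p q
    All⇒∉ (p ∷ ps) (there q) = All⇒∉ ps q

    length-mono : ∀ {xs} → Unique xs → ∀ {ys} → xs ⊆ ys → length xs ≤ length ys
    length-mono [] _ = z≤n
    length-mono {x ∷ xs} (px ∷ pxs) {ys} sub =
      ≤-trans (s≤s (length-mono pxs sub'))
        (filter-notAll other? ys (Any.map (λ x≈y ¬x≈y → ¬x≈y x≈y) (sub (here refl))))
      where
      other? : ∀ y → Dec (¬ (x ≈ y))
      other? y = ¬? (x ≟ y)
      sub' : xs ⊆ filter other? ys
      sub' z∈ = MemP.∈-filter⁺ setoid other? (λ y≈z x≉y x≈z → x≉y (trans x≈z (sym y≈z)))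
                  (sub (there z∈))
                  (λ x≈z → All⇒∉ px (MemP.∈-resp-≈ setoid (sym x≈z) z∈))

    length-≡ : ∀ {xs ys} → Unique xs → Unique ys → xs ⊆ ys → ys ⊆ xs → length xs ≡ length ys
    length-≡ u v s t = ≤-antisym (length-mono u s) (length-mono v t)

    -- If no class had size prime to q, the length would be a multiple of q.
    big-class : ∀ (q : ℕ) {_∼_ : S → S → Set} (_∼?_ : ∀ x y → Dec (x ∼ y)) →
                (∀ {x} → x ∼ x) → (∀ {x y z} → x ∼ y → z ∼ y → x ∼ z) →
                ∀ xs → ¬ q ∣ length xs → ∃ λ x → Any (x ≡_) xs × ¬ q ∣ length (filter (x ∼?_) xs)
    big-class q {_∼_} _∼?_ rfl eucl xs = go (length xs) xs ≤-refl
      where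
      go : ∀ n xs → length xs ≤ n → ¬ q ∣ length xs →
           ∃ λ x → Any (x ≡_) xs × ¬ q ∣ length (filter (x ∼?_) xs)
      go n [] _ ¬d = ⊥-elim (¬d (q ∣0))
      go (suc n) xs@(x ∷ ys) (s≤s le) ¬d with q ∣? length (filter (x ∼?_) xs)
      ... | no ¬c = x , here ≡.refl , ¬c
      ... | yes c = let (y , y∈ , ¬e) = go n rest le' ¬r in
                    y , mem y∈ , λ e → ¬e (subst (λ l → q ∣ length l) (≡.sym (same y∈)) e)
        where
        rest = filter (¬? ∘ (x ∼?_)) xs
        ¬r : ¬ q ∣ length rest
        ¬r r = ¬d (subst (q ∣_) (≡.sym (length-split (x ∼?_) xs)) (∣m∣n⇒∣m+n r c))
        le' : length rest ≤ n
        le' = ≤-trans (≤-reflexive (cong length (filter-reject (¬? ∘ (x ∼?_)) {x} {ys} (λ n → n rfl))))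
                      (≤-trans (length-filter _ ys) le)
        out : ∀ {y} zs → Any (y ≡_) (filter (¬? ∘ (x ∼?_)) zs) → Any (y ≡_) zs × ¬ x ∼ y
        out {y} (z ∷ zs) p with x ∼? z
        out {y} (z ∷ zs) p         | yes _ = map₁ there (out zs p)
        out {y} (z ∷ zs) (here ≡.refl) | no n  = here ≡.refl , n
        out {y} (z ∷ zs) (there p) | no n  = map₁ there (out zs p)
        mem : ∀ {y} → Any (y ≡_) rest → Any (y ≡_) xs
        mem p = proj₁ (out xs p)
        same : ∀ {y} → Any (y ≡_) rest → filter (y ∼?_) rest ≡ filter (y ∼?_) xs
        same {y} p = filter-filter (¬? ∘ (x ∼?_)) (y ∼?_) (λ y∼z x∼z → proj₂ (out xs p) (eucl x∼z y∼z)) xs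

    module Cyclic {q : ℕ} (q-prime : Prime q) (g : S → S)
                  (g-cong : ∀ {x y} → x ≈ y → g x ≈ g y) (g-per : ∀ x → iter g q x ≈ x) where

      fixed? : ∀ x → Dec (g x ≈ x)
      fixed? x = g x ≟ x

      iter-cong : ∀ n {x y} → x ≈ y → iter g n x ≈ iter g n y
      iter-cong zero    e = e
      iter-cong (suc n) e = g-cong (iter-cong n e)

      iter-+ : ∀ m n x → iter g (m + n) x ≡ iter g m (iter g n x)
      iter-+ zero    n x = ≡.refl
      iter-+ (suc m) n x = cong g (iter-+ m n x)

      iter-* : ∀ m n {x} → iter g n x ≈ x → iter g (m * n) x ≈ x
      iter-* zero    n e = refl
      iter-* (suc m) n {x} e =
        trans (reflexive (iter-+ n (m * n) x)) (trans (iter-cong n (iter-* m n e)) e)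

      instance
        q≢0 : NonZero q
        q≢0 = prime⇒nonZero q-prime

      iter-inj : ∀ n {x y} → iter g n x ≈ iter g n y → x ≈ y
      iter-inj n {x} {y} e = trans (sym (back x)) (trans (iter-cong (n * pred q) e) (back y))
        where
        back : ∀ x → iter g (n * pred q) (iter g n x) ≈ x
        back x = trans (reflexive (≡.trans (≡.sym (iter-+ (n * pred q) n x))
                   (cong (λ k → iter g k x)
                     (≡.trans (+-comm (n * pred q) n) (≡.trans (≡.sym (*-suc n (pred q)))
                       (cong (n *_) (suc-pred q)))))))
                   (iter-* n q (g-per x))

      coprime-fixed : ∀ {d x} → Coprime d q → iter g d x ≈ x → g x ≈ x
      coprime-fixed {d} {x} c e with coprime-Bézout c
      ... | Bézout.+- a b eq = trans (g-cong (sym (iter-* b q (g-per x))))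
                                 (trans (reflexive (cong (λ k → iter g k x) eq)) (iter-* a d e))
      ... | Bézout.-+ a b eq = trans (g-cong (sym (iter-* a d e)))
                                 (trans (reflexive (cong (λ k → iter g k x) eq)) (iter-* b q (g-per x)))

      small-fixed : ∀ {d x} → 0 < d → d < q → iter g d x ≈ x → g x ≈ x
      small-fixed {d} 0<d d<q = coprime-fixed λ (a , b) → prime⇒coprime q-prime {{>-nonZero 0<d}} d<q (b , a)

      orbit : S → List S
      orbit x = applyUpTo (λ i → iter g i x) q

      orbit-unique : ∀ {x} → ¬ g x ≈ x → Unique (orbit x)
      orbit-unique {x} nf = UniqueP.applyUpTo⁺₁ setoid (λ i → iter g i x) q
        λ {i} {j} i<j j<q e → nf (small-fixed (m<n⇒0<n∸m i<j) (≤-<-trans (m∸n≤m j i) j<q)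
          (sym (iter-inj i (trans e (reflexive
            (≡.trans (cong (λ k → iter g k x) (≡.sym (m+[n∸m]≡n (<⇒≤ i<j)))) (iter-+ i (j ∸ i) x)))))))

      _∼_ : S → S → Set
      x ∼ y = y ∈ orbit x

      _∼?_ : ∀ x y → Dec (x ∼ y)
      x ∼? y = Any.any? (y ≟_) (orbit x)

      iter∼ : ∀ n x → x ∼ iter g n x
      iter∼ zero x = MemP.∈-applyUpTo⁺ setoid _ (>-nonZero⁻¹ q)
      iter∼ (suc n) x with MemP.∈-applyUpTo⁻ setoid _ (iter∼ n x)
      ... | i , i<q , e with suc i ≟ℕ q
        where open import Data.Nat.Properties renaming (_≟_ to _≟ℕ_)
      ...   | yes ≡.refl = MemP.∈-resp-≈ setoid (sym (trans (g-cong e) (g-per x))) (iter∼ zero x)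
      ...   | no  ne = MemP.∈-resp-≈ setoid (sym (g-cong e))
                         (MemP.∈-applyUpTo⁺ setoid (λ i → iter g i x) (≤∧≢⇒< i<q ne))

      ∼-iter : ∀ {x y} → x ∼ y → ∃ λ i → y ≈ iter g i x × i < q
      ∼-iter p = let (i , l , e) = MemP.∈-applyUpTo⁻ setoid _ p in i , e , l

      ∼-eucl : ∀ {x y z} → x ∼ y → z ∼ y → x ∼ z
      ∼-eucl {x} {y} {z} p r with ∼-iter p | ∼-iter r
      ... | i , e , _ | j , f , j<q = MemP.∈-resp-≈ setoid (sym z≈) (iter∼ ((q ∸ j) + i) x)
        where
        z≈ : z ≈ iter g ((q ∸ j) + i) x
        z≈ = trans (sym (g-per z))
               (trans (reflexive (≡.trans (cong (λ k → iter g k z) (≡.sym (m∸n+n≡m (<⇒≤ j<q))))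
                                          (iter-+ (q ∸ j) j z)))
                 (trans (iter-cong (q ∸ j) (trans (sym f) e)) (reflexive (≡.sym (iter-+ (q ∸ j) i x)))))

      count-mod : ∀ {xs} → Unique xs → (∀ {x} → x ∈ xs → g x ∈ xs) →
                  ∃ λ k → length xs ≡ k * q + length (filter fixed? xs)
      count-mod {xs} u closed with q ∣? length moved
        where moved = filter (¬? ∘ fixed?) xs
      ... | yes (divides k e) = k , ≡.trans (length-split fixed? xs) (cong (_+ length (filter fixed? xs)) e)
      ... | no ¬d = ⊥-elim (contra (big-class q _∼?_ (iter∼ 0 _) ∼-eucl moved ¬d))
        where
        moved = filter (¬? ∘ fixed?) xs
        resp : ∀ {x y} → x ≈ y → ¬ (g x ≈ x) → ¬ (g y ≈ y)
        resp e nf f = nf (trans (g-cong e) (trans f (sym e)))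
        closed' : ∀ {x} → x ∈ moved → g x ∈ moved
        closed' x∈ = let (a , b) = MemP.∈-filter⁻ setoid (¬? ∘ fixed?) resp x∈ in
                     MemP.∈-filter⁺ setoid (¬? ∘ fixed?) resp (closed a) (λ f → b (iter-inj 1 f))
        iter-closed : ∀ n {x} → x ∈ moved → iter g n x ∈ moved
        iter-closed zero x∈ = x∈
        iter-closed (suc n) x∈ = closed' (iter-closed n x∈)
        contra : ¬ (∃ λ x → Any (x ≡_) moved × ¬ q ∣ length (filter (x ∼?_) moved))
        contra (x , x∈ , nd) = nd (subst (q ∣_) (≡.sym eq) (divides 1 (≡.sym (+-identityʳ q))))
          where
          x∈' : x ∈ moved
          x∈' = Any.map reflexive x∈
          resp' : ∀ {y z} → y ≈ z → x ∼ y → x ∼ z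
          resp' e = MemP.∈-resp-≈ setoid e
          eq : length (filter (x ∼?_) moved) ≡ q
          eq = ≡.trans (length-≡
                 (UniqueP.filter⁺ setoid (x ∼?_) (UniqueP.filter⁺ setoid (¬? ∘ fixed?) u))
                 (orbit-unique (proj₂ (MemP.∈-filter⁻ setoid (¬? ∘ fixed?) resp {xs = xs} x∈')))
                 (λ p → proj₂ (MemP.∈-filter⁻ setoid (x ∼?_) resp' {xs = moved} p))
                 (λ p → MemP.∈-filter⁺ setoid (x ∼?_) resp'
                          (let (i , e , _) = ∼-iter p in MemP.∈-resp-≈ setoid (sym e) (iter-closed i x∈')) p))
               (length-applyUpTo _ q)

      fixed-resp : ∀ {x y} → x ≈ y → g x ≈ x → g y ≈ y
      fixed-resp e f = trans (g-cong (sym e)) (trans f e)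

      some-fixed : ∀ {xs} → Unique xs → (∀ {x} → x ∈ xs → g x ∈ xs) → ¬ q ∣ length xs →
                   ∃ λ x → x ∈ xs × g x ≈ x
      some-fixed {xs} u closed ¬d = pick (filter fixed? xs) ≡.refl
        where
        pick : ∀ ys → filter fixed? xs ≡ ys → ∃ λ x → x ∈ xs × g x ≈ x
        pick [] e = ⊥-elim (¬d (divides (proj₁ (count-mod u closed))
          (≡.trans (proj₂ (count-mod u closed))
            (≡.trans (cong (λ ys → proj₁ (count-mod u closed) * q + length ys) e) (+-identityʳ _)))))
        pick (y ∷ ys) e = y , MemP.∈-filter⁻ setoid fixed? fixed-resp (subst (y ∈_) (≡.sym e) (here refl))

      unique-fixed : ∀ {xs x₀} → Unique xs → (∀ {x} → x ∈ xs → g x ∈ xs) → x₀ ∈ xs → g x₀ ≈ x₀ →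
                     (∀ {x} → x ∈ xs → g x ≈ x → x ≈ x₀) → ¬ q ∣ length xs
      unique-fixed {xs} {x₀} u closed x₀∈ f only d = ¬prime[1] (subst Prime (∣1⇒≡1 q∣1) q-prime)
        where
        one : length (filter fixed? xs) ≡ 1
        one = length-≡ (UniqueP.filter⁺ setoid fixed? u) ([] ∷ [])
          (λ y∈ → let (a , b) = MemP.∈-filter⁻ setoid fixed? fixed-resp {xs = xs} y∈ in here (only a b))
          (λ { (here e) → MemP.∈-resp-≈ setoid (sym e) (MemP.∈-filter⁺ setoid fixed? fixed-resp x₀∈ f) })
        n = proj₁ (count-mod u closed)
        q∣1 : q ∣ 1
        q∣1 = ∣m+n∣m⇒∣n (subst (q ∣_) (≡.trans (proj₂ (count-mod u closed)) (cong (n * q +_) one)) d)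
                        (divides n ≡.refl)

    module Commuting {q : ℕ} (q-prime : Prime q) {I : Set} (g : I → S → S)
                     (g-cong : ∀ i {x y} → x ≈ y → g i x ≈ g i y)
                     (g-per : ∀ i x → iter (g i) q x ≈ x)
                     (g-comm : ∀ i j x → g i (g j x) ≈ g j (g i x)) where
      private module C i = Cyclic q-prime (g i) (g-cong i) (g-per i)

      Closed : List S → Set
      Closed xs = ∀ i {x} → x ∈ xs → g i x ∈ xs

      step : ∀ {xs} → Unique xs → Closed xs → ∀ i →
             let ys = filter (C.fixed? i) xs in
             Unique ys × Closed ys × (q ∣ length xs → q ∣ length ys) × (q ∣ length ys → q ∣ length xs)
      step {xs} u cl i = UniqueP.filter⁺ setoid (C.fixed? i) u ,
        (λ j x∈ → let (a , f) = MemP.∈-filter⁻ setoid (C.fixed? i) (C.fixed-resp i) {xs = xs} x∈ in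
          MemP.∈-filter⁺ setoid (C.fixed? i) (C.fixed-resp i) (cl j a)
            (trans (g-comm i j _) (g-cong j f))) ,
        (λ d → ∣m+n∣m⇒∣n (subst (q ∣_) eq d) (divides n ≡.refl)) ,
        (λ d → subst (q ∣_) (≡.sym eq) (∣m∣n⇒∣m+n (divides n ≡.refl) d))
        where
        n  = proj₁ (C.count-mod i u (cl i))
        eq = proj₂ (C.count-mod i u (cl i))

      common : ∀ {xs} → Unique xs → Closed xs → (is : List I) → ∃ λ ys →
               (∀ {x} → x ∈ ys → x ∈ xs × All (λ i → g i x ≈ x) is) ×
               (∀ {x} → x ∈ xs → All (λ i → g i x ≈ x) is → x ∈ ys) ×
               Unique ys × Closed ys × (q ∣ length xs → q ∣ length ys) × (q ∣ length ys → q ∣ length xs)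
      common {xs} u cl [] = xs , (λ x∈ → x∈ , []) , (λ x∈ _ → x∈) , u , cl , (λ d → d) , (λ d → d)
      common {xs} u cl (i ∷ is) with common u cl is
      ... | ys , out , inn , u' , cl' , f , b with step u' cl' i
      ...   | u'' , cl'' , f' , b' = filter (C.fixed? i) ys ,
              (λ x∈ → let (a , e) = MemP.∈-filter⁻ setoid (C.fixed? i) (C.fixed-resp i) {xs = ys} x∈
                          (c , es) = out a in c , e ∷ es) ,
              (λ { x∈ (e ∷ es) → MemP.∈-filter⁺ setoid (C.fixed? i) (C.fixed-resp i) (inn x∈ es) e }) ,
              u'' , cl'' , (λ d → f' (f d)) , (λ d → b (b' d))

      common-fixed : ∀ {xs} → Unique xs → Closed xs → (is : List I) → ¬ q ∣ length xs →
                     ∃ λ x → x ∈ xs × All (λ i → g i x ≈ x) is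
      common-fixed u cl is ¬d with common u cl is
      ... | [] , _ , _ , _ , _ , _ , b = ⊥-elim (¬d (b (q ∣0)))
      ... | x ∷ _ , out , _ = x , out (here refl)

      common-count : ∀ {xs ys} → Unique xs → Closed xs → (is : List I) → Unique ys →
                     (∀ {x} → x ∈ ys → x ∈ xs × All (λ i → g i x ≈ x) is) →
                     (∀ {x} → x ∈ xs → All (λ i → g i x ≈ x) is → x ∈ ys) →
                     ¬ q ∣ length ys → ¬ q ∣ length xs
      common-count u cl is v out inn ¬d d with common u cl is
      ... | zs , out' , inn' , u' , _ , f , _ = ¬d (subst (q ∣_)
              (length-≡ u' v (λ z∈ → let (a , b) = out' z∈ in inn a b) (λ y∈ → let (a , b) = out y∈ in inn' a b))
              (f d))

module Perms where

  open import Data.Nat hiding (_≟_)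
  open import Data.List hiding (find)
  open import Data.List.Relation.Unary.Any as Any using (Any; here; there)
  open import Data.List.Relation.Unary.All as All using (All; []; _∷_)
  open import Data.List.Relation.Unary.AllPairs using ([]; _∷_)
  import Data.List.Relation.Unary.Any.Properties as AnyP
  open import Data.List.Membership.Propositional using (_∈_)
  open import Data.List.Membership.Propositional.Properties using (∈-cartesianProductWith⁺; ∈-cartesianProduct⁺)
  open import Data.Product hiding (map)
  open import Data.Empty
  open import Function using (_∘_)
  open import Relation.Nullary
  open import Relation.Nullary.Decidable using (_×-dec_; map′)
  open import Relation.Binary
  open import Relation.Binary.PropositionalEquality as ≡ using (_≡_; cong; refl; sym; trans)
  open import Level using (0ℓ)

  record Perm (V : Set) : Set where
    no-eta-equality
    constructor perm
    field
      to      : V → V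
      from    : V → V
      to-from : ∀ x → to (from x) ≡ x
      from-to : ∀ x → from (to x) ≡ x
  open Perm public

  module _ {V : Set} where

    idₚ : Perm V
    idₚ = perm (λ x → x) (λ x → x) (λ _ → refl) (λ _ → refl)

    abstract
      ∙-inverse : ∀ (f g : Perm V) x → to f (to g (from g (from f x))) ≡ x
      ∙-inverse f g x = trans (cong (to f) (to-from g _)) (to-from f x)

      ∙-inverse' : ∀ (f g : Perm V) x → from g (from f (to f (to g x))) ≡ x
      ∙-inverse' f g x = trans (cong (from g) (from-to f _)) (from-to g x)

    infixr 9 _∙_
    _∙_ : Perm V → Perm V → Perm V
    f ∙ g = perm (to f ∘ to g) (from g ∘ from f) (∙-inverse f g) (∙-inverse' f g)

    infix 10 _⁻¹
    _⁻¹ : Perm V → Perm V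
    f ⁻¹ = perm (from f) (to f) (from-to f) (to-from f)

    infix 4 _≗ₚ_
    record _≗ₚ_ (f g : Perm V) : Set where
      constructor pt
      field at : ∀ x → to f x ≡ to g x
    open _≗ₚ_ public

    to-inj : (f : Perm V) → ∀ {x y} → to f x ≡ to f y → x ≡ y
    to-inj f {x} {y} e = trans (sym (from-to f x)) (trans (cong (from f) e) (from-to f y))

    from-≡ : (f : Perm V) → ∀ {x y} → to f x ≡ y → from f y ≡ x
    from-≡ f {x} refl = from-to f x

    ⁻¹-cong : ∀ {f g} → f ≗ₚ g → f ⁻¹ ≗ₚ g ⁻¹
    ⁻¹-cong {f} {g} e = pt λ x → from-≡ f (trans (at e _) (to-from g x))

    ≗-refl : ∀ {f} → f ≗ₚ f
    ≗-refl = pt λ _ → refl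

    ≗-sym : ∀ {f g} → f ≗ₚ g → g ≗ₚ f
    ≗-sym e = pt λ x → sym (at e x)

    ≗-trans : ∀ {f g h} → f ≗ₚ g → g ≗ₚ h → f ≗ₚ h
    ≗-trans e f = pt λ x → trans (at e x) (at f x)

  record Group (V : Set) : Set₁ where
    field
      mem    : Perm V → Set
      mem?   : ∀ f → Dec (mem f)
      resp   : ∀ {f g} → f ≗ₚ g → mem f → mem g
      id∈    : mem idₚ
      ∙∈     : ∀ {f g} → mem f → mem g → mem (f ∙ g)
      ⁻¹∈    : ∀ {f} → mem f → mem (f ⁻¹)

  Closed₃ : ∀ {V} → Group V → Set
  Closed₃ {V} A = ∀ f → (∀ x y z → ∃ λ k → mem k × to k x ≡ to f x × to k y ≡ to f y × to k z ≡ to f z) → mem f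
    where open Group A

  module Finite {V : Set} (_≟_ : DecidableEquality V) (vs : List V) (cover : ∀ x → x ∈ vs) where

    ∀? : ∀ {P : V → Set} → (∀ x → Dec (P x)) → Dec (∀ x → P x)
    ∀? P? = map′ (λ a x → All.lookup a (cover x)) (λ h → All.tabulate (λ {x} _ → h x)) (All.all? P? vs)

    ∃? : ∀ {P : V → Set} → (∀ x → Dec (P x)) → Dec (∃ P)
    ∃? P? = map′ Any.satisfied (λ (x , p) → Any.map (λ { refl → p }) (cover x)) (Any.any? P? vs)

    update : V → V → (V → V) → V → V
    update u w f x with x ≟ u
    ... | yes _ = w
    ... | no  _ = f x

    tables : List V → List (V → V)
    tables []       = (λ x → x) ∷ []
    tables (u ∷ us) = cartesianProductWith (update u) vs (tables us)

    tables-complete : ∀ (h : V → V) us → ∃ λ f → f ∈ tables us × (∀ {x} → x ∈ us → f x ≡ h x)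
    tables-complete h []       = _ , here refl , λ ()
    tables-complete h (u ∷ us) with tables-complete h us
    ... | f , f∈ , e = update u (h u) f , ∈-cartesianProductWith⁺ (update u) (cover (h u)) f∈ , agree
      where
      agree : ∀ {x} → x ∈ u ∷ us → update u (h u) f x ≡ h x
      agree {x} x∈ with x ≟ u
      ... | yes refl = refl
      agree (here p)  | no ne = ⊥-elim (ne p)
      agree (there p) | no ne = e p

    Inverses : (V → V) × (V → V) → Set
    Inverses (f , g) = (∀ x → f (g x) ≡ x) × (∀ x → g (f x) ≡ x)

    inverses? : ∀ fg → Dec (Inverses fg)
    inverses? (f , g) = ∀? (λ x → f (g x) ≟ x) ×-dec ∀? (λ x → g (f x) ≟ x)

    toPerms : (V → V) × (V → V) → List (Perm V)
    toPerms fg with inverses? fg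
    ... | yes (p , q) = perm (proj₁ fg) (proj₂ fg) p q ∷ []
    ... | no  _       = []

    abstract
      perms : List (Perm V)
      perms = concatMap toPerms (cartesianProduct (tables vs) (tables vs))

      perms-complete : ∀ h → Any (h ≗ₚ_) perms
      perms-complete h with tables-complete (to h) vs | tables-complete (from h) vs
      ... | f , f∈ , ef | g , g∈ , eg =
        AnyP.concatMap⁺ toPerms (Any.map (λ { refl → found }) (∈-cartesianProduct⁺ f∈ g∈))
        where
        found : Any (h ≗ₚ_) (toPerms (f , g))
        found with inverses? (f , g)
        ... | yes _ = here (pt λ x → sym (ef (cover x)))
        ... | no ¬i = ⊥-elim (¬i
          ( (λ x → trans (ef (cover _)) (trans (cong (to h) (eg (cover x))) (to-from h x)))
          , (λ x → trans (eg (cover _)) (trans (cong (from h) (ef (cover x))) (from-to h x)))))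

    _≗?_ : (f g : Perm V) → Dec (f ≗ₚ g)
    f ≗? g = map′ pt at (∀? (λ x → to f x ≟ to g x))

    ∃perm? : ∀ {P : Perm V → Set} → (∀ {f g} → f ≗ₚ g → P f → P g) → (∀ f → Dec (P f)) → Dec (∃ P)
    ∃perm? r P? = map′ Any.satisfied (λ (f , p) → Any.map (λ e → r e p) (perms-complete f)) (Any.any? P? perms)

    permDecSetoid : DecSetoid 0ℓ 0ℓ
    permDecSetoid = record
      { Carrier = Perm V ; _≈_ = _≗ₚ_
      ; isDecEquivalence = record
        { isEquivalence = record { refl = ≗-refl ; sym = ≗-sym ; trans = ≗-trans }
        ; _≟_ = _≗?_ } }

module Sylow where

  open import Data.Nat hiding (_≟_)
  open import Data.Nat.Properties hiding (_≟_)
  open import Data.Nat.Divisibility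
  open import Data.Nat.Primality
  open import Data.List hiding (find)
  open import Data.List.Relation.Unary.Any as Any using (Any)
  import Data.List.Relation.Unary.Unique.DecSetoid.Properties as UniqueDP
  import Data.List.Membership.Setoid.Properties as MemP
  open import Data.List.Membership.Propositional as Mem using () renaming (_∈_ to _∈ₚ_)
  open import Data.Product hiding (map)
  open import Data.Sum using (_⊎_; inj₁; inj₂)
  open import Data.Empty
  open import Function using (_∘_)
  open import Relation.Nullary
  open import Relation.Nullary.Decidable using (_×-dec_; map′; ¬?)
  open import Relation.Binary
  open import Relation.Binary.PropositionalEquality as ≡ using (_≡_; cong; refl; sym; trans)
  open import Level using (0ℓ)
  open Count
  open Perms

  _∩_ : ∀ {V} → Group V → Group V → Group V
  A ∩ N = record
    { mem  = λ f → A.mem f × N.mem f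
    ; mem? = λ f → A.mem? f ×-dec N.mem? f
    ; resp = λ e (a , n) → A.resp e a , N.resp e n
    ; id∈  = A.id∈ , N.id∈
    ; ∙∈   = λ (a , n) (b , m) → A.∙∈ a b , N.∙∈ n m
    ; ⁻¹∈  = λ (a , n) → A.⁻¹∈ a , N.⁻¹∈ n }
    where
    module A = Group A
    module N = Group N

  module FiniteSylow {V : Set} (_≟_ : DecidableEquality V) (vs : List V) (cover : ∀ x → x ∈ₚ vs) where
    open Finite _≟_ vs cover

    module Cosets (A N : Group V) where
      private
        module A = Group A
        module N = Group N
        module M = Group (A ∩ N)

      infix 4 _≈_
      record _≈_ (k l : Perm V) : Set where
        constructor coset
        field diff : M.mem (k ⁻¹ ∙ l)
      open _≈_

      ≗⇒≈ : ∀ {k l} → k ≗ₚ l → k ≈ l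
      ≗⇒≈ {k} e = coset (M.resp (pt λ x → sym (from-≡ k (at e x))) M.id∈)

      ≈-refl : ∀ {k} → k ≈ k
      ≈-refl = ≗⇒≈ ≗-refl

      ≈-sym : ∀ {k l} → k ≈ l → l ≈ k
      ≈-sym e = coset (M.resp (pt λ _ → refl) (M.⁻¹∈ (diff e)))

      ≈-trans : ∀ {j k l} → j ≈ k → k ≈ l → j ≈ l
      ≈-trans {j} {k} {l} e f =
        coset (M.resp (pt λ x → cong (from j) (to-from k (to l x))) (M.∙∈ (diff e) (diff f)))

      mul-cong : ∀ z {k l} → k ≈ l → (z ∙ k) ≈ (z ∙ l)
      mul-cong z {k} {l} e = coset (M.resp (pt λ x → cong (from k) (sym (from-to z (to l x)))) (diff e))

      cosetDecSetoid : DecSetoid 0ℓ 0ℓ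
      cosetDecSetoid = record
        { Carrier = Perm V ; _≈_ = _≈_
        ; isDecEquivalence = record
          { isEquivalence = record { refl  = ≈-refl ; sym   = ≈-sym ; trans = ≈-trans }
          ; _≟_ = λ k l → map′ coset diff (M.mem? _) } }

      open DecSetoid cosetDecSetoid using (setoid) renaming (_≟_ to _≈?_)
      open Counting cosetDecSetoid

      A-resp : ∀ {k l} → k ≈ l → A.mem k → A.mem l
      A-resp {k} {l} e m = A.resp (pt λ x → to-from k (to l x)) (A.∙∈ m (proj₁ (diff e)))

      abstract
        cosets : List (Perm V)
        cosets = deduplicate _≈?_ (filter A.mem? perms)

        cosets-unique : Unique cosets
        cosets-unique = UniqueDP.deduplicate-! cosetDecSetoid (filter A.mem? perms)

        ∈cosets : ∀ {k} → A.mem k → k ∈ cosets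
        ∈cosets m = MemP.∈-deduplicate⁺ setoid _≈?_ (λ e f → ≈-trans f (≈-sym e))
          (MemP.∈-filter⁺ setoid A.mem? A-resp (Any.map ≗⇒≈ (perms-complete _)) m)

        cosets∈ : ∀ {k} → k ∈ cosets → A.mem k
        cosets∈ k∈ = proj₂ (MemP.∈-filter⁻ setoid A.mem? A-resp {xs = perms}
          (MemP.∈-deduplicate⁻ setoid _≈?_ (filter A.mem? perms) k∈))

      module LeftMul {q : ℕ} (q-prime : Prime q) (z : Perm V) (z∈ : A.mem z)
                     (z-per : ∀ x → iter (to z) q x ≡ x) where

        iter-mul : ∀ n k x → to (iter (z ∙_) n k) x ≡ iter (to z) n (to k x)
        iter-mul zero    k x = refl
        iter-mul (suc n) k x = cong (to z) (iter-mul n k x)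

        open Cyclic q-prime (z ∙_) (mul-cong z)
          (λ k → ≗⇒≈ (pt λ x → trans (iter-mul q k x) (z-per _))) public

        closed : ∀ {k} → k ∈ cosets → (z ∙ k) ∈ cosets
        closed k∈ = ∈cosets (A.∙∈ z∈ (cosets∈ k∈))

        fixed⇒ : ∀ {k} → (z ∙ k) ≈ k → M.mem (k ⁻¹ ∙ z ∙ k)
        fixed⇒ m = M.resp (pt λ _ → refl) (M.⁻¹∈ (diff m))

        fixed⇐ : ∀ k → M.mem (k ⁻¹ ∙ z ∙ k) → (z ∙ k) ≈ k
        fixed⇐ k m = coset (M.resp (pt λ _ → refl) (M.⁻¹∈ m))

      module _ {q : ℕ} (q-prime : Prime q) (z z' : Perm V) (z∈ : A.mem z) (z'∈ : A.mem z')
               (z-per : ∀ x → iter (to z) q x ≡ x) (z'-per : ∀ x → iter (to z') q x ≡ x)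
               (zN : N.mem z) where
        private
          module L = LeftMul q-prime z z∈ z-per
          module L' = LeftMul q-prime z' z'∈ z'-per

        Alien : Perm V → Set
        Alien k = A.mem k × ¬ N.mem k × N.mem (k ⁻¹ ∙ z ∙ k)

        alien? : Dec (∃ Alien)
        alien? = ∃perm?
          (λ {f} {g} e (a , b , c) → A.resp e a , (λ n → b (N.resp (≗-sym e) n)) ,
            N.resp (pt λ x → trans (at (⁻¹-cong e) _) (cong (from g ∘ to z) (at e x))) c)
          (λ k → A.mem? k ×-dec ¬? (N.mem? k) ×-dec N.mem? _)

        -- z acts on A/N fixing the trivial coset; if it fixes no other, |A/N| ≡ 1 (mod q) and z' has a fixed coset too.
        coset-fixed : (∃ λ k → A.mem k × N.mem (k ⁻¹ ∙ z' ∙ k)) ⊎ ∃ Alien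
        coset-fixed with alien?
        ... | yes a = inj₂ a
        ... | no ¬a = inj₁ (let (k , k∈ , f) = fix in k , cosets∈ k∈ , proj₂ (L'.fixed⇒ f))
          where
          only : ∀ {k} → k ∈ cosets → (z ∙ k) ≈ k → k ≈ idₚ
          only {k} k∈ f with N.mem? k
          ... | yes n = coset (M.resp (pt λ _ → refl) (M.⁻¹∈ (cosets∈ k∈ , n)))
          ... | no ¬n = ⊥-elim (¬a (k , cosets∈ k∈ , ¬n , proj₂ (L.fixed⇒ f)))
          fix : ∃ λ k → k ∈ cosets × (z' ∙ k) ≈ k
          fix = L'.some-fixed cosets-unique L'.closed
            (L.unique-fixed cosets-unique L.closed (∈cosets A.id∈)
              (L.fixed⇐ idₚ (M.resp (pt λ _ → refl) (z∈ , zN))) only)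

  abstract
    coset-alternative : ∀ {V : Set} (_≟_ : DecidableEquality V) (vs : List V) → (∀ x → x ∈ₚ vs) →
      (A N : Group V) (let module A = Group A ; module N = Group N) →
      ∀ {q} → Prime q → ∀ z z' → A.mem z → A.mem z' → (∀ x → iter (to z) q x ≡ x) → (∀ x → iter (to z') q x ≡ x) →
      N.mem z → (∃ λ k → A.mem k × N.mem (k ⁻¹ ∙ z' ∙ k)) ⊎ (∃ λ k → A.mem k × ¬ N.mem k × N.mem (k ⁻¹ ∙ z ∙ k))
    coset-alternative _≟_ vs cover A N pr z z' = FiniteSylow.Cosets.coset-fixed _≟_ vs cover A N pr z z'

module Two where

  open import Data.Nat hiding (_≟_; _+_)
  open import Data.Nat.Properties using ()
  open import Data.Nat.Divisibility
  open import Data.Nat.Primality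
  open import Data.List hiding (find)
  open import Data.List.Properties using (length-map)
  open import Data.List.Relation.Unary.Any as Any using (Any)
  open import Data.List.Relation.Unary.All as All using (All)
  import Data.List.Relation.Unary.AllPairs as AllPairs
  import Data.List.Relation.Unary.AllPairs.Properties as AllPairsP
  import Data.List.Relation.Unary.Any.Properties as AnyP
  import Data.List.Relation.Unary.Unique.DecSetoid.Properties as UniqueDP
  import Data.List.Membership.Setoid.Properties as MemP
  import Data.List.Relation.Unary.Unique.Propositional as UP
  import Data.List.Relation.Unary.Unique.Propositional.Properties as UPP
  open import Data.List.Membership.Propositional as Mem using () renaming (_∈_ to _∈ₚ_)
  import Data.List.Membership.Propositional.Properties as MemPP
  open import Data.Product hiding (map)
  open import Data.Empty
  open import Function using (_∘_)
  open import Relation.Nullary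
  open import Relation.Nullary.Decidable using (_×-dec_; map′)
  open import Relation.Binary
  open import Relation.Binary.PropositionalEquality as ≡ using (_≡_; _≢_; cong; subst; refl; sym; trans)
  import Relation.Binary.PropositionalEquality.Properties as ≡P
  open Count
  open Perms

  module ElementaryTwo {V : Set} (_≟_ : DecidableEquality V) (vs : List V) (cover : ∀ x → x ∈ₚ vs)
    (_+_ : V → V → V) (0# : V) (+-comm : ∀ x y → x + y ≡ y + x)
    (+-assoc : ∀ x y z → (x + y) + z ≡ x + (y + z)) (+-identity : ∀ x → x + 0# ≡ x)
    (+-self : ∀ x → x + x ≡ 0#)
    (nz : List V) (nz-unique : UP.Unique nz) (nz⁺ : ∀ {x} → x ≢ 0# → x ∈ₚ nz) (nz⁻ : ∀ {x} → x ∈ₚ nz → x ≢ 0#)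
    (nz-odd : ¬ 2 ∣ length nz) where

    open Finite _≟_ vs cover

    +-cancel : ∀ x y → x + (x + y) ≡ y
    +-cancel x y = trans (sym (+-assoc x x y)) (trans (cong (_+ y) (+-self x)) (trans (+-comm _ y) (+-identity y)))

    shift : V → Perm V
    shift v = perm (v +_) (v +_) (+-cancel v) (+-cancel v)

    module _ (A : Group V) (φ : Perm V)
             (shift∈ : ∀ v → Group.mem A (shift v)) (shift'∈ : ∀ v → Group.mem A (φ ⁻¹ ∙ shift v ∙ φ)) where
      private module A = Group A

      infix 4 _∼_
      record _∼_ (f g : Perm V) : Set where
        constructor conj
        field witness : ∃ λ k → A.mem k × k ∙ f ≗ₚ g ∙ k
      open _∼_

      _∼?_ : ∀ f g → Dec (f ∼ g)
      f ∼? g = map′ conj witness (∃perm?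
        (λ { {k} {l} e (a , b) → A.resp e a ,
             pt λ x → trans (sym (at e _)) (trans (at b x) (cong (to g) (at e x))) })
        (λ k → A.mem? k ×-dec (k ∙ f) ≗? (g ∙ k)))

      ∼-refl : ∀ {f} → f ∼ f
      ∼-refl = conj (idₚ , A.id∈ , pt λ _ → refl)

      ∼-sym : ∀ {f g} → f ∼ g → g ∼ f
      ∼-sym {f} {g} (conj (k , a , e)) = conj (k ⁻¹ , A.⁻¹∈ a ,
        pt λ x → from-≡ k (trans (at e _) (cong (to g) (to-from k x))))

      ∼-trans : ∀ {f g h} → f ∼ g → g ∼ h → f ∼ h
      ∼-trans (conj (k , a , e)) (conj (l , b , d)) = conj (l ∙ k , A.∙∈ b a ,
        pt λ x → trans (cong (to l) (at e x)) (at d _))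

      ∼-resp : ∀ {f g h} → g ≗ₚ h → f ∼ g → f ∼ h
      ∼-resp e (conj (k , a , d)) = conj (k , a , pt λ x → trans (at d x) (at e _))

      conj-∼ : ∀ {f g k} → A.mem k → f ∼ g → f ∼ k ∙ g ∙ k ⁻¹
      conj-∼ {f} {g} {k} m (conj (l , a , e)) = conj (k ∙ l , A.∙∈ m a ,
        pt λ x → cong (to k) (trans (at e x) (cong (to g) (sym (from-to k _)))))

      abstract
        classes-odd : ∃ λ v → v ∈ₚ nz × ¬ 2 ∣ length (filter (λ w → shift v ∼? shift w) nz)
        classes-odd = Counting.big-class (≡P.decSetoid _≟_) 2
          (λ v w → shift v ∼? shift w) ∼-refl (λ p q → ∼-trans p (∼-sym q)) nz nz-odd

      v₀ = proj₁ classes-odd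

      open Counting permDecSetoid
      open DecSetoid permDecSetoid using (setoid)

      abstract
        class : List (Perm V)
        class = deduplicate _≗?_ (filter (λ f → shift v₀ ∼? f) perms)

        class-unique : Unique class
        class-unique = UniqueDP.deduplicate-! permDecSetoid (filter (λ f → shift v₀ ∼? f) perms)

        ∈class : ∀ {f} → shift v₀ ∼ f → f ∈ class
        ∈class {f} p = MemP.∈-deduplicate⁺ setoid _≗?_ (λ e d → ≗-trans d (≗-sym e))
          (MemP.∈-filter⁺ setoid (λ f → shift v₀ ∼? f) ∼-resp (perms-complete f) p)

        class∈ : ∀ {f} → f ∈ class → shift v₀ ∼ f
        class∈ f∈ = proj₂ (MemP.∈-filter⁻ setoid (λ f → shift v₀ ∼? f) ∼-resp {xs = perms}
          (MemP.∈-deduplicate⁻ setoid _≗?_ (filter (λ f → shift v₀ ∼? f) perms) f∈))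

      module Conj (s : V → Perm V) (s∈ : ∀ v → A.mem (s v)) (s-invol : ∀ v x → to (s v) (to (s v) x) ≡ x)
                  (s-comm : ∀ v w x → to (s v) (to (s w) x) ≡ to (s w) (to (s v) x)) where

        s-from : ∀ v x → from (s v) x ≡ to (s v) x
        s-from v x = from-≡ (s v) (s-invol v x)

        actₛ : V → Perm V → Perm V
        actₛ v f = s v ∙ f ∙ s v ⁻¹

        open Commuting prime[2] actₛ
          (λ v e → pt λ x → cong (to (s v)) (at e _))
          (λ v f → pt λ x → trans (s-invol v _) (cong (to f) (trans (s-from v _)
                    (trans (cong (to (s v)) (s-from v x)) (s-invol v x)))))
          (λ v w f → pt λ x → trans (s-comm v w _) (cong (to (s w) ∘ to (s v) ∘ to f)
                    (trans (s-from w _) (trans (cong (to (s w)) (s-from v x))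
                    (trans (sym (s-comm v w x)) (trans (cong (to (s v)) (sym (s-from w x))) (sym (s-from v _))))))))
          public

        closed : Closed class
        closed v f∈ = ∈class (conj-∼ (s∈ v) (class∈ f∈))

        fixed⇒comm : ∀ {v f} → actₛ v f ≗ₚ f → ∀ x → to f (to (s v) x) ≡ to (s v) (to f x)
        fixed⇒comm {v} {f} e x = trans (sym (at e _)) (cong (to (s v) ∘ to f) (from-to (s v) x))

      module E = Conj shift shift∈ +-cancel
        (λ v w x → trans (sym (+-assoc v w x)) (trans (cong (_+ x) (+-comm v w)) (+-assoc w v x)))

      commutes⇒shift : ∀ {f} → (∀ v x → to f (v + x) ≡ v + to f x) → f ≗ₚ shift (to f 0#)
      commutes⇒shift {f} c = pt λ x → trans (cong (to f) (sym (+-identity x))) (trans (c x 0#) (+-comm x _))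

      shift-inj : ∀ {v w} → shift v ≗ₚ shift w → v ≡ w
      shift-inj {v} {w} e = trans (sym (+-identity v)) (trans (at e 0#) (+-identity w))

      odd-class : ¬ 2 ∣ length class
      odd-class = E.common-count {ys = map shift own} class-unique E.closed vs own-unique out inn
        (λ d → proj₂ (proj₂ classes-odd) (subst (2 ∣_) (length-map shift own) d))
        where
        own = filter (λ w → shift v₀ ∼? shift w) nz
        own-unique : Unique (map shift own)
        own-unique = AllPairsP.map⁺ (AllPairs.map (λ ne e → ne (shift-inj e))
          (UPP.filter⁺ (λ w → shift v₀ ∼? shift w) nz-unique))
        out : ∀ {f} → f ∈ map shift own → f ∈ class × All (λ v → E.actₛ v f ≗ₚ f) vs
        out {f} f∈ with Mem.find (AnyP.map⁻ f∈)
        ... | w , w∈ , e = ∈class (∼-resp (≗-sym e) (proj₂ (MemPP.∈-filter⁻ (λ w → shift v₀ ∼? shift w) {xs = nz} w∈))) ,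
          All.tabulate (λ {v} _ → pt λ x → trans (cong (v +_) (at e _)) (trans (trans (sym (+-assoc v w _))
            (trans (cong (_+ (v + x)) (+-comm v w)) (trans (+-assoc w v _) (cong (w +_) (+-cancel v x))))) (sym (at e x))))
        inn : ∀ {f} → f ∈ class → All (λ v → E.actₛ v f ≗ₚ f) vs → f ∈ map shift own
        inn {f} f∈ fix = AnyP.map⁺ (Any.map (λ { refl → e })
          (MemPP.∈-filter⁺ (λ w → shift v₀ ∼? shift w) (nz⁺ nonzero) f∼))
          where
          e : f ≗ₚ shift (to f 0#)
          e = commutes⇒shift λ v x → E.fixed⇒comm {v} {f} (All.lookup fix (cover v)) x
          f∼ : shift v₀ ∼ shift (to f 0#)
          f∼ = ∼-resp e (class∈ f∈)
          nonzero : to f 0# ≢ 0#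
          nonzero eq = let (k , _ , d) = witness f∼ in nz⁻ (proj₁ (proj₂ classes-odd))
            (trans (sym (+-identity v₀)) (to-inj k (trans (at d 0#)
              (trans (cong (_+ to k 0#) eq) (trans (+-comm 0# _) (+-identity _))))))

      shift-comm : ∀ v w x → v + (w + x) ≡ w + (v + x)
      shift-comm v w x = trans (sym (+-assoc v w x)) (trans (cong (_+ x) (+-comm v w)) (+-assoc w v x))

      private module E' = Conj (λ v → φ ⁻¹ ∙ shift v ∙ φ) shift'∈
               (λ v x → trans (cong (from φ ∘ (v +_)) (to-from φ _)) (trans (cong (from φ) (+-cancel v _)) (from-to φ x)))
               (λ v w x → cong (from φ) (trans (cong (v +_) (to-from φ _)) (trans (shift-comm v w (to φ x))
                            (sym (cong (w +_) (to-from φ _))))))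

      -- An odd conjugacy class of A meets both regular subgroups, as each acts on it by conjugation.
      common-shift : ∃ λ v → ∃ λ v' → v ≢ 0# × ∃ λ k → A.mem k × (φ ∙ k) ∙ shift v ≗ₚ shift v' ∙ (φ ∙ k)
      common-shift with E'.common-fixed class-unique E'.closed vs odd-class
      ... | f , f∈ , fix with class∈ f∈
      ...   | conj (k , k∈ , e) = v₀ , to (φ ∙ f ∙ φ ⁻¹) 0# , nz⁻ (proj₁ (proj₂ classes-odd)) , k , k∈ ,
        pt λ x → trans (cong (to φ) (at e x)) (trans (cong (to φ ∘ to f) (sym (from-to φ _))) (at s (to φ (to k x))))
        where
        c : ∀ v x → to f (from φ (v + to φ x)) ≡ from φ (v + to φ (to f x))
        c v x = E'.fixed⇒comm {v} {f} (All.lookup fix (cover v)) x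
        s : φ ∙ f ∙ φ ⁻¹ ≗ₚ shift (to (φ ∙ f ∙ φ ⁻¹) 0#)
        s = commutes⇒shift λ v x → trans (cong (to φ ∘ to f ∘ from φ ∘ (v +_)) (sym (to-from φ x)))
                                     (trans (cong (to φ) (c v (from φ x))) (to-from φ _))

module Fp where

  open import Defs using (_+ₙ_)
  open import Data.Nat as ℕ using (ℕ; zero; suc)
  import Data.Nat.Properties as ℕP
  open import Data.Nat.DivMod
  open import Data.Nat.Divisibility
  open import Data.Nat.Primality
  open import Data.Nat.Coprimality using (prime⇒coprime; coprime-Bézout)
  open import Data.Nat.GCD using (module Bézout)
  open import Data.Fin using (Fin; zero; suc; toℕ; _≟_)
  open import Data.Fin.Properties using (toℕ-injective; toℕ<n; toℕ-fromℕ<)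
  open import Data.Product
  open import Data.Empty
  open import Data.Maybe using (Maybe; just; nothing)
  open import Relation.Nullary
  open import Relation.Binary.PropositionalEquality
  open import Algebra.Bundles using (CommutativeRing)
  open import Algebra.Structures
  open import Level using (0ℓ)
  open import Algebra.Bundles using (RawRing)
  import Algebra.Properties.Ring as RingP
  import Algebra.Properties.AbelianGroup as AbelianGroupP
  open import Algebra.Solver.Ring.AlmostCommutativeRing using (_-Raw-AlmostCommutative⟶_; fromCommutativeRing)
  import Algebra.Solver.Ring as RingSolver

  module Mod (n : ℕ) where

    F : Set
    F = Fin (suc n)

    infixl 6 _+_
    infixl 7 _*_
    infix 8 -_

    abstract
      ⟦_⟧ : ℕ → F
      ⟦ a ⟧ = a mod suc n

      _+_ _*_ : F → F → F
      _+_ = _+ₙ_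
      a * b = ⟦ toℕ a ℕ.* toℕ b ⟧

      -_ : F → F
      - a = ⟦ suc n ℕ.∸ toℕ a ⟧

      toℕ-⟦⟧ : ∀ a → toℕ ⟦ a ⟧ ≡ a % suc n
      toℕ-⟦⟧ a = toℕ-fromℕ< (m%n<n a (suc n))

      +-def : ∀ a b → a + b ≡ ⟦ toℕ a ℕ.+ toℕ b ⟧
      +-def a b = refl

      +≡+ₙ : ∀ a b → a + b ≡ a +ₙ b
      +≡+ₙ a b = refl

      *-def : ∀ a b → a * b ≡ ⟦ toℕ a ℕ.* toℕ b ⟧
      *-def a b = refl

      neg-def : ∀ a → - a ≡ ⟦ suc n ℕ.∸ toℕ a ⟧
      neg-def a = refl

    0# 1# : F
    0# = ⟦ 0 ⟧
    1# = ⟦ 1 ⟧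

    ⟦⟧-cong-% : ∀ {a b} → a % suc n ≡ b % suc n → ⟦ a ⟧ ≡ ⟦ b ⟧
    ⟦⟧-cong-% {a} {b} e = toℕ-injective (trans (toℕ-⟦⟧ a) (trans e (sym (toℕ-⟦⟧ b))))

    ⟦toℕ⟧ : ∀ a → ⟦ toℕ a ⟧ ≡ a
    ⟦toℕ⟧ a = toℕ-injective (trans (toℕ-⟦⟧ (toℕ a)) (m<n⇒m%n≡m (toℕ<n a)))

    ⟦+⟧ : ∀ a b → ⟦ a ℕ.+ b ⟧ ≡ ⟦ a ⟧ + ⟦ b ⟧
    ⟦+⟧ a b = trans (⟦⟧-cong-% (trans (%-distribˡ-+ a b (suc n))
      (cong₂ (λ x y → (x ℕ.+ y) % suc n) (sym (toℕ-⟦⟧ a)) (sym (toℕ-⟦⟧ b))))) (sym (+-def _ _))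

    ⟦*⟧ : ∀ a b → ⟦ a ℕ.* b ⟧ ≡ ⟦ a ⟧ * ⟦ b ⟧
    ⟦*⟧ a b = trans (⟦⟧-cong-% (trans (%-distribˡ-* a b (suc n))
      (cong₂ (λ x y → (x ℕ.* y) % suc n) (sym (toℕ-⟦⟧ a)) (sym (toℕ-⟦⟧ b))))) (sym (*-def _ _))

    private
      lift₂ : ∀ {_∘_ : F → F → F} {_∘'_ : ℕ → ℕ → ℕ} → (∀ a b → ⟦ a ∘' b ⟧ ≡ ⟦ a ⟧ ∘ ⟦ b ⟧) →
              ∀ a b → ⟦ toℕ a ∘' b ⟧ ≡ a ∘ ⟦ b ⟧
      lift₂ {_∘_} h a b = trans (h (toℕ a) b) (cong (λ x → x ∘ ⟦ b ⟧) (⟦toℕ⟧ a))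

      lift-assoc : ∀ {_∘_ : F → F → F} {_∘'_ : ℕ → ℕ → ℕ} → (∀ a b → ⟦ a ∘' b ⟧ ≡ ⟦ a ⟧ ∘ ⟦ b ⟧) →
                   (∀ a b → a ∘ b ≡ ⟦ toℕ a ∘' toℕ b ⟧) →
                   (∀ a b c → (a ∘' b) ∘' c ≡ a ∘' (b ∘' c)) → ∀ a b c → (a ∘ b) ∘ c ≡ a ∘ (b ∘ c)
      lift-assoc {_∘_} {_∘'_} h def assoc a b c = begin
        (a ∘ b) ∘ c                          ≡⟨ cong₂ _∘_ (def a b) (sym (⟦toℕ⟧ c)) ⟩
        ⟦ toℕ a ∘' toℕ b ⟧ ∘ ⟦ toℕ c ⟧       ≡⟨ sym (h _ (toℕ c)) ⟩
        ⟦ (toℕ a ∘' toℕ b) ∘' toℕ c ⟧        ≡⟨ cong ⟦_⟧ (assoc (toℕ a) _ _) ⟩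
        ⟦ toℕ a ∘' (toℕ b ∘' toℕ c) ⟧        ≡⟨ lift₂ {_∘_} h a _ ⟩
        a ∘ ⟦ toℕ b ∘' toℕ c ⟧               ≡⟨ cong (a ∘_) (sym (def b c)) ⟩
        a ∘ (b ∘ c)                          ∎
        where open ≡-Reasoning

    +-assoc : ∀ a b c → (a + b) + c ≡ a + (b + c)
    +-assoc = lift-assoc ⟦+⟧ +-def ℕP.+-assoc

    *-assoc : ∀ a b c → (a * b) * c ≡ a * (b * c)
    *-assoc = lift-assoc ⟦*⟧ *-def ℕP.*-assoc

    +-comm : ∀ a b → a + b ≡ b + a
    +-comm a b = trans (+-def a b) (trans (cong ⟦_⟧ (ℕP.+-comm (toℕ a) (toℕ b))) (sym (+-def b a)))

    *-comm : ∀ a b → a * b ≡ b * a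
    *-comm a b = trans (*-def a b) (trans (cong ⟦_⟧ (ℕP.*-comm (toℕ a) (toℕ b))) (sym (*-def b a)))

    +-identityˡ : ∀ a → 0# + a ≡ a
    +-identityˡ a = trans (cong (0# +_) (sym (⟦toℕ⟧ a))) (trans (sym (⟦+⟧ 0 (toℕ a))) (⟦toℕ⟧ a))

    *-identityˡ : ∀ a → 1# * a ≡ a
    *-identityˡ a = trans (cong (1# *_) (sym (⟦toℕ⟧ a)))
      (trans (sym (⟦*⟧ 1 (toℕ a))) (trans (cong ⟦_⟧ (ℕP.*-identityˡ (toℕ a))) (⟦toℕ⟧ a)))

    ⟦p⟧ : ⟦ suc n ⟧ ≡ 0#
    ⟦p⟧ = ⟦⟧-cong-% {suc n} {0} (n%n≡0 (suc n))

    -‿inverseʳ : ∀ a → a + - a ≡ 0#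
    -‿inverseʳ a = trans (cong (a +_) (neg-def a)) (trans (sym (lift₂ {_+_} ⟦+⟧ a _))
      (trans (cong ⟦_⟧ (ℕP.m+[n∸m]≡n (ℕP.<⇒≤ (toℕ<n a)))) ⟦p⟧))

    *-distribˡ-+ : ∀ a b c → a * (b + c) ≡ a * b + a * c
    *-distribˡ-+ a b c = trans (cong (a *_) (+-def b c)) (trans (sym (lift₂ {_*_} ⟦*⟧ a _))
      (trans (cong ⟦_⟧ (ℕP.*-distribˡ-+ (toℕ a) (toℕ b) (toℕ c)))
        (trans (⟦+⟧ _ _) (cong₂ _+_ (sym (*-def a b)) (sym (*-def a c))))))

    commutativeRing : CommutativeRing 0ℓ 0ℓ
    commutativeRing = record
      { Carrier = F ; _≈_ = _≡_ ; _+_ = _+_ ; _*_ = _*_ ; -_ = -_ ; 0# = 0# ; 1# = 1#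
      ; isCommutativeRing = record
        { isRing = record
          { +-isAbelianGroup = record
            { isGroup = record
              { isMonoid = record
                { isSemigroup = record
                  { isMagma = record { isEquivalence = isEquivalence ; ∙-cong = cong₂ _+_ }
                  ; assoc = +-assoc }
                ; identity = +-identityˡ , λ a → trans (+-comm a 0#) (+-identityˡ a) }
              ; inverse = (λ a → trans (+-comm (- a) a) (-‿inverseʳ a)) , -‿inverseʳ
              ; ⁻¹-cong = cong -_ }
            ; comm = +-comm }
          ; *-cong = cong₂ _*_
          ; *-assoc = *-assoc
          ; *-identity = *-identityˡ , λ a → trans (*-comm a 1#) (*-identityˡ a)
          ; distrib = *-distribˡ-+ , λ a b c → trans (*-comm (b + c) a)
              (trans (*-distribˡ-+ a b c) (cong₂ _+_ (*-comm a b) (*-comm a c))) }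
        ; *-comm = *-comm } }

    open CommutativeRing commutativeRing public
      using (ring; +-abelianGroup; *-identityʳ; +-identityʳ; -‿inverseˡ; zeroˡ; zeroʳ)
    open RingP ring public using (-‿distribˡ-*; -‿distribʳ-*; -‿involutive)
    open AbelianGroupP +-abelianGroup public using () renaming (⁻¹-∙-comm to -‿+-comm)

    private
      swap-mid : ∀ a b c d → (a + b) + (c + d) ≡ (a + c) + (b + d)
      swap-mid a b c d = trans (+-assoc a b (c + d)) (trans (cong (a +_)
        (trans (sym (+-assoc b c d)) (trans (cong (_+ d) (+-comm b c)) (+-assoc c b d))))
        (sym (+-assoc a c (b + d))))

      -- Solver coefficients: (a , b) stands for the integer a - b.
      Coeff : RawRing 0ℓ 0ℓ
      Coeff = record
        { Carrier = ℕ × ℕ ; _≈_ = _≡_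
        ; _+_ = λ (a , b) (c , d) → a ℕ.+ c , b ℕ.+ d
        ; _*_ = λ (a , b) (c , d) → a ℕ.* c ℕ.+ b ℕ.* d , a ℕ.* d ℕ.+ b ℕ.* c
        ; -_ = λ (a , b) → b , a ; 0# = 0 , 0 ; 1# = 1 , 0 }

      ι' : ℕ × ℕ → F
      ι' (a , b) = ⟦ a ⟧ + - ⟦ b ⟧

      neg-0 : - 0# ≡ 0#
      neg-0 = trans (sym (+-identityˡ (- 0#))) (-‿inverseʳ 0#)

      ι'-+ : ∀ u v → ι' (RawRing._+_ Coeff u v) ≡ ι' u + ι' v
      ι'-+ (a , b) (c , d) = trans (cong₂ (λ x y → x + - y) (⟦+⟧ a c) (⟦+⟧ b d))
        (trans (cong (⟦ a ⟧ + ⟦ c ⟧ +_) (sym (-‿+-comm ⟦ b ⟧ ⟦ d ⟧))) (swap-mid _ _ _ _))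

      ι'-* : ∀ u v → ι' (RawRing._*_ Coeff u v) ≡ ι' u * ι' v
      ι'-* (a , b) (c , d) = begin
        ⟦ a ℕ.* c ℕ.+ b ℕ.* d ⟧ + - ⟦ a ℕ.* d ℕ.+ b ℕ.* c ⟧
          ≡⟨ cong₂ (λ x y → x + - y) (trans (⟦+⟧ (a ℕ.* c) _) (cong₂ _+_ (⟦*⟧ a c) (⟦*⟧ b d)))
                                     (trans (⟦+⟧ (a ℕ.* d) _) (cong₂ _+_ (⟦*⟧ a d) (⟦*⟧ b c))) ⟩
        (x * z + y * w) + - (x * w + y * z)
          ≡⟨ cong (x * z + y * w +_) (trans (sym (-‿+-comm _ _)) (+-comm _ _)) ⟩
        (x * z + y * w) + (- (y * z) + - (x * w))
          ≡⟨ cong₂ (λ s t → (x * z + s) + (t + - (x * w)))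
               (trans (sym (-‿involutive _)) (trans (cong -_ (-‿distribʳ-* y w)) (-‿distribˡ-* y (- w))))
               (-‿distribˡ-* y z) ⟩
        (x * z + (- y) * (- w)) + ((- y) * z + - (x * w))
          ≡⟨ trans (cong (x * z + (- y) * (- w) +_) (trans (+-comm _ _) (cong (_+ (- y) * z) (-‿distribʳ-* x w)))) (swap-mid _ _ _ _) ⟩
        (x * z + x * (- w)) + ((- y) * (- w) + (- y) * z)
          ≡⟨ cong₂ _+_ (sym (*-distribˡ-+ x z (- w))) (trans (+-comm _ _) (sym (*-distribˡ-+ (- y) z (- w)))) ⟩
        x * (z + - w) + (- y) * (z + - w)
          ≡⟨ trans (cong₂ _+_ (*-comm x _) (*-comm (- y) _)) (trans (sym (*-distribˡ-+ _ x (- y))) (*-comm _ _)) ⟩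
        (x + - y) * (z + - w) ∎
        where
        open ≡-Reasoning
        x = ⟦ a ⟧
        y = ⟦ b ⟧
        z = ⟦ c ⟧
        w = ⟦ d ⟧

      ι'-neg : ∀ u → ι' (RawRing.-_ Coeff u) ≡ - ι' u
      ι'-neg (a , b) = sym (trans (sym (-‿+-comm ⟦ a ⟧ (- ⟦ b ⟧)))
        (trans (+-comm _ _) (cong (_+ - ⟦ a ⟧) (-‿involutive ⟦ b ⟧))))

      normal : ℕ × ℕ → ℕ × ℕ
      normal (a , b) = a ℕ.∸ b , b ℕ.∸ a

      ι'-normal : ∀ u → ι' (normal u) ≡ ι' u
      ι'-normal (a , b) = begin
        ⟦ a ℕ.∸ b ⟧ + - ⟦ b ℕ.∸ a ⟧                  ≡⟨ cong₂ _+_ (cancel ⟦ a ℕ.∸ b ⟧ m) refl ⟩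
        ((⟦ a ℕ.∸ b ⟧ + m) + - m) + - ⟦ b ℕ.∸ a ⟧    ≡⟨ trans (+-assoc _ _ _) (cong (⟦ a ℕ.∸ b ⟧ + m +_) (-‿+-comm _ _)) ⟩
        (⟦ a ℕ.∸ b ⟧ + m) + - (m + ⟦ b ℕ.∸ a ⟧)      ≡⟨ cong₂ (λ x y → x + - y) (trans (sym (⟦+⟧ (a ℕ.∸ b) _)) (cong ⟦_⟧ left))
                                                       (trans (sym (⟦+⟧ _ (b ℕ.∸ a))) (cong ⟦_⟧ right)) ⟩
        ⟦ a ⟧ + - ⟦ b ⟧                              ∎
        where
        open ≡-Reasoning
        m = ⟦ a ℕ.⊓ b ⟧
        cancel : ∀ x y → x ≡ (x + y) + - y
        cancel x y = sym (trans (+-assoc x y _) (trans (cong (x +_) (-‿inverseʳ y)) (+-identityʳ x)))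
        left : a ℕ.∸ b ℕ.+ a ℕ.⊓ b ≡ a
        left = trans (ℕP.+-comm (a ℕ.∸ b) _) (trans (cong (ℕ._+ (a ℕ.∸ b)) (ℕP.⊓-comm a b)) (ℕP.m⊓n+n∸m≡n b a))
        right : a ℕ.⊓ b ℕ.+ (b ℕ.∸ a) ≡ b
        right = ℕP.m⊓n+n∸m≡n a b

      Coeff' : RawRing 0ℓ 0ℓ
      Coeff' = record
        { Carrier = ℕ × ℕ ; _≈_ = _≡_
        ; _+_ = λ u v → normal (RawRing._+_ Coeff u v)
        ; _*_ = λ u v → normal (RawRing._*_ Coeff u v)
        ; -_ = RawRing.-_ Coeff ; 0# = 0 , 0 ; 1# = 1 , 0 }

      -- ι agrees with ι', but is definitionally 0# and 1# on the constants.
      ι : ℕ × ℕ → F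
      ι (a , zero)  = ⟦ a ⟧
      ι (a , suc b) = ⟦ a ⟧ + - ⟦ suc b ⟧

      ι≡ : ∀ u → ι u ≡ ι' u
      ι≡ (a , zero)  = sym (trans (cong (⟦ a ⟧ +_) neg-0) (+-identityʳ ⟦ a ⟧))
      ι≡ (a , suc b) = refl

      morphism : Coeff' -Raw-AlmostCommutative⟶ fromCommutativeRing commutativeRing
      morphism = record
        { ⟦_⟧ = ι
        ; +-homo = λ u v → trans (ι≡ (RawRing._+_ Coeff' u v)) (trans (trans (ι'-normal (RawRing._+_ Coeff u v)) (ι'-+ u v))
            (cong₂ _+_ (sym (ι≡ u)) (sym (ι≡ v))))
        ; *-homo = λ u v → trans (ι≡ (RawRing._*_ Coeff' u v)) (trans (trans (ι'-normal (RawRing._*_ Coeff u v)) (ι'-* u v))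
            (cong₂ _*_ (sym (ι≡ u)) (sym (ι≡ v))))
        ; -‿homo = λ u → trans (ι≡ (RawRing.-_ Coeff u)) (trans (ι'-neg u) (cong -_ (sym (ι≡ u))))
        ; 0-homo = refl
        ; 1-homo = refl }

      coeff? : ∀ u v → Maybe (ι u ≡ ι v)
      coeff? (a , b) (c , d) with a ℕ.≟ c | b ℕ.≟ d
      ... | yes refl | yes refl = just refl
      ... | _        | _        = nothing

    module Solver = RingSolver Coeff' (fromCommutativeRing commutativeRing) morphism coeff?
    open Solver public using (solve; _:=_; _:+_; _:*_; :-_; con)

    inverse : Prime (suc n) → ∀ {a} → a ≢ 0# → ∃ λ b → b * a ≡ 1#
    inverse pr {a} a≢0 = bez (toℕ a) refl
      where
      to1 : ∀ k x → 1 ℕ.+ k ℕ.* suc n ≡ x ℕ.* toℕ a → ⟦ x ⟧ * a ≡ 1#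
      to1 k x e = trans (cong (⟦ x ⟧ *_) (sym (⟦toℕ⟧ a))) (trans (sym (⟦*⟧ x (toℕ a)))
        (⟦⟧-cong-% {x ℕ.* toℕ a} {1} (trans (cong (_% suc n) (sym e)) ([m+kn]%n≡m%n 1 k (suc n)))))
      neg : ∀ y → 1# + y ≡ 0# → - y ≡ 1#
      neg y e = begin
        - y               ≡⟨ ring₁ y ⟩
        1# + - (1# + y)   ≡⟨ cong (λ t → 1# + - t) e ⟩
        1# + - 0#         ≡⟨ cong (1# +_) ring₀ ⟩
        1# + 0#           ≡⟨ trans (+-comm 1# 0#) (+-identityˡ 1#) ⟩
        1#                ∎
        where
        open ≡-Reasoning
        ring₁ : ∀ y → - y ≡ 1# + - (1# + y)
        ring₁ = solve 1 (λ y → :- y := con (1 , 0) :+ :- (con (1 , 0) :+ y)) refl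
        ring₀ : - 0# ≡ 0#
        ring₀ = neg-0
      neg-* : ∀ y x → (- y) * x ≡ - (y * x)
      neg-* = solve 2 (λ y x → (:- y) :* x := :- (y :* x)) refl
      bez : ∀ m → toℕ a ≡ m → ∃ λ b → b * a ≡ 1#
      bez zero e = ⊥-elim (a≢0 (trans (sym (⟦toℕ⟧ a)) (cong ⟦_⟧ e)))
      bez (suc m) e with coprime-Bézout (prime⇒coprime pr {{_}} (subst (ℕ._< suc n) e (toℕ<n a)))
      ... | Bézout.-+ k x eq = ⟦ x ⟧ , to1 k x (trans eq (cong (x ℕ.*_) (sym e)))
      ... | Bézout.+- k x eq = - ⟦ x ⟧ , trans (neg-* ⟦ x ⟧ a) (neg (⟦ x ⟧ * a) (begin
        1# + ⟦ x ⟧ * a            ≡⟨ cong (λ t → 1# + ⟦ x ⟧ * t) (sym (⟦toℕ⟧ a)) ⟩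
        1# + ⟦ x ⟧ * ⟦ toℕ a ⟧    ≡⟨ cong (1# +_) (sym (⟦*⟧ x (toℕ a))) ⟩
        1# + ⟦ x ℕ.* toℕ a ⟧      ≡⟨ sym (⟦+⟧ 1 (x ℕ.* toℕ a)) ⟩
        ⟦ 1 ℕ.+ x ℕ.* toℕ a ⟧     ≡⟨ cong ⟦_⟧ (trans (cong (λ t → 1 ℕ.+ x ℕ.* t) e) eq) ⟩
        ⟦ k ℕ.* suc n ⟧           ≡⟨ ⟦⟧-cong-% {k ℕ.* suc n} {0} (m*n%n≡0 k (suc n)) ⟩
        0#                        ∎))
        where open ≡-Reasoning

module Moves where

  open import Data.Product
  open import Relation.Binary.PropositionalEquality hiding (resp)
  open import Function using (_∘_)
  open Perms

  module Moves {V I : Set} (shift : I → Perm V) where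

    record Hol (β : Perm V) : Set where
      constructor hol
      field
        push : ∀ v → ∃ λ v' → β ∙ shift v ≗ₚ shift v' ∙ β
        pull : ∀ v → ∃ λ v' → β ⁻¹ ∙ shift v ≗ₚ shift v' ∙ β ⁻¹
    open Hol public

    hol-⁻¹ : ∀ {β} → Hol β → Hol (β ⁻¹)
    hol-⁻¹ h = hol (pull h) (λ v → let (v' , e) = push h v in v' , pt λ x → at e x)

    hol-∙ : ∀ {β γ} → Hol β → Hol γ → Hol (β ∙ γ)
    hol-∙ {β} {γ} h k = hol
      (λ v → let (w , e) = push k v ; (u , d) = push h w in u , pt λ x → trans (cong (to β) (at e x)) (at d _))
      (λ v → let (w , e) = pull h v ; (u , d) = pull k w in u , pt λ x → trans (cong (from γ) (at e x)) (at d _))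

    record Instance : Set₁ where
      constructor inst
      field
        A     : Group V
        φ     : Perm V
        cl₃   : Closed₃ A
        sh∈   : ∀ v → Group.mem A (shift v)
        sh'∈  : ∀ v → Group.mem A (φ ⁻¹ ∙ shift v ∙ φ)
      open Group A public

    module _ (S : Instance) where
      open Instance S

      Good : Set
      Good = ∃ λ α → Hol α × mem (φ ⁻¹ ∙ α)

      right : ∀ k → mem k → Instance
      right k k∈ = inst A (φ ∙ k) cl₃ sh∈
        λ v → resp (pt λ _ → refl) (∙∈ (⁻¹∈ k∈) (∙∈ (sh'∈ v) k∈))

      left : ∀ β → Hol β → Instance
      left β h = inst A (β ∙ φ) cl₃ sh∈ λ v → let (v' , e) = pull h v in
        resp (pt λ x → cong (from φ) (trans (cong (to (shift v')) (sym (from-to β _))) (sym (at e _)))) (sh'∈ v')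

      conjugate : Perm V → Group V
      conjugate β = record
        { mem  = λ f → mem (β ∙ f ∙ β ⁻¹)
        ; mem? = λ f → mem? (β ∙ f ∙ β ⁻¹)
        ; resp = λ e → resp (pt λ x → cong (to β) (at e _))
        ; id∈  = resp (pt λ x → sym (to-from β x)) id∈
        ; ∙∈   = λ {f} {g} m n → resp (pt λ x → cong (to β ∘ to f) (from-to β _)) (∙∈ m n)
        ; ⁻¹∈  = λ m → resp (pt λ _ → refl) (⁻¹∈ m) }

      both : ∀ β → Hol β → Instance
      both β h = inst (conjugate β) (φ ∙ β)
        (λ f c → cl₃ _ λ x y z → let (k , k∈ , ex , ey , ez) = c (from β x) (from β y) (from β z) in
          β ∙ k ∙ β ⁻¹ , k∈ , cong (to β) ex , cong (to β) ey , cong (to β) ez)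
        (λ v → let (v' , e) = push h v in
          resp (pt λ x → sym (trans (at e (from β x)) (cong (to (shift v')) (to-from β x)))) (sh∈ v'))
        (λ v → resp (pt λ x → sym (trans (to-from β _) (cong (from φ ∘ to (shift v) ∘ to φ) (to-from β x)))) (sh'∈ v))

    good-right : ∀ S k k∈ → Good (right S k k∈) → Good S
    good-right S k k∈ (α , h , m) = α , h , resp (pt λ x → to-from k _) (∙∈ k∈ m)
      where open Instance S

    good-left : ∀ S β h → Good (left S β h) → Good S
    good-left S β h (α , k , m) = β ⁻¹ ∙ α , hol-∙ (hol-⁻¹ h) k , resp (pt λ _ → refl) m
      where open Instance S

    good-both : ∀ S β h → Good (both S β h) → Good S
    good-both S β h (α , k , m) = α ∙ β ⁻¹ , hol-∙ k (hol-⁻¹ h) , resp (pt λ x → to-from β _) m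
      where open Instance S

module Space where

  open import Data.Nat as ℕ using (ℕ; zero; suc)
  open import Data.Nat.Primality
  open import Data.Fin using (Fin; zero; suc)
  import Data.Fin.Properties as FinP
  open import Data.Bool using (Bool; true; false; _xor_)
  import Data.Bool.Properties as BoolP
  open import Data.List using (List; []; _∷_; cartesianProduct; allFin)
  open import Data.List.Relation.Unary.Any as Any using (here; there)
  open import Data.List.Relation.Unary.All as All using ([]; _∷_)
  open import Data.List.Relation.Unary.AllPairs using ([]; _∷_)
  open import Data.List.Membership.Propositional using (_∈_)
  open import Data.List.Membership.Propositional.Properties using (∈-cartesianProduct⁺; ∈-allFin)
  open import Data.Product hiding (map)
  open import Data.Product.Properties using (≡-dec; ,-injectiveˡ; ,-injectiveʳ)
  open import Data.Empty
  open import Function using (_∘_)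
  open import Relation.Nullary
  open import Relation.Nullary.Decidable using (map′)
  open import Relation.Binary using (DecidableEquality)
  open import Relation.Binary.PropositionalEquality hiding (resp)
  open Count
  open Perms
  open Fp
  open Moves

  B : Set
  B = Bool × Bool × Bool

  infixl 6 _⊕_
  _⊕_ : B → B → B
  (a , b , c) ⊕ (a' , b' , c') = a xor a' , b xor b' , c xor c'

  0ᴮ e₁ : B
  0ᴮ = false , false , false
  e₁ = true , false , false

  _≟ᴮ_ : DecidableEquality B
  _≟ᴮ_ = ≡-dec BoolP._≟_ (≡-dec BoolP._≟_ BoolP._≟_)

  nonzeroᴮ allᴮ : List B
  nonzeroᴮ = (true , false , false) ∷ (false , true , false) ∷ (true , true , false) ∷ (false , false , true) ∷
             (true , false , true) ∷ (false , true , true) ∷ (true , true , true) ∷ []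
  allᴮ = 0ᴮ ∷ nonzeroᴮ

  pattern 0th = here refl
  pattern 1st = there 0th
  pattern 2nd = there 1st
  pattern 3rd = there 2nd
  pattern 4th = there 3rd
  pattern 5th = there 4th
  pattern 6th = there 5th
  pattern 7th = there 6th

  ∈allᴮ : ∀ x → x ∈ allᴮ
  ∈allᴮ (false , false , false) = 0th
  ∈allᴮ (true  , false , false) = 1st
  ∈allᴮ (false , true  , false) = 2nd
  ∈allᴮ (true  , true  , false) = 3rd
  ∈allᴮ (false , false , true)  = 4th
  ∈allᴮ (true  , false , true)  = 5th
  ∈allᴮ (false , true  , true)  = 6th
  ∈allᴮ (true  , true  , true)  = 7th

  module FinB = Finite _≟ᴮ_ allᴮ ∈allᴮ

  ⊕-comm : ∀ x y → x ⊕ y ≡ y ⊕ x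
  ⊕-comm (a , b , c) (a' , b' , c') = cong₂ _,_ (BoolP.xor-comm a a') (cong₂ _,_ (BoolP.xor-comm b b') (BoolP.xor-comm c c'))

  ⊕-assoc : ∀ x y z → (x ⊕ y) ⊕ z ≡ x ⊕ (y ⊕ z)
  ⊕-assoc (a , b , c) (a' , b' , c') (a″ , b″ , c″) =
    cong₂ _,_ (BoolP.xor-assoc a a' a″) (cong₂ _,_ (BoolP.xor-assoc b b' b″) (BoolP.xor-assoc c c' c″))

  ⊕-self : ∀ x → x ⊕ x ≡ 0ᴮ
  ⊕-self (a , b , c) = cong₂ _,_ (BoolP.xor-same a) (cong₂ _,_ (BoolP.xor-same b) (BoolP.xor-same c))

  ⊕-identityʳ : ∀ x → x ⊕ 0ᴮ ≡ x
  ⊕-identityʳ (a , b , c) = cong₂ _,_ (BoolP.xor-identityʳ a) (cong₂ _,_ (BoolP.xor-identityʳ b) (BoolP.xor-identityʳ c))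

  ⊕-cancel : ∀ x y → x ⊕ (x ⊕ y) ≡ y
  ⊕-cancel x y = trans (sym (⊕-assoc x x y)) (trans (cong (_⊕ y) (⊕-self x)) (trans (⊕-comm 0ᴮ y) (⊕-identityʳ y)))

  -- Points (x , y) of B × F: the fibre over x is the row of x.
  module Space (n : ℕ) (pr : Prime (suc n)) where
    open Mod n public

    V : Set
    V = B × F

    infixl 6 _⊞_
    _⊞_ : V → V → V
    (x , y) ⊞ (x' , y') = x ⊕ x' , y + y'

    _≟ᶠ_ : DecidableEquality F
    _≟ᶠ_ = FinP._≟_

    _≟ⱽ_ : DecidableEquality V
    _≟ⱽ_ = ≡-dec _≟ᴮ_ _≟ᶠ_

    abstract
      allⱽ : List V
      allⱽ = cartesianProduct allᴮ (allFin (suc n))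

      ∈allⱽ : ∀ v → v ∈ allⱽ
      ∈allⱽ (x , y) = ∈-cartesianProduct⁺ (∈allᴮ x) (∈-allFin y)

      allᶠ : List F
      allᶠ = allFin (suc n)

      ∈allᶠ : ∀ y → y ∈ allᶠ
      ∈allᶠ = ∈-allFin

    module FinV = Finite _≟ⱽ_ allⱽ ∈allⱽ
    module FinF = Finite _≟ᶠ_ allᶠ ∈allᶠ

    +-cancelˡ : ∀ s y → - s + (s + y) ≡ y
    +-cancelˡ = solve 2 (λ s y → :- s :+ (s :+ y) := y) refl

    +-cancelˡ' : ∀ s y → s + (- s + y) ≡ y
    +-cancelˡ' = solve 2 (λ s y → s :+ (:- s :+ y) := y) refl

    abstract
      shift-inverse : ∀ b s v → (b , s) ⊞ ((b , - s) ⊞ v) ≡ v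
      shift-inverse b s (x , y) = cong₂ _,_ (⊕-cancel b x) (+-cancelˡ' s y)

      shift-inverse' : ∀ b s v → (b , - s) ⊞ ((b , s) ⊞ v) ≡ v
      shift-inverse' b s (x , y) = cong₂ _,_ (⊕-cancel b x) (+-cancelˡ s y)

      rowShift-inverse : ∀ (u : B → F) v → _≡_ {A = V} (proj₁ v , u (proj₁ v) + (- u (proj₁ v) + proj₂ v)) v
      rowShift-inverse u (x , y) = cong (x ,_) (+-cancelˡ' (u x) y)

      rowShift-inverse' : ∀ (u : B → F) v → _≡_ {A = V} (proj₁ v , - u (proj₁ v) + (u (proj₁ v) + proj₂ v)) v
      rowShift-inverse' u (x , y) = cong (x ,_) (+-cancelˡ (u x) y)

    shift : V → Perm V
    shift (b , s) = perm (λ v → (b , s) ⊞ v) (λ v → (b , - s) ⊞ v) (shift-inverse b s) (shift-inverse' b s)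

    open Moves.Moves shift public

    z : Perm V
    z = shift (0ᴮ , 1#)

    tᴮ : B → Perm V
    tᴮ b = shift (b , 0#)

    rowShift : (B → F) → Perm V
    rowShift u = perm (λ (x , y) → x , u x + y) (λ (x , y) → x , - u x + y) (rowShift-inverse u) (rowShift-inverse' u)

    inv : ∀ {a} → a ≢ 0# → ∃ λ b → b * a ≡ 1#
    inv = inverse pr

    1≢0 : 1# ≢ 0#
    1≢0 e with trans (sym (toℕ-⟦⟧ 1)) (trans (cong Data.Fin.toℕ e) (toℕ-⟦⟧ 0))
    ... | eq = contra n pr eq
      where
      open import Data.Nat.DivMod
      contra : ∀ n → Prime (suc n) → 1 % suc n ≡ 0 % suc n → ⊥
      contra zero    p _ = ¬prime[1] p
      contra (suc n) p ()

    *-cancel : ∀ {a b c} → a ≢ 0# → a * b ≡ a * c → b ≡ c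
    *-cancel {a} {b} {c} a≢0 e = let (i , ia) = inv a≢0 in
      trans (sym (go i ia b)) (trans (cong (i *_) e) (go i ia c))
      where
      go : ∀ i → i * a ≡ 1# → ∀ b → i * (a * b) ≡ b
      go i ia b = trans (sym (*-assoc i a b)) (trans (cong (_* b) ia) (*-identityˡ b))

    no-zero-divisors : ∀ {a b} → a ≢ 0# → b ≢ 0# → a * b ≢ 0#
    no-zero-divisors {a} {b} a≢0 b≢0 e = b≢0 (*-cancel a≢0 (trans e (sym (zeroʳ a))))

    record RowAffine (f : Perm V) : Set where
      constructor rowAffine
      field
        σ   : B → B
        m c : B → F
        eq  : ∀ x y → to f (x , y) ≡ (σ x , m x * y + c x)

    module _ {f : Perm V} (R : RowAffine f) where
      open RowAffine R

      mult≢0 : ∀ x → m x ≢ 0#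
      mult≢0 x e = 1≢0 (,-injectiveʳ (to-inj f (trans (eq x 1#) (trans (cong (σ x ,_) same) (sym (eq x 0#))))))
        where
        same : m x * 1# + c x ≡ m x * 0# + c x
        same = cong (_+ c x) (trans (cong (_* 1#) e) (trans (zeroˡ 1#) (sym (zeroʳ (m x)))))

      row-onto : ∀ x → σ (proj₁ (from f (x , 0#))) ≡ x
      row-onto x = ,-injectiveˡ (trans (sym (eq _ _)) (to-from f (x , 0#)))

      row-inj : ∀ {x x'} → σ x ≡ σ x' → x ≡ x'
      row-inj {x} {x'} e = ,-injectiveˡ (to-inj f (trans (eq x 0#)
        (trans (cong₂ _,_ e solved) (sym (eq x' y')))))
        where
        i = proj₁ (inv (mult≢0 x'))
        y' = i * (m x * 0# + c x + - c x')
        solved : m x * 0# + c x ≡ m x' * y' + c x'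
        solved = sym (trans (cong (_+ c x') (trans (sym (*-assoc (m x') i _))
          (trans (cong (_* (m x * 0# + c x + - c x')) (trans (*-comm (m x') i) (proj₂ (inv (mult≢0 x'))))) (*-identityˡ _))))
          (solve 2 (λ a b → (a :+ :- b) :+ b := a) refl (m x * 0# + c x) (c x')))

      rowPerm : Perm B
      rowPerm = perm σ (λ x → proj₁ (from f (x , 0#))) row-onto (λ x → row-inj (row-onto (σ x)))

      rowAffine-⁻¹ : RowAffine (f ⁻¹)
      rowAffine-⁻¹ = rowAffine σ' m' c' eq'
        where
        σ' : B → B
        σ' x = proj₁ (from f (x , 0#))
        m' c' : B → F
        m' x = proj₁ (inv (mult≢0 (σ' x)))
        c' x = - (m' x * c (σ' x))
        eq' : ∀ x y → from f (x , y) ≡ (σ' x , m' x * y + c' x)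
        eq' x y = from-≡ f (trans (eq _ _) (cong₂ _,_ (row-onto x)
          (trans (solve 4 (λ a i y c → a :* (i :* y :+ :- (i :* c)) :+ c := (i :* a) :* y :+ :- ((i :* a) :* c) :+ c) refl
                   (m (σ' x)) (m' x) y (c (σ' x)))
            (trans (cong (λ t → t * y + - (t * c (σ' x)) + c (σ' x)) (proj₂ (inv (mult≢0 (σ' x)))))
              (solve 2 (λ y c → con (1 , 0) :* y :+ :- (con (1 , 0) :* c) :+ c := y) refl y (c (σ' x)))))))

    rowAffine-∙ : ∀ {f g} → RowAffine f → RowAffine g → RowAffine (f ∙ g)
    rowAffine-∙ {f} {g} (rowAffine σ m c e) (rowAffine σ' m' c' e') =
      rowAffine (σ ∘ σ') (λ x → m (σ' x) * m' x) (λ x → m (σ' x) * c' x + c (σ' x))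
        (λ x y → trans (cong (to f) (e' x y)) (trans (e _ _) (cong (σ (σ' x) ,_)
          (solve 5 (λ a b y d c → a :* (b :* y :+ d) :+ c := (a :* b) :* y :+ (a :* d :+ c)) refl
            (m (σ' x)) (m' x) y (c' x) (c (σ' x))))))

    rowAffine-resp : ∀ {f g} → f ≗ₚ g → RowAffine f → RowAffine g
    rowAffine-resp e (rowAffine σ m c eq) = rowAffine σ m c λ x y → trans (sym (at e _)) (eq x y)

    rowAffine-shift : ∀ v → RowAffine (shift v)
    rowAffine-shift (b , s) = rowAffine (b ⊕_) (λ _ → 1#) (λ _ → s)
      (λ x y → cong (b ⊕ x ,_) (solve 2 (λ s y → s :+ y := con (1 , 0) :* y :+ s) refl s y))

    rowAffine? : ∀ f → Dec (RowAffine f)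
    rowAffine? f = map′ (λ h → rowAffine σ₀ m₀ c₀ (λ x y → h (x , y))) back
      (FinV.∀? (λ (x , y) → to f (x , y) ≟ⱽ (σ₀ x , m₀ x * y + c₀ x)))
      where
      σ₀ : B → B
      σ₀ x = proj₁ (to f (x , 0#))
      m₀ c₀ : B → F
      c₀ x = proj₂ (to f (x , 0#))
      m₀ x = proj₂ (to f (x , 1#)) + - c₀ x
      back : RowAffine f → ∀ v → to f v ≡ (σ₀ (proj₁ v) , m₀ (proj₁ v) * proj₂ v + c₀ (proj₁ v))
      back (rowAffine σ m c eq) (x , y) = trans (eq x y) (cong₂ _,_ (sym (cong proj₁ (eq x 0#)))
        (trans (solve 3 (λ m y c → m :* y :+ c :=
                  (m :* con (1 , 0) :+ c :+ :- (m :* con (0 , 0) :+ c)) :* y :+ (m :* con (0 , 0) :+ c)) refl (m x) y (c x))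
          (sym (cong₂ (λ u w → (u + - w) * y + w) (cong proj₂ (eq x 1#)) (cong proj₂ (eq x 0#))))))

    RowAffineGroup : Group V
    RowAffineGroup = record
      { mem = RowAffine ; mem? = rowAffine? ; resp = rowAffine-resp
      ; id∈ = rowAffine (λ x → x) (λ _ → 1#) (λ _ → 0#)
          (λ x y → cong (x ,_) (solve 1 (λ y → y := con (1 , 0) :* y :+ con (0 , 0)) refl y))
      ; ∙∈ = rowAffine-∙ ; ⁻¹∈ = rowAffine-⁻¹ }

module Stage1 where

  open import Data.Nat as ℕ using (ℕ; zero; suc)
  import Data.Nat.Properties as ℕP
  open import Data.Nat.Primality
  open import Data.Fin using (toℕ)
  open import Data.List.Properties using (length-applyUpTo)
  open import Data.Product hiding (map)
  open import Data.Product.Properties using (,-injectiveʳ)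
  open import Data.Sum using (_⊎_; inj₁; inj₂; [_,_]′)
  open import Data.Empty
  open import Function using (_∘_)
  open import Relation.Nullary
  open import Relation.Nullary.Decidable using (¬?; decidable-stable)
  open import Relation.Binary.PropositionalEquality hiding (resp)
  import Relation.Binary.PropositionalEquality.Properties as ≡P
  open Count
  open Perms
  open Space
  open Sylow using (coset-alternative)

  iter-conj : ∀ {V} (k z : Perm V) j x → iter (to (k ⁻¹ ∙ z ∙ k)) j x ≡ from k (iter (to z) j (to k x))
  iter-conj k z zero    x = sym (from-to k x)
  iter-conj k z (suc j) x = trans (cong (from k ∘ to z ∘ to k) (iter-conj k z j x)) (cong (from k ∘ to z) (to-from k _))

  small-order : ∀ {p} → Prime p → 8 ℕ.< p → (σ : B → B) → (∀ x → iter σ p x ≡ x) → ∀ x → σ x ≡ x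
  small-order {p} pr 8<p σ per x with σ x ≟ᴮ x
  ... | yes e = e
  ... | no ne = ⊥-elim (ℕP.<⇒≱ 8<p (subst (ℕ._≤ 8) (length-applyUpTo _ p)
                  (length-mono (orbit-unique ne) {allᴮ} (λ {y} _ → ∈allᴮ y))))
    where
    open Counting (≡P.decSetoid _≟ᴮ_)
    open Cyclic pr σ (cong σ) per

  module _ (n : ℕ) (pr : Prime (suc n)) where
    open Space.Space n pr

    p : ℕ
    p = suc n

    iter-z : ∀ j x y → iter (to z) j (x , y) ≡ (x , ⟦ j ⟧ + y)
    iter-z zero    x y = cong (x ,_) (sym (+-identityˡ y))
    iter-z (suc j) x y = trans (cong (to z) (iter-z j x y)) (cong (x ,_)
      (trans (sym (+-assoc 1# _ y)) (cong (_+ y) (sym (⟦+⟧ 1 j)))))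

    z-period : ∀ v → iter (to z) p v ≡ v
    z-period (x , y) = trans (iter-z p x y) (cong (x ,_) (trans (cong (_+ y) ⟦p⟧) (+-identityˡ y)))

    conj-period : ∀ k v → iter (to (k ⁻¹ ∙ z ∙ k)) p v ≡ v
    conj-period k v = trans (iter-conj k z p v) (trans (cong (from k) (z-period _)) (from-to k v))

    z-free : ∀ v → to z v ≢ v
    z-free (x , y) e = 1≢0 (trans (solve 2 (λ o y → o := (o :+ y) :+ :- y) refl 1# y)
      (trans (cong (_+ - y) (,-injectiveʳ e)) (-‿inverseʳ y)))

    conj-free : ∀ k v → to (k ⁻¹ ∙ z ∙ k) v ≢ v
    conj-free k v e = z-free (to k v) (trans (sym (to-from k _)) (cong (to k) e))

    straight⇒affine : ∀ k (u : B → F) → (∀ x → u x ≢ 0#) →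
                      (∀ x y → to k (x , u x + y) ≡ to z (to k (x , y))) → RowAffine k
    straight⇒affine k u u≢0 com = rowAffine σ m c λ x y →
      trans (cong (λ t → to k (x , t)) (coord x y)) (trans (run x (toℕ (m x * y))) (cong (σ x ,_)
        (cong (_+ c x) (⟦toℕ⟧ _))))
      where
      σ : B → B
      σ x = proj₁ (to k (x , 0#))
      m c : B → F
      c x = proj₂ (to k (x , 0#))
      m x = proj₁ (inv (u≢0 x))
      coord : ∀ x y → y ≡ ⟦ toℕ (m x * y) ⟧ * u x
      coord x y = sym (trans (cong (_* u x) (⟦toℕ⟧ _)) (trans (solve 3 (λ m y u → m :* y :* u := (m :* u) :* y) refl (m x) y (u x))
        (trans (cong (_* y) (proj₂ (inv (u≢0 x)))) (*-identityˡ y))))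
      run : ∀ x j → to k (x , ⟦ j ⟧ * u x) ≡ (σ x , ⟦ j ⟧ + c x)
      run x zero = trans (cong (λ t → to k (x , t)) (zeroˡ (u x))) (cong (σ x ,_) (sym (+-identityˡ _)))
      run x (suc j) = trans (cong (λ t → to k (x , t)) (trans (cong (_* u x) (⟦+⟧ 1 j))
          (solve 2 (λ j u → (con (1 , 0) :+ j) :* u := u :+ j :* u) refl ⟦ j ⟧ (u x))))
        (trans (com x _) (trans (cong (to z) (run x j)) (cong (σ x ,_)
          (trans (sym (+-assoc 1# ⟦ j ⟧ (c x))) (cong (_+ c x) (sym (⟦+⟧ 1 j)))))))

    mult-one : ∀ {k} (R : RowAffine k) → (∀ v → to k v ≢ v) → ∀ {x} → RowAffine.σ R x ≡ x → RowAffine.m R x ≡ 1#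
    mult-one {k} R free {x} e with RowAffine.m R x ≟ᶠ 1#
    ... | yes e₁ = e₁
    ... | no ne = ⊥-elim (free (x , y) (trans (eq x y) (cong₂ _,_ e fix)))
      where
      open RowAffine R
      d≢0 : 1# + - m x ≢ 0#
      d≢0 d0 = ne (trans (solve 1 (λ m → m := con (1 , 0) :+ :- (con (1 , 0) :+ :- m)) refl (m x))
        (trans (cong (λ t → 1# + - t) d0) (solve 0 (con (1 , 0) :+ :- con (0 , 0) := con (1 , 0)) refl)))
      i = proj₁ (inv d≢0)
      y = i * c x
      fix : m x * y + c x ≡ y
      fix = trans (cong (m x * y +_) (trans (sym (*-identityˡ (c x))) (cong (_* c x) (sym (proj₂ (inv d≢0))))))
        (solve 3 (λ m i c → m :* (i :* c) :+ i :* (con (1 , 0) :+ :- m) :* c := i :* c) refl (m x) i (c x))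

    straighten : ∀ h (R : RowAffine (h ⁻¹ ∙ z ∙ h)) → (∀ x → RowAffine.σ R x ≡ x) → RowAffine h
    straighten h R triv = straight⇒affine h c
      (λ x c0 → conj-free h (x , 0#) (trans (form x 0#) (cong (x ,_) (trans (cong (_+ 0#) c0) (+-identityˡ 0#)))))
      (λ x y → trans (cong (to h) (sym (form x y))) (to-from h _))
      where
      open RowAffine R
      form : ∀ x y → to (h ⁻¹ ∙ z ∙ h) (x , y) ≡ (x , c x + y)
      form x y = trans (eq x y) (cong₂ _,_ (triv x) (trans (cong (λ t → t * y + c x)
        (mult-one R (conj-free h) (triv x))) (solve 2 (λ y c → con (1 , 0) :* y :+ c := c :+ y) refl y (c x))))

    Moves-rows : Perm V → Set
    Moves-rows ψ = ∃ λ (R : RowAffine (ψ ⁻¹ ∙ z ∙ ψ)) → ∃ λ x → RowAffine.σ R x ≢ x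

    RowMoving : Instance → Set
    RowMoving S = ∃ λ ψ → (∀ v → Instance.mem S (ψ ⁻¹ ∙ shift v ∙ ψ)) × Moves-rows ψ

    trivial? : ∀ h (R : RowAffine (h ⁻¹ ∙ z ∙ h)) → RowAffine h ⊎ ∃ λ x → RowAffine.σ R x ≢ x
    trivial? h R with FinB.∃? (λ x → ¬? (RowAffine.σ R x ≟ᴮ x))
    ... | yes e = inj₂ e
    ... | no ¬e = inj₁ (straighten h R (λ x → decidable-stable (RowAffine.σ R x ≟ᴮ x) (λ ne → ¬e (x , ne))))

    module _ (S : Instance) where
      open Instance S

      Aligned : Set
      Aligned = ∃ λ k → mem k × RowAffine (φ ∙ k)

      aligned-or-moving : ∀ k → mem k → RowAffine ((φ ∙ k) ⁻¹ ∙ z ∙ (φ ∙ k)) → Aligned ⊎ RowMoving S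
      aligned-or-moving k k∈ R = [ (λ a → inj₁ (k , k∈ , a)) , (λ (x , ne) → inj₂ (φ ∙ k ,
        (λ v → resp (pt λ _ → refl) (∙∈ (⁻¹∈ k∈) (∙∈ (sh'∈ v) k∈))) , R , x , ne)) ]′ (trivial? (φ ∙ k) R)

      alien⇒moving : ∀ k → mem k → ¬ RowAffine k → RowAffine (k ⁻¹ ∙ z ∙ k) → Aligned ⊎ RowMoving S
      alien⇒moving k k∈ ¬a R = [ (λ a → ⊥-elim (¬a a)) , (λ (x , ne) → inj₂ (k ,
        (λ v → ∙∈ (⁻¹∈ k∈) (∙∈ (sh∈ v) k∈)) , R , x , ne)) ]′ (trivial? k R)

      alternatives : (∃ λ k → mem k × RowAffine (k ⁻¹ ∙ (φ ⁻¹ ∙ z ∙ φ) ∙ k)) ⊎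
                     (∃ λ k → mem k × ¬ RowAffine k × RowAffine (k ⁻¹ ∙ z ∙ k))
      alternatives = coset-alternative _≟ⱽ_ allⱽ ∈allⱽ A RowAffineGroup pr z (φ ⁻¹ ∙ z ∙ φ) (sh∈ (0ᴮ , 1#)) (sh'∈ (0ᴮ , 1#))
                       z-period (conj-period φ) (rowAffine-shift (0ᴮ , 1#))

      regroup : ∀ k → RowAffine (k ⁻¹ ∙ (φ ⁻¹ ∙ z ∙ φ) ∙ k) → RowAffine ((φ ∙ k) ⁻¹ ∙ z ∙ (φ ∙ k))
      regroup k (rowAffine σ m c eq) = rowAffine σ m c eq

      align-rows : Aligned ⊎ RowMoving S
      align-rows = go alternatives
        where
        go : (∃ λ k → mem k × RowAffine (k ⁻¹ ∙ (φ ⁻¹ ∙ z ∙ φ) ∙ k)) ⊎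
             (∃ λ k → mem k × ¬ RowAffine k × RowAffine (k ⁻¹ ∙ z ∙ k)) → Aligned ⊎ RowMoving S
        go (inj₁ (k , k∈ , R))      = aligned-or-moving k k∈ (regroup k R)
        go (inj₂ (k , k∈ , ¬a , R)) = alien⇒moving k k∈ ¬a R

    iter-row : ∀ {f} (R : RowAffine f) j x y → proj₁ (iter (to f) j (x , y)) ≡ iter (RowAffine.σ R) j x
    iter-row R zero    x y = refl
    iter-row R (suc j) x y = trans (cong proj₁ (RowAffine.eq R _ _)) (cong (RowAffine.σ R) (iter-row R j x y))

    row-period : ∀ h (R : RowAffine (h ⁻¹ ∙ z ∙ h)) x → iter (RowAffine.σ R) p x ≡ x
    row-period h R x = trans (sym (iter-row R p x 0#)) (cong proj₁ (conj-period h (x , 0#)))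

    align-rows-large : 8 ℕ.< p → ∀ S → Aligned S
    align-rows-large 8<p S = go (align-rows S)
      where
      go : Aligned S ⊎ RowMoving S → Aligned S
      go (inj₁ a) = a
      go (inj₂ (ψ , _ , R , x , ne)) = ⊥-elim (ne (small-order pr 8<p _ (row-period ψ R) x))

module Stage2 where

  open import Data.Nat as ℕ using (ℕ; suc)
  open import Data.Nat.Primality
  open import Data.Nat.Divisibility using (_∣_; _∣?_)
  open import Data.Bool using (Bool; true; false; _xor_; _∧_)
  import Data.Bool.Properties as BoolP
  open import Data.List using (List; []; _∷_)
  open import Data.List.Relation.Unary.All as All using (All; []; _∷_)
  open import Data.List.Relation.Unary.AllPairs as AllPairs using ([]; _∷_)
  import Data.List.Relation.Unary.Unique.Propositional as UP
  open import Data.List.Membership.Propositional using (_∈_)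
  open import Data.List.Relation.Unary.Any using (here; there)
  open import Data.Product hiding (map)
  open import Data.Product.Properties using (≡-dec; ,-injectiveʳ)
  open import Data.Empty
  open import Function using (_∘_)
  open import Relation.Nullary
  open import Relation.Nullary.Decidable using (_×-dec_; _→-dec_; ¬?; from-yes; from-no)
  open import Relation.Binary.PropositionalEquality hiding (resp)
  open Perms
  open Space
  open Two using (module ElementaryTwo)

  abstract
    nonzeroᴮ-unique : UP.Unique nonzeroᴮ
    nonzeroᴮ-unique = from-yes (AllPairs.allPairs? (λ x y → ¬? (x ≟ᴮ y)) nonzeroᴮ)

    ∈nonzeroᴮ : ∀ {x} → x ≢ 0ᴮ → x ∈ nonzeroᴮ
    ∈nonzeroᴮ {x} ne = out (∈allᴮ x)
      where
      out : x ∈ allᴮ → x ∈ nonzeroᴮ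
      out (here e)  = ⊥-elim (ne e)
      out (there p) = p

    nonzeroᴮ∈ : ∀ {x} → x ∈ nonzeroᴮ → x ≢ 0ᴮ
    nonzeroᴮ∈ = All.lookup (from-yes (All.all? (λ x → ¬? (x ≟ᴮ 0ᴮ)) nonzeroᴮ))

    common-shiftᴮ : (A : Group B) (let module A = Group A) (θ : Perm B)
      (tr : B → Perm B) → (∀ v x → to (tr v) x ≡ v ⊕ x) →
      (∀ v → A.mem (tr v)) → (∀ v → A.mem (θ ⁻¹ ∙ tr v ∙ θ)) →
      ∃ λ v → ∃ λ v' → v ≢ 0ᴮ × ∃ λ k → A.mem k × (∀ x → to θ (to k (v ⊕ x)) ≡ v' ⊕ to θ (to k x))
    common-shiftᴮ A θ tr tr≡ m m' = unpack (E.common-shift A θ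
          (λ v → A.resp (pt (tr≡ v)) (m v))
          (λ v → A.resp (pt λ x → cong (from θ) (tr≡ v (to θ x))) (m' v)))
      where
      module A = Group A
      module E = ElementaryTwo _≟ᴮ_ allᴮ ∈allᴮ _⊕_ 0ᴮ ⊕-comm ⊕-assoc ⊕-identityʳ ⊕-self
        nonzeroᴮ nonzeroᴮ-unique ∈nonzeroᴮ nonzeroᴮ∈ (from-no (2 ∣? 7))
      unpack : (∃ λ v → ∃ λ v' → v ≢ 0ᴮ × ∃ λ k → A.mem k × (θ ∙ k) ∙ E.shift v ≗ₚ E.shift v' ∙ (θ ∙ k)) →
               ∃ λ v → ∃ λ v' → v ≢ 0ᴮ × ∃ λ k → A.mem k × (∀ x → to θ (to k (v ⊕ x)) ≡ v' ⊕ to θ (to k x))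
      unpack (v , v' , ne , k , k∈ , e) = v , v' , ne , k , k∈ , at e

  lin : B × B × B → B → B
  lin (u , v , w) (a , b , c) = scale a u ⊕ (scale b v ⊕ scale c w)
    where
    scale : Bool → B → B
    scale false _ = 0ᴮ
    scale true  v = v

  lin-⊕? : ∀ m → Dec (∀ x y → lin m (x ⊕ y) ≡ lin m x ⊕ lin m y)
  lin-⊕? m = FinB.∀? λ x → FinB.∀? λ y → lin m (x ⊕ y) ≟ᴮ (lin m x ⊕ lin m y)

  record Linearᴮ : Set where
    constructor linear
    field
      perm₀ : Perm B
      add   : ∀ x y → to perm₀ (x ⊕ y) ≡ to perm₀ x ⊕ to perm₀ y

  mkLinear : ∀ m m' → (∀ x → lin m (lin m' x) ≡ x) → (∀ x → lin m' (lin m x) ≡ x) →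
             (∀ x y → lin m (x ⊕ y) ≡ lin m x ⊕ lin m y) → Linearᴮ
  mkLinear m m' p q r = linear (perm (lin m) (lin m') p q) r

  decLinear : ∀ m m' → Dec ((∀ x → lin m (lin m' x) ≡ x) × (∀ x → lin m' (lin m x) ≡ x) ×
                            (∀ x y → lin m (x ⊕ y) ≡ lin m x ⊕ lin m y))
  decLinear m m' = FinB.∀? (λ x → lin m (lin m' x) ≟ᴮ x) ×-dec FinB.∀? (λ x → lin m' (lin m x) ≟ᴮ x) ×-dec lin-⊕? m

  e₂ e₃ : B
  e₂ = false , true , false
  e₃ = false , false , true

  sending-e₁ : ∀ v → v ≢ 0ᴮ → ∃ λ (L : Linearᴮ) → to (Linearᴮ.perm₀ L) e₁ ≡ v
  sending-e₁ (false , false , false) ne = ⊥-elim (ne refl)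
  sending-e₁ v@(true , b , c) _ = go b c
    where
    go : ∀ b c → ∃ λ L → to (Linearᴮ.perm₀ L) e₁ ≡ (true , b , c)
    go false false = let (p , q , r) = from-yes (decLinear (e₁ , e₂ , e₃) (e₁ , e₂ , e₃)) in mkLinear _ _ p q r , refl
    go false true  = let m = (true , false , true) , e₂ , e₃ ; (p , q , r) = from-yes (decLinear m m) in mkLinear m m p q r , refl
    go true  false = let m = (true , true , false) , e₂ , e₃ ; (p , q , r) = from-yes (decLinear m m) in mkLinear m m p q r , refl
    go true  true  = let m = (true , true , true) , e₂ , e₃ ; (p , q , r) = from-yes (decLinear m m) in mkLinear m m p q r , refl
  sending-e₁ (false , true , false) _ =
    let m = e₂ , e₁ , e₃ ; (p , q , r) = from-yes (decLinear m m) in mkLinear m m p q r , refl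
  sending-e₁ (false , true , true) _ =
    let m = (false , true , true) , e₁ , e₃ ; m' = e₂ , (true , false , true) , e₃
        (p , q , r) = from-yes (decLinear m m') in mkLinear m m' p q r , refl
  sending-e₁ (false , false , true) _ =
    let m = e₃ , e₂ , e₁ ; (p , q , r) = from-yes (decLinear m m) in mkLinear m m p q r , refl

  Plane : Set
  Plane = Bool × Bool

  infixl 6 _⊕ₚ_
  _⊕ₚ_ : Plane → Plane → Plane
  (a , b) ⊕ₚ (c , d) = a xor c , b xor d

  0ₚ : Plane
  0ₚ = false , false

  _≟ₚ_ : (x y : Plane) → Dec (x ≡ y)
  _≟ₚ_ = ≡-dec BoolP._≟_ BoolP._≟_

  allₚ : List Plane
  allₚ = (false , false) ∷ (true , false) ∷ (false , true) ∷ (true , true) ∷ []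

  ∈allₚ : ∀ x → x ∈ allₚ
  ∈allₚ (false , false) = 0th
  ∈allₚ (true  , false) = 1st
  ∈allₚ (false , true)  = 2nd
  ∈allₚ (true  , true)  = 3rd

  module FinP₂ = Finite _≟ₚ_ allₚ ∈allₚ

  -- The inverse of the affine map of the plane sending 0, (1,0), (0,1) to a, b, c; its linear part has determinant 1.
  unaffine : Plane → Plane → Plane → Plane → Plane
  unaffine a b c x = adj (b ⊕ₚ a) (c ⊕ₚ a) (x ⊕ₚ a)
    where
    adj : Plane → Plane → Plane → Plane
    adj (p , r) (q , s) (u , v) = (s ∧ u) xor (q ∧ v) , (r ∧ u) xor (p ∧ v)

  affine : Plane → Plane → Plane → Plane → Plane
  affine a b c (u , v) = a ⊕ₚ (scale u (b ⊕ₚ a) ⊕ₚ scale v (c ⊕ₚ a))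
    where
    scale : Bool → Plane → Plane
    scale false _ = 0ₚ
    scale true  v = v

  abstract
    plane-affine : ∀ a b c d → a ≢ b → a ≢ c → a ≢ d → b ≢ c → b ≢ d → c ≢ d →
      (unaffine a b c a ≡ (false , false) × unaffine a b c b ≡ (true , false) ×
       unaffine a b c c ≡ (false , true) × unaffine a b c d ≡ (true , true)) ×
      (∀ x → affine a b c (unaffine a b c x) ≡ x) × (∀ x → unaffine a b c (affine a b c x) ≡ x) ×
      (∀ x y → unaffine a b c (x ⊕ₚ y) ≡ (unaffine a b c x ⊕ₚ unaffine a b c 0ₚ) ⊕ₚ unaffine a b c y)
    plane-affine = from-yes (FinP₂.∀? λ a → FinP₂.∀? λ b → FinP₂.∀? λ c → FinP₂.∀? λ d →
      ¬? (a ≟ₚ b) →-dec ¬? (a ≟ₚ c) →-dec ¬? (a ≟ₚ d) →-dec ¬? (b ≟ₚ c) →-dec ¬? (b ≟ₚ d) →-dec ¬? (c ≟ₚ d) →-dec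
      ((unaffine a b c a ≟ₚ (false , false) ×-dec unaffine a b c b ≟ₚ (true , false) ×-dec
        unaffine a b c c ≟ₚ (false , true) ×-dec unaffine a b c d ≟ₚ (true , true)) ×-dec
       FinP₂.∀? (λ x → affine a b c (unaffine a b c x) ≟ₚ x) ×-dec
       FinP₂.∀? (λ x → unaffine a b c (affine a b c x) ≟ₚ x) ×-dec
       FinP₂.∀? (λ x → FinP₂.∀? λ y →
         unaffine a b c (x ⊕ₚ y) ≟ₚ ((unaffine a b c x ⊕ₚ unaffine a b c 0ₚ) ⊕ₚ unaffine a b c y))))

  ⊕-0 : ∀ x y → x ⊕ y ≡ x → y ≡ 0ᴮ
  ⊕-0 x y e = trans (sym (⊕-cancel x y)) (trans (cong (x ⊕_) e) (⊕-self x))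

  module Normalise (n : ℕ) (pr : Prime (suc n)) where
    open Space.Space n pr

    liftᴮ : Perm B → Perm V
    liftᴮ θ = perm (λ (x , y) → to θ x , y) (λ (x , y) → from θ x , y)
      (λ (x , y) → cong (_, y) (to-from θ x)) (λ (x , y) → cong (_, y) (from-to θ x))

    Translating : Perm B → Set
    Translating θ = ∀ b x → to θ (b ⊕ x) ≡ (to θ b ⊕ to θ 0ᴮ) ⊕ to θ x

    hol-lift : ∀ θ → Translating θ → Hol (liftᴮ θ)
    hol-lift θ h = hol
      (λ (b , s) → (to θ b ⊕ to θ 0ᴮ , s) , pt λ (x , y) → cong (_, s + y) (h b x))
      (λ (b , s) → (from θ (b ⊕ to θ 0ᴮ) , s) , pt λ (x , y) → cong (_, s + y) (back b x))
      where
      back : ∀ b x → from θ (b ⊕ x) ≡ from θ (b ⊕ to θ 0ᴮ) ⊕ from θ x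
      back b x = from-≡ θ (trans (h _ _) (cong₂ _⊕_
        (trans (cong (_⊕ to θ 0ᴮ) (to-from θ _)) (trans (⊕-assoc b _ _) (trans (cong (b ⊕_) (⊕-self (to θ 0ᴮ))) (⊕-identityʳ b))))
        (to-from θ x)))

    linear-translating : ∀ (L : Linearᴮ) → Translating (Linearᴮ.perm₀ L)
    linear-translating (linear θ add) b x = trans (add b x) (cong (_⊕ to θ x) (sym fixed))
      where
      fixed : to θ b ⊕ to θ 0ᴮ ≡ to θ b
      fixed = trans (cong (to θ b ⊕_) (⊕-0 (to θ 0ᴮ) (to θ 0ᴮ) (sym (add 0ᴮ 0ᴮ)))) (⊕-identityʳ (to θ b))

    module _ (S : Instance) where
      open Instance S

      Induces : Perm B → Perm V → Set
      Induces s k = mem k × RowAffine k × (∀ x → proj₁ (to k (x , 0#)) ≡ to s x)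

      row-map : ∀ {k} → RowAffine k → ∀ x y → proj₁ (to k (x , y)) ≡ proj₁ (to k (x , 0#))
      row-map (rowAffine σ m c eq) x y = trans (cong proj₁ (eq x y)) (sym (cong proj₁ (eq x 0#)))

      rowsGroup : Group B
      rowsGroup = record
        { mem  = λ s → ∃ (Induces s)
        ; mem? = λ s → FinV.∃perm?
            (λ e (a , R , h) → resp e a , rowAffine-resp e R , λ x → trans (sym (cong proj₁ (at e (x , 0#)))) (h x))
            (λ k → mem? k ×-dec rowAffine? k ×-dec FinB.∀? (λ x → proj₁ (to k (x , 0#)) ≟ᴮ to s x))
        ; resp = λ e (k , a , R , h) → k , a , R , λ x → trans (h x) (at e x)
        ; id∈  = idₚ , id∈ , Group.id∈ RowAffineGroup , λ _ → refl
        ; ∙∈   = λ {s} (k , a , R , h) (l , b , Q , g) → k ∙ l , ∙∈ a b , rowAffine-∙ R Q ,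
                   λ x → trans (row-map R _ _) (trans (h _) (cong (to s) (g x)))
        ; ⁻¹∈  = λ {s} (k , a , R , h) → k ⁻¹ , ⁻¹∈ a , rowAffine-⁻¹ R ,
                   λ x → sym (from-≡ s (trans (sym (h _)) (trans (sym (row-map R _ _)) (cong proj₁ (to-from k (x , 0#))))))
        }

      module _ (R : RowAffine φ) where
        open RowAffine R

        trᴮ : B → Perm B
        trᴮ v = perm (v ⊕_) (v ⊕_) (⊕-cancel v) (⊕-cancel v)

        commonᴮ : ∃ λ v → ∃ λ v' → v ≢ 0ᴮ × ∃ λ s → Group.mem rowsGroup s × (∀ x → σ (to s (v ⊕ x)) ≡ v' ⊕ σ (to s x))
        commonᴮ = common-shiftᴮ rowsGroup (rowPerm R) trᴮ (λ _ _ → refl)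
          (λ v → tᴮ v , sh∈ (v , 0#) , rowAffine-shift (v , 0#) , λ _ → refl)
          (λ v → φ ⁻¹ ∙ tᴮ v ∙ φ , sh'∈ (v , 0#) , rowAffine-∙ (rowAffine-⁻¹ R) (rowAffine-∙ (rowAffine-shift (v , 0#)) R) ,
            λ x → trans (row-map (rowAffine-⁻¹ R) _ _) (cong (λ t → proj₁ (from φ (v ⊕ t , 0#))) (cong proj₁ (eq x 0#))))

    NormalForm : Perm V → Set
    NormalForm φ = ∃ λ (f : Plane → Bool) → ∃ λ (R : RowAffine φ) → ∀ a x → RowAffine.σ R (a , x) ≡ (a xor f x , x)

    Reduces : Instance → (Instance → Set) → Set₁
    Reduces S P = Σ Instance λ S' → P S' × (Good S' → Good S)

    CommutesE₁ : Instance → Set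
    CommutesE₁ S = ∃ λ (R : RowAffine (Instance.φ S)) → ∀ x → RowAffine.σ R (e₁ ⊕ x) ≡ e₁ ⊕ RowAffine.σ R x

    to-commuting : ∀ S → RowAffine (Instance.φ S) → Reduces S CommutesE₁
    to-commuting S R = go (commonᴮ S R)
      where
      open Instance S
      open RowAffine R
      nonzero : ∀ {v v' : B} (s : Perm B) → v ≢ 0ᴮ → (∀ x → σ (to s (v ⊕ x)) ≡ v' ⊕ σ (to s x)) → v' ≢ 0ᴮ
      nonzero {v} s ne e refl = ne (to-inj s (row-inj R (trans (cong (σ ∘ to s) (sym (⊕-identityʳ v))) (e 0ᴮ))))
      go : (∃ λ v → ∃ λ v' → v ≢ 0ᴮ × ∃ λ s → Group.mem (rowsGroup S) s × (∀ x → σ (to s (v ⊕ x)) ≡ v' ⊕ σ (to s x))) →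
           Reduces S CommutesE₁
      go (v , v' , ne , s , (k , k∈ , Q , h) , e) = reduce (sending-e₁ v ne) (sending-e₁ v' (nonzero s ne e))
        where
        reduce : (∃ λ (L : Linearᴮ) → to (Linearᴮ.perm₀ L) e₁ ≡ v) →
                 (∃ λ (L : Linearᴮ) → to (Linearᴮ.perm₀ L) e₁ ≡ v') → Reduces S CommutesE₁
        reduce (linear L add , eL) (linear L' add' , eL') = S₃ , (R₃ , comm) ,
          λ g → good-right S k k∈ (good-both S₁ (liftᴮ L) hL (good-left S₂ (liftᴮ L' ⁻¹) hL' g))
          where
          hL = hol-lift L (linear-translating (linear L add))
          hL' = hol-⁻¹ (hol-lift L' (linear-translating (linear L' add')))
          S₁ = right S k k∈
          S₂ = both S₁ (liftᴮ L) hL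
          S₃ = left S₂ (liftᴮ L' ⁻¹) hL'
          τ : B → B
          τ x = from L' (σ (to s (to L x)))
          R₃ : RowAffine (liftᴮ L' ⁻¹ ∙ (φ ∙ k) ∙ liftᴮ L)
          R₃ = rowAffine τ (λ x → m (to s (to L x)) * RowAffine.m Q (to L x))
                 (λ x → m (to s (to L x)) * RowAffine.c Q (to L x) + c (to s (to L x)))
                 λ x y → trans (cong (to (liftᴮ L' ⁻¹) ∘ to φ) (kform (to L x) y))
                   (trans (cong (to (liftᴮ L' ⁻¹)) (eq _ _)) (cong (τ x ,_)
                     (solve 5 (λ a b y d c → a :* (b :* y :+ d) :+ c := (a :* b) :* y :+ (a :* d :+ c)) refl
                       (m (to s (to L x))) (RowAffine.m Q (to L x)) y (RowAffine.c Q (to L x)) (c (to s (to L x))))))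
            where
            kform : ∀ x y → to k (x , y) ≡ (to s x , RowAffine.m Q x * y + RowAffine.c Q x)
            kform x y = trans (RowAffine.eq Q x y) (cong (_, _) (trans (sym (cong proj₁ (RowAffine.eq Q x 0#))) (h x)))
          comm : ∀ x → τ (e₁ ⊕ x) ≡ e₁ ⊕ τ x
          comm x = trans (cong (λ t → from L' (σ (to s t))) (trans (add e₁ x) (cong (_⊕ to L x) eL)))
            (trans (cong (from L') (e (to L x)))
              (from-≡ L' (trans (add' e₁ (τ x)) (cong₂ _⊕_ eL' (to-from L' _)))))

    to-normal : ∀ S → CommutesE₁ S → Reduces S (NormalForm ∘ Instance.φ)
    to-normal S (R , comm) = left S (liftᴮ U) hU , (f , R' , nf) , good-left S (liftᴮ U) hU
      where
      open Instance S
      open RowAffine R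
      plane : Plane → Plane
      plane x = proj₂ (σ (false , x))
      f : Plane → Bool
      f x = proj₁ (σ (false , x))
      σ-true : ∀ x → σ (true , x) ≡ e₁ ⊕ σ (false , x)
      σ-true x = comm (false , x)
      plane-inj : ∀ {x x'} → x ≢ x' → plane x ≢ plane x'
      plane-inj {x} {x'} ne e = dec (BoolP._≟_ (f x) (f x'))
        where
        dec : Dec (f x ≡ f x') → ⊥
        dec (yes d) = ne (,-injectiveʳ (row-inj R (cong₂ _,_ d e)))
        dec (no  d) = ne (sym (,-injectiveʳ (row-inj R (trans (σ-true x') (cong₂ _,_ (flip (f x) (f x') d) (sym e))))))
          where
          flip : ∀ a b → a ≢ b → true xor b ≡ a
          flip false false ne = ⊥-elim (ne refl)
          flip false true  ne = refl
          flip true  false ne = refl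
          flip true  true  ne = ⊥-elim (ne refl)
      p₀ = plane (false , false)
      p₁ = plane (true , false)
      p₂ = plane (false , true)
      p₃ = plane (true , true)
      PA = plane-affine p₀ p₁ p₂ p₃ (plane-inj λ ()) (plane-inj λ ()) (plane-inj λ ())
             (plane-inj λ ()) (plane-inj λ ()) (plane-inj λ ())
      U : Perm B
      U = perm (λ (a , x) → a , unaffine p₀ p₁ p₂ x) (λ (a , x) → a , affine p₀ p₁ p₂ x)
        (λ (a , x) → cong (a ,_) (proj₁ (proj₂ (proj₂ PA)) x)) (λ (a , x) → cong (a ,_) (proj₁ (proj₂ PA) x))
      hU : Hol (liftᴮ U)
      hU = hol-lift U λ (b , u) (a , x) → cong₂ _,_ (cong (_xor a) (sym (BoolP.xor-identityʳ b))) (proj₂ (proj₂ (proj₂ PA)) u x)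
      straight : ∀ x → unaffine p₀ p₁ p₂ (plane x) ≡ x
      straight (false , false) = proj₁ (proj₁ PA)
      straight (true  , false) = proj₁ (proj₂ (proj₁ PA))
      straight (false , true)  = proj₁ (proj₂ (proj₂ (proj₁ PA)))
      straight (true  , true)  = proj₂ (proj₂ (proj₂ (proj₁ PA)))
      R' : RowAffine (liftᴮ U ∙ φ)
      R' = rowAffine (to U ∘ σ) m c λ x y → cong (to (liftᴮ U)) (eq x y)
      nf : ∀ a x → to U (σ (a , x)) ≡ (a xor f x , x)
      nf false x = cong (f x ,_) (straight x)
      nf true  x = trans (cong (to U) (σ-true x)) (cong (true xor f x ,_) (straight x))

    normalise : ∀ S → RowAffine (Instance.φ S) → Reduces S (NormalForm ∘ Instance.φ)
    normalise S R = let (S₁ , c , g₁) = to-commuting S R ; (S₂ , nf , g₂) = to-normal S₁ c in S₂ , nf , λ g → g₁ (g₂ g)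

module Shifts where

  open import Data.Nat as ℕ using (ℕ; zero; suc)
  open import Data.Nat.Primality
  open import Data.Fin using (toℕ)
  open import Data.Product hiding (map)
  open import Data.Empty
  open import Function using (_∘_)
  open import Relation.Nullary
  open import Relation.Nullary.Decidable using (_×-dec_; ¬?; map′; decidable-stable)
  open import Relation.Binary.PropositionalEquality hiding (resp)
  open Perms
  open Space

  ⊕-identityˡ : ∀ x → 0ᴮ ⊕ x ≡ x
  ⊕-identityˡ x = trans (⊕-comm 0ᴮ x) (⊕-identityʳ x)

  ⊕-cancelʳ : ∀ x y → (x ⊕ y) ⊕ y ≡ x
  ⊕-cancelʳ x y = trans (⊕-assoc x y y) (trans (cong (x ⊕_) (⊕-self y)) (⊕-identityʳ x))

  ⊕-to : ∀ x y → (x ⊕ y) ⊕ x ≡ y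
  ⊕-to x y = trans (cong (_⊕ x) (⊕-comm x y)) (⊕-cancelʳ y x)

  module RowShifts (n : ℕ) (pr : Prime (suc n)) (S : Space.Space.Instance n pr) where
    open Space.Space n pr
    open Instance S

    T : (B → F) → Set
    T u = mem (rowShift u)

    T-resp : ∀ {u w} → (∀ x → u x ≡ w x) → T u → T w
    T-resp e = resp (pt λ (x , y) → cong (λ t → x , t + y) (e x))

    T-+ : ∀ {u w} → T u → T w → T (λ x → u x + w x)
    T-+ {u} {w} a b = resp (pt λ (x , y) → cong (x ,_) (sym (+-assoc (u x) (w x) y))) (∙∈ a b)

    T-const : ∀ s → T (λ _ → s)
    T-const s = resp (pt λ (x , y) → cong (_, s + y) (⊕-identityˡ x)) (sh∈ (0ᴮ , s))

    T-translate : ∀ b {u} → T u → T (u ∘ (b ⊕_))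
    T-translate b {u} m = resp (pt λ (x , y) → cong₂ _,_ (⊕-cancel b x)
        (solve 2 (λ u y → con (0 , 0) :+ (u :+ (con (0 , 0) :+ y)) := u :+ y) refl (u (b ⊕ x)) y))
      (∙∈ (sh∈ (b , 0#)) (∙∈ m (sh∈ (b , 0#))))

    T-multiple : ∀ j {u} → T u → T (λ x → ⟦ j ⟧ * u x)
    T-multiple zero    {u} m = T-resp (λ x → sym (zeroˡ (u x))) (T-const 0#)
    T-multiple (suc j) {u} m = T-resp (λ x → trans (solve 2 (λ u j → u :+ j :* u := (con (1 , 0) :+ j) :* u) refl (u x) ⟦ j ⟧)
      (cong (_* u x) (sym (⟦+⟧ 1 j)))) (T-+ m (T-multiple j m))

    T-scale : ∀ s {u} → T u → T (λ x → s * u x)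
    T-scale s {u} m = T-resp (λ x → cong (_* u x) (⟦toℕ⟧ s)) (T-multiple (toℕ s) m)

    T-- : ∀ {u w} → T u → T w → T (λ x → u x + - w x)
    T-- {u} {w} a b = T-resp (λ x → cong (u x +_) (solve 1 (λ w → (:- con (1 , 0)) :* w := :- w) refl (w x)))
      (T-+ a (T-scale (- 1#) b))

    T-conj : ∀ {k u w} (R : RowAffine k) → mem k → (∀ x → RowAffine.m R x * w x ≡ u (RowAffine.σ R x)) → T u → T w
    T-conj {k} {u} {w} R k∈ e m = resp (pt λ (x , y) → from-≡ k (trans (R.eq x _) (trans (cong (R.σ x ,_)
        (trans (solve 4 (λ a w y c → a :* (w :+ y) :+ c := a :* w :+ (a :* y :+ c)) refl (R.m x) (w x) y (R.c x))
          (cong (_+ (R.m x * y + R.c x)) (e x))))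
        (cong (to (rowShift u)) (sym (R.eq x y))))))
      (∙∈ (⁻¹∈ k∈) (∙∈ m k∈))
      where module R = RowAffine R

    Sep : B → B → Set
    Sep x x' = ∃ λ u → T u × u x ≢ u x'

    abstract
      sep? : ∀ x x' → Dec (Sep x x')
      sep? x x' = map′ (λ (k , m , e , ne) → amount k , resp (pt e) m , ne)
        (λ (u , m , ne) → rowShift u , m ,
          (λ (x , y) → cong (λ t → x , t + y) (sym (+-identityʳ (u x)))) ,
          (λ e → ne (trans (sym (+-identityʳ (u x))) (trans e (+-identityʳ (u x'))))))
        (FinV.∃perm?
          (λ { {f} {g} d (m , e , ne) → resp d m ,
               (λ v → trans (sym (at d v)) (trans (e v) (cong (λ t → proj₁ v , t + proj₂ v) (cong proj₂ (at d (proj₁ v , 0#)))))) ,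
               λ q → ne (trans (cong proj₂ (at d (x , 0#))) (trans q (sym (cong proj₂ (at d (x' , 0#)))))) })
          (λ k → mem? k ×-dec FinV.∀? (λ v → to k v ≟ⱽ to (rowShift (amount k)) v) ×-dec
                 ¬? (amount k x ≟ᶠ amount k x')))
        where
        amount : Perm V → B → F
        amount k x = proj₂ (to k (x , 0#))

    agree : ∀ {x x' u} → ¬ Sep x x' → T u → u x ≡ u x'
    agree {x} {x'} {u} ns m = decidable-stable (u x ≟ᶠ u x') λ ne → ns (u , m , ne)

    Sep-sym : ∀ {x x'} → Sep x x' → Sep x' x
    Sep-sym (u , m , ne) = u , m , ne ∘ sym

    Sep-translate : ∀ b {x x'} → Sep (b ⊕ x) (b ⊕ x') → Sep x x'
    Sep-translate b (u , m , ne) = u ∘ (b ⊕_) , T-translate b m , ne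

    Invariant : (B → F) → Set
    Invariant u = ∀ x x' → ¬ Sep x x' → u x ≡ u x'

    T⇒invariant : ∀ {u} → T u → Invariant u
    T⇒invariant m x x' ns = agree ns m

    module Odd (2≢0 : 1# + 1# ≢ 0#) where

      two : ∀ {a} → a ≢ 0# → a + a ≢ 0#
      two {a} a≢0 e = no-zero-divisors 2≢0 a≢0 (trans (solve 1 (λ a → (con (1 , 0) :+ con (1 , 0)) :* a := a :+ a) refl a) e)

      Delta : B → B → B → Set
      Delta x₁ x₂ x₃ = ∃ λ w → T w × w x₁ ≡ 1# × w x₂ ≡ 0# × w x₃ ≡ 0#

      rescale : ∀ {x₁ x₂ x₃ w d} → T w → d ≢ 0# → w x₁ ≡ d → w x₂ ≡ 0# → w x₃ ≡ 0# → Delta x₁ x₂ x₃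
      rescale {w = w} m ne e₁ e₂ e₃ = let (i , id) = inv ne in (λ x → i * w x) , T-scale i m ,
        trans (cong (i *_) e₁) id , trans (cong (i *_) e₂) (zeroʳ i) , trans (cong (i *_) e₃) (zeroʳ i)

      signed : ∀ {x₁ x₂ x₃ e d} → T e → d ≢ 0# → e x₁ ≡ d → e x₂ ≡ - d → e x₃ ≡ - d → Delta x₁ x₂ x₃
      signed {e = e} {d} m ne e₁ e₂ e₃ = rescale (T-+ m (T-const d)) (two ne) (cong (_+ d) e₁)
        (trans (cong (_+ d) e₂) (-‿inverseˡ d)) (trans (cong (_+ d) e₃) (-‿inverseˡ d))

      delta : ∀ {x₁ x₂ x₃} → Sep x₁ x₂ → Sep x₁ x₃ → Delta x₁ x₂ x₃
      delta {x₁} {x₂} {x₃} (u , mu , α≢0) (u' , mu' , γ≢0) = cases ((α + - β) ≟ᶠ 0#) ((γ + - δ) ≟ᶠ 0#)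
        where
        h h' x₄ : B
        h = x₁ ⊕ x₂
        h' = x₁ ⊕ x₃
        x₄ = h ⊕ x₃
        v w : B → F
        v x = u x + - u (h ⊕ x)
        w x = u' x + - u' (h' ⊕ x)
        α β γ δ : F
        α = u x₁ + - u x₂
        β = u x₃ + - u x₄
        γ = u' x₁ + - u' x₃
        δ = u' x₂ + - u' x₄
        Tv : T v
        Tv = T-- mu (T-translate h mu)
        Tw : T w
        Tw = T-- mu' (T-translate h' mu')
        h1 : h ⊕ x₁ ≡ x₂
        h1 = ⊕-to x₁ x₂
        h2 : h ⊕ x₂ ≡ x₁
        h2 = ⊕-cancelʳ x₁ x₂
        h4 : h ⊕ x₄ ≡ x₃
        h4 = ⊕-cancel h x₃
        h'1 : h' ⊕ x₁ ≡ x₃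
        h'1 = ⊕-to x₁ x₃
        h'3 : h' ⊕ x₃ ≡ x₁
        h'3 = ⊕-cancelʳ x₁ x₃
        h'2 : h' ⊕ x₂ ≡ x₄
        h'2 = trans (⊕-assoc x₁ x₃ x₂) (trans (cong (x₁ ⊕_) (⊕-comm x₃ x₂)) (sym (⊕-assoc x₁ x₂ x₃)))
        h'4 : h' ⊕ x₄ ≡ x₂
        h'4 = trans (cong (h' ⊕_) (sym h'2)) (⊕-cancel h' x₂)
        anti : ∀ a b → b + - a ≡ - (a + - b)
        anti = solve 2 (λ a b → b :+ :- a := :- (a :+ :- b)) refl
        v1 : v x₁ ≡ α
        v1 = cong (λ t → u x₁ + - u t) h1
        v2 : v x₂ ≡ - α
        v2 = trans (cong (λ t → u x₂ + - u t) h2) (anti _ _)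
        v4 : v x₄ ≡ - β
        v4 = trans (cong (λ t → u x₄ + - u t) h4) (anti _ _)
        w1 : w x₁ ≡ γ
        w1 = cong (λ t → u' x₁ + - u' t) h'1
        w2 : w x₂ ≡ δ
        w2 = cong (λ t → u' x₂ + - u' t) h'2
        w3 : w x₃ ≡ - γ
        w3 = trans (cong (λ t → u' x₃ + - u' t) h'3) (anti _ _)
        w4 : w x₄ ≡ - δ
        w4 = trans (cong (λ t → u' x₄ + - u' t) h'4) (anti _ _)
        ≢-diff : ∀ {a b} → a ≢ b → a + - b ≢ 0#
        ≢-diff {a} {b} ne e = ne (trans (solve 2 (λ a b → a := (a :+ :- b) :+ b) refl a b) (trans (cong (_+ b) e) (+-identityˡ b)))
        ≡-diff : ∀ {a b} → a + - b ≡ 0# → b ≡ a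
        ≡-diff {a} {b} e = trans (solve 2 (λ a b → b := a :+ :- (a :+ :- b)) refl a b)
          (trans (cong (λ t → a + - t) e) (solve 1 (λ a → a :+ :- con (0 , 0) := a) refl a))
        cases : Dec (α + - β ≡ 0#) → Dec (γ + - δ ≡ 0#) → Delta x₁ x₂ x₃
        cases (no ne) _ = signed (T-- Tv (T-translate h' Tv)) ne
          (cong₂ (λ a b → a + - b) v1 (cong v h'1))
          (trans (cong₂ (λ a b → a + - b) v2 (trans (cong v h'2) v4)) (solve 2 (λ a b → :- a :+ :- :- b := :- (a :+ :- b)) refl α β))
          (trans (cong (λ t → β + - t) (trans (cong v h'3) v1)) (anti α β))
        cases (yes _) (no ne) = signed (T-- Tw (T-translate h Tw)) ne
          (cong₂ (λ a b → a + - b) w1 (trans (cong w h1) w2))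
          (trans (cong₂ (λ a b → a + - b) w2 (trans (cong w h2) w1)) (anti γ δ))
          (trans (cong₂ (λ a b → a + - b) w3 w4) (solve 2 (λ a b → :- a :+ :- :- b := :- (a :+ :- b)) refl γ δ))
        cases (yes e) (yes e') = rescale
          (T-+ (T-scale γ (T-+ Tv (T-translate h' Tv))) (T-scale α (T-+ Tw (T-translate h Tw))))
          (two (two (no-zero-divisors (≢-diff α≢0) (≢-diff γ≢0))))
          (trans (cong₂ (λ a b → γ * a + α * b) (cong₂ _+_ v1 (trans (cong v h'1) (≡-diff e))) (cong₂ _+_ w1 (trans (cong w h1) (trans w2 (≡-diff e')))))
            (solve 2 (λ a g → g :* (a :+ a) :+ a :* (g :+ g) := (a :* g :+ a :* g) :+ (a :* g :+ a :* g)) refl α γ))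
          (trans (cong₂ (λ a b → γ * a + α * b) (cong₂ _+_ v2 (trans (cong v h'2) (trans v4 (cong -_ (≡-diff e)))))
                                                (cong₂ _+_ (trans w2 (≡-diff e')) (trans (cong w h2) w1)))
            (solve 2 (λ a g → g :* (:- a :+ :- a) :+ a :* (g :+ g) := con (0 , 0)) refl α γ))
          (trans (cong₂ (λ a b → γ * a + α * b) (cong₂ _+_ (≡-diff e) (trans (cong v h'3) v1))
                                                (cong₂ _+_ w3 (trans w4 (cong -_ (≡-diff e')))))
            (solve 2 (λ a g → g :* (a :+ a) :+ a :* (:- g :+ :- g) := con (0 , 0)) refl α γ))

      interpolate₂ : ∀ {u} → Invariant u → ∀ x₁ x₂ → ∃ λ w → T w × w x₁ ≡ u x₁ × w x₂ ≡ u x₂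
      interpolate₂ {u} iv x₁ x₂ = go (sep? x₁ x₂)
        where
        go : Dec (Sep x₁ x₂) → ∃ λ w → T w × w x₁ ≡ u x₁ × w x₂ ≡ u x₂
        go (no ns) = (λ _ → u x₁) , T-const (u x₁) , refl , iv x₁ x₂ ns
        go (yes s) = let (d , Td , e₁ , e₂ , _) = delta s s in
          (λ x → (u x₁ + - u x₂) * d x + u x₂) , T-+ (T-scale _ Td) (T-const _) ,
          trans (cong (λ t → (u x₁ + - u x₂) * t + u x₂) e₁)
            (solve 2 (λ a b → (a :+ :- b) :* con (1 , 0) :+ b := a) refl (u x₁) (u x₂)) ,
          trans (cong (λ t → (u x₁ + - u x₂) * t + u x₂) e₂)
            (solve 2 (λ a b → (a :+ :- b) :* con (0 , 0) :+ b := b) refl (u x₁) (u x₂))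

      interpolate₃ : ∀ {u} → Invariant u → ∀ x₁ x₂ x₃ → ∃ λ w → T w × w x₁ ≡ u x₁ × w x₂ ≡ u x₂ × w x₃ ≡ u x₃
      interpolate₃ {u} iv x₁ x₂ x₃ = go (sep? x₁ x₂) (sep? x₁ x₃)
        where
        go : Dec (Sep x₁ x₂) → Dec (Sep x₁ x₃) → ∃ λ w → T w × w x₁ ≡ u x₁ × w x₂ ≡ u x₂ × w x₃ ≡ u x₃
        go (no ns) _ = let (w , Tw , e₁ , e₃) = interpolate₂ iv x₁ x₃ in
          w , Tw , e₁ , trans (sym (agree ns Tw)) (trans e₁ (iv x₁ x₂ ns)) , e₃
        go (yes _) (no ns) = let (w , Tw , e₁ , e₂) = interpolate₂ iv x₁ x₂ in
          w , Tw , e₁ , e₂ , trans (sym (agree ns Tw)) (trans e₁ (iv x₁ x₃ ns))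
        go (yes s) (yes s') = let (w , Tw , e₂ , e₃) = interpolate₂ iv x₂ x₃ ; (d , Td , d₁ , d₂ , d₃) = delta s s' in
          (λ x → w x + (u x₁ + - w x₁) * d x) , T-+ Tw (T-scale _ Td) ,
          trans (cong (λ t → w x₁ + (u x₁ + - w x₁) * t) d₁)
            (solve 2 (λ a w → w :+ (a :+ :- w) :* con (1 , 0) := a) refl (u x₁) (w x₁)) ,
          trans (cong (λ t → w x₂ + (u x₁ + - w x₁) * t) d₂) (trans (cong (w x₂ +_) (zeroʳ _)) (trans (+-identityʳ _) e₂)) ,
          trans (cong (λ t → w x₃ + (u x₁ + - w x₁) * t) d₃) (trans (cong (w x₃ +_) (zeroʳ _)) (trans (+-identityʳ _) e₃))

      invariant⇒T : ∀ {u} → Invariant u → T u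
      invariant⇒T {u} iv = cl₃ (rowShift u) λ (x₁ , y₁) (x₂ , y₂) (x₃ , y₃) →
        let (w , Tw , e₁ , e₂ , e₃) = interpolate₃ iv x₁ x₂ x₃ in
        rowShift w , Tw , cong (λ t → x₁ , t + y₁) e₁ , cong (λ t → x₂ , t + y₂) e₂ , cong (λ t → x₃ , t + y₃) e₃

      module _ {k} (Q : RowAffine k) (k∈ : mem k) where
        private module Q = RowAffine Q

        Q⁻ : B → F
        Q⁻ x = proj₁ (inv (mult≢0 Q x))

        Q*Q⁻ : ∀ x → Q.m x * Q⁻ x ≡ 1#
        Q*Q⁻ x = trans (*-comm _ _) (proj₂ (inv (mult≢0 Q x)))

        mult-invariant : Invariant Q.m
        mult-invariant x x' ns = *-cancel (λ e → 1≢0 (trans (sym (Q*Q⁻ x)) (trans (cong (Q.m x *_) e) (zeroʳ _))))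
          (trans (*-comm (Q⁻ x) (Q.m x)) (trans (Q*Q⁻ x) (trans (sym (Q*Q⁻ x')) (trans (*-comm (Q.m x') (Q⁻ x'))
            (cong (_* Q.m x') (sym (T⇒invariant (T-conj {u = λ _ → 1#} Q k∈ Q*Q⁻ (T-const 1#)) x x' ns)))))))

        T-row : ∀ {u} → T u → T (u ∘ Q.σ)
        T-row {u} Tu = invariant⇒T λ x x' ns →
          trans (sym (mw x)) (trans (cong₂ _*_ (mult-invariant x x' ns) (T⇒invariant (T-conj {w = w} Q k∈ mw Tu) x x' ns)) (mw x'))
          where
          w : B → F
          w x = Q⁻ x * u (Q.σ x)
          mw : ∀ x → Q.m x * w x ≡ u (Q.σ x)
          mw x = trans (sym (*-assoc _ _ _)) (trans (cong (_* u (Q.σ x)) (Q*Q⁻ x)) (*-identityˡ _))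

module OddForm where

  open import Data.Nat as ℕ using (ℕ; suc)
  open import Data.Nat.Primality
  open import Data.Bool using (Bool; true; false; _xor_)
  import Data.Bool.Properties as BoolP
  open import Data.List using ([]; _∷_)
  open import Data.List.Membership.Propositional using (_∈_)
  open import Data.Product hiding (map; swap)
  open import Data.Sum using (_⊎_; inj₁; inj₂)
  open import Data.Empty
  open import Relation.Nullary
  open import Relation.Nullary.Decidable using (_×-dec_; _→-dec_; ¬?; from-yes)
  open import Relation.Binary.PropositionalEquality hiding (resp)
  open Perms
  open Space
  open Shifts
  open Stage2

  ∈Bools : ∀ b → b ∈ (false ∷ true ∷ [])
  ∈Bools false = 0th
  ∈Bools true  = 1st

  module FinBool = Finite BoolP._≟_ (false ∷ true ∷ []) ∈Bools

  th : (Plane → Bool) → B → B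
  th f (a , x) = a xor f x , x

  th-invol : ∀ f x → th f (th f x) ≡ x
  th-invol f (a , x) = cong (_, x) (trans (BoolP.xor-assoc a (f x) (f x)) (trans (cong (a xor_) (BoolP.xor-same (f x))) (BoolP.xor-identityʳ a)))

  th-e₁ : ∀ f x → th f (e₁ ⊕ x) ≡ e₁ ⊕ th f x
  th-e₁ f (a , x) = cong (_, x) (BoolP.xor-assoc true a (f x))

  parity : (Plane → Bool) → Bool
  parity f = (f (false , false) xor f (true , false)) xor (f (false , true) xor f (true , true))

  table : Bool → Bool → Bool → Bool → Plane → Bool
  table a b c d (false , false) = a
  table a b c d (true  , false) = b
  table a b c d (false , true)  = c
  table a b c d (true  , true)  = d

  table-of : (f : Plane → Bool) → ∀ x → f x ≡ table (f (false , false)) (f (true , false)) (f (false , true)) (f (true , true)) x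
  table-of f (false , false) = refl
  table-of f (true  , false) = refl
  table-of f (false , true)  = refl
  table-of f (true  , true)  = refl

  ∀Bool⁴? : ∀ {P : Bool → Bool → Bool → Bool → Set} → (∀ a b c d → Dec (P a b c d)) → Dec (∀ a b c d → P a b c d)
  ∀Bool⁴? P? = FinBool.∀? λ a → FinBool.∀? λ b → FinBool.∀? λ c → FinBool.∀? λ d → P? a b c d

  abstract
    even⇒affine : ∀ f → parity f ≡ false → ∀ x y → f (x ⊕ₚ y) ≡ (f x xor f 0ₚ) xor f y
    even⇒affine f e x y = trans (table-of f (x ⊕ₚ y)) (trans
      (go (f (false , false)) (f (true , false)) (f (false , true)) (f (true , true)) e x y)
      (sym (cong₂ (λ s t → (s xor f 0ₚ) xor t) (table-of f x) (table-of f y))))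
      where
      go : ∀ a b c d → (a xor b) xor (c xor d) ≡ false → ∀ x y →
           table a b c d (x ⊕ₚ y) ≡ (table a b c d x xor a) xor table a b c d y
      go = from-yes (∀Bool⁴? λ a b c d → ((a xor b) xor (c xor d)) BoolP.≟ false →-dec
        FinP₂.∀? λ x → FinP₂.∀? λ y → table a b c d (x ⊕ₚ y) BoolP.≟ ((table a b c d x xor a) xor table a b c d y))

    -- Two distinct nonzero vectors x, y of the plane give 0, x, y, x + y as its four points.
    odd-sum : ∀ f → parity f ≡ true → ∀ x y → x ≢ 0ₚ → y ≢ 0ₚ → x ≢ y →
              (f 0ₚ xor f x) xor (f y xor f (x ⊕ₚ y)) ≡ true
    odd-sum f e x y nx ny nxy = trans
      (cong₂ (λ s t → (f 0ₚ xor s) xor t) (table-of f x) (cong₂ _xor_ (table-of f y) (table-of f (x ⊕ₚ y))))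
      (go (f (false , false)) (f (true , false)) (f (false , true)) (f (true , true)) e x y nx ny nxy)
      where
      go : ∀ a b c d → (a xor b) xor (c xor d) ≡ true → ∀ x y → x ≢ 0ₚ → y ≢ 0ₚ → x ≢ y →
           (a xor table a b c d x) xor (table a b c d y xor table a b c d (x ⊕ₚ y)) ≡ true
      go = from-yes (∀Bool⁴? λ a b c d → ((a xor b) xor (c xor d)) BoolP.≟ true →-dec
        FinP₂.∀? λ x → FinP₂.∀? λ y → ¬? (x ≟ₚ 0ₚ) →-dec ¬? (y ≟ₚ 0ₚ) →-dec ¬? (x ≟ₚ y) →-dec
        ((a xor table a b c d x) xor (table a b c d y xor table a b c d (x ⊕ₚ y))) BoolP.≟ true)

    third : ∀ x → x ≢ 0ₚ → ∃ λ y → y ≢ 0ₚ × x ≢ y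
    third = from-yes (FinP₂.∀? λ x → ¬? (x ≟ₚ 0ₚ) →-dec FinP₂.∃? λ y → ¬? (y ≟ₚ 0ₚ) ×-dec ¬? (x ≟ₚ y))

  module Forms (n : ℕ) (pr : Prime (suc n)) where
    open Space.Space n pr
    open Normalise n pr

    Form : Perm V → (Plane → Bool) → (B → F) → (B → F) → Set
    Form φ f D c = ∀ x y → to φ (x , y) ≡ (th f x , D x * y + c x)

    form-mult≢0 : ∀ {φ f D c} → Form φ f D c → ∀ x → D x ≢ 0#
    form-mult≢0 {φ} {f} {D} {c} F = mult≢0 {φ} (rowAffine (th f) D c F)

    thPerm : (Plane → Bool) → Perm B
    thPerm f = perm (th f) (th f) (th-invol f) (th-invol f)

    hol-th : ∀ g → parity g ≡ false → Hol (liftᴮ (thPerm g))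
    hol-th g e = hol-lift (thPerm g) λ (b , u) (a , x) → cong₂ _,_
      (trans (cong ((b xor a) xor_) (even⇒affine g e u x)) (rearrange b a (g u) (g 0ₚ) (g x)))
      (cong (_⊕ₚ x) (sym (trans (cong (u ⊕ₚ_) refl) (⊕ₚ-0 u))))
      where
      ⊕ₚ-0 : ∀ u → u ⊕ₚ 0ₚ ≡ u
      ⊕ₚ-0 (a , b) = cong₂ _,_ (BoolP.xor-identityʳ a) (BoolP.xor-identityʳ b)
      rearrange : ∀ b a s t r → (b xor a) xor ((s xor t) xor r) ≡ ((b xor s) xor t) xor (a xor r)
      rearrange = from-yes (FinBool.∀? λ b → FinBool.∀? λ a → FinBool.∀? λ s → FinBool.∀? λ t → FinBool.∀? λ r →
        ((b xor a) xor ((s xor t) xor r)) BoolP.≟ (((b xor s) xor t) xor (a xor r)))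

    adjust : ∀ S {f D c} g → parity g ≡ false → Form (Instance.φ S) f D c →
             Σ Instance λ S' → Form (Instance.φ S') (λ x → f x xor g x) D c × Instance.A S' ≡ Instance.A S × (Good S' → Good S)
    adjust S {f} {D} {c} g e F = left S (liftᴮ (thPerm g)) (hol-th g e) ,
      (λ (a , x) y → trans (cong (to (liftᴮ (thPerm g))) (F (a , x) y)) (cong (λ t → (t , x) , D (a , x) * y + c (a , x)) (BoolP.xor-assoc a (f x) (g x)))) ,
      refl , good-left S (liftᴮ (thPerm g)) (hol-th g e)

    normal⇒form : ∀ {φ} → NormalForm φ → ∃ λ f → ∃ λ D → ∃ λ c → Form φ f D c
    normal⇒form (f , rowAffine σ m c eq , h) = f , m , c , λ (a , x) y → trans (eq (a , x) y) (cong (_, m (a , x) * y + c (a , x)) (h a x))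

    -- Killing the additive part c; f is zero or of odd weight.
    module Straighten (2≢0 : 1# + 1# ≢ 0#) (S : Instance) {f : Plane → Bool} {D c : B → F}
                      (form : Form (Instance.φ S) f D c) (f-shape : (∀ x → f x ≡ false) ⊎ parity f ≡ true) where
      open Instance S
      open RowShifts n pr S
      open Odd 2≢0

      D≢0 : ∀ x → D x ≢ 0#
      D≢0 = form-mult≢0 {φ} form

      I : B → F
      I x = proj₁ (inv (D≢0 x))

      I*D : ∀ x → I x * D x ≡ 1#
      I*D x = proj₂ (inv (D≢0 x))

      D*I : ∀ x → D x * I x ≡ 1#
      D*I x = trans (*-comm (D x) (I x)) (I*D x)

      R : RowAffine φ
      R = rowAffine (th f) D c form

      from-form : ∀ x y → from φ (x , y) ≡ (th f x , I (th f x) * (y + - c (th f x)))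
      from-form x y = from-≡ φ (trans (form _ _) (cong₂ _,_ (th-invol f x)
        (trans (cong (_+ c x') (trans (sym (*-assoc (D x') (I x') _)) (trans (cong (_* (y + - c x')) (D*I x')) (*-identityˡ _))))
          (solve 2 (λ y c → (y :+ :- c) :+ c := y) refl y (c x')))))
        where x' = th f x

      T-I : T I
      T-I = resp (pt λ (x , y) → from-≡ φ (trans (form x _) (sym (trans (cong (to z) (form x y)) (cong₂ _,_ (⊕-identityˡ (th f x))
        (trans (cong (_+ (D x * y + c x)) (sym (D*I x)))
          (solve 4 (λ d i y c → d :* i :+ (d :* y :+ c) := d :* (i :+ y) :+ c) refl (D x) (I x) y (c x))))))))
        (sh'∈ (0ᴮ , 1#))

      I-invariant : Invariant I
      I-invariant = T⇒invariant T-I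

      D-invariant : Invariant D
      D-invariant x x' ns = trans (sym (*-identityʳ (D x))) (trans (cong (D x *_) (sym (trans (cong (_* D x') (I-invariant x x' ns)) (I*D x'))))
        (trans (sym (*-assoc (D x) (I x) (D x'))) (trans (cong (_* D x') (D*I x)) (*-identityˡ (D x')))))

      H : B → Set
      H h = ¬ Sep 0ᴮ h

      H-translate : ∀ {h} → H h → ∀ x → ¬ Sep x (h ⊕ x)
      H-translate {h} Hh x s = Hh (Sep-translate x (subst₂ Sep (sym (⊕-identityʳ x)) (⊕-comm h x) s))

      H-diff : ∀ {x x'} → ¬ Sep x x' → H (x ⊕ x')
      H-diff {x} {x'} ns s = ns (Sep-translate x (subst₂ Sep (sym (⊕-self x)) refl s))

      κ : B → Perm V
      κ h = φ ⁻¹ ∙ tᴮ h ∙ φ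

      κ∈ : ∀ h → mem (κ h)
      κ∈ h = sh'∈ (h , 0#)

      κ-affine : ∀ h → RowAffine (κ h)
      κ-affine h = rowAffine-∙ (rowAffine-⁻¹ R) (rowAffine-∙ (rowAffine-shift (h , 0#)) R)

      ρ : B → B → B
      ρ h x = th f (h ⊕ th f x)

      κ-row : ∀ h x → RowAffine.σ (κ-affine h) x ≡ ρ h x
      κ-row h x = cong proj₁ (trans (sym (RowAffine.eq (κ-affine h) x 0#)) (trans (cong (λ v → from φ (to (tᴮ h) v)) (form x 0#)) (from-form _ _)))

      -- In odd weight, the classes can only be nontrivial modulo e₁ if they contain e₁.
      e₁∈H : parity f ≡ true → ∀ {h} → H h → proj₂ h ≢ 0ₚ → H e₁
      e₁∈H odd {h} Hh ne (u , Tu , u≢) = u≢ (trans (trans (cong u (sym (⊕-self h))) (trans (trans (cong u' (sym (⊕-identityʳ h))) (sym (agree (H-translate Hh 0ᴮ) Tu')))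
          (agree Hh' Tu'))) (cong u (trans (cong (h ⊕_) (⊕-comm h e₁)) (trans (cong (h ⊕_) (⊕-comm e₁ h)) (⊕-cancel h e₁)))))
        where
        u' : B → F
        u' x = u (h ⊕ x)
        Tu' : T u'
        Tu' = T-translate h Tu
        c̄ = proj₁ (third (proj₂ h) ne)
        cc : B
        cc = false , c̄
        image : ρ cc 0ᴮ ⊕ ρ cc h ≡ h ⊕ e₁
        image = cong₂ _,_ (trans (bits (f 0ₚ) (f c̄) (f (c̄ ⊕ₚ 0ₚ)) (proj₁ h) (f (proj₂ h)) (f (c̄ ⊕ₚ proj₂ h)) (cong f (p0 c̄)))
            (cong (proj₁ h xor_) (trans (cong (λ t → (f 0ₚ xor f (proj₂ h)) xor (f c̄ xor f t)) (p-comm c̄ (proj₂ h)))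
              (odd-sum f odd (proj₂ h) c̄ ne (proj₁ (proj₂ (third (proj₂ h) ne))) (proj₂ (proj₂ (third (proj₂ h) ne)))))))
            (planes c̄ (proj₂ h))
          where
          p0 : ∀ c → c ⊕ₚ 0ₚ ≡ c
          p0 (a , b) = cong₂ _,_ (BoolP.xor-identityʳ a) (BoolP.xor-identityʳ b)
          p-comm : ∀ c d → c ⊕ₚ d ≡ d ⊕ₚ c
          p-comm (a , b) (c , d) = cong₂ _,_ (BoolP.xor-comm a c) (BoolP.xor-comm b d)
          bits : ∀ f0 fc fc0 a fh fch → fc0 ≡ fc →
                 ((false xor (false xor f0)) xor fc0) xor ((false xor (a xor fh)) xor fch) ≡ a xor ((f0 xor fh) xor (fc xor fch))
          bits f0 fc .fc a fh fch refl = brute f0 fc a fh fch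
            where
            brute : ∀ f0 fc a fh fch → ((false xor (false xor f0)) xor fc) xor ((false xor (a xor fh)) xor fch) ≡ a xor ((f0 xor fh) xor (fc xor fch))
            brute = from-yes (FinBool.∀? λ f0 → FinBool.∀? λ fc → FinBool.∀? λ a → FinBool.∀? λ fh → FinBool.∀? λ fch →
              (((false xor (false xor f0)) xor fc) xor ((false xor (a xor fh)) xor fch)) BoolP.≟ (a xor ((f0 xor fh) xor (fc xor fch))))
          planes : ∀ c h → (c ⊕ₚ 0ₚ) ⊕ₚ (c ⊕ₚ h) ≡ h ⊕ₚ 0ₚ
          planes = from-yes (FinP₂.∀? λ c → FinP₂.∀? λ h → ((c ⊕ₚ 0ₚ) ⊕ₚ (c ⊕ₚ h)) ≟ₚ (h ⊕ₚ 0ₚ))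
        Hh' : H (h ⊕ e₁)
        Hh' = subst H image (H-diff λ (w , Tw , w≢) → Hh (_ , T-row (κ-affine cc) (κ∈ cc) Tw ,
          λ e → w≢ (trans (cong w (sym (κ-row cc 0ᴮ))) (trans e (cong w (κ-row cc h))))))

      u : B → F
      u x = I x * c x

      -- Where κ h fixes classes, it acts by y ↦ y + (u x - u (ρ h x)).
      κ-form : ∀ h → (∀ x → ¬ Sep x (ρ h x)) → ∀ x y → to (κ h) (x , y) ≡ (ρ h x , y + (u x + - u (ρ h x)))
      κ-form h same x y = trans (cong (λ v → from φ (to (tᴮ h) v)) (form x y)) (trans (from-form _ _) (cong (ρ h x ,_)
        (trans (cong (λ i → i * (0# + (D x * y + c x) + - c (ρ h x))) (sym (I-invariant _ _ (same x))))
          (trans (solve 5 (λ i d y a b → i :* (con (0 , 0) :+ (d :* y :+ a) :+ :- b) := (i :* d) :* y :+ (i :* a :+ :- (i :* b))) refl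
                   (I x) (D x) y (c x) (c (ρ h x)))
            (trans (cong₂ (λ s i → s * y + (I x * c x + - (i * c (ρ h x)))) (I*D x) (I-invariant _ _ (same x)))
              (cong (_+ (u x + - u (ρ h x))) (*-identityˡ y)))))))

      antisymmetric⇒0 : ∀ {h v} → H h → T v → (∀ x → v (h ⊕ x) ≡ - v x) → ∀ x → v x ≡ 0#
      antisymmetric⇒0 {h} {v} Hh Tv anti x with v x ≟ᶠ 0#
      ... | yes e = e
      ... | no ne = ⊥-elim (two ne (trans (cong (v x +_) (trans (agree (H-translate Hh x) Tv) (anti x))) (-‿inverseʳ (v x))))

      diff : B → B → F
      diff h x = u x + - u (h ⊕ x)

      diff-anti : ∀ h x → diff h (h ⊕ x) ≡ - diff h x
      diff-anti h x = trans (cong (λ t → u (h ⊕ x) + - u t) (⊕-cancel h x)) (solve 2 (λ a b → a :+ :- b := :- (b :+ :- a)) refl _ _)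

      diff-0 : ∀ h x → diff h x ≡ 0# → u (h ⊕ x) ≡ u x
      diff-0 h x e = trans (solve 2 (λ a b → b := a :+ :- (a :+ :- b)) refl (u x) (u (h ⊕ x)))
        (trans (cong (λ t → u x + - t) e) (solve 1 (λ a → a :+ :- con (0 , 0) := a) refl (u x)))

      translating : ∀ {h} → H h → (∀ x → ρ h x ≡ h ⊕ x) → ∀ x → u (h ⊕ x) ≡ u x
      translating {h} Hh tr x = diff-0 h x (antisymmetric⇒0 Hh Tdiff (diff-anti h) x)
        where
        Tdiff : T (diff h)
        Tdiff = resp (pt λ (x , y) → trans (cong (to (tᴮ h)) (trans (κ-form h (λ x → subst (λ t → ¬ Sep x t) (sym (tr x)) (H-translate Hh x)) x y)
            (cong (λ t → t , y + (u x + - u t)) (tr x)))) (cong₂ _,_ (⊕-cancel h x)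
              (solve 2 (λ y d → con (0 , 0) :+ (y :+ d) := d :+ y) refl y (diff h x))))
          (∙∈ (sh∈ (h , 0#)) (κ∈ h))

      ρ-e₁ : ∀ x → ρ e₁ x ≡ e₁ ⊕ x
      ρ-e₁ x = trans (th-e₁ f (th f x)) (cong (e₁ ⊕_) (th-invol f x))

      g : B → B → Bool
      g h x = f (proj₂ x) xor f (proj₂ (h ⊕ x))

      bump : B → B → B
      bump h x = (g h x , 0ₚ) ⊕ x

      ρ-bump : ∀ h x → ρ h x ≡ h ⊕ bump h x
      ρ-bump (b , h) (a , x) = cong (_, h ⊕ₚ x) (brute b a (f x) (f (h ⊕ₚ x)))
        where
        brute : ∀ b a s t → (b xor (a xor s)) xor t ≡ b xor ((s xor t) xor a)
        brute = from-yes (∀Bool⁴? λ b a s t → ((b xor (a xor s)) xor t) BoolP.≟ (b xor ((s xor t) xor a)))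

      bump-u : (∀ x → u (e₁ ⊕ x) ≡ u x) → ∀ b x → u ((b , 0ₚ) ⊕ x) ≡ u x
      bump-u inv false x = refl
      bump-u inv true  x = inv x

      bump-bump : ∀ h x → bump h (bump h x) ≡ x
      bump-bump h x = ⊕-cancel (g h x , 0ₚ) x

      general : ∀ {h} → H h → H e₁ → ∀ x → u (h ⊕ x) ≡ u x
      general {h} Hh He x = diff-0 h x (antisymmetric⇒0 Hh Tdiff (diff-anti h) x)
        where
        u-e₁ : ∀ x → u (e₁ ⊕ x) ≡ u x
        u-e₁ = translating He ρ-e₁
        swap : ∀ h b x → h ⊕ ((b , 0ₚ) ⊕ x) ≡ (b , 0ₚ) ⊕ (h ⊕ x)
        swap h b x = trans (sym (⊕-assoc h (b , 0ₚ) x)) (trans (cong (_⊕ x) (⊕-comm h (b , 0ₚ))) (⊕-assoc (b , 0ₚ) h x))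
        u-ρ : ∀ x → u (ρ h x) ≡ u (h ⊕ x)
        u-ρ x = trans (cong u (trans (ρ-bump h x) (swap h (g h x) x))) (bump-u u-e₁ (g h x) (h ⊕ x))
        same : ∀ x → ¬ Sep x (ρ h x)
        same x (w , Tw , ne) = ne (trans (agree (H-translate Hh x) Tw) (trans (w-e₁ (g h x) (h ⊕ x)) (cong w (sym (trans (ρ-bump h x) (swap h (g h x) x))))))
          where
          w-e₁ : ∀ b x → w x ≡ w ((b , 0ₚ) ⊕ x)
          w-e₁ false x = refl
          w-e₁ true  x = agree (H-translate He x) Tw
        step : ∀ x y → to (tᴮ h ∙ κ h) (x , y) ≡ (bump h x , diff h x + y)
        step x y = trans (cong (to (tᴮ h)) (trans (κ-form h same x y) (cong₂ (λ s t → s , y + (u x + - t)) (ρ-bump h x) (u-ρ x))))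
          (cong₂ _,_ (⊕-cancel h (bump h x)) (solve 2 (λ y d → con (0 , 0) :+ (y :+ d) := d :+ y) refl y (diff h x)))
        diff-bump : ∀ x → diff h (bump h x) ≡ diff h x
        diff-bump x = cong₂ (λ s t → s + - t) (bump-u u-e₁ (g h x) x) (trans (cong u (swap h (g h x) x)) (bump-u u-e₁ (g h x) (h ⊕ x)))
        T2diff : T (λ x → diff h x + diff h x)
        T2diff = resp (pt λ (x , y) → trans (cong (to (tᴮ h ∙ κ h)) (step x y)) (trans (step _ _) (cong₂ _,_ (bump-bump h x)
            (trans (cong (_+ (diff h x + y)) (diff-bump x)) (sym (+-assoc _ _ y))))))
          (∙∈ (∙∈ (sh∈ (h , 0#)) (κ∈ h)) (∙∈ (sh∈ (h , 0#)) (κ∈ h)))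
        half = proj₁ (inv 2≢0)
        Tdiff : T (diff h)
        Tdiff = T-resp (λ x → trans (solve 2 (λ i d → i :* (d :+ d) := (i :* (con (1 , 0) :+ con (1 , 0))) :* d) refl half (diff h x))
          (trans (cong (_* diff h x) (proj₂ (inv 2≢0))) (*-identityˡ _))) (T-scale half T2diff)

      u-invariant : Invariant u
      u-invariant x x' ns = trans (sym (by f-shape (proj₂ h ≟ₚ 0ₚ))) (cong u (⊕-to x x'))
        where
        h = x ⊕ x'
        Hh : H h
        Hh = H-diff ns
        vertical : ∀ b → H (b , 0ₚ) → u ((b , 0ₚ) ⊕ x) ≡ u x
        vertical false _ = refl
        vertical true  k = translating k ρ-e₁ x
        by : (∀ x → f x ≡ false) ⊎ parity f ≡ true → Dec (proj₂ h ≡ 0ₚ) → u (h ⊕ x) ≡ u x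
        by (inj₁ f0) _ = translating Hh (λ y → trans (ρ-bump h y) (cong (λ t → h ⊕ ((t , 0ₚ) ⊕ y)) (cong₂ _xor_ (f0 _) (f0 _)))) x
        by (inj₂ odd) (no ne) = general Hh (e₁∈H odd Hh ne) x
        by (inj₂ odd) (yes e) = subst (λ t → u (t ⊕ x) ≡ u x) (cong (proj₁ h ,_) (sym e)) (vertical (proj₁ h) (subst H (cong (proj₁ h ,_) e) Hh))

      straightened : Σ Instance λ S' → Form (Instance.φ S') f D (λ _ → 0#) × (Good S' → Good S)
      straightened = right S k k∈ , form' , good-right S k k∈
        where
        k = rowShift (λ x → - u x)
        k∈ : mem k
        k∈ = T-resp (λ x → solve 1 (λ w → (:- con (1 , 0)) :* w := :- w) refl (u x)) (T-scale (- 1#) (invariant⇒T u-invariant))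
        form' : Form (φ ∙ k) f D (λ _ → 0#)
        form' x y = trans (form x _) (cong (th f x ,_) (trans
          (solve 4 (λ d i c y → d :* (:- (i :* c) :+ y) :+ c := (d :* y :+ :- ((d :* i) :* c)) :+ c) refl (D x) (I x) (c x) y)
          (trans (cong (λ t → (D x * y + - (t * c x)) + c x) (D*I x))
            (solve 2 (λ a c → (a :+ :- (con (1 , 0) :* c)) :+ c := a :+ con (0 , 0)) refl (D x * y) (c x)))))

module NonBad where

  open import Data.Nat as ℕ using (ℕ; zero; suc; s≤s)
  import Data.Nat.Properties as ℕP
  open import Data.Nat.Primality
  open import Data.Nat.Induction using (<-rec)
  open import Data.Fin using (toℕ)
  import Data.Fin.Properties as FinP
  open import Data.Bool using (Bool; true; false; _xor_)
  import Data.Bool.Properties as BoolP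
  open import Data.Product hiding (map; swap)
  open import Data.Sum using (_⊎_; inj₁; inj₂)
  open import Data.Empty
  open import Function using (_∘_)
  open import Relation.Nullary
  open import Relation.Binary.PropositionalEquality hiding (resp)
  open Perms
  open Space
  open Shifts
  open Stage2
  open OddForm

  halve : ∀ a → (∃ λ a' → a ≡ a' ℕ.+ a') ⊎ (∃ λ a' → a ≡ suc (a' ℕ.+ a'))
  halve zero = inj₁ (0 , refl)
  halve (suc a) with halve a
  ... | inj₁ (a' , e) = inj₂ (a' , cong suc e)
  ... | inj₂ (a' , e) = inj₁ (suc a' , cong suc (trans e (sym (ℕP.+-suc a' a'))))

  module Powers (n : ℕ) (pr : Prime (suc n)) where
    open Space.Space n pr

    infixr 8 _^_
    _^_ : F → ℕ → F
    a ^ zero  = 1#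
    a ^ suc k = a * a ^ k

    ^-+ : ∀ a k l → a ^ (k ℕ.+ l) ≡ a ^ k * a ^ l
    ^-+ a zero    l = sym (*-identityˡ _)
    ^-+ a (suc k) l = trans (cong (a *_) (^-+ a k l)) (sym (*-assoc a _ _))

    ^≢0 : ∀ {a} → a ≢ 0# → ∀ k → a ^ k ≢ 0#
    ^≢0 ne zero    = 1≢0
    ^≢0 ne (suc k) = no-zero-divisors ne (^≢0 ne k)

    finite-order : ∀ {a} → a ≢ 0# → ∃ λ k → a ^ suc k ≡ 1#
    finite-order {a} ne with FinP.pigeonhole (ℕP.n<1+n (suc n)) (λ i → a ^ toℕ i)
    ... | i , j , i<j , e = toℕ j ℕ.∸ suc (toℕ i) ,
      sym (*-cancel (^≢0 ne (toℕ i)) (trans (*-identityʳ _) (trans e (trans (cong (a ^_)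
        (trans (sym (ℕP.m+[n∸m]≡n i<j)) (sym (ℕP.+-suc (toℕ i) _)))) (^-+ a (toℕ i) _)))))

    square-root : ∀ {c} → c * c ≡ 1# → c ≡ 1# ⊎ c ≡ - 1#
    square-root {c} e with (c + - 1#) ≟ᶠ 0# | (c + 1#) ≟ᶠ 0#
    ... | yes d | _ = inj₁ (trans (solve 1 (λ c → c := (c :+ :- con (1 , 0)) :+ con (1 , 0)) refl c) (trans (cong (_+ 1#) d) (+-identityˡ 1#)))
    ... | no _ | yes d = inj₂ (trans (solve 1 (λ c → c := (c :+ con (1 , 0)) :+ :- con (1 , 0)) refl c) (trans (cong (_+ - 1#) d) (+-identityˡ _)))
    ... | no d | no d' = ⊥-elim (no-zero-divisors d d' (trans
        (solve 1 (λ c → (c :+ :- con (1 , 0)) :* (c :+ con (1 , 0)) := c :* c :+ :- con (1 , 0)) refl c)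
        (trans (cong (_+ - 1#) e) (-‿inverseʳ 1#))))

    -- If α and β only satisfied relations with both exponents even, halving relations would produce four square roots of 1.
    module Relations {α β : F} (α≢0 : α ≢ 0#) (β≢0 : β ≢ 0#) {Win : Set}
      (odd-β : ∀ a b → α ^ a * β ^ suc (b ℕ.+ b) ≡ 1# → Win)
      (odd-α : ∀ a b → α ^ suc (a ℕ.+ a) * β ^ b ≡ 1# → Win) where

      root : ∀ a b → α ^ (a ℕ.+ a) * β ^ (b ℕ.+ b) ≡ 1# → α ^ a * β ^ b ≡ 1# ⊎ α ^ a * β ^ b ≡ - 1#
      root a b e = square-root (trans (solve 2 (λ x y → (x :* y) :* (x :* y) := (x :* x) :* (y :* y)) refl (α ^ a) (β ^ b))
        (trans (sym (cong₂ _*_ (^-+ α a a) (^-+ β b b))) e))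

      smaller : ∀ {a} a' → suc a ≡ suc a' ℕ.+ suc a' → a' ℕ.< a
      smaller {a} a' d = subst (a' ℕ.<_) (sym (trans (ℕP.suc-injective d) (ℕP.+-suc a' a'))) (s≤s (ℕP.m≤m+n a' a'))

      Root-α : Set
      Root-α = ∃ λ h → α ^ h ≡ - 1#

      descend-α : ∀ a → α ^ suc a ≡ 1# → Win ⊎ Root-α
      descend-α = <-rec (λ a → α ^ suc a ≡ 1# → Win ⊎ Root-α) go
        where
        go : ∀ a → (∀ {a'} → a' ℕ.< a → α ^ suc a' ≡ 1# → Win ⊎ Root-α) → α ^ suc a ≡ 1# → Win ⊎ Root-α
        go a rec e = split (halve (suc a))
          where
          rel : ∀ k → suc a ≡ k → α ^ k * β ^ 0 ≡ 1#
          rel k d = trans (*-identityʳ _) (trans (cong (α ^_) (sym d)) e)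
          done : ∀ a' → suc a ≡ suc a' ℕ.+ suc a' →
                 α ^ suc a' * β ^ 0 ≡ 1# ⊎ α ^ suc a' * β ^ 0 ≡ - 1# → Win ⊎ Root-α
          done a' d (inj₁ r) = rec (smaller a' d) (trans (sym (*-identityʳ _)) r)
          done a' d (inj₂ r) = inj₂ (suc a' , trans (sym (*-identityʳ _)) r)
          split : (∃ λ a' → suc a ≡ a' ℕ.+ a') ⊎ (∃ λ a' → suc a ≡ suc (a' ℕ.+ a')) → Win ⊎ Root-α
          split (inj₂ (a' , d))     = inj₁ (odd-α a' 0 (rel _ d))
          split (inj₁ (suc a' , d)) = done a' d (root (suc a') 0 (rel _ d))

      descend-β : ∀ {h} → α ^ h ≡ - 1# → ∀ b a → α ^ a * β ^ suc b ≡ 1# → Win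
      descend-β {h} αh = <-rec (λ b → ∀ a → α ^ a * β ^ suc b ≡ 1# → Win) go
        where
        go : ∀ b → (∀ {b'} → b' ℕ.< b → ∀ a → α ^ a * β ^ suc b' ≡ 1# → Win) → ∀ a → α ^ a * β ^ suc b ≡ 1# → Win
        go b rec a e = split (halve a) (halve (suc b))
          where
          rel : ∀ k l → a ≡ k → suc b ≡ l → α ^ k * β ^ l ≡ 1#
          rel k l c d = trans (cong₂ (λ k l → α ^ k * β ^ l) (sym c) (sym d)) e
          done : ∀ a' b' → suc b ≡ suc b' ℕ.+ suc b' →
                 α ^ a' * β ^ suc b' ≡ 1# ⊎ α ^ a' * β ^ suc b' ≡ - 1# → Win
          done a' b' d (inj₁ r) = rec (smaller b' d) a' r
          done a' b' d (inj₂ r) = rec (smaller b' d) (h ℕ.+ a') (trans (cong (_* β ^ suc b') (^-+ α h a')) (trans (*-assoc _ _ _)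
            (trans (cong₂ _*_ αh r) (solve 0 ((:- con (1 , 0)) :* (:- con (1 , 0)) := con (1 , 0)) refl))))
          split : (∃ λ a' → a ≡ a' ℕ.+ a') ⊎ (∃ λ a' → a ≡ suc (a' ℕ.+ a')) →
                  (∃ λ b' → suc b ≡ b' ℕ.+ b') ⊎ (∃ λ b' → suc b ≡ suc (b' ℕ.+ b')) → Win
          split _ (inj₂ (b' , d)) = odd-β a b' (rel a _ refl d)
          split (inj₂ (a' , c)) (inj₁ _) = odd-α a' (suc b) (rel _ (suc b) c refl)
          split (inj₁ (a' , c)) (inj₁ (suc b' , d)) = done a' b' d (root a' (suc b') (rel _ _ c d))

      odd-relation : Win
      odd-relation = go₁ (finite-order α≢0)
        where
        go₂ : Root-α → ∃ (λ k → β ^ suc k ≡ 1#) → Win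
        go₂ (h , αh) (b , e) = descend-β {h} αh b 0 (trans (*-identityˡ _) e)
        go₃ : Win ⊎ Root-α → Win
        go₃ (inj₁ w) = w
        go₃ (inj₂ r) = go₂ r (finite-order β≢0)
        go₁ : ∃ (λ k → α ^ suc k ≡ 1#) → Win
        go₁ (a , e) = go₃ (descend-α a e)

  module Jumps (n : ℕ) (pr : Prime (suc n)) where
    open Space.Space n pr
    open Forms n pr
    open Powers n pr

    module _ (S : Instance) where
      open Instance S

      Jump : Plane → Bool → F → Set
      Jump v j μ = ∃ λ k → ∃ λ (ρ : B → B) → ∃ λ (m : B → F) → mem k × (∀ x y → to k (x , y) ≡ (ρ x , m x * y)) ×
        ρ 0ᴮ ≡ 0ᴮ × m 0ᴮ ≡ μ × ρ (false , v) ≡ (j , v) × (∀ x → ρ (e₁ ⊕ x) ≡ e₁ ⊕ ρ x)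

      jump-one : ∀ v → Jump v false 1#
      jump-one v = idₚ , (λ x → x) , (λ _ → 1#) , id∈ , (λ x y → cong (x ,_) (sym (*-identityˡ y))) , refl , refl , refl , λ _ → refl

      jump-* : ∀ {v j μ j' μ'} → Jump v j μ → Jump v j' μ' → Jump v (j xor j') (μ * μ')
      jump-* {v} {j} {μ} {j'} {μ'} (k , ρ , m , k∈ , e , ρ0 , m0 , ρv , ρe) (k' , ρ' , m' , k'∈ , e' , ρ0' , m0' , ρv' , ρe') =
        k ∙ k' , ρ ∘ ρ' , (λ x → m (ρ' x) * m' x) , ∙∈ k∈ k'∈ ,
        (λ x y → trans (cong (to k) (e' x y)) (trans (e _ _) (cong (ρ (ρ' x) ,_) (sym (*-assoc _ _ y))))) ,
        trans (cong ρ ρ0') ρ0 , cong₂ _*_ (trans (cong m ρ0') m0) m0' ,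
        trans (cong ρ ρv') (at-v j') , λ x → trans (cong ρ (ρe' x)) (ρe (ρ' x))
        where
        at-v : ∀ j' → ρ (j' , v) ≡ (j xor j' , v)
        at-v false = trans ρv (cong (_, v) (sym (BoolP.xor-identityʳ j)))
        at-v true  = trans (ρe (false , v)) (trans (cong (e₁ ⊕_) ρv) (cong (_, v) (BoolP.xor-comm true j)))

      jump-^-false : ∀ {v μ} → Jump v false μ → ∀ a → Jump v false (μ ^ a)
      jump-^-false {v} J zero    = jump-one v
      jump-^-false J (suc a) = jump-* J (jump-^-false J a)

      jump-^-even : ∀ {v j μ} → Jump v j μ → ∀ a → Jump v false (μ ^ (a ℕ.+ a))
      jump-^-even {v} {j} {μ} J a = subst (Jump v false) (sq a) (jump-^-false
        (subst (λ b → Jump v b (μ * μ)) (BoolP.xor-same j) (jump-* J J)) a)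
        where
        sq : ∀ a → (μ * μ) ^ a ≡ μ ^ (a ℕ.+ a)
        sq zero    = refl
        sq (suc a) = trans (*-assoc μ μ _) (cong (μ *_) (trans (cong (μ *_) (sq a)) (cong (μ ^_) (sym (ℕP.+-suc a a)))))

      jump-^-odd : ∀ {v j μ} → Jump v j μ → ∀ a → Jump v j (μ ^ suc (a ℕ.+ a))
      jump-^-odd {v} {j} {μ} J a = subst (λ b → Jump v b (μ ^ suc (a ℕ.+ a))) (BoolP.xor-identityʳ j) (jump-* J (jump-^-even J a))

    module Search (2≢0 : 1# + 1# ≢ 0#) (S : Instance) {f : Plane → Bool} {D : B → F}
                  (form : Form (Instance.φ S) f D (λ _ → 0#)) (odd : parity f ≡ true) (f0 : f 0ₚ ≡ false) (D0 : D 0ᴮ ≡ 1#) where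
      open Instance S
      open Straighten 2≢0 S form (inj₂ odd)

      from-form₀ : ∀ x y → from φ (x , y) ≡ (th f x , I (th f x) * y)
      from-form₀ x y = trans (from-form x y) (cong (λ t → th f x , I (th f x) * t) (solve 1 (λ y → y :+ :- con (0 , 0) := y) refl y))

      κ₂ : B → B → Perm V
      κ₂ b c = κ c ∙ tᴮ b

      κ₂∈ : ∀ b c → mem (κ₂ b c)
      κ₂∈ b c = ∙∈ (κ∈ c) (sh∈ (b , 0#))

      κ₂-form : ∀ b c x y → to (κ₂ b c) (x , y) ≡ (th f (c ⊕ th f (b ⊕ x)) , (I (th f (c ⊕ th f (b ⊕ x))) * D (b ⊕ x)) * y)
      κ₂-form b c x y = trans (cong (λ v → from φ (to (tᴮ c) v)) (form (b ⊕ x) _)) (trans (from-form₀ _ _)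
        (cong (th f (c ⊕ th f (b ⊕ x)) ,_)
          (solve 3 (λ i d y → i :* (con (0 , 0) :+ (d :* (con (0 , 0) :+ y) :+ con (0 , 0))) := (i :* d) :* y) refl
            (I (th f (c ⊕ th f (b ⊕ x)))) (D (b ⊕ x)) y)))

      I0 : I 0ᴮ ≡ 1#
      I0 = trans (sym (*-identityʳ _)) (trans (cong (I 0ᴮ *_) (sym D0)) (I*D 0ᴮ))

      basic : ∀ v b → Jump S v (f v xor (f (b ⊕ₚ v) xor f b)) (D (false , b))
      basic v b = κ₂ b' (th f b') , ρ' , (λ x → I (ρ' x) * D (b' ⊕ x)) , κ₂∈ b' (th f b') , κ₂-form b' (th f b') , ρ0 ,
        trans (cong₂ _*_ (trans (cong I ρ0) I0) (cong D (⊕-identityʳ b'))) (*-identityˡ _) ,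
        cong₂ _,_ (trans (cong (λ t → (f b xor f (b ⊕ₚ v)) xor f t) (same b v)) (turn (f b) (f (b ⊕ₚ v)) (f v))) (same b v) ,
        λ x → trans (cong (λ t → th f (th f b' ⊕ th f t)) (swap b' x)) (trans (cong (λ t → th f (th f b' ⊕ t)) (th-e₁ f (b' ⊕ x)))
          (trans (cong (th f) (swap (th f b') (th f (b' ⊕ x)))) (th-e₁ f (th f b' ⊕ th f (b' ⊕ x)))))
        where
        b' : B
        b' = false , b
        ρ' : B → B
        ρ' x = th f (th f b' ⊕ th f (b' ⊕ x))
        ρ0 : ρ' 0ᴮ ≡ 0ᴮ
        ρ0 = trans (cong (λ t → th f (th f b' ⊕ th f t)) (⊕-identityʳ b')) (trans (cong (th f) (⊕-self (th f b'))) (cong (_, 0ₚ) f0))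
        same : ∀ b v → b ⊕ₚ (b ⊕ₚ v) ≡ v
        same b v = cong proj₂ (⊕-cancel (false , b) (false , v))
        turn : ∀ s t r → (s xor t) xor r ≡ r xor (t xor s)
        turn s t r = trans (BoolP.xor-comm (s xor t) r) (cong (r xor_) (BoolP.xor-comm s t))
        swap : ∀ b x → b ⊕ (e₁ ⊕ x) ≡ e₁ ⊕ (b ⊕ x)
        swap b x = trans (sym (⊕-assoc b e₁ x)) (trans (cong (_⊕ x) (⊕-comm b e₁)) (⊕-assoc e₁ b x))

      v₁ v₂ : Plane
      v₁ = true , false
      v₂ = false , true

      sum₃ : f v₁ xor (f (true , true) xor f v₂) ≡ true
      sum₃ = trans (bits (f v₁) (f v₂) (f (true , true))) (trans (cong (λ t → (t xor f v₁) xor (f v₂ xor f (true , true))) (sym f0)) odd)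
        where
        bits : ∀ a b c → a xor (c xor b) ≡ (false xor a) xor (b xor c)
        bits a b c = cong (a xor_) (BoolP.xor-comm c b)

      own : ∀ a → a xor (f 0ₚ xor a) ≡ false
      own a = trans (cong (λ t → a xor (t xor a)) f0) (BoolP.xor-same a)

      α β : F
      α = D (false , v₁)
      β = D (false , v₂)

      J₁α : Jump S v₁ false α
      J₁α = subst (λ j → Jump S v₁ j α) (own (f v₁)) (basic v₁ v₁)

      J₁β : Jump S v₁ true β
      J₁β = subst (λ j → Jump S v₁ j β) sum₃ (basic v₁ v₂)

      J₂α : Jump S v₂ true α
      J₂α = subst (λ j → Jump S v₂ j α) (trans (rot (f v₂) (f (true , true)) (f v₁)) sum₃) (basic v₂ v₁)
        where
        rot : ∀ a b c → a xor (b xor c) ≡ c xor (b xor a)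
        rot a b c = trans (BoolP.xor-comm a (b xor c)) (trans (cong (_xor a) (BoolP.xor-comm b c)) (BoolP.xor-assoc c b a))

      J₂β : Jump S v₂ false β
      J₂β = subst (λ j → Jump S v₂ j β) (own (f v₂)) (basic v₂ v₂)

      clean-jump : ∃ λ v → v ≢ 0ₚ × Jump S v true 1#
      clean-jump = Relations.odd-relation {α} {β} (D≢0 _) (D≢0 _)
        (λ a b e → v₁ , (λ ()) , subst (Jump S v₁ true) e (jump-* S (jump-^-false S J₁α a) (jump-^-odd S J₁β b)))
        (λ a b e → v₂ , (λ ()) , subst (Jump S v₂ true) e (jump-* S (jump-^-odd S J₂α a) (jump-^-false S J₂β b)))

module OddFinal where

  open import Data.Nat as ℕ using (ℕ; suc)
  open import Data.Nat.Primality
  open import Data.Bool using (Bool; true; false; _xor_)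
  import Data.Bool.Properties as BoolP
  open import Data.Product hiding (map; swap)
  open import Data.Sum using (_⊎_; inj₁; inj₂)
  open import Data.Empty
  open import Function using (_∘_)
  open import Relation.Nullary
  open import Relation.Nullary.Decidable using (_×-dec_; _→-dec_; _⊎-dec_; ¬?; from-yes; dec-true; dec-false)
  open import Relation.Binary.PropositionalEquality hiding (resp)
  open Perms
  open Space
  open Shifts
  open Stage2
  open OddForm
  open NonBad

  point : Plane → Plane → Bool
  point v x = does (x ≟ₚ v)

  Choice : (Plane → Bool) → Set
  Choice av = (∀ x → av x ≡ true → x ≡ 0ₚ) ⊎ ∃ λ v → v ≢ 0ₚ ×
    (∀ g w → av g ≡ true → ∃ λ x → av x ≡ true × x ≢ v × x ⊕ₚ g ≢ v × x ⊕ₚ w ≢ v)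

  abstract
    point-odd : ∀ v → parity (point v) ≡ true
    point-odd = from-yes (FinP₂.∀? λ v → parity (point v) BoolP.≟ true)

    parity-xor : ∀ f g → parity (λ x → f x xor g x) ≡ parity f xor parity g
    parity-xor f g = trans (cong₂ _xor_ (mid (f (false , false)) (g (false , false)) _ _) (mid (f (false , true)) (g (false , true)) _ _))
      (mid (f (false , false) xor f (true , false)) (g (false , false) xor g (true , false)) _ _)
      where
      mid : ∀ a a' b b' → (a xor a') xor (b xor b') ≡ (a xor b) xor (a' xor b')
      mid = from-yes (∀Bool⁴? λ a a' b b' → ((a xor a') xor (b xor b')) BoolP.≟ ((a xor b) xor (a' xor b')))

    choice : ∀ av → av 0ₚ ≡ true → (∀ x y → av x ≡ true → av y ≡ true → av (x ⊕ₚ y) ≡ true) →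
      Choice av
    choice av z c = back (go _ _ _ _ z (λ x y p q → trans (sym (table-of av (x ⊕ₚ y))) (c x y (trans (table-of av x) p) (trans (table-of av y) q))))
      where
      av' : Plane → Bool
      av' = table (av (false , false)) (av (true , false)) (av (false , true)) (av (true , true))
      back : Choice av' → Choice av
      back (inj₁ h) = inj₁ λ x p → h x (trans (sym (table-of av x)) p)
      back (inj₂ (v , nv , h)) = inj₂ (v , nv , λ g w p → let (x , q , r) = h g w (trans (sym (table-of av g)) p) in
        x , trans (table-of av x) q , r)
      go : ∀ a b c d → a ≡ true →
           (∀ x y → table a b c d x ≡ true → table a b c d y ≡ true → table a b c d (x ⊕ₚ y) ≡ true) →
           Choice (table a b c d)
      go = from-yes (∀Bool⁴? λ a b c d → let t = table a b c d in a BoolP.≟ true →-dec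
        (FinP₂.∀? λ x → FinP₂.∀? λ y → t x BoolP.≟ true →-dec t y BoolP.≟ true →-dec t (x ⊕ₚ y) BoolP.≟ true) →-dec
        ((FinP₂.∀? λ x → t x BoolP.≟ true →-dec x ≟ₚ 0ₚ) ⊎-dec (FinP₂.∃? λ v → ¬? (v ≟ₚ 0ₚ) ×-dec
          (FinP₂.∀? λ g → FinP₂.∀? λ w → t g BoolP.≟ true →-dec FinP₂.∃? λ x →
            t x BoolP.≟ true ×-dec ¬? (x ≟ₚ v) ×-dec ¬? ((x ⊕ₚ g) ≟ₚ v) ×-dec ¬? ((x ⊕ₚ w) ≟ₚ v)))))

    avoid₃ : ∀ v a b c → ∃ λ x → x ⊕ₚ a ≢ v × x ⊕ₚ b ≢ v × x ⊕ₚ c ≢ v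
    avoid₃ = from-yes (FinP₂.∀? λ v → FinP₂.∀? λ a → FinP₂.∀? λ b → FinP₂.∀? λ c → FinP₂.∃? λ x →
      ¬? ((x ⊕ₚ a) ≟ₚ v) ×-dec ¬? ((x ⊕ₚ b) ≟ₚ v) ×-dec ¬? ((x ⊕ₚ c) ≟ₚ v))

  th-trivial : ∀ f x → f (proj₂ x) ≡ false → th f x ≡ x
  th-trivial f (a , x) e = cong (_, x) (trans (cong (a xor_) e) (BoolP.xor-identityʳ a))

  module Final (n : ℕ) (pr : Prime (suc n)) where
    open Space.Space n pr
    open Forms n pr
    open Jumps n pr

    module _ (S : Instance) where
      open RowShifts n pr S

      -- Plane coordinates of the classes of T-equivalent rows.
      Isolated : Set
      Isolated = ∀ h → ¬ Sep 0ᴮ h → proj₂ h ≡ 0ₚ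

      Avoidable : Plane → Set
      Avoidable v = ∀ g w → (∃ λ h → ¬ Sep 0ᴮ h × proj₂ h ≡ g) →
        ∃ λ x → (∃ λ h → ¬ Sep 0ᴮ h × proj₂ h ≡ x) × x ≢ v × x ⊕ₚ g ≢ v × x ⊕ₚ w ≢ v

      isolated-or-avoidable : Isolated ⊎ ∃ λ v → v ≢ 0ₚ × Avoidable v
      isolated-or-avoidable = out (choice av (dec-true (av? 0ₚ) (0ᴮ , (λ (u , Tu , ne) → ne refl) , refl))
          (λ x y p q → dec-true (av? (x ⊕ₚ y)) (sum (holds (av? x) p) (holds (av? y) q))))
        where
        Av : Plane → Set
        Av q = ∃ λ h → ¬ Sep 0ᴮ h × proj₂ h ≡ q
        av? : ∀ q → Dec (Av q)
        av? q = FinB.∃? λ h → ¬? (sep? 0ᴮ h) ×-dec (proj₂ h ≟ₚ q)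
        av : Plane → Bool
        av q = does (av? q)
        holds : ∀ {P : Set} (d : Dec P) → does d ≡ true → P
        holds (yes p) _ = p
        sum : ∀ {x y} → Av x → Av y → Av (x ⊕ₚ y)
        sum (h , Hh , refl) (h' , Hh' , refl) = h ⊕ h' , (λ (u , Tu , ne) → ne (trans (agree Hh Tu)
          (trans (cong u (sym (⊕-identityʳ h))) (agree Hh' (T-translate h Tu))))) , refl
        out : _ → Isolated ⊎ ∃ λ v → v ≢ 0ₚ × Avoidable v
        out (inj₁ h) = inj₁ λ b Hb → h (proj₂ b) (dec-true (av? _) (b , Hb , refl))
        out (inj₂ (v , nv , h)) = inj₂ (v , nv , λ g w a → let (x , p , r) = h g w (dec-true (av? g) a) in x , holds (av? x) p , r)

    hol-scale : ∀ s → s ≢ 0# → ∃ λ β → Hol β × (∀ x y → to β (x , y) ≡ (x , s * y))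
    hol-scale s ne = perm (λ (x , y) → x , s * y) (λ (x , y) → x , i * y)
        (λ (x , y) → cong (x ,_) (trans (sym (*-assoc s i y)) (trans (cong (_* y) si) (*-identityˡ y))))
        (λ (x , y) → cong (x ,_) (trans (sym (*-assoc i s y)) (trans (cong (_* y) (proj₂ (inv ne))) (*-identityˡ y)))) ,
      hol (λ (b , t) → (b , s * t) , pt λ (x , y) → cong (b ⊕ x ,_) (*-distribˡ-+ s t y))
          (λ (b , t) → (b , i * t) , pt λ (x , y) → cong (b ⊕ x ,_) (*-distribˡ-+ i t y)) ,
      λ _ _ → refl
      where
      i = proj₁ (inv ne)
      si : s * i ≡ 1#
      si = trans (*-comm s i) (proj₂ (inv ne))

    Shape : Instance → (Plane → Bool) → Set
    Shape S f = (∀ x → f x ≡ false) ⊎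
      ∃ λ v → v ≢ 0ₚ × (∀ x → f x ≡ point v x) × ((Isolated S × Jump S v true 1#) ⊎ Avoidable S v)

    shape⇒ : ∀ {S f} → Shape S f → (∀ x → f x ≡ false) ⊎ parity f ≡ true
    shape⇒ (inj₁ h) = inj₁ h
    shape⇒ (inj₂ (v , _ , e , _)) = inj₂ (trans (cong₂ _xor_ (cong₂ _xor_ (e _) (e _)) (cong₂ _xor_ (e _) (e _))) (point-odd v))

    module Match (2≢0 : 1# + 1# ≢ 0#) (S : Instance) {f : Plane → Bool} {D : B → F}
                 (form : Form (Instance.φ S) f D (λ _ → 0#)) (D0 : D 0ᴮ ≡ 1#) (shape : Shape S f) where
      open Instance S
      open RowShifts n pr S
      open Odd 2≢0
      open Straighten 2≢0 S form (shape⇒ {S} {f} shape)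

      from-form₀ : ∀ x y → from φ (x , y) ≡ (th f x , I (th f x) * y)
      from-form₀ x y = trans (from-form x y) (cong (λ t → th f x , I (th f x) * t) (solve 1 (λ y → y :+ :- con (0 , 0) := y) refl y))

      -- An element of A agreeing with φ⁻¹ on the rows of x₁, x₂, x₃, and exactly on rows 1 and 2 as well as on row 3 when it cannot be corrected.
      Agrees : B → B → B → Set
      Agrees x₁ x₂ x₃ = ∃ λ k → ∃ λ (m : B → F) → mem k ×
        (∀ y → to k (x₁ , y) ≡ (th f x₁ , m x₁ * y)) × (∀ y → to k (x₂ , y) ≡ (th f x₂ , m x₂ * y)) ×
        (∀ y → to k (x₃ , y) ≡ (th f x₃ , m x₃ * y))

      Exact : B → B → B → Set
      Exact x₁ x₂ x₃ = ∃ λ ((k , m , _) : Agrees x₁ x₂ x₃) → m x₁ ≡ I (th f x₁) × m x₂ ≡ I (th f x₂) ×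
        (Sep (th f x₁) (th f x₃) ⊎ m x₃ ≡ I (th f x₃))

      Quiet : B → B → Set
      Quiet b x = f (proj₂ (b ⊕ x)) ≡ false

      k[_] : B → Perm V
      k[ b ] = κ b ∙ tᴮ b

      k∈ : ∀ b → mem k[ b ]
      k∈ b = ∙∈ (κ∈ b) (sh∈ (b , 0#))

      k-form : ∀ b x → Quiet b x → ∀ y → to k[ b ] (x , y) ≡ (th f x , (I (th f x) * D (b ⊕ x)) * y)
      k-form b x q y = trans (cong (λ v → from φ (to (tᴮ b) v)) (trans (form (b ⊕ x) _)
          (cong (_, D (b ⊕ x) * (0# + y) + 0#) (th-trivial f (b ⊕ x) q))))
        (trans (cong (λ t → from φ (t , 0# + (D (b ⊕ x) * (0# + y) + 0#))) (⊕-cancel b x)) (trans (from-form₀ _ _) (cong (th f x ,_)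
          (solve 3 (λ i d y → i :* (con (0 , 0) :+ (d :* (con (0 , 0) :+ y) :+ con (0 , 0))) := (i :* d) :* y) refl (I (th f x)) (D (b ⊕ x)) y))))

      quiet-agrees : ∀ b {x₁ x₂ x₃} → Quiet b x₁ → Quiet b x₂ → Quiet b x₃ → Agrees x₁ x₂ x₃
      quiet-agrees b q₁ q₂ q₃ = k[ b ] , (λ x → I (th f x) * D (b ⊕ x)) , k∈ b , k-form b _ q₁ , k-form b _ q₂ , k-form b _ q₃

      quiet-exact : ∀ b {x₁ x₂ x₃} → ¬ Sep x₁ x₂ → (¬ Sep (th f x₁) (th f x₃) → ¬ Sep x₁ x₃) → D (b ⊕ x₁) ≡ 1# →
                    Quiet b x₁ → Quiet b x₂ → Quiet b x₃ → Exact x₁ x₂ x₃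
      quiet-exact b {x₁} {x₂} {x₃} ns back d q₁ q₂ q₃ = quiet-agrees b q₁ q₂ q₃ , unit d , unit (same ns) , third? (sep? (th f x₁) (th f x₃))
        where
        unit : ∀ {x} → D (b ⊕ x) ≡ 1# → I (th f x) * D (b ⊕ x) ≡ I (th f x)
        unit {x} e = trans (cong (I (th f x) *_) e) (*-identityʳ (I (th f x)))
        same : ∀ {x} → ¬ Sep x₁ x → D (b ⊕ x) ≡ 1#
        same ns = trans (sym (D-invariant _ _ (λ s → ns (Sep-translate b s)))) d
        third? : Dec (Sep (th f x₁) (th f x₃)) → Sep (th f x₁) (th f x₃) ⊎ I (th f x₃) * D (b ⊕ x₃) ≡ I (th f x₃)
        third? (yes s) = inj₁ s
        third? (no ns') = inj₂ (unit (same (back ns')))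

      some-quiet : ∀ x₁ x₂ x₃ → ∃ λ b → Quiet b x₁ × Quiet b x₂ × Quiet b x₃
      some-quiet x₁ x₂ x₃ = by shape
        where
        by : Shape S f → ∃ λ b → Quiet b x₁ × Quiet b x₂ × Quiet b x₃
        by (inj₁ f0) = 0ᴮ , f0 _ , f0 _ , f0 _
        by (inj₂ (v , _ , e , _)) = let (x , n₁ , n₂ , n₃) = avoid₃ v (proj₂ x₁) (proj₂ x₂) (proj₂ x₃) in
          (false , x) , trans (e _) (dec-false (_ ≟ₚ v) n₁) , trans (e _) (dec-false (_ ≟ₚ v) n₂) , trans (e _) (dec-false (_ ≟ₚ v) n₃)

      H-sym : ∀ {x x'} → H (x ⊕ x') → ¬ Sep x x'
      H-sym {x} {x'} Hh (u , Tu , ne) = H-translate Hh x (u , Tu , λ e → ne (trans e (cong u (⊕-to x x'))))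

      th-back : ∀ x x' → ¬ Sep (th f x) (th f x') → ¬ Sep x x'
      th-back x x' ns = by (shape⇒ {S} {f} shape) (proj₂ (x ⊕ x') ≟ₚ 0ₚ)
        where
        hT : H (th f x ⊕ th f x')
        hT = H-diff ns
        e : th f x ⊕ th f x' ≡ (f (proj₂ x) xor f (proj₂ x') , 0ₚ) ⊕ (x ⊕ x')
        e = cong (_, proj₂ x ⊕ₚ proj₂ x') (brute (proj₁ x) (f (proj₂ x)) (proj₁ x') (f (proj₂ x')))
          where
          brute : ∀ a s b t → (a xor s) xor (b xor t) ≡ (s xor t) xor (a xor b)
          brute = from-yes (∀Bool⁴? λ a s b t → ((a xor s) xor (b xor t)) BoolP.≟ ((s xor t) xor (a xor b)))
        unbump : ∀ b {h} → H e₁ → H ((b , 0ₚ) ⊕ h) → H h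
        unbump false _ k = k
        unbump true {h} He k (u , Tu , ne) = k (u , Tu , λ d → ne (trans d (sym (agree (H-translate He h) Tu))))
        eqf : proj₂ (x ⊕ x') ≡ 0ₚ → f (proj₂ x) xor f (proj₂ x') ≡ false
        eqf d = trans (cong (λ t → f (proj₂ x) xor f t) (sym same)) (BoolP.xor-same (f (proj₂ x)))
          where
          same : proj₂ x ≡ proj₂ x'
          same = trans (cong proj₂ (sym (⊕-identityʳ (false , proj₂ x)))) (trans (cong (proj₂ x ⊕ₚ_) (sym d)) (cong proj₂ (⊕-cancel x x')))
        by : (∀ x → f x ≡ false) ⊎ parity f ≡ true → Dec (proj₂ (x ⊕ x') ≡ 0ₚ) → ¬ Sep x x'
        by (inj₁ f0) _ = H-sym (subst H (trans e (cong (λ t → (t , 0ₚ) ⊕ (x ⊕ x')) (cong₂ _xor_ (f0 _) (f0 _)))) hT)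
        by (inj₂ odd) (yes d) = H-sym (subst H (trans e (cong (λ t → (t , 0ₚ) ⊕ (x ⊕ x')) (eqf d))) hT)
        by (inj₂ odd) (no ne) = H-sym (unbump (f (proj₂ x) xor f (proj₂ x')) (e₁∈H odd hT ne) (subst H e hT))

      -- Row differences x₁ ⊕ x₂ = (j , 0ₚ), x₁ ⊕ x₃ = (_ , v), corrected by the clean jump.
      jump-exact : ∀ {v} → v ≢ 0ₚ → (∀ x → f x ≡ point v x) → Isolated S → Jump S v true 1# →
                   ∀ x₁ x₂ x₃ → ¬ Sep x₁ x₂ → proj₂ (x₁ ⊕ x₂) ≡ 0ₚ → proj₂ (x₁ ⊕ x₃) ≡ v → Exact x₁ x₂ x₃
      jump-exact {v} nv e iso (j , ρ , m , j∈ , jf , ρ0 , m0 , ρv , ρe) x₁ x₂ x₃ ns p₂ p₃ =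
        (κ x₁ ∙ j ∙ tᴮ x₁ , mult , ∙∈ (κ∈ x₁) (∙∈ j∈ (sh∈ (x₁ , 0#))) , form-at x₁ r₁ , form-at x₂ r₂ , form-at x₃ r₃) ,
        exact (cong proj₂ (⊕-self x₁)) (λ (_ , _ , ne) → ne refl) , exact p₂ ns ,
        inj₁ (decide (sep? (th f x₁) (th f x₃)))
        where
        mult : B → F
        mult x = I (th f x) * (D (th f (x₁ ⊕ x)) * m (x₁ ⊕ x))
        f0 : f 0ₚ ≡ false
        f0 = trans (e 0ₚ) (dec-false (0ₚ ≟ₚ v) (nv ∘ sym))
        fv : f v ≡ true
        fv = trans (e v) (dec-true (v ≟ₚ v) refl)
        ρ-vert : ∀ a → ρ (a , 0ₚ) ≡ (a , 0ₚ)
        ρ-vert false = ρ0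
        ρ-vert true  = trans (ρe 0ᴮ) (cong (e₁ ⊕_) ρ0)
        ρ-v : ∀ a → ρ (a , v) ≡ th f (a , v)
        ρ-v false = trans ρv (cong (_, v) (sym fv))
        ρ-v true  = trans (ρe (false , v)) (trans (cong (e₁ ⊕_) ρv) (cong (_, v) (sym (cong (true xor_) fv))))
        r : ∀ w → (w ≡ 0ₚ ⊎ w ≡ v) → ∀ a → ρ (a , w) ≡ th f (a , w)
        r .0ₚ (inj₁ refl) a = trans (ρ-vert a) (sym (th-trivial f (a , 0ₚ) f0))
        r .v  (inj₂ refl) a = ρ-v a
        r₁ : ρ (x₁ ⊕ x₁) ≡ th f (x₁ ⊕ x₁)
        r₁ = r _ (inj₁ (cong proj₂ (⊕-self x₁))) _
        r₂ : ρ (x₁ ⊕ x₂) ≡ th f (x₁ ⊕ x₂)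
        r₂ = r _ (inj₁ p₂) _
        r₃ : ρ (x₁ ⊕ x₃) ≡ th f (x₁ ⊕ x₃)
        r₃ = r _ (inj₂ p₃) _
        form-at : ∀ x → ρ (x₁ ⊕ x) ≡ th f (x₁ ⊕ x) → ∀ y → to (κ x₁ ∙ j ∙ tᴮ x₁) (x , y) ≡ (th f x , mult x * y)
        form-at x rx y = trans (cong (λ w → from φ (to (tᴮ x₁) (to φ w))) (trans (jf _ _) (cong (_, m (x₁ ⊕ x) * (0# + y)) rx)))
          (trans (cong (λ w → from φ (to (tᴮ x₁) w)) (trans (form _ _) (cong (_, D (th f (x₁ ⊕ x)) * (m (x₁ ⊕ x) * (0# + y)) + 0#) (th-invol f (x₁ ⊕ x)))))
          (trans (cong (λ t → from φ (t , 0# + (D (th f (x₁ ⊕ x)) * (m (x₁ ⊕ x) * (0# + y)) + 0#))) (⊕-cancel x₁ x))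
          (trans (from-form₀ _ _) (cong (th f x ,_)
            (solve 4 (λ i d m y → i :* (con (0 , 0) :+ (d :* (m :* (con (0 , 0) :+ y)) :+ con (0 , 0))) := (i :* (d :* m)) :* y) refl
              (I (th f x)) (D (th f (x₁ ⊕ x))) (m (x₁ ⊕ x)) y)))))
        fix : ∀ {x} → proj₂ (x₁ ⊕ x) ≡ 0ₚ → th f (x₁ ⊕ x) ≡ x₁ ⊕ x
        fix {x} p = th-trivial f (x₁ ⊕ x) (trans (cong f p) f0)
        exact : ∀ {x} → proj₂ (x₁ ⊕ x) ≡ 0ₚ → ¬ Sep x₁ x → mult x ≡ I (th f x)
        exact {x} p ns = trans (cong (I (th f x) *_) (trans (cong₂ _*_
            (trans (cong D (fix p)) (trans (sym (D-invariant _ _ (H-diff ns))) D0))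
            (trans (sym (mult-invariant (rowAffine ρ m (λ _ → 0#) (λ x y → trans (jf x y) (cong (ρ x ,_) (sym (+-identityʳ _))))) j∈ _ _ (H-diff ns))) m0))
          (*-identityˡ _))) (*-identityʳ _)
        decide : Dec (Sep (th f x₁) (th f x₃)) → Sep (th f x₁) (th f x₃)
        decide (yes s) = s
        decide (no k) = ⊥-elim (nv (trans (sym p₃) (iso _ (H-diff (th-back x₁ x₃ k)))))

      exact : ∀ x₁ x₂ x₃ → ¬ Sep x₁ x₂ → Exact x₁ x₂ x₃
      exact x₁ x₂ x₃ ns = by shape
        where
        quiet₀ : ∀ b → (f (proj₂ (b ⊕ x₁)) ≡ false) → (f (proj₂ (b ⊕ x₂)) ≡ false) → (f (proj₂ (b ⊕ x₃)) ≡ false) →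
                 D (b ⊕ x₁) ≡ 1# → Exact x₁ x₂ x₃
        quiet₀ b q₁ q₂ q₃ d = quiet-exact b ns (th-back x₁ x₃) d q₁ q₂ q₃
        by : Shape S f → Exact x₁ x₂ x₃
        by (inj₁ f0) = quiet₀ x₁ (f0 _) (f0 _) (f0 _) (trans (cong D (⊕-self x₁)) D0)
        by (inj₂ (v , nv , e , inj₁ (iso , J))) = split (proj₂ (x₁ ⊕ x₃) ≟ₚ v)
          where
          p₂ : proj₂ (x₁ ⊕ x₂) ≡ 0ₚ
          p₂ = iso _ (H-diff ns)
          off : ∀ x → x ≢ v → f x ≡ false
          off x ne = trans (e x) (dec-false (x ≟ₚ v) ne)
          split : Dec (proj₂ (x₁ ⊕ x₃) ≡ v) → Exact x₁ x₂ x₃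
          split (yes p) = jump-exact nv e iso J x₁ x₂ x₃ ns p₂ p
          split (no ne) = quiet₀ x₁ (off (proj₂ (x₁ ⊕ x₁)) (λ q → nv (trans (sym q) (cong proj₂ (⊕-self x₁)))))
            (off (proj₂ (x₁ ⊕ x₂)) (λ q → nv (trans (sym q) p₂))) (off (proj₂ (x₁ ⊕ x₃)) ne)
            (trans (cong D (⊕-self x₁)) D0)
        by (inj₂ (v , nv , e , inj₂ av)) = pick (av (proj₂ (x₁ ⊕ x₂)) (proj₂ (x₁ ⊕ x₃)) (_ , H-diff ns , refl))
          where
          off : ∀ x → x ≢ v → f x ≡ false
          off x ne = trans (e x) (dec-false (x ≟ₚ v) ne)
          pick : (∃ λ x → (∃ λ h → H h × proj₂ h ≡ x) × x ≢ v × x ⊕ₚ proj₂ (x₁ ⊕ x₂) ≢ v × x ⊕ₚ proj₂ (x₁ ⊕ x₃) ≢ v) → Exact x₁ x₂ x₃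
          pick (_ , (h , Hh , refl) , n₁ , n₂ , n₃) = quiet₀ (h ⊕ x₁)
            (off (proj₂ ((h ⊕ x₁) ⊕ x₁)) (λ q → n₁ (trans (sym (cong proj₂ (⊕-cancelʳ h x₁))) q)))
            (off (proj₂ ((h ⊕ x₁) ⊕ x₂)) (λ q → n₂ (trans (sym (cong proj₂ (⊕-assoc h x₁ x₂))) q)))
            (off (proj₂ ((h ⊕ x₁) ⊕ x₃)) (λ q → n₃ (trans (sym (cong proj₂ (⊕-assoc h x₁ x₃))) q)))
            (trans (cong D (⊕-cancelʳ h x₁)) (trans (sym (D-invariant 0ᴮ h Hh)) D0))

      Hits : Perm V → V → Set
      Hits k (x , y) = to k (x , y) ≡ (th f x , I (th f x) * y)

      shift-hit : ∀ {k : Perm V} {m w : B → F} x y → (∀ y → to k (x , y) ≡ (th f x , m x * y)) →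
                  w (th f x) + m x * y ≡ I (th f x) * y → Hits (rowShift w ∙ k) (x , y)
      shift-hit {k} {m} {w} x y a e = trans (cong (to (rowShift w)) (a y)) (cong (th f x ,_) e)

      gap : (B → F) → V → F
      gap m (x , y) = I (th f x) * y + - (m x * y)

      fill : ∀ a b → (a + - b) + b ≡ a
      fill = solve 2 (λ a b → (a :+ :- b) :+ b := a) refl

      hit-pair : ∀ p₁ p₂ p₃ → ¬ Sep (th f (proj₁ p₁)) (th f (proj₁ p₂)) → ∃ λ k → mem k × Hits k p₁ × Hits k p₂ × Hits k p₃
      hit-pair (x₁ , y₁) (x₂ , y₂) (x₃ , y₃) ns = go (exact x₁ x₂ x₃ (th-back x₁ x₂ ns))
        where
        X₁ X₂ X₃ : B
        X₁ = th f x₁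
        X₂ = th f x₂
        X₃ = th f x₃
        Result : Set
        Result = ∃ λ k → mem k × Hits k (x₁ , y₁) × Hits k (x₂ , y₂) × Hits k (x₃ , y₃)
        sep₃₂ : Sep X₁ X₃ → Sep X₃ X₂
        sep₃₂ (u , Tu , ne) = u , Tu , λ d → ne (trans (agree ns Tu) (sym d))
        keep : ∀ γ {a m i} y → a ≡ 0# → m ≡ i → γ * a + m * y ≡ i * y
        keep γ y refl refl = trans (cong (_+ _) (zeroʳ γ)) (+-identityˡ _)
        correct : ∀ i m y {a} → a ≡ 1# → (i * y + - (m * y)) * a + m * y ≡ i * y
        correct i m y refl = trans (cong (_+ m * y) (*-identityʳ _)) (fill (i * y) (m * y))
        fix : ∀ k m → mem k → (∀ y → to k (x₁ , y) ≡ (X₁ , m x₁ * y)) → (∀ y → to k (x₂ , y) ≡ (X₂ , m x₂ * y)) →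
              (∀ y → to k (x₃ , y) ≡ (X₃ , m x₃ * y)) → m x₁ ≡ I X₁ → m x₂ ≡ I X₂ → Delta X₃ X₁ X₂ → Result
        fix k m k∈ a₁ a₂ a₃ e₁ e₂ (d , Td , d₃ , d₁ , d₂) = rowShift w ∙ k , ∙∈ (T-scale γ Td) k∈ ,
            shift-hit {k} {m} {w} x₁ y₁ a₁ (keep γ y₁ d₁ e₁) ,
            shift-hit {k} {m} {w} x₂ y₂ a₂ (keep γ y₂ d₂ e₂) ,
            shift-hit {k} {m} {w} x₃ y₃ a₃ (correct (I X₃) (m x₃) y₃ d₃)
          where
          γ : F
          γ = gap m (x₃ , y₃)
          w : B → F
          w x = γ * d x
        go : Exact x₁ x₂ x₃ → Result
        go ((k , m , k∈ , a₁ , a₂ , a₃) , e₁ , e₂ , inj₂ e₃) = k , k∈ ,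
          trans (a₁ y₁) (cong (λ t → X₁ , t * y₁) e₁) , trans (a₂ y₂) (cong (λ t → X₂ , t * y₂) e₂) ,
          trans (a₃ y₃) (cong (λ t → X₃ , t * y₃) e₃)
        go ((k , m , k∈ , a₁ , a₂ , a₃) , e₁ , e₂ , inj₁ s) =
          fix k m k∈ a₁ a₂ a₃ e₁ e₂ (delta {X₃} {X₁} {X₂} (Sep-sym s) (sep₃₂ s))

      hit-separated : ∀ p₁ p₂ p₃ → Sep (th f (proj₁ p₁)) (th f (proj₁ p₂)) → Sep (th f (proj₁ p₁)) (th f (proj₁ p₃)) →
        Sep (th f (proj₁ p₂)) (th f (proj₁ p₃)) → ∃ λ k → mem k × Hits k p₁ × Hits k p₂ × Hits k p₃
      hit-separated (x₁ , y₁) (x₂ , y₂) (x₃ , y₃) s₁₂ s₁₃ s₂₃ =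
        go (some-quiet x₁ x₂ x₃) (delta s₁₂ s₁₃) (delta (Sep-sym s₁₂) s₂₃) (delta (Sep-sym s₁₃) (Sep-sym s₂₃))
        where
        X₁ X₂ X₃ : B
        X₁ = th f x₁
        X₂ = th f x₂
        X₃ = th f x₃
        Result : Set
        Result = ∃ λ k → mem k × Hits k (x₁ , y₁) × Hits k (x₂ , y₂) × Hits k (x₃ , y₃)
        go : (∃ λ b → Quiet b x₁ × Quiet b x₂ × Quiet b x₃) → Delta X₁ X₂ X₃ → Delta X₂ X₁ X₃ → Delta X₃ X₁ X₂ → Result
        go (b , q₁ , q₂ , q₃) (d , Td , d₁ , d₂ , d₃) (d' , Td' , d'₂ , d'₁ , d'₃) (d″ , Td″ , d″₃ , d″₁ , d″₂) =
          rowShift w ∙ k[ b ] , ∙∈ (T-+ (T-scale g₁ Td) (T-+ (T-scale g₂ Td') (T-scale g₃ Td″))) (k∈ b) ,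
          shift-hit {k[ b ]} {m} {w} x₁ y₁ (k-form b x₁ q₁) (mix (m x₁ * y₁) d₁ d'₁ d″₁ (first g₁ g₂ g₃) (fill (I X₁ * y₁) (m x₁ * y₁))) ,
          shift-hit {k[ b ]} {m} {w} x₂ y₂ (k-form b x₂ q₂) (mix (m x₂ * y₂) d₂ d'₂ d″₂ (second g₁ g₂ g₃) (fill (I X₂ * y₂) (m x₂ * y₂))) ,
          shift-hit {k[ b ]} {m} {w} x₃ y₃ (k-form b x₃ q₃) (mix (m x₃ * y₃) d₃ d'₃ d″₃ (last g₁ g₂ g₃) (fill (I X₃ * y₃) (m x₃ * y₃)))
          where
          m : B → F
          m x = I (th f x) * D (b ⊕ x)
          g₁ g₂ g₃ : F
          g₁ = gap m (x₁ , y₁)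
          g₂ = gap m (x₂ , y₂)
          g₃ = gap m (x₃ , y₃)
          w : B → F
          w x = g₁ * d x + (g₂ * d' x + g₃ * d″ x)
          mix : ∀ {X i j l g r} s → d X ≡ i → d' X ≡ j → d″ X ≡ l → g₁ * i + (g₂ * j + g₃ * l) ≡ g → g + s ≡ r → w X + s ≡ r
          mix s refl refl refl e e' = trans (cong (_+ s) e) e'
          first : ∀ a b c → a * 1# + (b * 0# + c * 0#) ≡ a
          first = solve 3 (λ a b c → a :* con (1 , 0) :+ (b :* con (0 , 0) :+ c :* con (0 , 0)) := a) refl
          second : ∀ a b c → a * 0# + (b * 1# + c * 0#) ≡ b
          second = solve 3 (λ a b c → a :* con (0 , 0) :+ (b :* con (1 , 0) :+ c :* con (0 , 0)) := b) refl
          last : ∀ a b c → a * 0# + (b * 0# + c * 1#) ≡ c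
          last = solve 3 (λ a b c → a :* con (0 , 0) :+ (b :* con (0 , 0) :+ c :* con (1 , 0)) := c) refl

      hits : ∀ p₁ p₂ p₃ → ∃ λ k → mem k × Hits k p₁ × Hits k p₂ × Hits k p₃
      hits p₁ p₂ p₃ = go (sep? (X p₁) (X p₂)) (sep? (X p₁) (X p₃)) (sep? (X p₂) (X p₃))
        where
        X : V → B
        X p = th f (proj₁ p)
        go : Dec (Sep (X p₁) (X p₂)) → Dec (Sep (X p₁) (X p₃)) → Dec (Sep (X p₂) (X p₃)) → ∃ λ k → mem k × Hits k p₁ × Hits k p₂ × Hits k p₃
        go (no ns) _ _ = hit-pair p₁ p₂ p₃ ns
        go (yes _) (no ns) _ = let (k , k∈ , h₁ , h₃ , h₂) = hit-pair p₁ p₃ p₂ ns in k , k∈ , h₁ , h₂ , h₃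
        go (yes _) (yes _) (no ns) = let (k , k∈ , h₂ , h₃ , h₁) = hit-pair p₂ p₃ p₁ ns in k , k∈ , h₁ , h₂ , h₃
        go (yes s) (yes s') (yes s″) = hit-separated p₁ p₂ p₃ s s' s″

      good : Good S
      good = idₚ , hol (λ v → v , pt λ _ → refl) (λ v → v , pt λ _ → refl) ,
        resp (pt λ _ → refl) (cl₃ (φ ⁻¹) λ p₁ p₂ p₃ → let (k , k∈ , h₁ , h₂ , h₃) = hits p₁ p₂ p₃ in
          k , k∈ , trans h₁ (sym (from-form₀ _ _)) , trans h₂ (sym (from-form₀ _ _)) , trans h₃ (sym (from-form₀ _ _)))

    module Assemble (2≢0 : 1# + 1# ≢ 0#) where

      Normed : Instance → (Plane → Bool) → Set
      Normed S f = ∃ λ D → Form (Instance.φ S) f D (λ _ → 0#) × D 0ᴮ ≡ 1#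

      norm : ∀ S {f D c} → Form (Instance.φ S) f D c → (∀ x → f x ≡ false) ⊎ parity f ≡ true → f 0ₚ ≡ false →
             Σ Instance λ S' → Normed S' f × (Good S' → Good S)
      norm S {f} {D} form shape f0 = go (Straighten.straightened 2≢0 S form shape)
        where
        go : (Σ Instance λ S₁ → Form (Instance.φ S₁) f D (λ _ → 0#) × (Good S₁ → Good S)) → Σ Instance λ S' → Normed S' f × (Good S' → Good S)
        go (S₁ , form₁ , g) = scale (inv (form-mult≢0 {Instance.φ S₁} form₁ 0ᴮ))
          where
          scale : (∃ λ i → i * D 0ᴮ ≡ 1#) → Σ Instance λ S' → Normed S' f × (Good S' → Good S)
          scale (i , e) = finish (hol-scale i (λ i0 → 1≢0 (trans (sym e) (trans (cong (_* D 0ᴮ) i0) (zeroˡ _)))))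
            where
            finish : (∃ λ β → Hol β × (∀ x y → to β (x , y) ≡ (x , i * y))) → Σ Instance λ S' → Normed S' f × (Good S' → Good S)
            finish (β , hβ , bf) = left S₁ β hβ , ((λ x → i * D x) ,
              (λ x y → trans (cong (to β) (form₁ x y)) (trans (bf _ _) (cong (th f x ,_)
                (solve 3 (λ i d y → i :* (d :* y :+ con (0 , 0)) := (i :* d) :* y :+ con (0 , 0)) refl i (D x) y)))) , e) ,
              λ h → g (good-left S₁ β hβ h)

      even-good : ∀ S {f D c} → Form (Instance.φ S) f D c → (∀ x → f x ≡ false) → Good S
      even-good S {f} form f0 = go (norm S form (inj₁ f0) (f0 _))
        where
        go : (Σ Instance λ S' → Normed S' f × (Good S' → Good S)) → Good S
        go (S' , (D , form' , D0) , g) = g (Match.good 2≢0 S' form' D0 (inj₁ f0))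

      odd-good : ∀ S {f D c} → Form (Instance.φ S) f D c → parity f ≡ true → f 0ₚ ≡ false → Good S
      odd-good S {f} form odd f0 = go (norm S form (inj₂ odd) f0)
        where
        go : (Σ Instance λ S' → Normed S' f × (Good S' → Good S)) → Good S
        go (S₁ , (D , form₁ , D0) , g) = g (select (isolated-or-avoidable S₁))
          where
          point-good : ∀ v → v ≢ 0ₚ → (Isolated S₁ × Jump S₁ v true 1#) ⊎ Avoidable S₁ v → Good S₁
          point-good v nv choice = good-left S₁ β hβ (Match.good 2≢0 (left S₁ β hβ) form₂ D0
            (inj₂ (v , nv , (λ x → collapse (f x) (point v x)) , choice)))
            where
            h : Plane → Bool
            h x = f x xor point v x
            even : parity h ≡ false
            even = trans (parity-xor f (point v)) (cong₂ _xor_ odd (point-odd v))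
            β = Normalise.liftᴮ n pr (thPerm h)
            hβ = hol-th h even
            form₂ : Form (β ∙ Instance.φ S₁) (λ x → f x xor h x) D (λ _ → 0#)
            form₂ (a , x) y = trans (cong (to β) (form₁ (a , x) y)) (cong (λ t → (t , x) , D (a , x) * y + 0#) (BoolP.xor-assoc a (f x) (h x)))
            collapse : ∀ a b → a xor (a xor b) ≡ b
            collapse a b = trans (sym (BoolP.xor-assoc a a b)) (cong (_xor b) (BoolP.xor-same a))
          select : Isolated S₁ ⊎ (∃ λ v → v ≢ 0ₚ × Avoidable S₁ v) → Good S₁
          select (inj₂ (v , nv , a)) = point-good v nv (inj₂ a)
          select (inj₁ iso) = let (v , nv , J) = Search.clean-jump 2≢0 S₁ form₁ odd f0 D0 in point-good v nv (inj₁ (iso , J))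

      normal-good : ∀ S → Normalise.NormalForm n pr (Instance.φ S) → Good S
      normal-good S nf = go (normal⇒form nf)
        where
        go : (∃ λ f → ∃ λ D → ∃ λ c → Form (Instance.φ S) f D c) → Good S
        go (f , D , c , form) = by (parity f) refl
          where
          by : ∀ b → parity f ≡ b → Good S
          by false e = let (S' , form' , _ , g) = adjust S {f} {D} {c} f e form in
            g (even-good S' form' (λ x → BoolP.xor-same (f x)))
          by true e = let (S' , form' , _ , g) = adjust S {f} {D} {c} h even form in
            g (odd-good S' form' (trans (parity-xor f h) (cong₂ _xor_ e even)) (f0 (f 0ₚ)))
            where
            h : Plane → Bool
            h x = f x xor point (true , false) x
            even : parity h ≡ false
            even = trans (parity-xor f (point (true , false))) (cong₂ _xor_ e (point-odd (true , false)))
            f0 : ∀ a → a xor (a xor false) ≡ false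
            f0 = from-yes (FinBool.∀? λ a → (a xor (a xor false)) BoolP.≟ false)

module TwoCase where

  open import Data.Nat as ℕ using (zero; suc)
  open import Data.Nat.Primality
  open import Data.Nat.Divisibility using (_∣_; _∣?_)
  open import Data.Fin using (zero; suc)
  open import Data.Fin.Properties using (toℕ-injective)
  open import Data.Bool using (Bool; true; false; _xor_; _∧_)
  import Data.Bool.Properties as BoolP
  open import Data.List using (List; map; _++_)
  import Data.List.Relation.Unary.Unique.Propositional as UP
  import Data.List.Relation.Unary.Unique.Propositional.Properties as UPP
  open import Data.List.Membership.Propositional using (_∈_)
  open import Data.List.Membership.Propositional.Properties using (∈-map⁺; ∈-map⁻; ∈-++⁺ˡ; ∈-++⁺ʳ; ∈-++⁻)
  open import Data.Product hiding (map; swap)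
  open import Data.Sum using (_⊎_; inj₁; inj₂)
  open import Data.Empty
  open import Function using (_∘_)
  open import Relation.Nullary
  open import Relation.Nullary.Decidable using (_×-dec_; ¬?; from-yes; from-no; dec-true; dec-false)
  open import Relation.Binary.PropositionalEquality hiding (resp)
  open Perms
  open Space
  open Shifts
  open Stage1 using (straight⇒affine)
  open Stage2
  open OddForm
  open OddFinal using (point; point-odd; parity-xor)
  open Two using (module ElementaryTwo)

  open Space.Space 1 prime[2]
  open Normalise 1 prime[2]
  open Forms 1 prime[2]

  abstract
    bits : ∀ y → y ≡ 0# ⊎ y ≡ 1#
    bits zero       = inj₁ (toℕ-injective (sym (toℕ-⟦⟧ 0)))
    bits (suc zero) = inj₂ (toℕ-injective (sym (toℕ-⟦⟧ 1)))

    1+1 : 1# + 1# ≡ 0#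
    1+1 = trans (sym (⟦+⟧ 1 1)) ⟦p⟧

  y+y : ∀ y → y + y ≡ 0#
  y+y y = by (bits y)
    where
    by : y ≡ 0# ⊎ y ≡ 1# → y + y ≡ 0#
    by (inj₁ refl) = +-identityˡ 0#
    by (inj₂ refl) = 1+1

  bit : F → Bool
  bit y = does (y ≟ᶠ 1#)

  unbit : Bool → F
  unbit false = 0#
  unbit true  = 1#

  bit0 : bit 0# ≡ false
  bit0 = dec-false (0# ≟ᶠ 1#) (1≢0 ∘ sym)

  bit1 : bit 1# ≡ true
  bit1 = dec-true (1# ≟ᶠ 1#) refl

  bit-unbit : ∀ b → bit (unbit b) ≡ b
  bit-unbit false = bit0
  bit-unbit true  = bit1

  unbit-bit : ∀ y → unbit (bit y) ≡ y
  unbit-bit y = by (bits y)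
    where
    by : y ≡ 0# ⊎ y ≡ 1# → unbit (bit y) ≡ y
    by (inj₁ refl) = cong unbit bit0
    by (inj₂ refl) = cong unbit bit1

  unbit-xor : ∀ a b → unbit (a xor b) ≡ unbit a + unbit b
  unbit-xor false b     = sym (+-identityˡ _)
  unbit-xor true  false = sym (+-identityʳ _)
  unbit-xor true  true  = sym 1+1

  bit-+ : ∀ y y' → bit (y + y') ≡ bit y xor bit y'
  bit-+ y y' = trans (cong bit (sym (trans (unbit-xor (bit y) (bit y')) (cong₂ _+_ (unbit-bit y) (unbit-bit y'))))) (bit-unbit _)

  0ⱽ : V
  0ⱽ = 0ᴮ , 0#

  at₀ at₁ : B → V
  at₀ x = x , 0#
  at₁ x = x , 1#

  nonzeroⱽ : List V
  nonzeroⱽ = map at₁ allᴮ ++ map at₀ nonzeroᴮ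

  ⊞-self : ∀ v → v ⊞ v ≡ 0ⱽ
  ⊞-self (x , y) = cong₂ _,_ (⊕-self x) (y+y y)

  abstract
    nonzeroⱽ-unique : UP.Unique nonzeroⱽ
    nonzeroⱽ-unique = UPP.++⁺ (UPP.map⁺ {f = at₁} (cong proj₁) (from-yes (AllPairs.allPairs? (λ x y → ¬? (x ≟ᴮ y)) allᴮ)))
      (UPP.map⁺ {f = at₀} (cong proj₁) nonzeroᴮ-unique)
      (λ (p , q) → let (_ , _ , e) = ∈-map⁻ at₁ p ; (_ , _ , e') = ∈-map⁻ at₀ q in
        1≢0 (cong proj₂ (trans (sym e) e')))
      where import Data.List.Relation.Unary.AllPairs as AllPairs

    ∈nonzeroⱽ : ∀ {v} → v ≢ 0ⱽ → v ∈ nonzeroⱽ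
    ∈nonzeroⱽ {x , y} ne = by (bits y)
      where
      by : y ≡ 0# ⊎ y ≡ 1# → (x , y) ∈ nonzeroⱽ
      by (inj₁ refl) = ∈-++⁺ʳ (map at₁ allᴮ) (∈-map⁺ at₀ (∈nonzeroᴮ (λ e → ne (cong at₀ e))))
      by (inj₂ refl) = ∈-++⁺ˡ (∈-map⁺ at₁ (∈allᴮ x))

    nonzeroⱽ∈ : ∀ {v} → v ∈ nonzeroⱽ → v ≢ 0ⱽ
    nonzeroⱽ∈ {v} p e = by (∈-++⁻ (map at₁ allᴮ) p)
      where
      by : v ∈ map at₁ allᴮ ⊎ v ∈ map at₀ nonzeroᴮ → ⊥
      by (inj₁ q) = let (_ , _ , d) = ∈-map⁻ at₁ q in 1≢0 (cong proj₂ (trans (sym d) e))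
      by (inj₂ q) = let (_ , q' , d) = ∈-map⁻ at₀ q in nonzeroᴮ∈ q' (cong proj₁ (trans (sym d) e))

    common-shiftⱽ : ∀ S → let open Instance S in
      ∃ λ v → ∃ λ v' → v ≢ 0ⱽ × ∃ λ k → mem k × (∀ x → to φ (to k (v ⊞ x)) ≡ v' ⊞ to φ (to k x))
    common-shiftⱽ S = unpack (E.common-shift A φ
        (λ v → resp (pt λ _ → refl) (sh∈ v)) (λ v → resp (pt λ _ → refl) (sh'∈ v)))
      where
      open Instance S
      module E = ElementaryTwo _≟ⱽ_ allⱽ ∈allⱽ _⊞_ 0ⱽ
        (λ (a , b) (c , d) → cong₂ _,_ (⊕-comm a c) (+-comm b d))
        (λ (a , b) (c , d) (e , f) → cong₂ _,_ (⊕-assoc a c e) (+-assoc b d f))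
        (λ (a , b) → cong₂ _,_ (⊕-identityʳ a) (+-identityʳ b)) ⊞-self
        nonzeroⱽ nonzeroⱽ-unique ∈nonzeroⱽ nonzeroⱽ∈ (from-no (2 ∣? 15))
      unpack : (∃ λ v → ∃ λ v' → v ≢ 0ⱽ × ∃ λ k → mem k × (φ ∙ k) ∙ E.shift v ≗ₚ E.shift v' ∙ (φ ∙ k)) →
               ∃ λ v → ∃ λ v' → v ≢ 0ⱽ × ∃ λ k → mem k × (∀ x → to φ (to k (v ⊞ x)) ≡ v' ⊞ to φ (to k x))
      unpack (v , v' , ne , k , k∈ , e) = v , v' , ne , k , k∈ , at e

  Additive : Perm V → Set
  Additive β = ∀ v w → to β (v ⊞ w) ≡ to β v ⊞ to β w

  additive-hol : ∀ β → Additive β → Hol β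
  additive-hol β h = hol (λ v → to β v , pt (h v))
    (λ v → from β v , pt λ x → from-≡ β (trans (h _ _) (cong₂ _⊞_ (to-from β v) (to-from β x))))

  1ⱽ : V
  1ⱽ = 0ᴮ , 1#

  choose : Bool → B → B
  choose false _ = 0ᴮ
  choose true  b = b

  choose-xor : ∀ a a' b → choose (a xor a') b ≡ choose a b ⊕ choose a' b
  choose-xor false a'    b = sym (⊕-identityˡ (choose a' b))
  choose-xor true  false b = sym (⊕-identityʳ b)
  choose-xor true  true  b = sym (⊕-self b)

  ⊕-mid : ∀ a b c d → (a ⊕ b) ⊕ (c ⊕ d) ≡ (a ⊕ c) ⊕ (b ⊕ d)
  ⊕-mid a b c d = trans (⊕-assoc a b (c ⊕ d)) (trans (cong (a ⊕_) (trans (sym (⊕-assoc b c d))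
    (trans (cong (_⊕ d) (⊕-comm b c)) (⊕-assoc c b d)))) (sym (⊕-assoc a c (b ⊕ d))))

  sending-1ⱽ : ∀ v → v ≢ 0ⱽ → ∃ λ β → Additive β × to β 1ⱽ ≡ v
  sending-1ⱽ (b , s) ne = by (bits s)
    where
    shear : Perm V
    shear = perm f f invol invol
      where
      f : V → V
      f (x , y) = x ⊕ choose (bit y) b , y
      invol : ∀ v → f (f v) ≡ v
      invol (x , y) = cong (_, y) (⊕-cancelʳ x (choose (bit y) b))
    exchange : Linearᴮ → Perm V
    exchange (linear M _) = perm (λ ((a , x) , y) → to M (bit y , x) , unbit a)
      (λ (x , y) → let (a , x') = from M x in (bit y , x') , unbit a)
      (λ (x , y) → let (a , x') = from M x in cong₂ _,_ (trans (cong (λ t → to M (t , x')) (bit-unbit a)) (to-from M x)) (unbit-bit y))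
      (λ ((a , x) , y) → cong₂ _,_ (cong₂ _,_ (bit-unbit a) (cong proj₂ (from-to M (bit y , x))))
                           (trans (cong (unbit ∘ proj₁) (from-to M (bit y , x))) (unbit-bit y)))
    by : s ≡ 0# ⊎ s ≡ 1# → ∃ λ β → Additive β × to β 1ⱽ ≡ (b , s)
    by (inj₂ refl) = shear ,
      (λ (x , y) (x' , y') → cong (_, y + y') (trans (cong (x ⊕ x' ⊕_) (trans (cong (λ t → choose t b) (bit-+ y y')) (choose-xor (bit y) (bit y') b)))
        (⊕-mid x x' _ _))) ,
      cong (_, 1#) (trans (⊕-identityˡ (choose (bit 1#) b)) (cong (λ t → choose t b) bit1))
    by (inj₁ refl) = mk (sending-e₁ b (λ e → ne (cong (_, 0#) e)))
      where
      mk : (∃ λ (L : Linearᴮ) → to (Linearᴮ.perm₀ L) e₁ ≡ b) → ∃ λ β → Additive β × to β 1ⱽ ≡ (b , 0#)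
      mk (linear M add , e) = exchange (linear M add) ,
        (λ ((a , x) , y) ((a' , x') , y') → cong₂ _,_
          (trans (cong (λ t → to M (t , x ⊕ₚ x')) (bit-+ y y')) (add (bit y , x) (bit y' , x'))) (unbit-xor a a')) ,
        cong (_, 0#) (trans (cong (λ t → to M (t , 0ₚ)) bit1) e)

  to-affine : ∀ S → Reduces S (RowAffine ∘ Instance.φ)
  to-affine S = go (common-shiftⱽ S)
    where
    open Instance S
    go : (∃ λ v → ∃ λ v' → v ≢ 0ⱽ × ∃ λ k → mem k × (∀ x → to φ (to k (v ⊞ x)) ≡ v' ⊞ to φ (to k x))) →
         Reduces S (RowAffine ∘ Instance.φ)
    go (v , v' , ne , k , k∈ , e) = reduce (sending-1ⱽ v ne) (sending-1ⱽ v' nonzero)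
      where
      nonzero : v' ≢ 0ⱽ
      nonzero refl = ne (trans (sym (trans (⊞-comm0 v) refl)) (to-inj k (to-inj φ (trans (e 0ⱽ) (zero-⊞ _)))))
        where
        zero-⊞ : ∀ w → 0ⱽ ⊞ w ≡ w
        zero-⊞ (x , y) = cong₂ _,_ (⊕-identityˡ x) (+-identityˡ y)
        ⊞-comm0 : ∀ w → w ⊞ 0ⱽ ≡ w
        ⊞-comm0 (x , y) = cong₂ _,_ (⊕-identityʳ x) (+-identityʳ y)
      reduce : (∃ λ β → Additive β × to β 1ⱽ ≡ v) → (∃ λ β → Additive β × to β 1ⱽ ≡ v') → Reduces S (RowAffine ∘ Instance.φ)
      reduce (β , add , eβ) (γ , add' , eγ) = S₃ ,
        straight⇒affine 1 prime[2] (γ ⁻¹ ∙ (φ ∙ k) ∙ β) (λ _ → 1#) (λ _ → 1≢0) comm ,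
        λ g → good-right S k k∈ (good-both S₁ β hβ (good-left S₂ (γ ⁻¹) hγ g))
        where
        hβ = additive-hol β add
        hγ = hol-⁻¹ (additive-hol γ add')
        S₁ = right S k k∈
        S₂ = both S₁ β hβ
        S₃ = left S₂ (γ ⁻¹) hγ
        comm : ∀ x y → from γ (to φ (to k (to β (x , 1# + y)))) ≡ to z (from γ (to φ (to k (to β (x , y)))))
        comm x y = from-≡ γ (trans (add' 1ⱽ _) (trans (cong₂ _⊞_ eγ (to-from γ _)) (sym
          (trans (cong (to φ ∘ to k) (trans (cong (to β) (cong (_, 1# + y) (sym (⊕-identityˡ x)))) (trans (add 1ⱽ (x , y)) (cong (_⊞ to β (x , y)) eβ))))
            (e (to β (x , y)))))))

  Crit : (Plane → Bool) → (B → Bool) → Set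
  Crit f c = ∀ u w → ∃ λ q → f (proj₂ q) ≡ f (proj₂ (q ⊕ u)) × f (proj₂ q) ≡ f (proj₂ (q ⊕ w)) ×
    c q ≡ c (q ⊕ u) × c q ≡ c (q ⊕ w)

  crit? : ∀ f c → Dec (Crit f c)
  crit? f c = FinB.∀? λ u → FinB.∀? λ w → FinB.∃? λ q → f (proj₂ q) BoolP.≟ f (proj₂ (q ⊕ u)) ×-dec f (proj₂ q) BoolP.≟ f (proj₂ (q ⊕ w)) ×-dec
    c q BoolP.≟ c (q ⊕ u) ×-dec c q BoolP.≟ c (q ⊕ w)

  functional : Bool → Bool → Bool → Bool → B → Bool
  functional k l₁ l₂ l₃ (a , b , c) = k xor ((l₁ ∧ a) xor ((l₂ ∧ b) xor (l₃ ∧ c)))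

  tableᴮ : (Plane → Bool) → (Plane → Bool) → B → Bool
  tableᴮ g h (false , x) = g x
  tableᴮ g h (true  , x) = h x

  Scaled : Bool → Plane → Bool
  Scaled ε x = ε ∧ point (true , true) x

  -- c is normalised to vanish on 0 and on the standard basis.
  abstract
    fixable : ∀ ε c₁ c₂ c₃ c₄ → ∃ λ k → ∃ λ l₁ → ∃ λ l₂ → ∃ λ l₃ →
      Crit (Scaled ε) (λ x → tableᴮ (table false false false c₁) (table false c₂ c₃ c₄) x xor functional k l₁ l₂ l₃ (th (Scaled ε) x))
    fixable = from-yes (FinBool.∀? λ ε → ∀Bool⁴? λ c₁ c₂ c₃ c₄ → FinBool.∃? λ k → FinBool.∃? λ l₁ → FinBool.∃? λ l₂ → FinBool.∃? λ l₃ →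
      crit? (Scaled ε) (λ x → tableᴮ (table false false false c₁) (table false c₂ c₃ c₄) x xor functional k l₁ l₂ l₃ (th (Scaled ε) x)))

  form-one : ∀ {φ f D c} → Form φ f D c → Form φ f (λ _ → 1#) c
  form-one {φ} {f} {D} {c} form x y = trans (form x y) (cong (λ t → th f x , t * y + c x) (by (bits (D x))))
    where
    by : D x ≡ 0# ⊎ D x ≡ 1# → D x ≡ 1#
    by (inj₁ e) = ⊥-elim (form-mult≢0 {φ} form x e)
    by (inj₂ e) = e

  raise : (B → Bool) → Perm V
  raise l = perm f f invol invol
    where
    f : V → V
    f (x , y) = x , unbit (l x) + y
    invol : ∀ v → f (f v) ≡ v
    invol (x , y) = cong (x ,_) (trans (sym (+-assoc _ _ y)) (trans (cong (_+ y) (y+y _)) (+-identityˡ y)))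

  functional-⊕ : ∀ k l₁ l₂ l₃ b x → functional k l₁ l₂ l₃ (b ⊕ x) ≡ (functional k l₁ l₂ l₃ b xor k) xor functional k l₁ l₂ l₃ x
  functional-⊕ k l₁ l₂ l₃ (b₁ , b₂ , b₃) (x₁ , x₂ , x₃) =
    trans (cong (k xor_) (trans (cong₂ _xor_ (and l₁ b₁ x₁) (trans (cong₂ _xor_ (and l₂ b₂ x₂) (and l₃ b₃ x₃)) (mid (l₂ ∧ b₂) (l₂ ∧ x₂) (l₃ ∧ b₃) (l₃ ∧ x₃))))
        (mid (l₁ ∧ b₁) (l₁ ∧ x₁) ((l₂ ∧ b₂) xor (l₃ ∧ b₃)) ((l₂ ∧ x₂) xor (l₃ ∧ x₃)))))
      (outer k ((l₁ ∧ b₁) xor ((l₂ ∧ b₂) xor (l₃ ∧ b₃))) ((l₁ ∧ x₁) xor ((l₂ ∧ x₂) xor (l₃ ∧ x₃))))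
    where
    and : ∀ l b x → l ∧ (b xor x) ≡ (l ∧ b) xor (l ∧ x)
    and false b x = refl
    and true  b x = refl
    mid : ∀ a b c d → (a xor b) xor (c xor d) ≡ (a xor c) xor (b xor d)
    mid = from-yes (∀Bool⁴? λ a b c d → ((a xor b) xor (c xor d)) BoolP.≟ ((a xor c) xor (b xor d)))
    outer : ∀ k s t → k xor (s xor t) ≡ ((k xor s) xor k) xor (k xor t)
    outer = from-yes (FinBool.∀? λ k → FinBool.∀? λ s → FinBool.∀? λ t → (k xor (s xor t)) BoolP.≟ (((k xor s) xor k) xor (k xor t)))

  hol-raise : ∀ k l₁ l₂ l₃ → Hol (raise (functional k l₁ l₂ l₃))
  hol-raise k l₁ l₂ l₃ = hol push' push'
    where
    l = functional k l₁ l₂ l₃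
    push' : ∀ v → ∃ λ v' → raise l ∙ shift v ≗ₚ shift v' ∙ raise l
    push' (b , s) = (b , unbit (l b xor k) + s) , pt λ (x , y) → cong (b ⊕ x ,_) (trans
      (cong (_+ (s + y)) (trans (cong unbit (functional-⊕ k l₁ l₂ l₃ b x)) (unbit-xor (l b xor k) (l x))))
      (solve 4 (λ a c s y → (a :+ c) :+ (s :+ y) := (a :+ s) :+ (c :+ y)) refl (unbit (l b xor k)) (unbit (l x)) s y))

  raised : ∀ S {f c} k l₁ l₂ l₃ → Form (Instance.φ S) f (λ _ → 1#) c →
    Form (raise (functional k l₁ l₂ l₃) ∙ Instance.φ S) f (λ _ → 1#) (λ x → unbit (bit (c x) xor functional k l₁ l₂ l₃ (th f x)))
  raised S {f} {c} k l₁ l₂ l₃ form x y = trans (cong (to (raise l)) (form x y)) (cong (th f x ,_)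
    (trans (solve 3 (λ l y c → l :+ (con (1 , 0) :* y :+ c) := con (1 , 0) :* y :+ (c :+ l)) refl (unbit (l (th f x))) y (c x))
      (cong (1# * y +_) (trans (cong (_+ unbit (l (th f x))) (sym (unbit-bit (c x)))) (sym (unbit-xor (bit (c x)) _))))))
    where l = functional k l₁ l₂ l₃

  form-cong : ∀ φ {f f' c c'} → (∀ x → f x ≡ f' x) → (∀ x → c x ≡ c' x) → Form φ f (λ _ → 1#) c → Form φ f' (λ _ → 1#) c'
  form-cong φ e e' form (a , x) y = trans (form (a , x) y) (cong₂ (λ s t → ((a xor s) , x) , 1# * y + t) (e x) (e' (a , x)))

  crit-good : ∀ S {f c} → Form (Instance.φ S) f (λ _ → 1#) (λ x → unbit (c x)) → Crit f c → Good S
  crit-good S {f} {c} form crit = idₚ , hol (λ v → v , pt λ _ → refl) (λ v → v , pt λ _ → refl) ,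
    resp (pt λ _ → refl) (cl₃ (φ ⁻¹) λ p₁ p₂ p₃ → match p₁ p₂ p₃ (crit (proj₁ p₁ ⊕ proj₁ p₂) (proj₁ p₁ ⊕ proj₁ p₃)))
    where
    open Instance S
    hit : ∀ b t s x y → f (proj₂ (b ⊕ x)) ≡ t → c (b ⊕ x) ≡ s →
          to (φ ⁻¹ ∙ shift ((t , 0ₚ) ⊕ b , unbit s) ∙ φ ∙ shift (b , 0#)) (x , y) ≡ from φ (x , y)
    hit b t s x y refl refl = cong (from φ) (trans (cong (to (shift ((t , 0ₚ) ⊕ b , unbit s))) (form (b ⊕ x) (0# + y)))
      (cong₂ _,_ (trans (cong (((t , 0ₚ) ⊕ b) ⊕_) (trans (th-bump (b ⊕ x)) (sym (⊕-assoc (t , 0ₚ) b x)))) (⊕-cancel ((t , 0ₚ) ⊕ b) x))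
        (trans (solve 2 (λ s y → s :+ (con (1 , 0) :* (con (0 , 0) :+ y) :+ s) := (s :+ s) :+ y) refl (unbit s) y)
          (trans (cong (_+ y) (y+y (unbit s))) (+-identityˡ y)))))
      where
      th-bump : ∀ x → th f x ≡ (f (proj₂ x) , 0ₚ) ⊕ x
      th-bump (a , x) = cong (_, x) (BoolP.xor-comm a (f x))
    match : ∀ p₁ p₂ p₃ → (∃ λ q → f (proj₂ q) ≡ f (proj₂ (q ⊕ (proj₁ p₁ ⊕ proj₁ p₂))) × f (proj₂ q) ≡ f (proj₂ (q ⊕ (proj₁ p₁ ⊕ proj₁ p₃))) ×
              c q ≡ c (q ⊕ (proj₁ p₁ ⊕ proj₁ p₂)) × c q ≡ c (q ⊕ (proj₁ p₁ ⊕ proj₁ p₃))) →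
            ∃ λ k → mem k × to k p₁ ≡ from φ p₁ × to k p₂ ≡ from φ p₂ × to k p₃ ≡ from φ p₃
    match (x₁ , y₁) (x₂ , y₂) (x₃ , y₃) (q , f₂ , f₃ , c₂ , c₃) = φ ⁻¹ ∙ shift ((t , 0ₚ) ⊕ b , unbit s) ∙ φ ∙ shift (b , 0#) ,
      resp (pt λ _ → refl) (∙∈ (sh'∈ ((t , 0ₚ) ⊕ b , unbit s)) (sh∈ (b , 0#))) ,
      hit b t s x₁ y₁ (cong (f ∘ proj₂) (⊕-cancelʳ q x₁)) (cong c (⊕-cancelʳ q x₁)) ,
      hit b t s x₂ y₂ (trans (cong (f ∘ proj₂) (⊕-assoc q x₁ x₂)) (sym f₂)) (trans (cong c (⊕-assoc q x₁ x₂)) (sym c₂)) ,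
      hit b t s x₃ y₃ (trans (cong (f ∘ proj₂) (⊕-assoc q x₁ x₃)) (sym f₃)) (trans (cong c (⊕-assoc q x₁ x₃)) (sym c₃))
      where
      b = q ⊕ x₁
      t = f (proj₂ q)
      s = c q

  scaled-good : ∀ S ε {c} → Form (Instance.φ S) (Scaled ε) (λ _ → 1#) c → Good S
  scaled-good S ε {c} form = good-left S β₁ h₁ (fix (fixable ε (c₁ (false , true , true)) (c₁ (true , true , false)) (c₁ (true , false , true)) (c₁ (true , true , true))))
    where
    f = Scaled ε
    c₀ : B → Bool
    c₀ x = bit (c x)
    k l₁ l₂ l₃ : Bool
    k = c₀ 0ᴮ
    l₁ = c₀ 0ᴮ xor c₀ e₁
    l₂ = c₀ 0ᴮ xor c₀ e₂
    l₃ = c₀ 0ᴮ xor c₀ e₃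
    c₁ : B → Bool
    c₁ x = c₀ x xor functional k l₁ l₂ l₃ (th f x)
    β₁ = raise (functional k l₁ l₂ l₃)
    h₁ = hol-raise k l₁ l₂ l₃
    S₁ = left S β₁ h₁
    ε-off : ε ∧ false ≡ false
    ε-off = BoolP.∧-zeroʳ ε
    vanish₀ : ∀ e a l₁ l₂ l₃ → e ≡ false → a xor (a xor ((l₁ ∧ (false xor e)) xor ((l₂ ∧ false) xor (l₃ ∧ false)))) ≡ false
    vanish₀ .false a l₁ l₂ l₃ refl = brute a l₁ l₂ l₃
      where
      brute : ∀ a l₁ l₂ l₃ → a xor (a xor ((l₁ ∧ false) xor ((l₂ ∧ false) xor (l₃ ∧ false)))) ≡ false
      brute = from-yes (∀Bool⁴? λ a l₁ l₂ l₃ → (a xor (a xor ((l₁ ∧ false) xor ((l₂ ∧ false) xor (l₃ ∧ false))))) BoolP.≟ false)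
    vanish₁ : ∀ e a b l₂ l₃ → e ≡ false → b xor (a xor (((a xor b) ∧ (true xor e)) xor ((l₂ ∧ false) xor (l₃ ∧ false)))) ≡ false
    vanish₁ .false a b l₂ l₃ refl = brute a b l₂ l₃
      where
      brute : ∀ a b l₂ l₃ → b xor (a xor (((a xor b) ∧ true) xor ((l₂ ∧ false) xor (l₃ ∧ false)))) ≡ false
      brute = from-yes (∀Bool⁴? λ a b l₂ l₃ → (b xor (a xor (((a xor b) ∧ true) xor ((l₂ ∧ false) xor (l₃ ∧ false))))) BoolP.≟ false)
    vanish₂ : ∀ e a b l₁ l₃ → e ≡ false → b xor (a xor ((l₁ ∧ (false xor e)) xor (((a xor b) ∧ true) xor (l₃ ∧ false)))) ≡ false
    vanish₂ .false a b l₁ l₃ refl = brute a b l₁ l₃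
      where
      brute : ∀ a b l₁ l₃ → b xor (a xor ((l₁ ∧ false) xor (((a xor b) ∧ true) xor (l₃ ∧ false)))) ≡ false
      brute = from-yes (∀Bool⁴? λ a b l₁ l₃ → (b xor (a xor ((l₁ ∧ false) xor (((a xor b) ∧ true) xor (l₃ ∧ false))))) BoolP.≟ false)
    vanish₃ : ∀ e a b l₁ l₂ → e ≡ false → b xor (a xor ((l₁ ∧ (false xor e)) xor ((l₂ ∧ false) xor ((a xor b) ∧ true)))) ≡ false
    vanish₃ .false a b l₁ l₂ refl = brute a b l₁ l₂
      where
      brute : ∀ a b l₁ l₂ → b xor (a xor ((l₁ ∧ false) xor ((l₂ ∧ false) xor ((a xor b) ∧ true)))) ≡ false
      brute = from-yes (∀Bool⁴? λ a b l₁ l₂ → (b xor (a xor ((l₁ ∧ false) xor ((l₂ ∧ false) xor ((a xor b) ∧ true))))) BoolP.≟ false)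
    tabulated : ∀ x → c₁ x ≡ tableᴮ (table false false false (c₁ (false , true , true)))
                                    (table false (c₁ (true , true , false)) (c₁ (true , false , true)) (c₁ (true , true , true))) x
    tabulated (false , false , false) = vanish₀ (ε ∧ false) (c₀ 0ᴮ) l₁ l₂ l₃ ε-off
    tabulated (true  , false , false) = vanish₁ (ε ∧ false) (c₀ 0ᴮ) (c₀ e₁) l₂ l₃ ε-off
    tabulated (false , true  , false) = vanish₂ (ε ∧ false) (c₀ 0ᴮ) (c₀ e₂) l₁ l₃ ε-off
    tabulated (false , false , true)  = vanish₃ (ε ∧ false) (c₀ 0ᴮ) (c₀ e₃) l₁ l₂ ε-off
    tabulated (true  , true  , false) = refl
    tabulated (true  , false , true)  = refl
    tabulated (false , true  , true)  = refl
    tabulated (true  , true  , true)  = refl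
    t : B → Bool
    t = tableᴮ (table false false false (c₁ (false , true , true)))
               (table false (c₁ (true , true , false)) (c₁ (true , false , true)) (c₁ (true , true , true)))
    fix : (∃ λ k → ∃ λ l₁ → ∃ λ l₂ → ∃ λ l₃ → Crit f (λ x → t x xor functional k l₁ l₂ l₃ (th f x))) → Good S₁
    fix (k' , l₁' , l₂' , l₃' , cr) = good-left S₁ (raise l') h₂ (crit-good (left S₁ (raise l') h₂)
        (form-cong (raise l' ∙ Instance.φ S₁) (λ _ → refl) (λ x → cong unbit (cong (_xor l' (th f x)) (trans (bit-unbit (c₁ x)) (tabulated x))))
          (raised S₁ k' l₁' l₂' l₃' (raised S k l₁ l₂ l₃ form))) cr)
      where
      l' = functional k' l₁' l₂' l₃'
      h₂ = hol-raise k' l₁' l₂' l₃'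

  two-good : ∀ S → Good S
  two-good S = go (to-affine S)
    where
    go : Reduces S (RowAffine ∘ Instance.φ) → Good S
    go (S₁ , R , g₁) = go' (normalise S₁ R)
      where
      go' : Reduces S₁ (NormalForm ∘ Instance.φ) → Good S
      go' (S₂ , nf , g₂) = g₁ (g₂ (finish (normal⇒form nf)))
        where
        finish : (∃ λ f → ∃ λ D → ∃ λ c → Form (Instance.φ S₂) f D c) → Good S₂
        finish (f , D , c , form) = by (parity f) refl
          where
          by : ∀ b → parity f ≡ b → Good S₂
          by false e = let (S₃ , form₃ , _ , g) = adjust S₂ {f} {D} {c} f e form in
            g (scaled-good S₃ false (form-cong (Instance.φ S₃) (λ x → BoolP.xor-same (f x)) (λ _ → refl) (form-one {Instance.φ S₃} form₃)))
          by true e = let (S₃ , form₃ , _ , g) = adjust S₂ {f} {D} {c} h even form in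
            g (scaled-good S₃ true (form-cong (Instance.φ S₃) (λ x → collapse (f x) (point (true , true) x)) (λ _ → refl) (form-one {Instance.φ S₃} form₃)))
            where
            h : Plane → Bool
            h x = f x xor point (true , true) x
            even : parity h ≡ false
            even = trans (parity-xor f (point (true , true))) (cong₂ _xor_ e (point-odd (true , true)))
            collapse : ∀ a b → a xor (a xor b) ≡ b
            collapse a b = trans (sym (BoolP.xor-assoc a a b)) (cong (_xor b) (BoolP.xor-same a))

module Reduce where

  open import Defs
  open import Data.Nat as ℕ using (ℕ; zero; suc)
  open import Data.Nat.Primality
  open import Data.Fin using (Fin; zero; suc)
  open import Data.Bool using (Bool; true; false; _xor_)
  open import Data.List using (List; []; _∷_; cartesianProduct)
  open import Data.List.Relation.Unary.Any using (here; there)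
  open import Data.List.Membership.Propositional using (_∈_)
  open import Data.List.Membership.Propositional.Properties using (∈-cartesianProduct⁺)
  open import Data.Product hiding (map; swap)
  open import Data.Product.Properties using (≡-dec)
  open import Data.Sum using (_⊎_; inj₁; inj₂)
  open import Function using (_∘_; _↔_; Inverse; mk↔ₛ′)
  open import Relation.Nullary
  open import Relation.Nullary.Decidable using (_×-dec_; _⊎-dec_)
  open import Relation.Binary using (DecidableEquality)
  open import Relation.Binary.PropositionalEquality hiding (resp)
  open Perms
  open Space

  module Reachable {X : Set} (_≟_ : DecidableEquality X) (R : X → X → Set) (R? : ∀ x y → Dec (R x y))
                   (R-sym : ∀ {x y} → R x y → R y x) where

    -- Paths all of whose inner vertices are in the list.
    Path : List X → X → X → Set
    Path []       x y = x ≡ y ⊎ R x y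
    Path (v ∷ vs) x y = Path vs x y ⊎ Path vs x v × Path vs v y

    path? : ∀ vs x y → Dec (Path vs x y)
    path? []       x y = (x ≟ y) ⊎-dec R? x y
    path? (v ∷ vs) x y = path? vs x y ⊎-dec (path? vs x v ×-dec path? vs v y)

    path-refl : ∀ vs x → Path vs x x
    path-refl []       x = inj₁ refl
    path-refl (v ∷ vs) x = inj₁ (path-refl vs x)

    step : ∀ vs {x y} → R x y → Path vs x y
    step []       r = inj₂ r
    step (v ∷ vs) r = inj₁ (step vs r)

    path-sym : ∀ vs {x y} → Path vs x y → Path vs y x
    path-sym []       (inj₁ e)       = inj₁ (sym e)
    path-sym []       (inj₂ r)       = inj₂ (R-sym r)
    path-sym (v ∷ vs) (inj₁ p)       = inj₁ (path-sym vs p)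
    path-sym (v ∷ vs) (inj₂ (p , q)) = inj₂ (path-sym vs q , path-sym vs p)

    path-trans : ∀ vs {x u y} → u ∈ vs → Path vs x u → Path vs u y → Path vs x y
    path-trans (v ∷ vs) (here refl) p q = inj₂ (to-v p , from-v q)
      where
      to-v : ∀ {x} → Path (v ∷ vs) x v → Path vs x v
      to-v (inj₁ p)       = p
      to-v (inj₂ (p , _)) = p
      from-v : ∀ {y} → Path (v ∷ vs) v y → Path vs v y
      from-v (inj₁ p)       = p
      from-v (inj₂ (_ , p)) = p
    path-trans (v ∷ vs) (there u∈) (inj₁ p)       (inj₁ q)       = inj₁ (path-trans vs u∈ p q)
    path-trans (v ∷ vs) (there u∈) (inj₁ p)       (inj₂ (q , r)) = inj₂ (path-trans vs u∈ p q , r)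
    path-trans (v ∷ vs) (there u∈) (inj₂ (p , q)) (inj₁ r)       = inj₂ (p , path-trans vs u∈ q r)
    path-trans (v ∷ vs) (there u∈) (inj₂ (p , _)) (inj₂ (_ , q)) = inj₂ (p , q)

    invariant : ∀ {P : X → Set} → (∀ {x y} → R x y → P x → P y) → ∀ vs {x y} → Path vs x y → P x → P y
    invariant h []       (inj₁ refl)    = λ p → p
    invariant h []       (inj₂ r)       = h r
    invariant h (v ∷ vs) (inj₁ p)       = invariant h vs p
    invariant h (v ∷ vs) (inj₂ (p , q)) = invariant h vs q ∘ invariant h vs p

  toBool : Fin 2 → Bool
  toBool zero       = false
  toBool (suc zero) = true

  fromBool : Bool → Fin 2
  fromBool false = zero
  fromBool true  = suc zero

  to-fromBool : ∀ b → toBool (fromBool b) ≡ b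
  to-fromBool false = refl
  to-fromBool true  = refl

  from-toBool : ∀ a → fromBool (toBool a) ≡ a
  from-toBool zero       = refl
  from-toBool (suc zero) = refl

  fromBool-xor : ∀ a b → fromBool (a xor b) ≡ fromBool a +ₙ fromBool b
  fromBool-xor false false = refl
  fromBool-xor false true  = refl
  fromBool-xor true  false = refl
  fromBool-xor true  true  = refl

  xor-toBool : ∀ a b → toBool (a +ₙ b) ≡ toBool a xor toBool b
  xor-toBool zero       zero       = refl
  xor-toBool zero       (suc zero) = refl
  xor-toBool (suc zero) zero       = refl
  xor-toBool (suc zero) (suc zero) = refl

  module Reduction (n : ℕ) (pr : Prime (suc n)) where
    open Space.Space n pr

    Triple : Set
    Triple = V × V × V

    triple-≡ : ∀ {x y z x' y' z' : V} → x ≡ x' → y ≡ y' → z ≡ z' → (x , y , z) ≡ (x' , y' , z')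
    triple-≡ refl refl refl = refl

    _≟ᵀ_ : DecidableEquality Triple
    _≟ᵀ_ = ≡-dec _≟ⱽ_ (≡-dec _≟ⱽ_ _≟ⱽ_)

    abstract
      triples : List Triple
      triples = cartesianProduct allⱽ (cartesianProduct allⱽ allⱽ)

      ∈triples : ∀ t → t ∈ triples
      ∈triples (x , y , z) = ∈-cartesianProduct⁺ (∈allⱽ x) (∈-cartesianProduct⁺ (∈allⱽ y) (∈allⱽ z))

    module FinT = Finite _≟ᵀ_ triples ∈triples

    module Generated (φ : Perm V) where

      Step : Triple → Triple → Set
      Step t s = ∃ λ g → act (to (shift g)) t ≡ s ⊎ act (to (φ ⁻¹ ∙ shift g ∙ φ)) t ≡ s

      step? : ∀ t s → Dec (Step t s)
      step? t s = FinV.∃? λ g → (act (to (shift g)) t ≟ᵀ s) ⊎-dec (act (to (φ ⁻¹ ∙ shift g ∙ φ)) t ≟ᵀ s)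

      step-sym : ∀ {t s} → Step t s → Step s t
      step-sym {x , y , z} ((b , s) , inj₁ refl) = (b , - s) , inj₁ (triple-≡ (from-to (shift (b , s)) x) (from-to (shift (b , s)) y) (from-to (shift (b , s)) z))
      step-sym {x , y , z} ((b , s) , inj₂ refl) = (b , - s) , inj₂ (triple-≡ (from-to k x) (from-to k y) (from-to k z))
        where k = φ ⁻¹ ∙ shift (b , s) ∙ φ

      open Reachable _≟ᵀ_ Step step? step-sym

      infix 4 _~_
      _~_ : Triple → Triple → Set
      _~_ = Path triples

      ~-trans : ∀ {t s r} → t ~ s → s ~ r → t ~ r
      ~-trans = path-trans triples (∈triples _)

      generated : Group V
      generated = record
        { mem  = λ f → ∀ t → t ~ act (to f) t
        ; mem? = λ f → FinT.∀? λ t → path? triples t _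
        ; resp = λ e m (x , y , z) → subst (λ s → (x , y , z) ~ s) (triple-≡ (at e x) (at e y) (at e z)) (m (x , y , z))
        ; id∈  = path-refl triples
        ; ∙∈   = λ {f} {g} m l t → ~-trans (l t) (m (act (to g) t))
        ; ⁻¹∈  = λ {f} m (x , y , z) → path-sym triples (subst (λ s → act (from f) (x , y , z) ~ s)
                   (triple-≡ (to-from f x) (to-from f y) (to-from f z)) (m (act (from f) (x , y , z)))) }

      generated-closed : Closed₃ generated
      generated-closed f c (x , y , z) = let (k , m , ex , ey , ez) = c x y z in
        subst (λ s → (x , y , z) ~ s) (triple-≡ ex ey ez) (m (x , y , z))

      generatedInstance : Instance
      generatedInstance = inst generated φ generated-closed
        (λ g t → step triples (g , inj₁ refl)) (λ g t → step triples (g , inj₂ refl))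

      ~-invariant : ∀ {P : Triple → Set} → (∀ {t s} → Step t s → P t → P s) → ∀ {t s} → t ~ s → P t → P s
      ~-invariant h = invariant h triples

      ~-sym : ∀ {t s} → t ~ s → s ~ t
      ~-sym = path-sym triples

    -- A permutation normalising the translations is an automorphism up to a translation.
    good⇒aut : ∀ S → let open Instance S in Good S → ∃ λ α → (∀ v w → to α (v ⊞ w) ≡ to α v ⊞ to α w) × mem (φ ⁻¹ ∙ α)
    good⇒aut S (α , h , m) = shift (b , - s) ∙ α , additive ,
        resp (pt λ x → cong (from φ ∘ to (shift (b , - s))) (to-from φ (to α x))) (∙∈ (sh'∈ (b , - s)) m)
      where
      open Instance S
      0ⱽ : V
      0ⱽ = 0ᴮ , 0#
      b = proj₁ (to α 0ⱽ)
      s = proj₂ (to α 0ⱽ)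
      ⊞-0 : ∀ v → v ⊞ 0ⱽ ≡ v
      ⊞-0 (x , y) = cong₂ _,_ (⊕-identityʳ x) (+-identityʳ y)
      push-at : ∀ v w → to α (v ⊞ w) ≡ proj₁ (push h v) ⊞ to α w
      push-at v w = at (proj₂ (push h v)) w
      rearrange : ∀ u w → (b , - s) ⊞ (u ⊞ w) ≡ ((b , - s) ⊞ (u ⊞ (b , s))) ⊞ ((b , - s) ⊞ w)
      rearrange (x , y) (x' , y') = cong₂ _,_
        (trans (sym (⊕-assoc b x x')) (sym (trans (cong (_⊕ (b ⊕ x')) (trans (cong (b ⊕_) (⊕-comm x b)) (⊕-cancel b x)))
          (trans (sym (⊕-assoc x b x')) (cong (_⊕ x') (⊕-comm x b))))))
        (solve 3 (λ s y y' → :- s :+ (y :+ y') := (:- s :+ (y :+ s)) :+ (:- s :+ y')) refl s y y')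
      additive : ∀ v w → (b , - s) ⊞ to α (v ⊞ w) ≡ ((b , - s) ⊞ to α v) ⊞ ((b , - s) ⊞ to α w)
      additive v w = trans (cong ((b , - s) ⊞_) (push-at v w)) (trans (rearrange (proj₁ (push h v)) (to α w))
        (cong (λ t → ((b , - s) ⊞ t) ⊞ ((b , - s) ⊞ to α w)) (sym (trans (cong (to α) (sym (⊞-0 v))) (push-at v 0ⱽ)))))

    enc : G (suc n) → V
    enc (a , b , c , y) = (toBool a , toBool b , toBool c) , y

    dec : V → G (suc n)
    dec ((a , b , c) , y) = fromBool a , fromBool b , fromBool c , y

    enc-dec : ∀ v → enc (dec v) ≡ v
    enc-dec ((a , b , c) , y) = cong (_, y) (cong₂ _,_ (to-fromBool a) (cong₂ _,_ (to-fromBool b) (to-fromBool c)))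

    dec-enc : ∀ g → dec (enc g) ≡ g
    dec-enc (a , b , c , y) = cong₂ _,_ (from-toBool a) (cong₂ _,_ (from-toBool b) (cong (_, y) (from-toBool c)))

    dec-⊞ : ∀ v w → dec (v ⊞ w) ≡ dec v · dec w
    dec-⊞ ((a , b , c) , y) ((a' , b' , c') , y') = cong₂ _,_ (fromBool-xor a a') (cong₂ _,_ (fromBool-xor b b')
      (cong₂ _,_ (fromBool-xor c c') (+≡+ₙ y y')))

    enc-· : ∀ g h → enc (g · h) ≡ enc g ⊞ enc h
    enc-· g h = trans (cong enc (sym (trans (dec-⊞ (enc g) (enc h)) (cong₂ _·_ (dec-enc g) (dec-enc h))))) (enc-dec _)

    act-≡ : ∀ {W : Set} {f g : V → W} → (∀ x → f x ≡ g x) → ∀ (t : Triple) →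
            _≡_ {A = W × W × W} (f (proj₁ t) , f (proj₁ (proj₂ t)) , f (proj₂ (proj₂ t)))
                                (g (proj₁ t) , g (proj₁ (proj₂ t)) , g (proj₂ (proj₂ t)))
    act-≡ e (x , y , z) = cong₂ _,_ (e x) (cong₂ _,_ (e y) (e z))

    good⇒CI : (∀ S → Good S) → IsCI-ColorTernary (suc n)
    good⇒CI good c X Y CX CY = forward , λ (α , _ , iso) → α , iso
      where
      decT : Triple → G (suc n) × G (suc n) × G (suc n)
      decT (x , y , z) = dec x , dec y , dec z
      forward : Isomorphic X Y → Σ (G (suc n) ↔ G (suc n)) (λ α → IsGroupAut α × IsIso X Y α)
      forward (θ , iso) = build (good⇒aut generatedInstance (good generatedInstance))
        where
        φ : Perm V
        φ = perm (λ v → enc (Inverse.to θ (dec v))) (λ v → enc (Inverse.from θ (dec v)))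
          (λ v → trans (cong (enc ∘ Inverse.to θ) (dec-enc _)) (trans (cong enc (Inverse.strictlyInverseˡ θ _)) (enc-dec v)))
          (λ v → trans (cong (enc ∘ Inverse.from θ) (dec-enc _)) (trans (cong enc (Inverse.strictlyInverseʳ θ _)) (enc-dec v)))
        open Generated φ
        EX EY : Fin c → Triple → Set
        EX i t = E X i (decT t)
        EY i t = E Y i (decT t)
        dec-φ : ∀ v → dec (to φ v) ≡ Inverse.to θ (dec v)
        dec-φ v = dec-enc _
        isoⱽ : ∀ i t → (EX i t → EY i (act (to φ) t)) × (EY i (act (to φ) t) → EX i t)
        isoⱽ i t = (λ e → subst (E Y i) (sym eq) (proj₁ (iso i (decT t)) e)) , λ e → proj₂ (iso i (decT t)) (subst (E Y i) eq e)
          where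
          eq : decT (act (to φ) t) ≡ act (Inverse.to θ) (decT t)
          eq = act-≡ {f = λ v → dec (to φ v)} {g = λ v → Inverse.to θ (dec v)} dec-φ t
        translate : ∀ (Z : ColorTernary (G (suc n)) c) → IsCayley Z → ∀ g i t →
                    E Z i (decT t) → E Z i (decT (act (to (shift g)) t))
        translate Z CZ (b , s) i t e = subst (E Z i) (sym (act-≡ {f = λ v → dec ((b , s) ⊞ v)} {g = λ v → dec (b , s) · dec v} (dec-⊞ (b , s)) t)) (proj₁ (CZ (dec (b , s)) i (decT t)) e)
        step-invariant : ∀ i {t s} → Step t s → EX i t → EX i s
        step-invariant i {t} (g , inj₁ refl) e = translate X CX g i t e
        step-invariant i {t} (g , inj₂ refl) e = proj₂ (isoⱽ i _) (subst (EY i)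
          (sym (act-≡ {f = λ v → to φ (from φ (to (shift g) (to φ v)))} {g = λ v → to (shift g) (to φ v)} (λ v → to-from φ _) t))
          (translate Y CY g i (act (to φ) t) (proj₁ (isoⱽ i t) e)))
        build : (∃ λ α → (∀ v w → to α (v ⊞ w) ≡ to α v ⊞ to α w) × Group.mem generated (φ ⁻¹ ∙ α)) →
                Σ (G (suc n) ↔ G (suc n)) (λ α → IsGroupAut α × IsIso X Y α)
        build (α , add , m) = αG , hom , isoα
          where
          αG : G (suc n) ↔ G (suc n)
          αG = mk↔ₛ′ (λ g → dec (to α (enc g))) (λ g → dec (from α (enc g)))
            (λ g → trans (cong (dec ∘ to α) (enc-dec _)) (trans (cong dec (to-from α _)) (dec-enc g)))
            (λ g → trans (cong (dec ∘ from α) (enc-dec _)) (trans (cong dec (from-to α _)) (dec-enc g)))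
          hom : IsGroupAut αG
          hom g h = trans (cong (dec ∘ to α) (enc-· g h)) (trans (cong dec (add (enc g) (enc h))) (dec-⊞ (to α (enc g)) (to α (enc h))))
          encT : G (suc n) × G (suc n) × G (suc n) → Triple
          encT (x , y , z) = enc x , enc y , enc z
          dec-encT : ∀ t → decT (encT t) ≡ t
          dec-encT (x , y , z) = cong₂ _,_ (dec-enc x) (cong₂ _,_ (dec-enc y) (dec-enc z))
          moved : ∀ t → act (to φ) (act (to (φ ⁻¹ ∙ α)) t) ≡ act (to α) t
          moved t = act-≡ {f = λ v → to φ (from φ (to α v))} {g = to α} (λ v → to-from φ _) t
          isoα : IsIso X Y αG
          isoα i t = (λ e → subst (EY i) (moved (encT t)) (proj₁ (isoⱽ i _)
              (~-invariant {EX i} (step-invariant i) (m (encT t)) (subst (E X i) (sym (dec-encT t)) e)))) ,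
            λ e → subst (E X i) (dec-encT t) (~-invariant {EX i} (step-invariant i) (~-sym (m (encT t)))
              (proj₂ (isoⱽ i _) (subst (EY i) (sym (moved (encT t))) e)))

module Counter where

  open import Defs
  open import Data.Nat as ℕ using (ℕ; zero; suc)
  open import Data.Fin using (Fin; zero; suc; toℕ)
  import Data.Fin.Properties as FinP
  open import Data.Nat.DivMod using (_%_)
  open import Data.Bool using (Bool; true; false; _xor_; _∧_; not)
  import Data.Bool.Properties as BoolP
  open import Data.Product hiding (map; swap)
  open import Data.Empty
  open import Function using (_↔_; Inverse; mk↔ₛ′)
  open import Relation.Nullary
  open import Relation.Nullary.Decidable using (_→-dec_; from-yes; ¬?)
  open import Relation.Binary.PropositionalEquality
  open Space using (B; _⊕_; 0ᴮ; e₁; _≟ᴮ_; module FinB)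
  open Fp using (module Mod)
  open Reduce using (toBool; fromBool; to-fromBool; from-toBool; xor-toBool)

  equal : B → B → Bool
  equal (a , b , c) (a' , b' , c') = not (a xor a') ∧ not (b xor b') ∧ not (c xor c')

  -- The relations of a triple depend on its rows and on the differences of its levels; tw l acts on the rows of level l.
  module Twist (m : ℕ) (one d : Fin (suc m)) (R R' Q : B → B → B → Bool) (tw tw⁻ : Fin (suc m) → B → B) (x₀ x₁ : B)
    (tw-tw⁻ : ∀ y x → tw y (tw⁻ y x) ≡ x) (tw⁻-tw : ∀ y x → tw⁻ y (tw y x) ≡ x)
    (R-tr : ∀ b x y z → R (b ⊕ x) (b ⊕ y) (b ⊕ z) ≡ R x y z)
    (R'-tr : ∀ b x y z → R' (b ⊕ x) (b ⊕ y) (b ⊕ z) ≡ R' x y z)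
    (Q-tr : ∀ b x y z → Q (b ⊕ x) (b ⊕ y) (b ⊕ z) ≡ Q x y z)
    (R-tw : ∀ l x y z → R' (tw l x) (tw (l +ₙ one) y) (tw (l +ₙ d) z) ≡ R x y z)
    (Q-tw : ∀ l x y z → Q (tw l x) (tw l y) (tw l z) ≡ Q x y z)
    (lev : ∀ (g y z e : Fin (suc m)) → (z ≡ y +ₙ e → g +ₙ z ≡ (g +ₙ y) +ₙ e) × (g +ₙ z ≡ (g +ₙ y) +ₙ e → z ≡ y +ₙ e))
    (lev0 : ∀ (y : Fin (suc m)) → y +ₙ zero ≡ y) (0+ : ∀ (y : Fin (suc m)) → zero +ₙ y ≡ y) (one≢0 : ∀ (y : Fin (suc m)) → y ≢ y +ₙ one)
    (x₀≢0 : x₀ ≢ 0ᴮ) (R-000 : R 0ᴮ 0ᴮ 0ᴮ ≡ true) (R-x : R x₁ x₀ 0ᴮ ≡ true) (Q-x : Q 0ᴮ x₀ x₁ ≡ true)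
    (clash : ∀ a a' b e → Q 0ᴮ a a' ≡ true → R' 0ᴮ b e ≡ true → R' a' (a ⊕ b) e ≡ true → a ≡ 0ᴮ)
    where

    P : Set
    P = G (suc m)

    base : P → B
    base (a , b , c , y) = toBool a , toBool b , toBool c

    level : P → Fin (suc m)
    level (a , b , c , y) = y

    mk : B → Fin (suc m) → P
    mk (a , b , c) y = fromBool a , fromBool b , fromBool c , y

    base-mk : ∀ x y → base (mk x y) ≡ x
    base-mk (a , b , c) y = cong₂ _,_ (to-fromBool a) (cong₂ _,_ (to-fromBool b) (to-fromBool c))

    mk-base : ∀ g → mk (base g) (level g) ≡ g
    mk-base (a , b , c , y) = cong₂ _,_ (from-toBool a) (cong₂ _,_ (from-toBool b) (cong (_, y) (from-toBool c)))

    base-· : ∀ g h → base (g · h) ≡ base g ⊕ base h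
    base-· (a , b , c , y) (a' , b' , c' , y') = cong₂ _,_ (xor-toBool a a') (cong₂ _,_ (xor-toBool b b') (xor-toBool c c'))

    structure : (B → B → B → Bool) → ColorTernary P 2
    structure S = record { E = Rel ; disjoint = disj }
      where
      Rel : Fin 2 → P × P × P → Set
      Rel zero       (g , h , k) = level h ≡ level g +ₙ one × level k ≡ level g +ₙ d × S (base g) (base h) (base k) ≡ true
      Rel (suc zero) (g , h , k) = level h ≡ level g +ₙ zero × level k ≡ level g +ₙ zero × Q (base g) (base h) (base k) ≡ true
      disj : ∀ i j t → Rel i t → Rel j t → i ≡ j
      disj zero       zero       t _ _ = refl
      disj (suc zero) (suc zero) t _ _ = refl
      disj zero       (suc zero) (g , h , k) (e , _) (e' , _) = ⊥-elim (one≢0 (level g) (trans (sym (trans e' (lev0 _))) e))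
      disj (suc zero) zero       (g , h , k) (e , _) (e' , _) = ⊥-elim (one≢0 (level g) (trans (sym (trans e (lev0 _))) e'))

    cayley : ∀ S → (∀ b x y z → S (b ⊕ x) (b ⊕ y) (b ⊕ z) ≡ S x y z) → IsCayley (structure S)
    cayley S S-tr u i (g , h , k) = go i
      where
      b = base u
      three : ∀ S → (∀ b x y z → S (b ⊕ x) (b ⊕ y) (b ⊕ z) ≡ S x y z) →
              S (base (u · g)) (base (u · h)) (base (u · k)) ≡ S (base g) (base h) (base k)
      three S tr = trans (cong₂ (λ x (y , z) → S x y z) (base-· u g) (cong₂ _,_ (base-· u h) (base-· u k))) (tr b _ _ _)
      go : ∀ i → (E (structure S) i (g , h , k) → E (structure S) i (u · g , u · h , u · k)) ×
                 (E (structure S) i (u · g , u · h , u · k) → E (structure S) i (g , h , k))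
      go zero = (λ (p , q , r) → proj₁ (lev (level u) _ _ _) p , proj₁ (lev (level u) _ _ _) q , trans (three S S-tr) r) ,
                (λ (p , q , r) → proj₂ (lev (level u) _ _ _) p , proj₂ (lev (level u) _ _ _) q , trans (sym (three S S-tr)) r)
      go (suc zero) = (λ (p , q , r) → proj₁ (lev (level u) _ _ _) p , proj₁ (lev (level u) _ _ _) q , trans (three Q Q-tr) r) ,
                (λ (p , q , r) → proj₂ (lev (level u) _ _ _) p , proj₂ (lev (level u) _ _ _) q , trans (sym (three Q Q-tr)) r)

    twist : P ↔ P
    twist = mk↔ₛ′ (λ g → mk (tw (level g) (base g)) (level g)) (λ g → mk (tw⁻ (level g) (base g)) (level g))
      (λ g → trans (cong (λ t → mk (tw (level g) t) (level g)) (base-mk _ (level g))) (trans (cong (λ t → mk t (level g)) (tw-tw⁻ (level g) (base g))) (mk-base g)))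
      (λ g → trans (cong (λ t → mk (tw⁻ (level g) t) (level g)) (base-mk _ (level g))) (trans (cong (λ t → mk t (level g)) (tw⁻-tw (level g) (base g))) (mk-base g)))

    twist-iso : IsIso (structure R) (structure R') twist
    twist-iso zero (g , h , k) = (λ (p , q , r) → p , q , trans (same p q) r) , (λ (p , q , r) → p , q , trans (sym (same p q)) r)
      where
      same : level h ≡ level g +ₙ one → level k ≡ level g +ₙ d →
             R' (base (Inverse.to twist g)) (base (Inverse.to twist h)) (base (Inverse.to twist k)) ≡ R (base g) (base h) (base k)
      same p q = trans (cong₂ (λ x (y , z) → R' x y z) (base-mk _ (level g)) (cong₂ _,_
          (trans (base-mk _ (level h)) (cong (λ l → tw l (base h)) p)) (trans (base-mk _ (level k)) (cong (λ l → tw l (base k)) q))))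
        (R-tw (level g) (base g) (base h) (base k))
    twist-iso (suc zero) (g , h , k) = (λ (p , q , r) → p , q , trans (same p q) r) , (λ (p , q , r) → p , q , trans (sym (same p q)) r)
      where
      same : level h ≡ level g +ₙ zero → level k ≡ level g +ₙ zero →
             Q (base (Inverse.to twist g)) (base (Inverse.to twist h)) (base (Inverse.to twist k)) ≡ Q (base g) (base h) (base k)
      same p q = trans (cong₂ (λ x (y , z) → Q x y z) (base-mk _ (level g)) (cong₂ _,_
          (trans (base-mk _ (level h)) (cong (λ l → tw l (base h)) (trans p (lev0 _))))
          (trans (base-mk _ (level k)) (cong (λ l → tw l (base k)) (trans q (lev0 _))))))
        (Q-tw (level g) (base g) (base h) (base k))

    no-automorphism : ∀ (α : P ↔ P) → IsGroupAut α → ¬ IsIso (structure R) (structure R') α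
    no-automorphism α hom iso = x₀≢0 (trans (sym (base-mk x₀ zero)) (trans (cong base same) (base-mk 0ᴮ zero)))
      where
      f : P → P
      f = Inverse.to α
      o : P
      o = mk 0ᴮ zero
      o· : ∀ g → o · g ≡ g
      o· g = trans (sym (mk-base (o · g))) (trans (cong₂ mk (trans (base-· o g) (cong (_⊕ base g) (base-mk 0ᴮ zero))) (0+ (level g))) (mk-base g))
      base-fo : base (f o) ≡ 0ᴮ
      base-fo = idem (base (f o)) (trans (sym (base-· (f o) (f o))) (cong base (trans (sym (hom o o)) (cong f (o· o)))))
        where
        idem : ∀ x → x ⊕ x ≡ x → x ≡ 0ᴮ
        idem (a , b , c) e = trans (sym e) (cong₂ _,_ (BoolP.xor-same a) (cong₂ _,_ (BoolP.xor-same b) (BoolP.xor-same c)))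
      split : mk x₀ zero · mk 0ᴮ one ≡ mk x₀ one
      split = trans (sym (mk-base (mk x₀ zero · mk 0ᴮ one))) (cong₂ mk
        (trans (base-· (mk x₀ zero) (mk 0ᴮ one)) (trans (cong₂ _⊕_ (base-mk x₀ zero) (base-mk 0ᴮ one)) (⊕-0 x₀))) (0+ one))
        where
        ⊕-0 : ∀ x → x ⊕ 0ᴮ ≡ x
        ⊕-0 (a , b , c) = cong₂ _,_ (BoolP.xor-identityʳ a) (cong₂ _,_ (BoolP.xor-identityʳ b) (BoolP.xor-identityʳ c))
      through : ∀ S x y z l l' l″ → S x y z ≡ true → S (base (mk x l)) (base (mk y l')) (base (mk z l″)) ≡ true
      through S x y z l l' l″ e = trans (cong₂ (λ x (y , z) → S x y z) (base-mk x l) (cong₂ _,_ (base-mk y l') (base-mk z l″))) e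
      colour₁ = proj₁ (iso (suc zero) (o , mk x₀ zero , mk x₁ zero)) (sym (lev0 zero) , sym (lev0 zero) , through Q 0ᴮ x₀ x₁ zero zero zero Q-x)
      colour₀ = proj₁ (iso zero (o , mk 0ᴮ one , mk 0ᴮ d)) (sym (0+ one) , sym (0+ d) , through R 0ᴮ 0ᴮ 0ᴮ zero one d R-000)
      colour₀' = proj₁ (iso zero (mk x₁ zero , mk x₀ one , mk 0ᴮ d)) (sym (0+ one) , sym (0+ d) , through R x₁ x₀ 0ᴮ zero one d R-x)
      a≡0 : base (f (mk x₀ zero)) ≡ 0ᴮ
      a≡0 = clash (base (f (mk x₀ zero))) (base (f (mk x₁ zero))) (base (f (mk 0ᴮ one))) (base (f (mk 0ᴮ d)))
        (trans (cong (λ t → Q t (base (f (mk x₀ zero))) (base (f (mk x₁ zero)))) (sym base-fo)) (proj₂ (proj₂ colour₁)))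
        (trans (cong (λ t → R' t (base (f (mk 0ᴮ one))) (base (f (mk 0ᴮ d)))) (sym base-fo)) (proj₂ (proj₂ colour₀)))
        (trans (cong (λ t → R' (base (f (mk x₁ zero))) t (base (f (mk 0ᴮ d))))
          (sym (trans (cong base (trans (cong f (sym split)) (hom (mk x₀ zero) (mk 0ᴮ one)))) (base-· (f (mk x₀ zero)) (f (mk 0ᴮ one)))))) (proj₂ (proj₂ colour₀')))
      same : mk x₀ zero ≡ o
      same = trans (sym (Inverse.strictlyInverseʳ α (mk x₀ zero))) (trans (cong (Inverse.from α)
          (trans (sym (mk-base (f (mk x₀ zero)))) (trans (cong₂ mk (trans a≡0 (sym base-fo)) (trans (proj₁ colour₁) (lev0 (level (f o))))) (mk-base (f o)))))
        (Inverse.strictlyInverseʳ α o))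

    not-CI : ¬ IsCI-ColorTernary (suc m)
    not-CI ci = let (α , hom , iso) = proj₁ (ci 2 (structure R) (structure R') (cayley R R-tr) (cayley R' R'-tr)) (twist , twist-iso)
                in no-automorphism α hom iso

  -- Multiplication by ζ on F₈ = F₂[ζ]/(ζ³ + ζ + 1).
  ζ₈ : B → B
  ζ₈ (a , b , c) = c , a xor c , b

  -- Multiplication by ω on F₄ = F₂[ω]/(ω² + ω + 1), with an idle third coordinate.
  ζ₄ : B → B
  ζ₄ (a , b , c) = b , a xor b , c

  power : (B → B) → ℕ → B → B
  power f zero    x = x
  power f (suc k) x = f (power f k x)

  ∀Fin? : ∀ {n} {P : Fin n → Set} → (∀ i → Dec (P i)) → Dec (∀ i → P i)
  ∀Fin? = FinP.all?

  ∀ᴮ⁴? : (S S' : B → B → B → B → Bool) → Dec (∀ b x y z → S b x y z ≡ S' b x y z)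
  ∀ᴮ⁴? S S' = FinB.∀? λ b → FinB.∀? λ x → FinB.∀? λ y → FinB.∀? λ z → S b x y z BoolP.≟ S' b x y z

  Levels : ∀ m → Set
  Levels m = ∀ (g y z e : Fin (suc m)) → (z ≡ y +ₙ e → g +ₙ z ≡ (g +ₙ y) +ₙ e) × (g +ₙ z ≡ (g +ₙ y) +ₙ e → z ≡ y +ₙ e)

  levels : ∀ m → Levels m
  levels m g y z e =
    (λ eq → trans (sym (+≡+ₙ g z)) (trans (cong (g +_) (trans eq (sym (+≡+ₙ y e)))) (trans (sym (+-assoc g y e)) (both g y e)))) ,
    (λ eq → trans (cancel g z) (trans (cong (- g +_) (trans (+≡+ₙ g z) (trans eq (trans (sym (both g y e)) (+-assoc g y e)))))
      (trans (sym (cancel g (y + e))) (+≡+ₙ y e))))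
    where
    open Mod m
    both : ∀ g y e → (g + y) + e ≡ (g +ₙ y) +ₙ e
    both g y e = trans (+≡+ₙ (g + y) e) (cong (_+ₙ e) (+≡+ₙ g y))
    cancel : ∀ g z → z ≡ - g + (g + z)
    cancel = solve 2 (λ g z → z := :- g :+ (g :+ z)) refl

  module Seven where
    ζ : B → B
    ζ = ζ₈
    R R' Q : B → B → B → Bool
    R  x y z = equal (x ⊕ (ζ y ⊕ power ζ 3 z)) 0ᴮ
    R' x y z = equal (x ⊕ (power ζ 2 y ⊕ power ζ 6 z)) 0ᴮ
    Q  x y z = equal (x ⊕ z) (ζ (x ⊕ y))
    tw tw⁻ : Fin 7 → B → B
    tw⁻ y = power ζ (toℕ y)
    tw  y = power ζ ((6 ℕ.* toℕ y) % 7)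

    abstract
      not-CI-7 : ¬ IsCI-ColorTernary 7
      not-CI-7 = Twist.not-CI 6 (suc zero) (suc (suc (suc zero))) R R' Q tw tw⁻ e₁ (ζ₈ e₁)
          (from-yes (∀Fin? λ (y : Fin 7) → FinB.∀? λ x → tw y (tw⁻ y x) ≟ᴮ x))
          (from-yes (∀Fin? λ (y : Fin 7) → FinB.∀? λ x → tw⁻ y (tw y x) ≟ᴮ x))
          (from-yes (∀ᴮ⁴? (λ b x y z → R (b ⊕ x) (b ⊕ y) (b ⊕ z)) (λ _ → R)))
          (from-yes (∀ᴮ⁴? (λ b x y z → R' (b ⊕ x) (b ⊕ y) (b ⊕ z)) (λ _ → R')))
          (from-yes (∀ᴮ⁴? (λ b x y z → Q (b ⊕ x) (b ⊕ y) (b ⊕ z)) (λ _ → Q)))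
          (from-yes (∀Fin? λ (l : Fin 7) → FinB.∀? λ x → FinB.∀? λ y → FinB.∀? λ z →
            R' (tw l x) (tw (l +ₙ suc zero) y) (tw (l +ₙ suc (suc (suc zero))) z) BoolP.≟ R x y z))
          (from-yes (∀Fin? λ (l : Fin 7) → FinB.∀? λ x → FinB.∀? λ y → FinB.∀? λ z → Q (tw l x) (tw l y) (tw l z) BoolP.≟ Q x y z))
          (levels 6) (from-yes (∀Fin? λ (y : Fin 7) → (y +ₙ zero) FinP.≟ y)) (from-yes (∀Fin? λ (y : Fin 7) → (zero +ₙ y) FinP.≟ y))
          (from-yes (∀Fin? λ (y : Fin 7) → ¬? (y FinP.≟ (y +ₙ suc zero)))) (λ ()) refl refl refl
          (from-yes (FinB.∀? λ a → FinB.∀? λ a' → FinB.∀? λ b → FinB.∀? λ e →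
            Q 0ᴮ a a' BoolP.≟ true →-dec R' 0ᴮ b e BoolP.≟ true →-dec R' a' (a ⊕ b) e BoolP.≟ true →-dec a ≟ᴮ 0ᴮ))

  module Three where
    ζ : B → B
    ζ = ζ₄
    idle : B → B → B → Bool
    idle (_ , _ , c) (_ , _ , c') (_ , _ , c″) = not (c xor c') ∧ not (c xor c″)
    flat : B → B
    flat (a , b , _) = a , b , false
    R R' Q : B → B → B → Bool
    R  x y z = idle x y z ∧ equal (flat (x ⊕ (ζ y ⊕ power ζ 2 z))) 0ᴮ
    R' x y z = idle x y z ∧ equal (flat (x ⊕ (power ζ 2 y ⊕ ζ z))) 0ᴮ
    Q  x y z = idle x y z ∧ equal (x ⊕ z) (ζ (x ⊕ y))
    tw tw⁻ : Fin 3 → B → B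
    tw⁻ y = power ζ (toℕ y)
    tw  y = power ζ ((2 ℕ.* toℕ y) % 3)

    abstract
      not-CI-3 : ¬ IsCI-ColorTernary 3
      not-CI-3 = Twist.not-CI 2 (suc zero) (suc (suc zero)) R R' Q tw tw⁻ e₁ (ζ₄ e₁)
          (from-yes (∀Fin? λ (y : Fin 3) → FinB.∀? λ x → tw y (tw⁻ y x) ≟ᴮ x))
          (from-yes (∀Fin? λ (y : Fin 3) → FinB.∀? λ x → tw⁻ y (tw y x) ≟ᴮ x))
          (from-yes (∀ᴮ⁴? (λ b x y z → R (b ⊕ x) (b ⊕ y) (b ⊕ z)) (λ _ → R)))
          (from-yes (∀ᴮ⁴? (λ b x y z → R' (b ⊕ x) (b ⊕ y) (b ⊕ z)) (λ _ → R')))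
          (from-yes (∀ᴮ⁴? (λ b x y z → Q (b ⊕ x) (b ⊕ y) (b ⊕ z)) (λ _ → Q)))
          (from-yes (∀Fin? λ (l : Fin 3) → FinB.∀? λ x → FinB.∀? λ y → FinB.∀? λ z →
            R' (tw l x) (tw (l +ₙ suc zero) y) (tw (l +ₙ suc (suc zero)) z) BoolP.≟ R x y z))
          (from-yes (∀Fin? λ (l : Fin 3) → FinB.∀? λ x → FinB.∀? λ y → FinB.∀? λ z → Q (tw l x) (tw l y) (tw l z) BoolP.≟ Q x y z))
          (levels 2) (from-yes (∀Fin? λ (y : Fin 3) → (y +ₙ zero) FinP.≟ y)) (from-yes (∀Fin? λ (y : Fin 3) → (zero +ₙ y) FinP.≟ y))
          (from-yes (∀Fin? λ (y : Fin 3) → ¬? (y FinP.≟ (y +ₙ suc zero)))) (λ ()) refl refl refl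
          (from-yes (FinB.∀? λ a → FinB.∀? λ a' → FinB.∀? λ b → FinB.∀? λ e →
            Q 0ᴮ a a' BoolP.≟ true →-dec R' 0ᴮ b e BoolP.≟ true →-dec R' a' (a ⊕ b) e BoolP.≟ true →-dec a ≟ᴮ 0ᴮ))

module Transitive where

  open import Data.Product hiding (swap)
  open import Data.Sum using (_⊎_; inj₁; inj₂; [_,_]′)
  open import Data.Empty
  open import Function using (_∘_)
  open import Relation.Nullary
  open import Relation.Nullary.Decidable using (_×-dec_; _⊎-dec_)
  open import Relation.Binary using (DecidableEquality)
  open import Relation.Binary.PropositionalEquality hiding (resp)
  open Perms

  swap-fun : ∀ {V : Set} → DecidableEquality V → V → V → V → V
  swap-fun _≟_ a b x with x ≟ a | x ≟ b
  ... | yes _ | _     = b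
  ... | no _  | yes _ = a
  ... | no _  | no _  = x

  module Swap {V : Set} (_≟_ : DecidableEquality V) where

    private sw = swap-fun _≟_

    sw-a : ∀ a b → sw a b a ≡ b
    sw-a a b with a ≟ a | a ≟ b
    ... | yes _ | _ = refl
    ... | no ne | _ = ⊥-elim (ne refl)

    sw-b : ∀ a b → sw a b b ≡ a
    sw-b a b with b ≟ a | b ≟ b
    ... | yes e | _     = e
    ... | no _  | yes _ = refl
    ... | no _  | no ne = ⊥-elim (ne refl)

    sw-other : ∀ {a b x} → x ≢ a → x ≢ b → sw a b x ≡ x
    sw-other {a} {b} {x} na nb with x ≟ a | x ≟ b
    ... | yes e | _     = ⊥-elim (na e)
    ... | no _  | yes e = ⊥-elim (nb e)
    ... | no _  | no _  = refl

    abstract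
      sw-invol : ∀ a b x → sw a b (sw a b x) ≡ x
      sw-invol a b x = go (x ≟ a) (x ≟ b)
        where
        go : Dec (x ≡ a) → Dec (x ≡ b) → sw a b (sw a b x) ≡ x
        go (yes refl) _          = trans (cong (sw a b) (sw-a a b)) (sw-b a b)
        go (no _)     (yes refl) = trans (cong (sw a b) (sw-b a b)) (sw-a a b)
        go (no na)    (no nb)    = trans (cong (sw a b) (sw-other na nb)) (sw-other na nb)

    swap : V → V → Perm V
    swap a b = perm (sw a b) (sw a b) (sw-invol a b) (sw-invol a b)

    moving₂ : ∀ {a b c d} → a ≢ b → c ≢ d → ∃ λ ρ → to ρ a ≡ c × to ρ b ≡ d
    moving₂ {a} {b} {c} {d} ab cd = swap b' d ∙ swap a c ,
        trans (cong (sw b' d) (sw-a a c)) (sw-other c≢b' cd) , sw-a b' d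
      where
      b' = sw a c b
      c≢b' : c ≢ b'
      c≢b' e = ab (to-inj (swap a c) (trans (sw-a a c) e))

  module Transitivity {V : Set} (_≟_ : DecidableEquality V) (A : Group V) where
    open Group A

    record TransOff (W : V → Set) : Set where
      constructor transOff
      field
        W?   : ∀ v → Dec (W v)
        move : ∀ u v → ¬ W u → ¬ W v → ∃ λ k → mem k × (∀ w → W w → to k w ≡ w) × to k u ≡ v

    image : ∀ {W} h → mem h → TransOff W → TransOff (W ∘ from h)
    image h h∈ (transOff W? move) = transOff (W? ∘ from h) λ u v nu nv →
      let (k , k∈ , fix , e) = move (from h u) (from h v) nu nv in
      h ∙ k ∙ h ⁻¹ , ∙∈ h∈ (∙∈ k∈ (⁻¹∈ h∈)) ,
      (λ w Ww → trans (cong (to h) (fix _ Ww)) (to-from h w)) , trans (cong (to h) e) (to-from h v)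

    respects : ∀ {W W'} → (∀ v → W v → W' v) → (∀ v → W' v → W v) → TransOff W → TransOff W'
    respects f g (transOff W? move) = transOff (λ v → dec v (W? v))
        λ u v nu nv → let (k , k∈ , fix , e) = move u v (nu ∘ f u) (nv ∘ f v) in k , k∈ , (λ w → fix w ∘ g w) , e
      where
      dec : ∀ v → Dec _ → Dec _
      dec v (yes p) = yes (f v p)
      dec v (no n)  = no (n ∘ g v)

    inter : ∀ {W W'} o → ¬ W o → ¬ W' o → TransOff W → TransOff W' → TransOff (λ v → W v × W' v)
    inter {W} {W'} o no₁ no₂ (transOff W? move) (transOff W'? move') = transOff (λ v → W? v ×-dec W'? v)
        λ u v nu nv →
          let (k , k∈ , fix , e) = to-o u nu ; (l , l∈ , fix' , e') = to-o v nv in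
          l ⁻¹ ∙ k , ∙∈ (⁻¹∈ l∈) k∈ ,
          (λ w Ww → trans (cong (from l) (fix w Ww)) (from-≡ l (fix' w Ww))) ,
          trans (cong (from l) e) (from-≡ l e')
      where
      to-o : ∀ u → ¬ (W u × W' u) → ∃ λ k → mem k × (∀ w → W w × W' w → to k w ≡ w) × to k u ≡ o
      to-o u nu = go (W? u)
        where
        go : Dec (W u) → ∃ λ k → mem k × (∀ w → W w × W' w → to k w ≡ w) × to k u ≡ o
        go (no ¬w) = let (k , k∈ , fix , e) = move u o ¬w no₁ in k , k∈ , (λ w p → fix w (proj₁ p)) , e
        go (yes w) = let (k , k∈ , fix , e) = move' u o (λ w' → nu (w , w')) no₂ in k , k∈ , (λ w p → fix w (proj₂ p)) , e

    module _ (cl₃ : Closed₃ A) (transitive : ∀ u v → ∃ λ k → mem k × to k u ≡ v)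
             {p q} (p≢q : p ≢ q) (one : TransOff (_≡ p)) (two : TransOff (λ v → v ≡ p ⊎ v ≡ q)) where

      one-at : ∀ p' → TransOff (_≡ p')
      one-at p' = let (k , k∈ , e) = transitive p p' in
        respects (λ v d → trans (sym (to-from k v)) (trans (cong (to k) d) e)) (λ v d → from-≡ k (trans e (sym d))) (image k k∈ one)

      two-at : ∀ {p' q'} → p' ≢ q' → TransOff (λ v → v ≡ p' ⊎ v ≡ q')
      two-at {p'} {q'} ne =
        let (k , k∈ , e) = transitive p p'
            (l , l∈ , fix , e') = TransOff.move (one-at p') (to k q) q' (λ d → p≢q (to-inj k (trans e (sym d)))) (ne ∘ sym)
            ep : to (l ∙ k) p ≡ p'
            ep = trans (cong (to l) e) (fix p' refl)
        in respects
          (λ { v (inj₁ d) → inj₁ (trans (sym (to-from (l ∙ k) v)) (trans (cong (to (l ∙ k)) d) ep))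
             ; v (inj₂ d) → inj₂ (trans (sym (to-from (l ∙ k) v)) (trans (cong (to (l ∙ k)) d) e')) })
          (λ { v (inj₁ d) → inj₁ (from-≡ (l ∙ k) (trans ep (sym d))) ; v (inj₂ d) → inj₂ (from-≡ (l ∙ k) (trans e' (sym d))) })
          (image (l ∙ k) (∙∈ l∈ k∈) two)

      all-perms : ∀ f → mem f
      all-perms f = cl₃ f triple
        where
        triple : ∀ x y z → ∃ λ k → mem k × to k x ≡ to f x × to k y ≡ to f y × to k z ≡ to f z
        triple x y z = let (k , k∈ , e) = transitive x (to f x) in second k k∈ e (y ≟ x)
          where
          third : ∀ k → mem k → to k x ≡ to f x → to k y ≡ to f y → y ≢ x → Dec (z ≡ x ⊎ z ≡ y) →
                  ∃ λ k → mem k × to k x ≡ to f x × to k y ≡ to f y × to k z ≡ to f z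
          third k k∈ ex ey ne (yes (inj₁ refl)) = k , k∈ , ex , ey , ex
          third k k∈ ex ey ne (yes (inj₂ refl)) = k , k∈ , ex , ey , ey
          third k k∈ ex ey ne (no nz) =
            let (l , l∈ , fix , e) = TransOff.move (two-at {to f x} {to f y} (ne ∘ sym ∘ to-inj f)) (to k z) (to f z)
                  [ (λ d → nz (inj₁ (to-inj k (trans d (sym ex))))) , (λ d → nz (inj₂ (to-inj k (trans d (sym ey))))) ]′
                  [ (λ d → nz (inj₁ (to-inj f d))) , (λ d → nz (inj₂ (to-inj f d))) ]′
            in l ∙ k , ∙∈ l∈ k∈ , trans (cong (to l) ex) (fix _ (inj₁ refl)) , trans (cong (to l) ey) (fix _ (inj₂ refl)) , e
          third' : ∀ k → mem k → to k x ≡ to f x → y ≡ x → Dec (z ≡ x) →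
                  ∃ λ k → mem k × to k x ≡ to f x × to k y ≡ to f y × to k z ≡ to f z
          third' k k∈ ex refl (yes refl) = k , k∈ , ex , ex , ex
          third' k k∈ ex refl (no nz) =
            let (l , l∈ , fix , e) = TransOff.move (one-at (to f x)) (to k z) (to f z)
                  (λ d → nz (to-inj k (trans d (sym ex)))) (nz ∘ to-inj f)
                ex' = trans (cong (to l) ex) (fix _ refl)
            in l ∙ k , ∙∈ l∈ k∈ , ex' , ex' , e
          second : ∀ k → mem k → to k x ≡ to f x → Dec (y ≡ x) →
                   ∃ λ k → mem k × to k x ≡ to f x × to k y ≡ to f y × to k z ≡ to f z
          second k k∈ ex (yes d) = third' k k∈ ex d (z ≟ x)
          second k k∈ ex (no ne) =
            let (l , l∈ , fix , e) = TransOff.move (one-at (to f x)) (to k y) (to f y)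
                  (λ d → ne (to-inj k (trans d (sym ex)))) (ne ∘ to-inj f)
            in third (l ∙ k) (∙∈ l∈ k∈) (trans (cong (to l) ex) (fix _ refl)) e ne ((z ≟ x) ⊎-dec (z ≟ y))

module Cycles where

  open import Data.Nat as ℕ using (ℕ; zero; suc; s≤s; z≤n)
  import Data.Nat.Properties as ℕP
  open import Data.Nat.DivMod using (_%_)
  open import Data.Nat.Primality
  open import Data.Bool using (Bool; true; false; if_then_else_; _xor_; _∧_)
  open import Data.List using (List; []; _∷_; length; filter; upTo)
  open import Data.List.Relation.Unary.All as All using (All; []; _∷_)
  open import Data.List.Relation.Unary.AllPairs as AllPairs using (AllPairs; []; _∷_)
  open import Data.List.Relation.Unary.Any as Any using (Any; here; there)
  open import Data.List.Membership.Propositional using (_∈_; find)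
  import Data.List.Relation.Unary.Unique.Propositional.Properties as UniqueP
  open import Data.List.Membership.DecPropositional as DecMem using ()
  open import Data.List.Membership.Propositional.Properties using (∈-filter⁻; ∈-filter⁺)
  open import Data.Product hiding (map)
  open import Data.Product.Properties using (≡-dec)
  open import Data.Sum using (_⊎_; inj₁; inj₂)
  open import Data.Empty
  open import Function using (_∘_)
  open import Relation.Nullary
  open import Relation.Nullary.Decidable using (_×-dec_; _→-dec_; _⊎-dec_; ¬?; from-yes; ⌊_⌋)
  open import Relation.Binary.PropositionalEquality hiding (resp)
  import Relation.Binary.PropositionalEquality.Properties as ≡P
  open Count
  open Perms
  open Space
  open Stage1 using (iter-conj)
  open Stage2

  _∈ᴮ?_ : ∀ x xs → Dec (x ∈ xs)
  _∈ᴮ?_ = DecMem._∈?_ _≟ᴮ_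

  b₃ b₅ b₆ b₇ : B
  b₃ = true , true , false
  b₅ = true , false , true
  b₆ = false , true , true
  b₇ = true , true , true

  Frame : B → B → B → Set
  Frame d₁ d₂ d₃ = d₁ ≢ 0ᴮ × d₂ ≢ 0ᴮ × d₁ ≢ d₂ × d₃ ≢ 0ᴮ × d₃ ≢ d₁ × d₃ ≢ d₂ × d₃ ≢ d₁ ⊕ d₂

  det₃ : B → B → B → Bool
  det₃ (a , b , c) (d , e , f) (g , h , i) =
    (a ∧ ((e ∧ i) xor (f ∧ h))) xor ((b ∧ ((d ∧ i) xor (f ∧ g))) xor (c ∧ ((d ∧ h) xor (e ∧ g))))

  -- Cramer's rule over the field with two elements, where an invertible determinant is 1.
  cramer : B → B → B → B → B
  cramer d₁ d₂ d₃ x = det₃ x d₂ d₃ , det₃ d₁ x d₃ , det₃ d₁ d₂ x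

  abstract
    frame-linear : ∀ d₁ d₂ d₃ → Frame d₁ d₂ d₃ → let m = d₁ , d₂ , d₃ in
      ((∀ x → lin m (cramer d₁ d₂ d₃ x) ≡ x) × (∀ x → cramer d₁ d₂ d₃ (lin m x) ≡ x) ×
       (∀ x y → lin m (x ⊕ y) ≡ lin m x ⊕ lin m y)) ×
      lin m 0ᴮ ≡ 0ᴮ × lin m e₁ ≡ d₁ × lin m e₂ ≡ d₂ × lin m e₃ ≡ d₃ × lin m b₃ ≡ d₁ ⊕ d₂
    frame-linear = from-yes (FinB.∀? λ d₁ → FinB.∀? λ d₂ → FinB.∀? λ d₃ →
      (¬? (d₁ ≟ᴮ 0ᴮ) ×-dec ¬? (d₂ ≟ᴮ 0ᴮ) ×-dec ¬? (d₁ ≟ᴮ d₂) ×-dec ¬? (d₃ ≟ᴮ 0ᴮ) ×-dec ¬? (d₃ ≟ᴮ d₁) ×-dec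
       ¬? (d₃ ≟ᴮ d₂) ×-dec ¬? (d₃ ≟ᴮ (d₁ ⊕ d₂))) →-dec let m = d₁ , d₂ , d₃ in
      (FinB.∀? (λ x → lin m (cramer d₁ d₂ d₃ x) ≟ᴮ x) ×-dec FinB.∀? (λ x → cramer d₁ d₂ d₃ (lin m x) ≟ᴮ x) ×-dec lin-⊕? m) ×-dec
      lin m 0ᴮ ≟ᴮ 0ᴮ ×-dec lin m e₁ ≟ᴮ d₁ ×-dec lin m e₂ ≟ᴮ d₂ ×-dec lin m e₃ ≟ᴮ d₃ ×-dec lin m b₃ ≟ᴮ (d₁ ⊕ d₂))

  Params : Set
  Params = B × B × B

  -- The five-cycle (b₃ e₃ p q r).
  table : Params → B → B
  table (p , q , r) x =
    if ⌊ x ≟ᴮ b₃ ⌋ then e₃ else if ⌊ x ≟ᴮ e₃ ⌋ then p else if ⌊ x ≟ᴮ p ⌋ then q else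
    if ⌊ x ≟ᴮ q ⌋ then r else if ⌊ x ≟ᴮ r ⌋ then b₃ else x

  graph : Params → List (B × B)
  graph (p , q , r) = (0ᴮ , 0ᴮ) ∷ (e₁ , e₁) ∷ (e₂ , e₂) ∷ (b₃ , e₃) ∷ (e₃ , p) ∷ (p , q) ∷ (q , r) ∷ (r , b₃) ∷ []

  Distinct : List B → Set
  Distinct = AllPairs _≢_

  distinct? : ∀ xs → Dec (Distinct xs)
  distinct? = AllPairs.allPairs? (λ x y → ¬? (x ≟ᴮ y))

  -- The words e ∘ table, with exponents N, that successively force a cocycle to vanish at r.
  Rules : Set
  Rules = List (B × B × ℕ)

  standard : List (Params × Rules)
  standard =
    ((b₅ , b₆ , b₇) , (e₃ , e₁ , 4) ∷ (b₆ , e₁ , 4) ∷ (b₅ , b₃ , 6) ∷ (b₇ , e₃ , 7) ∷ (b₃ , b₇ , 7) ∷ (e₂ , e₁ , 4) ∷ (0ᴮ , e₂ , 6) ∷ (e₁ , e₂ , 6) ∷ []) ∷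
    ((b₅ , b₇ , b₆) , (e₃ , e₁ , 4) ∷ (b₇ , e₁ , 4) ∷ (b₅ , e₂ , 6) ∷ (b₆ , b₅ , 7) ∷ (b₃ , b₇ , 7) ∷ (e₂ , e₁ , 4) ∷ (0ᴮ , e₂ , 6) ∷ (e₁ , e₂ , 6) ∷ []) ∷
    ((b₆ , b₅ , b₇) , (e₃ , e₂ , 4) ∷ (b₅ , e₂ , 4) ∷ (b₆ , b₃ , 6) ∷ (b₇ , e₃ , 7) ∷ (b₃ , b₇ , 7) ∷ (e₂ , e₁ , 6) ∷ (0ᴮ , e₂ , 4) ∷ (e₁ , e₂ , 4) ∷ []) ∷
    ((b₆ , b₇ , b₅) , (b₆ , e₁ , 6) ∷ (e₃ , e₂ , 4) ∷ (b₇ , e₂ , 4) ∷ (b₅ , b₆ , 7) ∷ (b₃ , b₇ , 7) ∷ (e₂ , e₁ , 6) ∷ (0ᴮ , e₂ , 4) ∷ (e₁ , e₂ , 4) ∷ []) ∷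
    ((b₇ , b₅ , b₆) , (b₇ , e₂ , 6) ∷ (e₃ , b₃ , 4) ∷ (b₅ , b₃ , 4) ∷ (b₆ , b₅ , 7) ∷ (b₃ , b₇ , 7) ∷ (e₂ , e₁ , 6) ∷ (0ᴮ , e₂ , 6) ∷ (e₁ , e₂ , 6) ∷ []) ∷
    ((b₇ , b₆ , b₅) , (b₇ , e₁ , 6) ∷ (e₃ , b₃ , 4) ∷ (b₆ , b₃ , 4) ∷ (b₅ , b₆ , 7) ∷ (b₃ , b₇ , 7) ∷ (e₂ , e₁ , 6) ∷ (0ᴮ , e₂ , 6) ∷ (e₁ , e₂ , 6) ∷ []) ∷ []

  word : (B → B) → B → B → B
  word s e x = e ⊕ s x

  hits : (B → B) → B → ℕ → ℕ
  hits g r zero    = 0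
  hits g r (suc j) = if ⌊ iter g j r ≟ᴮ r ⌋ then suc (hits g r j) else hits g r j

  Forces : (B → B) → List B → B → B → ℕ → Set
  Forces s K r e N = let g = word s e in
    (∀ x → iter g N x ≡ x) × All (λ j → iter g j r ∈ K ⊎ iter g j r ≡ r) (upTo N) × hits g r N % 5 ≢ 0

  Derivation : (B → B) → List B → Rules → Set
  Derivation s K []                 = ∀ x → x ∈ K
  Derivation s K ((r , e , N) ∷ rs) = Forces s K r e N × Derivation s (r ∷ K) rs

  derivation? : ∀ s K rs → Dec (Derivation s K rs)
  derivation? s K []                 = FinB.∀? (_∈ᴮ? K)
  derivation? s K ((r , e , N) ∷ rs) =
    (FinB.∀? (λ x → iter (word s e) N x ≟ᴮ x) ×-dec
     All.all? (λ j → (iter (word s e) j r ∈ᴮ? K) ⊎-dec (iter (word s e) j r ≟ᴮ r)) (upTo N) ×-dec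
     ¬? (hits (word s e) r N % 5 ℕ.≟ 0)) ×-dec derivation? s (r ∷ K) rs

  _≟ᴾ_ : (p q : Params) → Dec (p ≡ q)
  _≟ᴾ_ = ≡-dec _≟ᴮ_ (≡-dec _≟ᴮ_ _≟ᴮ_)

  abstract
    standard-params : ∀ p q r → Distinct (0ᴮ ∷ e₁ ∷ e₂ ∷ b₃ ∷ e₃ ∷ p ∷ q ∷ r ∷ []) → Any (λ (ps , _) → (p , q , r) ≡ ps) standard
    standard-params = from-yes (FinB.∀? λ p → FinB.∀? λ q → FinB.∀? λ r →
      distinct? (0ᴮ ∷ e₁ ∷ e₂ ∷ b₃ ∷ e₃ ∷ p ∷ q ∷ r ∷ []) →-dec Any.any? (λ (ps , _) → (p , q , r) ≟ᴾ ps) standard)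

    standard-graph : All (λ (ps , _) → ∀ x → Any (λ (x' , y) → x ≡ x' × table ps x ≡ y) (graph ps)) standard
    standard-graph = from-yes (All.all? (λ (ps , _) → FinB.∀? λ x →
      Any.any? (λ (x' , y) → (x ≟ᴮ x') ×-dec (table ps x ≟ᴮ y)) (graph ps)) standard)

    standard-derivation : All (λ (ps , rs) → Derivation (table ps) [] rs) standard
    standard-derivation = from-yes (All.all? (λ (ps , rs) → derivation? (table ps) [] rs) standard)

    standard-fixed : All (λ (ps , _) → ∀ x → table ps x ≡ x → x ≡ 0ᴮ ⊎ x ≡ e₁ ⊎ x ≡ e₂) standard
    standard-fixed = from-yes (All.all? (λ (ps , _) → FinB.∀? λ x →
      (table ps x ≟ᴮ x) →-dec ((x ≟ᴮ 0ᴮ) ⊎-dec (x ≟ᴮ e₁) ⊎-dec (x ≟ᴮ e₂))) standard)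

    allᴮ-distinct : Distinct allᴮ
    allᴮ-distinct = from-yes (distinct? allᴮ)

  -- Up to an affine map, every five-cycle fixes 0, e₁, e₂ and takes b₃ = e₁ + e₂ to e₃; six of them are left.
  record Standard (s : B → B) : Set where
    constructor mkStandard
    field
      {ps} : Params
      {rs} : Rules
      ps∈  : (ps , rs) ∈ standard
      s≗   : ∀ x → s x ≡ table ps x

  module FiveCycle (pr : Prime 5) where

    module Analysis (σ : Perm B) (per : ∀ x → iter (to σ) 5 x ≡ x) {x₀} (moved : to σ x₀ ≢ x₀) where
      open Counting (≡P.decSetoid _≟ᴮ_) using (module Cyclic; length-mono)
      open Cyclic pr (to σ) (cong (to σ)) per

      fixeds : List B
      fixeds = filter fixed? allᴮ

      ∈fixeds : ∀ {x} → to σ x ≡ x → x ∈ fixeds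
      ∈fixeds {x} e = ∈-filter⁺ fixed? (∈allᴮ x) e

      fixeds∈ : ∀ {x} → x ∈ fixeds → to σ x ≡ x
      fixeds∈ p = proj₂ (∈-filter⁻ fixed? {xs = allᴮ} p)

      fixeds-distinct : Distinct fixeds
      fixeds-distinct = UniqueP.filter⁺ fixed? allᴮ-distinct

      three : length fixeds ≡ 3
      three = go (count-mod allᴮ-distinct (λ {x} _ → ∈allᴮ (to σ x)))
        where
        fewer : length fixeds ℕ.< 8
        fewer = length-mono {xs = x₀ ∷ fixeds} (All.tabulate (λ {y} y∈ e → moved (trans (cong (to σ) e) (trans (fixeds∈ y∈) (sym e)))) ∷ fixeds-distinct)
                  {allᴮ} (λ {y} _ → ∈allᴮ y)
        go : (∃ λ k → 8 ≡ k ℕ.* 5 ℕ.+ length fixeds) → length fixeds ≡ 3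
        go (0 , e) = ⊥-elim (ℕP.<-irrefl (sym e) fewer)
        go (1 , e) = sym (ℕP.+-cancelˡ-≡ 5 _ _ e)
        go (suc (suc k) , e) = ⊥-elim (ℕP.<⇒≱ (s≤s (s≤s (s≤s (s≤s (s≤s (s≤s (s≤s (s≤s (s≤s z≤n)))))))))
          (ℕP.≤-trans (ℕP.m≤m+n 10 (k ℕ.* 5 ℕ.+ length fixeds)) (ℕP.≤-reflexive (sym e))))

      record FixedRows : Set where
        constructor fixedRows
        field
          {f₁ f₂ f₃} : B
          fixed₁ : to σ f₁ ≡ f₁
          fixed₂ : to σ f₂ ≡ f₂
          fixed₃ : to σ f₃ ≡ f₃
          f₁≢f₂  : f₁ ≢ f₂
          f₁≢f₃  : f₁ ≢ f₃
          f₂≢f₃  : f₂ ≢ f₃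
          only   : ∀ {x} → to σ x ≡ x → x ≡ f₁ ⊎ x ≡ f₂ ⊎ x ≡ f₃

      fixed-rows : FixedRows
      fixed-rows = go fixeds three fixeds-distinct fixeds∈ ∈fixeds
        where
        go : ∀ xs → length xs ≡ 3 → Distinct xs → (∀ {x} → x ∈ xs → to σ x ≡ x) → (∀ {x} → to σ x ≡ x → x ∈ xs) → FixedRows
        go (f₁ ∷ f₂ ∷ f₃ ∷ []) _ ((n₁ ∷ n₂ ∷ []) ∷ (n₃ ∷ []) ∷ _) fx mem = fixedRows (fx 0th) (fx 1st) (fx 2nd) n₁ n₂ n₃ (out ∘ mem)
          where
          out : ∀ {x} → x ∈ f₁ ∷ f₂ ∷ f₃ ∷ [] → x ≡ f₁ ⊎ x ≡ f₂ ⊎ x ≡ f₃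
          out (here e) = inj₁ e
          out (there (here e)) = inj₂ (inj₁ e)
          out (there (there (here e))) = inj₂ (inj₂ e)

      orbit-distinct : ∀ {x} → to σ x ≢ x → Distinct (orbit x)
      orbit-distinct = orbit-unique

    standardise : ∀ (s : Perm B) → (∀ x → iter (to s) 5 x ≡ x) → to s 0ᴮ ≡ 0ᴮ → to s e₁ ≡ e₁ → to s e₂ ≡ e₂ →
                  to s b₃ ≡ e₃ → Standard (to s)
    standardise s per s0 s1 s2 s3 = go found
      where
      moved : to s b₃ ≢ b₃
      moved e = b₃≢ (trans (sym s3) e)
        where
        b₃≢ : e₃ ≢ b₃
        b₃≢ ()
      p q r : B
      p = to s e₃
      q = to s p
      r = to s q
      sr : to s r ≡ b₃
      sr = trans (cong (to s ∘ to s ∘ to s ∘ to s) (sym s3)) (per b₃)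
      cycle : Distinct (b₃ ∷ e₃ ∷ p ∷ q ∷ r ∷ [])
      cycle = subst (λ t → Distinct (b₃ ∷ t ∷ to s t ∷ to s (to s t) ∷ to s (to s (to s t)) ∷ [])) s3
                (Analysis.orbit-distinct s per moved moved)
      not-fixed : ∀ {f} → to s f ≡ f → All (f ≢_) (b₃ ∷ e₃ ∷ p ∷ q ∷ r ∷ [])
      not-fixed {f} e = nb ∷ n3 ∷ np ∷ nq ∷ nr ∷ []
        where
        nr : f ≢ r
        nb : f ≢ b₃
        nb refl = moved e
        nr refl = nb (trans (sym e) sr)
        nq : f ≢ q
        nq refl = nr (sym e)
        np : f ≢ p
        np refl = nq (sym e)
        n3 : f ≢ e₃
        n3 refl = np (sym e)
      found : Any (λ (ps , _) → (p , q , r) ≡ ps) standard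
      found = standard-params p q r (((λ ()) ∷ (λ ()) ∷ not-fixed s0) ∷ ((λ ()) ∷ not-fixed s1) ∷ not-fixed s2 ∷ cycle)
      on-graph : All (λ (x , y) → to s x ≡ y) (graph (p , q , r))
      on-graph = s0 ∷ s1 ∷ s2 ∷ s3 ∷ refl ∷ refl ∷ refl ∷ sr ∷ []
      build : ∀ {c} → c ∈ standard → (p , q , r) ≡ proj₁ c → Standard (to s)
      build {_ , rs} c∈ refl = mkStandard c∈ λ x → match (All.lookup standard-graph c∈ x) on-graph
        where
        match : ∀ {x y gs} → Any (λ (x' , y') → x ≡ x' × y ≡ y') gs → All (λ (x' , y') → to s x' ≡ y') gs → to s x ≡ y
        match (here (refl , refl)) (e ∷ _) = e
        match (there a) (_ ∷ es) = match a es
      go : Any (λ (ps , _) → (p , q , r) ≡ ps) standard → Standard (to s)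
      go a = let (c , c∈ , e) = find a in build c∈ e

    module _ (σ : Perm B) (per : ∀ x → iter (to σ) 5 x ≡ x) {x₀} (moved : to σ x₀ ≢ x₀) where
      open Analysis σ per moved
      open FixedRows fixed-rows

      private
        a₁ a₂ d₁ d₂ d₃ : B
        a₁ = f₁ ⊕ (f₂ ⊕ f₃)
        a₂ = to σ a₁
        d₁ = f₁ ⊕ f₂
        d₂ = f₁ ⊕ f₃
        d₃ = f₁ ⊕ a₂

        ≢⇒⊕ : ∀ {x y} → x ≢ y → x ⊕ y ≢ 0ᴮ
        ≢⇒⊕ {x} {y} ne e = ne (trans (sym (⊕-identityʳ x)) (trans (cong (x ⊕_) (sym e)) (⊕-cancel x y)))

        ⊕-injʳ : ∀ x {y y'} → x ⊕ y ≡ x ⊕ y' → y ≡ y'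
        ⊕-injʳ x {y} {y'} e = trans (sym (⊕-cancel x y)) (trans (cong (x ⊕_) e) (⊕-cancel x y'))

        d₁⊕d₂ : d₁ ⊕ d₂ ≡ f₂ ⊕ f₃
        d₁⊕d₂ = trans (cong (_⊕ d₂) (⊕-comm f₁ f₂)) (trans (⊕-assoc f₂ f₁ d₂) (cong (f₂ ⊕_) (⊕-cancel f₁ f₃)))

        a₁≢f₁ : a₁ ≢ f₁
        a₁≢f₁ e = ≢⇒⊕ f₂≢f₃ (⊕-injʳ f₁ (trans e (sym (⊕-identityʳ f₁))))

        a₁≢f₂ : a₁ ≢ f₂
        a₁≢f₂ e = f₁≢f₃ (⊕-injʳ f₂ (trans (⊕-comm f₂ f₁) (trans (cong (f₁ ⊕_) (sym e)) (⊕-cancel f₁ (f₂ ⊕ f₃)))))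

        a₁≢f₃ : a₁ ≢ f₃
        a₁≢f₃ e = f₁≢f₂ (⊕-injʳ f₃ (trans (⊕-comm f₃ f₁) (trans (cong (f₁ ⊕_) (sym e)) (trans (⊕-cancel f₁ (f₂ ⊕ f₃)) (⊕-comm f₂ f₃)))))

        a₁-moved : a₂ ≢ a₁
        a₁-moved e = out (only e)
          where
          out : a₁ ≡ f₁ ⊎ a₁ ≡ f₂ ⊎ a₁ ≡ f₃ → ⊥
          out (inj₁ d) = a₁≢f₁ d
          out (inj₂ (inj₁ d)) = a₁≢f₂ d
          out (inj₂ (inj₂ d)) = a₁≢f₃ d

        a₂≢ : ∀ {f} → to σ f ≡ f → a₂ ≢ f
        a₂≢ e d = a₁-moved (trans d (sym (to-inj σ (trans d (sym e)))))

        frame : Frame d₁ d₂ d₃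
        frame = ≢⇒⊕ f₁≢f₂ , ≢⇒⊕ f₁≢f₃ , f₂≢f₃ ∘ ⊕-injʳ f₁ , ≢⇒⊕ (a₂≢ fixed₁ ∘ sym) , a₂≢ fixed₂ ∘ ⊕-injʳ f₁ ,
                a₂≢ fixed₃ ∘ ⊕-injʳ f₁ , λ e → a₁-moved (⊕-injʳ f₁ (trans e (trans d₁⊕d₂ (sym (⊕-cancel f₁ (f₂ ⊕ f₃))))))

        FL = frame-linear d₁ d₂ d₃ frame
        L : B → B
        L = lin (d₁ , d₂ , d₃)
        K : B → B
        K = cramer d₁ d₂ d₃

        LK : ∀ x → L (K x) ≡ x
        LK = proj₁ (proj₁ FL)

        KL : ∀ x → K (L x) ≡ x
        KL = proj₁ (proj₂ (proj₁ FL))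

      θ : Perm B
      θ = perm (λ x → f₁ ⊕ L x) (λ x → K (f₁ ⊕ x))
        (λ x → trans (cong (f₁ ⊕_) (LK _)) (⊕-cancel f₁ x))
        (λ x → trans (cong K (⊕-cancel f₁ _)) (KL x))

      θ-translating : ∀ b x → to θ (b ⊕ x) ≡ (to θ b ⊕ to θ 0ᴮ) ⊕ to θ x
      θ-translating b x = trans (cong (f₁ ⊕_) (proj₂ (proj₂ (proj₁ FL)) b x)) (sym (trans (cong (_⊕ (f₁ ⊕ L x)) shape)
        (trans (sym (⊕-assoc (L b) f₁ (L x))) (trans (cong (_⊕ L x) (⊕-comm (L b) f₁)) (⊕-assoc f₁ (L b) (L x))))))
        where
        shape : (f₁ ⊕ L b) ⊕ (f₁ ⊕ L 0ᴮ) ≡ L b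
        shape = trans (cong₂ _⊕_ (⊕-comm f₁ (L b)) (trans (cong (f₁ ⊕_) (proj₁ (proj₂ FL))) (⊕-identityʳ f₁)))
          (trans (⊕-assoc (L b) f₁ f₁) (trans (cong (L b ⊕_) (⊕-self f₁)) (⊕-identityʳ (L b))))

      θ-standard : Standard (to (θ ⁻¹ ∙ σ ∙ θ))
      θ-standard = standardise (θ ⁻¹ ∙ σ ∙ θ) (λ x → trans (iter-conj θ σ 5 x) (trans (cong (from θ) (per _)) (from-to θ x)))
        (fix θ0 fixed₁) (fix θ1 fixed₂) (fix θ2 fixed₃) (from-≡ θ (trans θ3 (cong (to σ) (sym θb))))
        where
        fix : ∀ {x f} → to θ x ≡ f → to σ f ≡ f → from θ (to σ (to θ x)) ≡ x
        fix {x} refl e = trans (cong (from θ) e) (from-to θ x)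
        θ0 : to θ 0ᴮ ≡ f₁
        θ0 = trans (cong (f₁ ⊕_) (proj₁ (proj₂ FL))) (⊕-identityʳ f₁)
        θ1 : to θ e₁ ≡ f₂
        θ1 = trans (cong (f₁ ⊕_) (proj₁ (proj₂ (proj₂ FL)))) (⊕-cancel f₁ f₂)
        θ2 : to θ e₂ ≡ f₃
        θ2 = trans (cong (f₁ ⊕_) (proj₁ (proj₂ (proj₂ (proj₂ FL))))) (⊕-cancel f₁ f₃)
        θ3 : to θ e₃ ≡ a₂
        θ3 = trans (cong (f₁ ⊕_) (proj₁ (proj₂ (proj₂ (proj₂ (proj₂ FL)))))) (⊕-cancel f₁ a₂)
        θb : to θ b₃ ≡ a₁
        θb = cong (f₁ ⊕_) (trans (proj₂ (proj₂ (proj₂ (proj₂ (proj₂ FL))))) d₁⊕d₂)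

module Moving where

  open import Data.Nat as ℕ using (ℕ; zero; suc)
  open import Data.Nat.Primality
  open import Data.Fin using (Fin; zero; suc; toℕ)
  import Data.Fin.Properties as FinP
  open import Data.Bool using (if_then_else_)
  open import Data.List using (List)
  open import Data.List.Relation.Unary.All as All using (All)
  open import Data.List.Membership.Propositional using (_∈_)
  open import Data.List.Membership.Propositional.Properties using (∈-map⁺)
  open import Data.Product hiding (map; swap)
  open import Data.Product.Properties using (,-injectiveʳ)
  open import Data.Sum using (_⊎_; inj₁; inj₂; [_,_]′)
  open import Data.Empty
  open import Function using (_∘_)
  open import Relation.Nullary
  open import Relation.Nullary.Decidable using (_→-dec_; _⊎-dec_; ¬?; from-yes; ⌊_⌋)
  open import Relation.Binary.PropositionalEquality hiding (resp)
  open Count using (iter)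
  open Perms
  open Space
  open Stage2 using (e₂; e₃)
  open Shifts
  open Cycles
  open Transitive

  Special : B → Set
  Special x = x ≡ 0ᴮ ⊎ x ≡ e₁ ⊎ x ≡ e₂

  special? : ∀ x → Dec (Special x)
  special? x = (x ≟ᴮ 0ᴮ) ⊎-dec (x ≟ᴮ e₁) ⊎-dec (x ≟ᴮ e₂)

  OrbitCovers OrbitGeneral OrbitDistinct Periodic : Params → Set
  OrbitCovers ps   = ∀ x → Special x ⊎ ∃ λ (k : Fin 5) → iter (table ps) (toℕ k) b₃ ≡ x
  OrbitGeneral ps  = ∀ (k : Fin 5) → ¬ Special (iter (table ps) (toℕ k) b₃)
  OrbitDistinct ps = ∀ (k k' : Fin 5) → iter (table ps) (toℕ k) b₃ ≡ iter (table ps) (toℕ k') b₃ → k ≡ k'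
  Periodic ps      = ∀ x → iter (table ps) 5 x ≡ x

  orbitCovers? : ∀ ps → Dec (OrbitCovers ps)
  orbitCovers? ps = FinB.∀? λ x → special? x ⊎-dec FinP.any? (λ k → iter (table ps) (toℕ k) b₃ ≟ᴮ x)

  orbitGeneral? : ∀ ps → Dec (OrbitGeneral ps)
  orbitGeneral? ps = FinP.all? λ k → ¬? (special? (iter (table ps) (toℕ k) b₃))

  orbitDistinct? : ∀ ps → Dec (OrbitDistinct ps)
  orbitDistinct? ps = FinP.all? λ k → FinP.all? λ k' →
    (iter (table ps) (toℕ k) b₃ ≟ᴮ iter (table ps) (toℕ k') b₃) →-dec (k FinP.≟ k')

  periodic? : ∀ ps → Dec (Periodic ps)
  periodic? ps = FinB.∀? λ x → iter (table ps) 5 x ≟ᴮ x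

  abstract
    standard-covers : All (OrbitCovers ∘ proj₁) standard
    standard-covers = from-yes (All.all? (orbitCovers? ∘ proj₁) standard)

    standard-general : All (OrbitGeneral ∘ proj₁) standard
    standard-general = from-yes (All.all? (orbitGeneral? ∘ proj₁) standard)

    standard-distinct : All (OrbitDistinct ∘ proj₁) standard
    standard-distinct = from-yes (All.all? (orbitDistinct? ∘ proj₁) standard)

    standard-periodic : All (Periodic ∘ proj₁) standard
    standard-periodic = from-yes (All.all? (periodic? ∘ proj₁) standard)

    table-fixed : ∀ ps → ps ∈ Data.List.map proj₁ standard → table ps 0ᴮ ≡ 0ᴮ × table ps e₁ ≡ e₁ × table ps e₂ ≡ e₂ × table ps b₃ ≡ e₃
    table-fixed _ 0th = refl , refl , refl , refl
    table-fixed _ 1st = refl , refl , refl , refl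
    table-fixed _ 2nd = refl , refl , refl , refl
    table-fixed _ 3rd = refl , refl , refl , refl
    table-fixed _ 4th = refl , refl , refl , refl
    table-fixed _ 5th = refl , refl , refl , refl

  module StandardFacts {s : B → B} (std : Standard s) where
    open Standard std

    private
      vals = table-fixed ps (∈-map⁺ proj₁ ps∈)

    iter-table : ∀ k x → iter s k x ≡ iter (table ps) k x
    iter-table zero    x = refl
    iter-table (suc k) x = trans (s≗ _) (cong (table ps) (iter-table k x))

    s0 : s 0ᴮ ≡ 0ᴮ
    s0 = trans (s≗ _) (proj₁ vals)

    s1 : s e₁ ≡ e₁
    s1 = trans (s≗ _) (proj₁ (proj₂ vals))

    s2 : s e₂ ≡ e₂
    s2 = trans (s≗ _) (proj₁ (proj₂ (proj₂ vals)))

    s3 : s b₃ ≡ e₃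
    s3 = trans (s≗ _) (proj₂ (proj₂ (proj₂ vals)))

    period : ∀ x → iter s 5 x ≡ x
    period x = trans (iter-table 5 x) (All.lookup standard-periodic ps∈ x)

    orbit-cover : ∀ x → Special x ⊎ ∃ λ (k : Fin 5) → iter s (toℕ k) b₃ ≡ x
    orbit-cover x = go (All.lookup standard-covers ps∈ x)
      where
      go : Special x ⊎ (∃ λ (k : Fin 5) → iter (table ps) (toℕ k) b₃ ≡ x) → Special x ⊎ ∃ λ (k : Fin 5) → iter s (toℕ k) b₃ ≡ x
      go (inj₁ p)       = inj₁ p
      go (inj₂ (k , e)) = inj₂ (k , trans (iter-table (toℕ k) b₃) e)

    orbit-not-special : ∀ (k : Fin 5) → ¬ Special (iter s (toℕ k) b₃)
    orbit-not-special k = subst (¬_ ∘ Special) (sym (iter-table (toℕ k) b₃)) (All.lookup standard-general ps∈ k)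

    orbit-inj : ∀ (k k' : Fin 5) → iter s (toℕ k) b₃ ≡ iter s (toℕ k') b₃ → k ≡ k'
    orbit-inj k k' e = All.lookup standard-distinct ps∈ k k' (trans (sym (iter-table (toℕ k) b₃)) (trans e (iter-table (toℕ k') b₃)))

    fixed-special : ∀ x → s x ≡ x → Special x
    fixed-special x e = All.lookup standard-fixed ps∈ x (trans (sym (s≗ x)) e)

    -- The conjugates of s by e₁ and e₂ tie the rows e₂ and e₁ to the five-cycle.
    connect : ∀ {P : B → Set} → P b₃ → (∀ x → P x → P (s x)) → (P b₅ → P e₂) → ∀ x → x ≢ 0ᴮ → x ≢ e₁ → P x
    connect {P} start step jump x n0 n1 = go (orbit-cover x)
      where
      along : ∀ k → P (iter s k b₃)
      along zero    = start
      along (suc k) = step _ (along k)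
      on-orbit : ∀ y → ¬ Special y → P y
      on-orbit y ns = [ ⊥-elim ∘ ns , (λ (k , e) → subst P e (along (toℕ k))) ]′ (orbit-cover y)
      go : Special x ⊎ (∃ λ (k : Fin 5) → iter s (toℕ k) b₃ ≡ x) → P x
      go (inj₁ (inj₁ e))        = ⊥-elim (n0 e)
      go (inj₁ (inj₂ (inj₁ e))) = ⊥-elim (n1 e)
      go (inj₁ (inj₂ (inj₂ e))) = subst P (sym e) (jump (on-orbit b₅ λ { (inj₁ ()) ; (inj₂ (inj₁ ())) ; (inj₂ (inj₂ ())) }))
      go (inj₂ (k , e))         = subst P e (along (toℕ k))

    connect₁ : ∀ {P : B → Set} → P b₃ → (∀ x → P x → P (s x)) → (P b₅ → P e₂) → (P b₆ → P e₁) → ∀ x → x ≢ 0ᴮ → P x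
    connect₁ {P} start step jump jump₁ x n0 = go (x ≟ᴮ e₁)
      where
      go : Dec (x ≡ e₁) → P x
      go (no n1) = connect {P} start step jump x n0 n1
      go (yes e) = subst P (sym e) (jump₁ (connect {P} start step jump b₆ (λ ()) (λ ())))

  module MovingRows (pr : Prime 5) (S : Space.Space.Instance 4 pr) where
    open Space.Space 4 pr
    open Instance S
    open RowShifts 4 pr S

    2≢0 : 1# + 1# ≢ 0#
    2≢0 e with trans (sym (toℕ-⟦⟧ 2)) (trans (cong toℕ (trans (⟦+⟧ 1 1) e)) (toℕ-⟦⟧ 0))
    ... | ()

    open Odd 2≢0

    module Given (ψ : Perm V) (ψ∈ : ∀ v → mem (ψ ⁻¹ ∙ shift v ∙ ψ)) (R : RowAffine (ψ ⁻¹ ∙ z ∙ ψ))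
                 (std : Standard (RowAffine.σ R)) where
      open RowAffine R public
      open StandardFacts std public

      g : Perm V
      g = ψ ⁻¹ ∙ z ∙ ψ

      g∈ : mem g
      g∈ = ψ∈ (0ᴮ , 1#)

      g-free : ∀ v → to g v ≢ v
      g-free = Stage1.conj-free 4 pr ψ

      m-fixed : ∀ {x} → σ x ≡ x → m x ≡ 1#
      m-fixed = Stage1.mult-one 4 pr R g-free

      on-fixed : ∀ {x} → σ x ≡ x → ∀ y → to g (x , y) ≡ (x , y + c x)
      on-fixed {x} e y = trans (eq x y) (cong₂ _,_ e (cong (_+ c x) (trans (cong (_* y) (m-fixed e)) (*-identityˡ y))))

      c-fixed≢0 : ∀ {x} → σ x ≡ x → c x ≢ 0#
      c-fixed≢0 {x} e c0 = g-free (x , 0#) (trans (on-fixed e 0#) (cong (x ,_) (trans (+-identityˡ (c x)) c0)))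

      Sep-σ : ∀ {x x'} → Sep (σ x) (σ x') → Sep x x'
      Sep-σ (u , Tu , ne) = u ∘ σ , T-row R g∈ Tu , ne

      Sep-σ⁺ : ∀ {x x'} → Sep x x' → Sep (σ x) (σ x')
      Sep-σ⁺ {x} {x'} s = Sep-σ (Sep-σ (Sep-σ (Sep-σ (subst₂ Sep (sym (period x)) (sym (period x')) s))))

      Sep-t : ∀ b {x x'} → Sep x x' → Sep (b ⊕ x) (b ⊕ x')
      Sep-t b {x} {x'} s = Sep-translate b (subst₂ Sep (sym (⊕-cancel b x)) (sym (⊕-cancel b x')) s)

      Sep-at : ∀ {a b a' b'} → Sep a b → a ≡ a' → b ≡ b' → Sep a' b'
      Sep-at s refl refl = s

      sep-all : ∀ {x x'} → Sep x x' → ∀ {y y'} → y ≢ y' → Sep y y'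
      sep-all {x} {x'} s {y} {y'} ne = Sep-at (Sep-t y (out (y ⊕ y') (≢0 ne))) (⊕-identityʳ y) (⊕-cancel y y')
        where
        ≢0 : ∀ {y y'} → y ≢ y' → y ⊕ y' ≢ 0ᴮ
        ≢0 {y} {y'} ne e = ne (trans (sym (⊕-identityʳ y)) (trans (cong (y ⊕_) (sym e)) (⊕-cancel y y')))
        x≢x' : x ≢ x'
        x≢x' refl = proj₂ (proj₂ s) refl
        σ0 : ∀ {d} → Sep 0ᴮ d → Sep 0ᴮ (σ d)
        σ0 s = Sep-at (Sep-σ⁺ s) s0 refl
        σ0⁻ : ∀ {d} → Sep 0ᴮ (σ d) → Sep 0ᴮ d
        σ0⁻ s = Sep-σ (Sep-at s (sym s0) refl)
        base : Sep 0ᴮ b₃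
        base = connect₁ {λ d → Sep 0ᴮ d → Sep 0ᴮ b₃} (λ s → s) (λ x f s → f (σ0⁻ s))
          (λ f s → f (Sep-at (Sep-t e₁ (Sep-σ⁺ (Sep-t e₁ s))) (cong (e₁ ⊕_) s1) (cong (e₁ ⊕_) s3)))
          (λ f s → f (Sep-at (Sep-t e₂ (Sep-σ⁺ (Sep-t e₂ s))) (cong (e₂ ⊕_) s2) (cong (e₂ ⊕_) s3)))
          (x ⊕ x') (≢0 x≢x') (Sep-at (Sep-t x s) (⊕-self x) refl)
        out : ∀ d → d ≢ 0ᴮ → Sep 0ᴮ d
        out = connect₁ {Sep 0ᴮ} base (λ x → σ0)
          (λ s → Sep-at (Sep-t e₁ (Sep-σ (Sep-at (Sep-t e₁ s) (sym s1) (sym s3)))) refl refl)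
          (λ s → Sep-at (Sep-t e₂ (Sep-σ (Sep-at (Sep-t e₂ s) (sym s2) (sym s3)))) refl refl)

      separated : (∃ λ x → ∃ (Sep x)) ⊎ (∀ u → T u → ∀ x x' → u x ≡ u x')
      separated = go (FinB.∃? λ x → FinB.∃? (sep? x))
        where
        go : Dec (∃ λ x → ∃ (Sep x)) → (∃ λ x → ∃ (Sep x)) ⊎ (∀ u → T u → ∀ x x' → u x ≡ u x')
        go (yes p) = inj₁ p
        go (no np) = inj₂ λ u Tu x x' → agree (λ s → np (x , x' , s)) Tu

      open Transitivity _≟ⱽ_ A

      p₁ : V
      p₁ = b₃ , 0#

      Row : B → V → Set
      Row r v = proj₁ v ≡ r

      module Star (row0 : TransOff (Row 0ᴮ)) where

        d : V
        d = to ψ p₁ ⊞ (proj₁ (to ψ (0ᴮ , 0#)) , - proj₂ (to ψ (0ᴮ , 0#)))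

        h : Perm V
        h = ψ ⁻¹ ∙ shift d ∙ ψ

        h0 : to h (0ᴮ , 0#) ≡ p₁
        h0 = trans (cong (from ψ) (go (to ψ p₁) (to ψ (0ᴮ , 0#)))) (from-to ψ p₁)
          where
          go : ∀ v w → (v ⊞ (proj₁ w , - proj₂ w)) ⊞ w ≡ v
          go (x , y) (x' , y') = cong₂ _,_ (⊕-cancelʳ x x') (solve 2 (λ y w → (y :+ :- w) :+ w := y) refl y y')

        commute : ∀ v → to h (to g v) ≡ to g (to h v)
        commute v = trans (cong (from ψ ∘ to (shift d)) (to-from ψ _)) (trans (cong (from ψ) (go d (to ψ v)))
          (cong (from ψ ∘ to z) (sym (to-from ψ _))))
          where
          go : ∀ d v → d ⊞ ((0ᴮ , 1#) ⊞ v) ≡ (0ᴮ , 1#) ⊞ (d ⊞ v)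
          go (x , y) (x' , y') = cong₂ _,_ (trans (cong (x ⊕_) (⊕-identityˡ x')) (sym (⊕-identityˡ (x ⊕ x'))))
            (solve 2 (λ y w → y :+ (con (1 , 0) :+ w) := con (1 , 0) :+ (y :+ w)) refl y y')

        star : ℕ → V
        star k = iter (to g) k p₁

        commute-iter : ∀ k → to h (iter (to g) k (0ᴮ , 0#)) ≡ star k
        commute-iter zero    = h0
        commute-iter (suc k) = trans (commute _) (cong (to g) (commute-iter k))

        row-zero : ∀ k → iter (to g) k (0ᴮ , 0#) ≡ (0ᴮ , ⟦ k ⟧ * c 0ᴮ)
        row-zero zero    = cong (0ᴮ ,_) (sym (zeroˡ _))
        row-zero (suc k) = trans (cong (to g) (row-zero k)) (trans (on-fixed s0 _) (cong (0ᴮ ,_)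
          (trans (solve 2 (λ k c → k :* c :+ c := (con (1 , 0) :+ k) :* c) refl ⟦ k ⟧ (c 0ᴮ)) (cong (_* c 0ᴮ) (sym (⟦+⟧ 1 k))))))

        record InStar (v : V) : Set where
          constructor inStar
          field un : proj₁ (from h v) ≡ 0ᴮ

        star-row : ∀ k → proj₁ (star k) ≡ iter σ k b₃
        star-row k = Stage1.iter-row 4 pr R k b₃ 0#

        in-star : ∀ k → InStar (star k)
        in-star k = inStar (cong proj₁ (trans (from-≡ h (commute-iter k)) (row-zero k)))

        star-points : ∀ {v} → InStar v → ∃ λ (k : F) → v ≡ star (toℕ k)
        star-points {v} (inStar e) = k , trans (sym (to-from h v)) (trans (cong (to h) (sym at-k)) (commute-iter (toℕ k)))
          where
          i = inv (c-fixed≢0 s0)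
          y k : F
          y = proj₂ (from h v)
          k = y * proj₁ i
          at-k : iter (to g) (toℕ k) (0ᴮ , 0#) ≡ from h v
          at-k = trans (row-zero (toℕ k)) (cong₂ _,_ (sym e) (trans (cong (_* c 0ᴮ) (⟦toℕ⟧ k))
            (trans (*-assoc y _ _) (trans (cong (y *_) (proj₂ i)) (*-identityʳ y)))))

        star-not-special : ∀ {v} → InStar v → ¬ Special (proj₁ v)
        star-not-special {v} is = go (star-points is)
          where
          go : (∃ λ (k : F) → v ≡ star (toℕ k)) → ¬ Special (proj₁ v)
          go (k , e) sp = orbit-not-special k (subst Special (trans (cong proj₁ e) (star-row (toℕ k))) sp)

        star-row-inj : ∀ {v w} → InStar v → InStar w → proj₁ v ≡ proj₁ w → v ≡ w
        star-row-inj {v} {w} a b e = go (star-points a) (star-points b)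
          where
          go : (∃ λ (k : F) → v ≡ star (toℕ k)) → (∃ λ (k : F) → w ≡ star (toℕ k)) → v ≡ w
          go (k , d) (k' , d') = trans d (trans (cong (star ∘ toℕ) same) (sym d'))
            where
            same : k ≡ k'
            same = orbit-inj k k' (trans (sym (trans (cong proj₁ d) (star-row (toℕ k))))
              (trans e (trans (cong proj₁ d') (star-row (toℕ k')))))

        star-off : TransOff InStar
        star-off = respects (λ v → inStar) (λ v → InStar.un) (image {Row 0ᴮ} h (ψ∈ d) row0)

        o : V
        o = b₃ , 1#

        o∉star : ¬ InStar o
        o∉star is = 1≢0 (,-injectiveʳ (star-row-inj is (in-star 0) refl))

        rowb : TransOff (Row b₃)
        rowb = respects (λ v e → trans (sym (⊕-cancel b₃ _)) (cong (b₃ ⊕_) e)) (λ v e → cong (b₃ ⊕_) e)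
          (image {Row 0ᴮ} (shift (b₃ , 0#)) (sh∈ _) row0)

        point-off : TransOff (_≡ p₁)
        point-off = respects (λ v (e , is) → star-row-inj is (in-star 0) e) (λ { v refl → refl , in-star 0 })
          (inter {Row b₃} {InStar} (0ᴮ , 0#) (λ ()) (λ is → star-not-special is (inj₁ refl)) rowb star-off)

        module _ (P : Perm V) (P∈ : mem P) (P1 : to P p₁ ≡ p₁) (P2 : to P (star 1) ≡ star 1) (Po : to P o ≡ o)
                 (P-move : ∀ v → InStar v → proj₁ v ≢ b₃ → proj₁ v ≢ e₃ → ¬ InStar (from P v)) where

          pair-off : TransOff (λ v → v ≡ p₁ ⊎ v ≡ star 1)
          pair-off = respects fwd bwd (inter {InStar} {InStar ∘ from P} o o∉star
              (subst (¬_ ∘ InStar) (sym (from-≡ P Po)) o∉star) star-off (image {InStar} P P∈ star-off))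
            where
            fwd : ∀ v → InStar v × InStar (from P v) → v ≡ p₁ ⊎ v ≡ star 1
            fwd v (is , is') = go (proj₁ v ≟ᴮ b₃) (proj₁ v ≟ᴮ e₃)
              where
              go : Dec (proj₁ v ≡ b₃) → Dec (proj₁ v ≡ e₃) → v ≡ p₁ ⊎ v ≡ star 1
              go (yes e) _       = inj₁ (star-row-inj is (in-star 0) e)
              go (no _)  (yes e) = inj₂ (star-row-inj is (in-star 1) (trans e (sym (trans (star-row 1) s3))))
              go (no n)  (no n') = ⊥-elim (P-move v is n n' is')
            bwd : ∀ v → v ≡ p₁ ⊎ v ≡ star 1 → InStar v × InStar (from P v)
            bwd v (inj₁ refl) = in-star 0 , subst InStar (sym (from-≡ P P1)) (in-star 0)
            bwd v (inj₂ refl) = in-star 1 , subst InStar (sym (from-≡ P P2)) (in-star 1)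

          everything : ∀ f → mem f
          everything = all-perms cl₃ (λ u v → shift (v ⊞ (proj₁ u , - proj₂ u)) , sh∈ _ , to-target u v)
            (g-free p₁ ∘ sym) point-off pair-off
            where
            to-target : ∀ u v → (v ⊞ (proj₁ u , - proj₂ u)) ⊞ u ≡ v
            to-target (x' , y') (x , y) = cong₂ _,_ (⊕-cancelʳ x x') (solve 2 (λ y w → (y :+ :- w) :+ w := y) refl y y')

          star-good : Good S
          star-good = idₚ , hol (λ v → v , pt λ _ → refl) (λ v → v , pt λ _ → refl) , everything _

      module Separated (T-all : ∀ u → T u) where

        bump : B → F → B → F
        bump x d x' = if ⌊ x' ≟ᴮ x ⌋ then d else 0#

        bump-at : ∀ x d → bump x d x ≡ d
        bump-at x d with x ≟ᴮ x
        ... | yes _ = refl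
        ... | no ne = ⊥-elim (ne refl)

        bump-off : ∀ {x x'} d → x' ≢ x → bump x d x' ≡ 0#
        bump-off {x} {x'} d ne with x' ≟ᴮ x
        ... | yes e = ⊥-elim (ne e)
        ... | no _  = refl

        FixesRow : Perm V → Set
        FixesRow k = ∀ w → Row 0ᴮ w → to k w ≡ w

        Reached : B → Set
        Reached x = x ≢ 0ᴮ × ∀ y y' → ∃ λ k → mem k × FixesRow k × to k (b₃ , y) ≡ (x , y')

        settle : ∀ {x} → x ≢ 0ᴮ → (∀ y → ∃ λ k → mem k × FixesRow k × ∃ λ t → to k (b₃ , y) ≡ (x , t)) → Reached x
        settle {x} ne h = ne , λ y y' → let (k , k∈ , fix , t , e) = h y ; u = bump x (y' + - t) in
          rowShift u ∙ k , ∙∈ (T-all u) k∈ ,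
          (λ { w refl → trans (cong (to (rowShift u)) (fix w refl)) (cong (0ᴮ ,_)
            (trans (cong (_+ proj₂ w) (bump-off _ (ne ∘ sym))) (+-identityˡ _))) }) ,
          trans (cong (to (rowShift u)) e) (cong (x ,_) (trans (cong (_+ t) (bump-at x _))
            (solve 2 (λ y t → (y :+ :- t) :+ t := y) refl y' t)))

        extend : ∀ J → mem J → FixesRow J → ∀ {x x'} → x' ≢ 0ᴮ → proj₁ (to J (x , 0#)) ≡ x' → Reached x → Reached x'
        extend J J∈ fixJ ne refl (_ , r) = settle ne λ y → let (k , k∈ , fix , e) = r y 0# in
          J ∙ k , ∙∈ J∈ k∈ , (λ w ew → trans (cong (to J) (fix w ew)) (fixJ w ew)) , _ , cong (to J) e

        retract : ∀ J → mem J → FixesRow J → ∀ {x x'} → x' ≢ 0ᴮ → proj₁ (to J (x' , 0#)) ≡ x → Reached x → Reached x'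
        retract J J∈ fixJ {x' = x'} ne refl (_ , r) = settle ne λ y →
          let (k , k∈ , fix , e) = r y (proj₂ (to J (x' , 0#))) in
          J ⁻¹ ∙ k , ∙∈ (⁻¹∈ J∈) k∈ , (λ w ew → trans (cong (from J) (fix w ew)) (from-≡ J (fixJ w ew))) , 0# ,
          trans (cong (from J) e) (from-to J _)

        g⟨_⟩ : B → Perm V
        g⟨ e ⟩ = shift (e , - c e) ∙ g ∙ tᴮ e

        g⟨⟩∈ : ∀ e → mem g⟨ e ⟩
        g⟨⟩∈ e = ∙∈ (sh∈ _) (∙∈ g∈ (sh∈ _))

        g⟨⟩-fixes : ∀ e → σ e ≡ e → FixesRow g⟨ e ⟩
        g⟨⟩-fixes e se (_ , y) refl = trans (cong (λ t → to (shift (e , - c e)) (to g (t , 0# + y))) (⊕-identityʳ e))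
          (trans (cong (to (shift (e , - c e))) (on-fixed se (0# + y))) (cong₂ _,_ (⊕-self e)
            (solve 2 (λ c y → :- c :+ ((con (0 , 0) :+ y) :+ c) := y) refl (c e) y)))

        g⟨⟩-row : ∀ e x → proj₁ (to g⟨ e ⟩ (x , 0#)) ≡ e ⊕ σ (e ⊕ x)
        g⟨⟩-row e x = cong (λ v → e ⊕ proj₁ v) (eq (e ⊕ x) _)

        reached : ∀ x → x ≢ 0ᴮ → Reached x
        reached = connect₁ {Reached}
          (settle (λ ()) λ y → idₚ , id∈ , (λ _ _ → refl) , y , refl)
          (λ x r → extend g⟨ 0ᴮ ⟩ (g⟨⟩∈ 0ᴮ) (g⟨⟩-fixes 0ᴮ s0)
            (λ e → proj₁ r (row-inj R (trans e (sym s0))))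
            (trans (g⟨⟩-row 0ᴮ x) (trans (⊕-identityˡ _) (cong σ (⊕-identityˡ x)))) r)
          (retract g⟨ e₁ ⟩ (g⟨⟩∈ e₁) (g⟨⟩-fixes e₁ s1) (λ ()) (trans (g⟨⟩-row e₁ e₂) (cong (e₁ ⊕_) s3)))
          (retract g⟨ e₂ ⟩ (g⟨⟩∈ e₂) (g⟨⟩-fixes e₂ s2) (λ ()) (trans (g⟨⟩-row e₂ e₁) (cong (e₂ ⊕_) s3)))

        row0 : TransOff (Row 0ᴮ)
        row0 = transOff (λ v → proj₁ v ≟ᴮ 0ᴮ) λ (x , y) (x' , y') nu nv →
          let (k , k∈ , fix , e) = proj₂ (reached x nu) 0# y ; (l , l∈ , fix' , e') = proj₂ (reached x' nv) 0# y' in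
          l ∙ k ⁻¹ , ∙∈ l∈ (⁻¹∈ k∈) , (λ w ew → trans (cong (to l) (from-≡ k (fix w ew))) (fix' w ew)) ,
          trans (cong (to l) (from-≡ k e)) e'

        open Star row0

        off-two : B → F
        off-two x = if ⌊ x ≟ᴮ b₃ ⌋ then 0# else if ⌊ x ≟ᴮ e₃ ⌋ then 0# else 1#

        off-two≡1 : ∀ x → x ≢ b₃ → x ≢ e₃ → off-two x ≡ 1#
        off-two≡1 x n n' with x ≟ᴮ b₃ | x ≟ᴮ e₃
        ... | yes e | _     = ⊥-elim (n e)
        ... | no _  | yes e = ⊥-elim (n' e)
        ... | no _  | no _  = refl

        still : ∀ v → off-two (proj₁ v) ≡ 0# → to (rowShift off-two) v ≡ v
        still (x , y) e = cong (x ,_) (trans (cong (_+ y) e) (+-identityˡ y))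

        separated-good : Good S
        separated-good = star-good (rowShift off-two) (T-all _) (still p₁ refl)
          (still (star 1) (cong off-two (trans (star-row 1) s3))) (still o refl)
          λ v is n n' is' → 1≢0 (trans (sym (off-two≡1 (proj₁ v) n n')) (zero-shift (proj₂ v) (,-injectiveʳ (star-row-inj is' is refl))))
          where
          zero-shift : ∀ {a} y → - a + y ≡ y → a ≡ 0#
          zero-shift {a} y e = trans (solve 2 (λ a y → a := y :+ :- (:- a :+ y)) refl a y)
            (trans (cong (λ t → y + - t) e) (-‿inverseʳ y))

      separated⇒good : (∃ λ x → ∃ (Sep x)) → Good S
      separated⇒good (x , x' , s) = Separated.separated-good λ u → invariant⇒T λ y y' ns → cases u y y' ns (y ≟ᴮ y')
        where
        cases : ∀ u y y' → ¬ Sep y y' → Dec (y ≡ y') → u y ≡ u y'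
        cases u y y' ns (yes e) = cong u e
        cases u y y' ns (no ne) = ⊥-elim (ns (sep-all s ne))

module Constant where

  open import Data.Nat as ℕ using (ℕ; zero; suc)
  import Data.Nat.Properties as ℕP
  open import Data.Nat.DivMod using (_%_)
  open import Data.Nat.Primality
  open import Data.List.Relation.Unary.Any using (here; there)
  import Algebra.Bundles
  open import Data.Fin using (zero; suc; toℕ)
  open import Data.Bool using (Bool; true; false; if_then_else_)
  open import Data.List using (List; []; _∷_; foldr; map)
  open import Data.List.Properties using (map-∘; map-cong)
  open import Data.List.Relation.Unary.All as All using (All; []; _∷_)
  open import Data.List.Membership.Propositional using (_∈_)
  open import Data.List.Membership.Propositional.Properties using (∈-map⁺; ∈-upTo⁺)
  open import Data.List.Membership.Propositional.Properties.WithK using (unique∧set⇒bag)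
  open import Data.List.Relation.Binary.BagAndSetEquality using (∼bag⇒↭)
  open import Data.List.Relation.Binary.Permutation.Propositional using (_↭_; ↭⇒↭ₛ)
  import Data.List.Relation.Binary.Permutation.Propositional.Properties as PermP
  import Data.List.Relation.Binary.Permutation.Setoid.Properties as PermS
  import Data.List.Relation.Unary.Unique.Propositional.Properties as UniqueP
  open import Data.Product hiding (map; swap)
  open import Data.Sum using (_⊎_; inj₁; inj₂; [_,_]′)
  open import Data.Empty
  open import Function using (_∘_; mk⇔)
  open import Relation.Nullary
  open import Relation.Nullary.Decidable using (⌊_⌋)
  open import Relation.Binary.PropositionalEquality hiding (resp)
  open Count using (iter)
  open Perms
  open Space
  open Stage2 using (e₂; e₃; module Normalise)
  open Shifts
  open Cycles
  open Transitive
  open Moving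

  rows-↭ : ∀ (τ : Perm B) → map (to τ) allᴮ ↭ allᴮ
  rows-↭ τ = ∼bag⇒↭ (unique∧set⇒bag (UniqueP.map⁺ (to-inj τ) allᴮ-distinct) allᴮ-distinct
    (λ {x} → mk⇔ (λ _ → ∈allᴮ x) (λ _ → subst (_∈ map (to τ) allᴮ) (to-from τ x) (∈-map⁺ (to τ) (∈allᴮ (from τ x))))))

  -- As a row permutation it keeps two points of the star and moves the other three to fixed rows of the five-cycle.
  ex : B → B
  ex (false , false , false) = b₅
  ex (true  , false , false) = b₆
  ex (false , true  , false) = b₇
  ex (true  , true  , false) = b₃
  ex (false , false , true)  = e₃
  ex (true  , false , true)  = 0ᴮ
  ex (false , true  , true)  = e₁
  ex (true  , true  , true)  = e₂

  ex-invol : ∀ x → ex (ex x) ≡ x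
  ex-invol (false , false , false) = refl
  ex-invol (true  , false , false) = refl
  ex-invol (false , true  , false) = refl
  ex-invol (true  , true  , false) = refl
  ex-invol (false , false , true)  = refl
  ex-invol (true  , false , true)  = refl
  ex-invol (false , true  , true)  = refl
  ex-invol (true  , true  , true)  = refl

  ex-special : ∀ x → ¬ Special x → x ≢ b₃ → x ≢ e₃ → Special (ex x)
  ex-special (false , false , false) ns _ _ = ⊥-elim (ns (inj₁ refl))
  ex-special (true  , false , false) ns _ _ = ⊥-elim (ns (inj₂ (inj₁ refl)))
  ex-special (false , true  , false) ns _ _ = ⊥-elim (ns (inj₂ (inj₂ refl)))
  ex-special (true  , true  , false) _ n _ = ⊥-elim (n refl)
  ex-special (false , false , true)  _ _ n = ⊥-elim (n refl)
  ex-special (true  , false , true)  _ _ _ = inj₁ refl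
  ex-special (false , true  , true)  _ _ _ = inj₂ (inj₁ refl)
  ex-special (true  , true  , true)  _ _ _ = inj₂ (inj₂ refl)

  module Sums (pr : Prime 5) where
    open Space.Space 4 pr

    Σᴮ : (B → F) → F
    Σᴮ u = foldr _+_ 0# (map u allᴮ)

    Σᴮ-perm : ∀ u τ → Σᴮ (u ∘ to τ) ≡ Σᴮ u
    Σᴮ-perm u τ = trans (cong (foldr _+_ 0#) (map-∘ {g = u} {f = to τ} allᴮ))
      (PermS.foldr-commMonoid (setoid F) (Algebra.Bundles.CommutativeRing.+-isCommutativeMonoid commutativeRing) (↭⇒↭ₛ (PermP.map⁺ u (rows-↭ τ))))

    Σᴮ-cong : ∀ {u w} → (∀ x → u x ≡ w x) → Σᴮ u ≡ Σᴮ w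
    Σᴮ-cong e = cong (foldr _+_ 0#) (map-cong e allᴮ)

    Σᴮ-+ : ∀ u w → Σᴮ (λ x → u x + w x) ≡ Σᴮ u + Σᴮ w
    Σᴮ-+ u w = go allᴮ
      where
      go : ∀ xs → foldr _+_ 0# (map (λ x → u x + w x) xs) ≡ foldr _+_ 0# (map u xs) + foldr _+_ 0# (map w xs)
      go []       = sym (+-identityˡ 0#)
      go (x ∷ xs) = trans (cong (u x + w x +_) (go xs))
        (solve 4 (λ a b c d → (a :+ b) :+ (c :+ d) := (a :+ c) :+ (b :+ d)) refl (u x) (w x) _ _)

    Σᴮ-const : ∀ s → Σᴮ (λ _ → s) ≡ ⟦ 8 ⟧ * s
    Σᴮ-const s = go allᴮ
      where
      go : ∀ (xs : List B) → foldr _+_ 0# (map (λ _ → s) xs) ≡ ⟦ Data.List.length xs ⟧ * s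
      go []       = sym (zeroˡ s)
      go (x ∷ xs) = trans (cong (s +_) (go xs)) (trans
        (solve 2 (λ s j → s :+ j :* s := (con (1 , 0) :+ j) :* s) refl s ⟦ Data.List.length xs ⟧)
        (cong (_* s) (sym (⟦+⟧ 1 (Data.List.length xs)))))

    ⟦⟧≢0 : ∀ j → j % 5 ≢ 0 → ⟦ j ⟧ ≢ 0#
    ⟦⟧≢0 j ne e = ne (trans (sym (toℕ-⟦⟧ j)) (trans (cong toℕ e) (toℕ-⟦⟧ 0)))

  module ConstantShifts (pr : Prime 5) (S : Space.Space.Instance 4 pr) where
    open Space.Space 4 pr
    open Instance S
    open RowShifts 4 pr S
    open Sums pr
    open MovingRows pr S
    open Odd 2≢0

    module Const (ψ : Perm V) (ψ∈ : ∀ v → mem (ψ ⁻¹ ∙ shift v ∙ ψ)) (R : RowAffine (ψ ⁻¹ ∙ z ∙ ψ))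
                 (std : Standard (RowAffine.σ R)) (only-constants : ∀ u → T u → ∀ x x' → u x ≡ u x') where
      open Given ψ ψ∈ R std
      open Standard std

      mult≡1 : ∀ x → m x ≡ 1#
      mult≡1 x = trans (mult-invariant R g∈ x 0ᴮ λ (u , Tu , ne) → ne (only-constants u Tu x 0ᴮ)) (m-fixed s0)

      eighth : ∃ λ i → i * ⟦ 8 ⟧ ≡ 1#
      eighth = inv (⟦⟧≢0 8 λ ())

      mean : F
      mean = proj₁ eighth * Σᴮ c

      c₀ : B → F
      c₀ x = c x + - mean

      Σc₀ : Σᴮ c₀ ≡ 0#
      Σc₀ = trans (Σᴮ-+ c (λ _ → - mean)) (trans (cong (Σᴮ c +_) (Σᴮ-const (- mean)))
        (trans (solve 3 (λ t e i → t :+ e :* (:- (i :* t)) := t :+ :- ((i :* e) :* t)) refl (Σᴮ c) ⟦ 8 ⟧ (proj₁ eighth))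
          (trans (cong (λ t → Σᴮ c + - (t * Σᴮ c)) (proj₂ eighth))
            (solve 1 (λ t → t :+ :- (con (1 , 0) :* t) := con (0 , 0)) refl (Σᴮ c)))))

      module Word (e : B) where

        τ : B → B
        τ = word σ e

        w : Perm V
        w = shift (e , - mean) ∙ g

        w∈ : mem w
        w∈ = ∙∈ (sh∈ _) g∈

        w-form : ∀ x y → to w (x , y) ≡ (τ x , y + c₀ x)
        w-form x y = trans (cong (to (shift (e , - mean))) (eq x y)) (cong (τ x ,_)
          (trans (cong (λ t → - mean + (t * y + c x)) (mult≡1 x))
            (solve 3 (λ m y c → :- m :+ (con (1 , 0) :* y :+ c) := y :+ (c :+ :- m)) refl mean y (c x))))

        partial : ℕ → B → F
        partial zero    x = 0#
        partial (suc j) x = partial j x + c₀ (iter τ j x)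

        w-iter : ∀ j x y → iter (to w) j (x , y) ≡ (iter τ j x , y + partial j x)
        w-iter zero    x y = cong (x ,_) (sym (+-identityʳ y))
        w-iter (suc j) x y = trans (cong (to w) (w-iter j x y)) (trans (w-form _ _) (cong (_ ,_) (+-assoc y _ _)))

        power : ℕ → Perm V
        power zero    = idₚ
        power (suc j) = w ∙ power j

        power∈ : ∀ j → mem (power j)
        power∈ zero    = id∈
        power∈ (suc j) = ∙∈ w∈ (power∈ j)

        power≡ : ∀ j v → to (power j) v ≡ iter (to w) j v
        power≡ zero    v = refl
        power≡ (suc j) v = cong (to w) (power≡ j v)

        T-partial : ∀ N → (∀ x → iter τ N x ≡ x) → T (partial N)
        T-partial N per = resp (pt λ (x , y) → trans (power≡ N (x , y)) (trans (w-iter N x y) (cong₂ _,_ (per x) (+-comm y _)))) (power∈ N)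

        τₚ : Perm B
        τₚ = rowPerm {w} (rowAffine τ (λ _ → 1#) c₀ λ x y → trans (w-form x y) (cong (λ t → τ x , t + c₀ x) (sym (*-identityˡ y))))

        τ-power : ℕ → Perm B
        τ-power zero    = idₚ
        τ-power (suc j) = τₚ ∙ τ-power j

        τ-power≡ : ∀ j x → to (τ-power j) x ≡ iter τ j x
        τ-power≡ zero    x = refl
        τ-power≡ (suc j) x = cong τ (τ-power≡ j x)

        Σ-partial : ∀ j → Σᴮ (partial j) ≡ 0#
        Σ-partial zero    = trans (Σᴮ-const 0#) (zeroʳ _)
        Σ-partial (suc j) = trans (Σᴮ-+ (partial j) (c₀ ∘ iter τ j)) (trans (cong₂ _+_ (Σ-partial j)
          (trans (Σᴮ-cong {c₀ ∘ iter τ j} {c₀ ∘ to (τ-power j)} (λ x → cong c₀ (sym (τ-power≡ j x)))) (trans (Σᴮ-perm c₀ (τ-power j)) Σc₀))) (+-identityˡ 0#))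

        -- The row shift in question is constant, and its values sum to zero over the eight rows.
        partial≡0 : ∀ N → (∀ x → iter τ N x ≡ x) → ∀ x → partial N x ≡ 0#
        partial≡0 N per x = *-cancel (⟦⟧≢0 8 λ ()) (trans (sym (Σᴮ-const (partial N x)))
          (trans (Σᴮ-cong {λ _ → partial N x} {partial N} (only-constants _ (T-partial N per) x)) (trans (Σ-partial N) (sym (zeroʳ _)))))

      word-table : ∀ e j x → iter (word σ e) j x ≡ iter (word (table ps) e) j x
      word-table e zero    x = refl
      word-table e (suc j) x = trans (cong (e ⊕_) (s≗ _)) (cong (word (table ps) e) (word-table e j x))

      forced : ∀ {K r e N} → Forces (table ps) K r e N → (∀ {x} → x ∈ K → c₀ x ≡ 0#) → c₀ r ≡ 0#
      forced {K} {r} {e} {N} (per , known , unit) zeros = *-cancel (⟦⟧≢0 _ unit) (trans (sym (count N ℕP.≤-refl))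
          (trans (partial≡0 N (λ x → trans (word-table e N x) (per x)) r) (sym (zeroʳ _))))
        where
        open Word e
        t : ℕ → B
        t j = iter (word (table ps) e) j r
        term : ∀ a h → Dec (t a ≡ r) → (t a ∈ K ⊎ t a ≡ r) → c₀ (t a) ≡ (if ⌊ t a ≟ᴮ r ⌋ then c₀ r else 0#)
        term a h _ k with t a ≟ᴮ r
        ... | yes e = cong c₀ e
        ... | no ne = [ zeros , ⊥-elim ∘ ne ]′ k
        add : ∀ (b : Bool) n → ⟦ n ⟧ * c₀ r + (if b then c₀ r else 0#) ≡ ⟦ if b then suc n else n ⟧ * c₀ r
        add true  n = trans (solve 2 (λ j s → j :* s :+ s := (con (1 , 0) :+ j) :* s) refl ⟦ n ⟧ (c₀ r)) (cong (_* c₀ r) (sym (⟦+⟧ 1 n)))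
        add false n = +-identityʳ _
        count : ∀ j → j ℕ.≤ N → partial j r ≡ ⟦ hits (word (table ps) e) r j ⟧ * c₀ r
        count zero    _   = sym (zeroˡ _)
        count (suc j) j<N = trans (cong₂ _+_ (count j (ℕP.<⇒≤ j<N)) (trans (cong c₀ (word-table e j r))
          (term j 0 (t j ≟ᴮ r) (All.lookup known (∈-upTo⁺ j<N))))) (add ⌊ t j ≟ᴮ r ⌋ _)

      derive : ∀ {K} rs → Derivation (table ps) K rs → (∀ {x} → x ∈ K → c₀ x ≡ 0#) → ∀ x → c₀ x ≡ 0#
      derive []       d        zeros x = zeros (d x)
      derive {K} ((r , e , N) ∷ rs) (f , d) zeros = derive rs d λ where
        (here refl) → forced {K} {r} {e} {N} f zeros
        (there p)   → zeros p

      c₀≡0 : ∀ x → c₀ x ≡ 0#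
      c₀≡0 = derive _ (All.lookup standard-derivation ps∈) (λ ())

      g-form : ∀ x y → to g (x , y) ≡ (σ x , mean + y)
      g-form x y = trans (eq x y) (cong (σ x ,_) (trans (cong₂ (λ a b → a * y + b) (mult≡1 x) (c≡mean x))
        (solve 2 (λ y s → con (1 , 0) :* y :+ s := s :+ y) refl y mean)))
        where
        c≡mean : ∀ x → c x ≡ mean
        c≡mean x = trans (solve 2 (λ a b → a := (a :+ :- b) :+ b) refl (c x) mean) (trans (cong (_+ mean) (c₀≡0 x)) (+-identityˡ mean))

      mean≢0 : mean ≢ 0#
      mean≢0 e = g-free (0ᴮ , 0#) (trans (g-form 0ᴮ 0#) (cong₂ _,_ s0 (trans (cong (_+ 0#) e) (+-identityˡ 0#))))

      open Normalise 4 pr using (liftᴮ)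

      rowGroup : Group B
      rowGroup = record
        { mem  = λ ρ → mem (liftᴮ ρ)
        ; mem? = λ ρ → mem? (liftᴮ ρ)
        ; resp = λ e → resp (pt λ (x , y) → cong (_, y) (at e x))
        ; id∈  = resp (pt λ _ → refl) id∈
        ; ∙∈   = λ a b → resp (pt λ _ → refl) (∙∈ a b)
        ; ⁻¹∈  = λ a → resp (pt λ _ → refl) (⁻¹∈ a) }

      rowGroup-closed : Closed₃ rowGroup
      rowGroup-closed f h = cl₃ (liftᴮ f) λ (x , y) (x' , y') (x″ , y″) →
        let (k , k∈ , e , e' , e″) = h x x' x″ in liftᴮ k , k∈ , cong (_, y) e , cong (_, y') e' , cong (_, y″) e″

      private
        module RG = Group rowGroup
        module RT = Transitivity _≟ᴮ_ rowGroup

      σₚ : Perm B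
      σₚ = rowPerm R

      σ∈ : RG.mem σₚ
      σ∈ = resp (pt λ (x , y) → trans (cong (to (shift (0ᴮ , - mean))) (g-form x y)) (cong₂ _,_ (⊕-identityˡ (σ x)) (+-cancelˡ mean y)))
        (∙∈ (sh∈ (0ᴮ , - mean)) g∈)

      tr : B → Perm B
      tr b = perm (b ⊕_) (b ⊕_) (⊕-cancel b) (⊕-cancel b)

      tr∈ : ∀ b → RG.mem (tr b)
      tr∈ b = resp (pt λ (x , y) → cong (b ⊕ x ,_) (+-identityˡ y)) (sh∈ (b , 0#))

      cj : B → Perm B
      cj e = tr e ∙ σₚ ∙ tr e

      cj∈ : ∀ e → RG.mem (cj e)
      cj∈ e = RG.∙∈ {tr e} {σₚ ∙ tr e} (tr∈ e) (RG.∙∈ {σₚ} {tr e} σ∈ (tr∈ e))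

      Reach : (B → Set) → B → Set
      Reach W x = ∃ λ ρ → RG.mem ρ × (∀ w → W w → to ρ w ≡ w) × to ρ b₃ ≡ x

      reach-start : ∀ {W} → Reach W b₃
      reach-start = idₚ , RG.id∈ , (λ _ _ → refl) , refl

      reach-by : ∀ {W} J → RG.mem J → (∀ w → W w → to J w ≡ w) → ∀ {x x'} → to J x ≡ x' → Reach W x → Reach W x'
      reach-by J J∈ fixJ e (ρ , ρ∈ , fix , d) =
        J ∙ ρ , RG.∙∈ {J} {ρ} J∈ ρ∈ , (λ w Ww → trans (cong (to J) (fix w Ww)) (fixJ w Ww)) , trans (cong (to J) d) e

      reach-back : ∀ {W} J → RG.mem J → (∀ w → W w → to J w ≡ w) → ∀ {x x'} → to J x' ≡ x → Reach W x → Reach W x'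
      reach-back J J∈ fixJ e = reach-by (J ⁻¹) (RG.⁻¹∈ {J} J∈) (λ w Ww → from-≡ J (fixJ w Ww)) (from-≡ J e)

      reach-off : ∀ {W} → (∀ x → Dec (W x)) → (∀ x → ¬ W x → Reach W x) → RT.TransOff W
      reach-off W? h = RT.transOff W? λ u v nu nv → let (ρ , ρ∈ , fix , e) = h u nu ; (π , π∈ , fix' , e') = h v nv in
        π ∙ ρ ⁻¹ , RG.∙∈ {π} {ρ ⁻¹} π∈ (RG.⁻¹∈ {ρ} ρ∈) , (λ w Ww → trans (cong (to π) (from-≡ ρ (fix w Ww))) (fix' w Ww)) ,
        trans (cong (to π) (from-≡ ρ e)) e'

      lift∈ : ∀ ρ → mem (liftᴮ ρ)
      lift∈ = RT.all-perms rowGroup-closed (λ u v → tr (u ⊕ v) , tr∈ (u ⊕ v) , ⊕-to u v) {0ᴮ} {e₁} (λ ()) off₁ off₂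
        where
        cj-value : ∀ e {x x'} → σ (e ⊕ x) ≡ x' → to (cj e) x ≡ e ⊕ x'
        cj-value e d = cong (e ⊕_) d
        off₁ : RT.TransOff (_≡ 0ᴮ)
        off₁ = reach-off (_≟ᴮ 0ᴮ) (connect₁ {Reach (_≡ 0ᴮ)} reach-start
          (λ x → reach-by σₚ σ∈ (λ { _ refl → s0 }) refl)
          (reach-back (cj e₁) (cj∈ e₁) (λ { _ refl → cj-value e₁ {0ᴮ} {e₁} s1 }) (cj-value e₁ {e₂} {e₃} s3))
          (reach-back (cj e₂) (cj∈ e₂) (λ { _ refl → cj-value e₂ {0ᴮ} {e₂} s2 }) (cj-value e₂ {e₁} {e₃} s3)))
        W : B → Set
        W x = x ≡ 0ᴮ ⊎ x ≡ e₁
        off₂ : RT.TransOff W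
        off₂ = reach-off (λ x → (x ≟ᴮ 0ᴮ) Relation.Nullary.Decidable.⊎-dec (x ≟ᴮ e₁)) λ x nW → connect {Reach W} reach-start
          (λ x → reach-by σₚ σ∈ (λ { _ (inj₁ refl) → s0 ; _ (inj₂ refl) → s1 }) refl)
          (reach-back (cj e₁) (cj∈ e₁) (λ { _ (inj₁ refl) → cj-value e₁ {0ᴮ} {e₁} s1 ; _ (inj₂ refl) → cj-value e₁ {e₁} {0ᴮ} s0 })
            (cj-value e₁ {e₂} {e₃} s3))
          x (nW ∘ inj₁) (nW ∘ inj₂)

      row-off⇒good : Transitivity.TransOff _≟ⱽ_ A (Row 0ᴮ) → Good S
      row-off⇒good row0 = star-good (liftᴮ exₚ) (lift∈ exₚ) refl
          (trans (cong (λ r → ex r , proj₂ (star 1)) (trans (star-row 1) s3)) (cong (_, proj₂ (star 1)) (sym (trans (star-row 1) s3)))) refl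
          λ v is n n' is' → star-not-special is' (ex-special (proj₁ v) (star-not-special is) n n')
        where
        open Star row0
        exₚ : Perm B
        exₚ = perm ex ex ex-invol ex-invol

module Levels where

  open import Data.Nat.Primality
  open import Data.Product hiding (map; swap)
  open import Data.Sum using (_⊎_; inj₁; inj₂)
  open import Data.Empty
  open import Function using (_∘_)
  open import Relation.Nullary
  open import Relation.Nullary.Decidable using (_×-dec_; ¬?; from-yes)
  open import Relation.Binary.PropositionalEquality hiding (resp)
  open Count
  open Perms
  open Space
  open Stage2 using (module Normalise)
  open Shifts
  open Cycles
  open Transitive
  open Moving
  open Constant

  open Swap _≟ᴮ_

  Avoids : B → B → B → B → B → Set
  Avoids a b c d s = s ≢ a × s ≢ b × s ≢ c × s ≢ d

  avoids? : ∀ a b c d s → Dec (Avoids a b c d s)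
  avoids? a b c d s = ¬? (s ≟ᴮ a) ×-dec ¬? (s ≟ᴮ b) ×-dec ¬? (s ≟ᴮ c) ×-dec ¬? (s ≟ᴮ d)

  abstract
    avoid : ∀ a b c d → ∃ (Avoids a b c d)
    avoid = from-yes (FinB.∀? λ a → FinB.∀? λ b → FinB.∀? λ c → FinB.∀? λ d → FinB.∃? (avoids? a b c d))

  commutes-not : ∀ (α β : Perm B) {x p} → to α x ≢ x → to β p ≢ p →
                 ∃ λ ρ → ∃ λ y → to α (to (ρ ∙ β ∙ ρ ⁻¹) y) ≢ to (ρ ∙ β ∙ ρ ⁻¹) (to α y)
  commutes-not α β {x} {p} αx≢x q≢p = pick (avoid p q q q)
    where
    q : B
    q = to β p
    pick : ∃ (Avoids p q q q) → _
    pick (r , r≢p , r≢q , _) = place (moving₂ (r≢p ∘ sym) (αx≢x ∘ sym)) (avoid p q r (to β r))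
      where
      value : ∀ ρ {a b} → to ρ a ≡ b → to (ρ ∙ β ∙ ρ ⁻¹) b ≡ to ρ (to β a)
      value ρ e = cong (to ρ ∘ to β) (from-≡ ρ e)
      place : (∃ λ ρ → to ρ p ≡ x × to ρ r ≡ to α x) → ∃ (Avoids p q r (to β r)) → _
      place (ρ , ρp , ρr) (s , s≢p , s≢q , s≢r , s≢βr) = decide (to α (to ρ q) ≟ᴮ to ρ (to β r))
        where
        ρ' : Perm B
        ρ' = ρ ∙ swap q s
        stays : ∀ {a} → a ≢ q → a ≢ s → to ρ' a ≡ to ρ a
        stays n n' = cong (to ρ) (sw-other n n')
        ρ'q : to ρ' q ≡ to ρ s
        ρ'q = cong (to ρ) (sw-a q s)
        βr≢q : to β r ≢ q
        βr≢q e = r≢p (to-inj β e)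
        decide : Dec (to α (to ρ q) ≡ to ρ (to β r)) →
                 ∃ λ ρ → ∃ λ y → to α (to (ρ ∙ β ∙ ρ ⁻¹) y) ≢ to (ρ ∙ β ∙ ρ ⁻¹) (to α y)
        decide (no ne) = ρ , x , λ e → ne (trans (cong (to α) (sym (value ρ ρp))) (trans e (value ρ ρr)))
        decide (yes d) = ρ' , x , λ e → s≢q (to-inj ρ (to-inj α (trans (cong (to α) (sym (trans (value ρ' ρ'p) ρ'q)))
            (trans e (trans (value ρ' ρ'r) (trans (stays βr≢q (s≢βr ∘ sym)) (sym d)))))))
          where
          ρ'p : to ρ' p ≡ x
          ρ'p = trans (stays (q≢p ∘ sym) (s≢p ∘ sym)) ρp
          ρ'r : to ρ' r ≡ to α x
          ρ'r = trans (stays r≢q (s≢r ∘ sym)) ρr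

  module Preserving (pr : Prime 5) where
    open Space.Space 4 pr

    record Lev (k : Perm V) : Set where
      constructor lev
      field level : ∀ v → proj₂ (to k v) ≡ proj₂ v
    open Lev public

    lev-∙ : ∀ {k l} → Lev k → Lev l → Lev (k ∙ l)
    lev-∙ a b = lev λ v → trans (level a _) (level b v)

    lev-⁻¹ : ∀ {k} → Lev k → Lev (k ⁻¹)
    lev-⁻¹ {k} a = lev λ v → trans (sym (level a _)) (cong proj₂ (to-from k v))

    at-level : ∀ {k} → Lev k → ∀ x y → to k (x , y) ≡ (proj₁ (to k (x , y)) , y)
    at-level {k} a x y = cong (proj₁ (to k (x , y)) ,_) (level a (x , y))

    abstract
      restrict-inverse : ∀ {k} (a : Lev k) y x → proj₁ (to k (proj₁ (from k (x , y)) , y)) ≡ x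
      restrict-inverse {k} a y x = cong proj₁ (trans (cong (to k) (sym (at-level (lev-⁻¹ {k} a) x y))) (to-from k (x , y)))

    restrict : ∀ k → Lev k → F → Perm B
    restrict k a y = perm (λ x → proj₁ (to k (x , y))) (λ x → proj₁ (from k (x , y)))
      (restrict-inverse a y) (restrict-inverse (lev-⁻¹ {k} a) y)

  module LevelGroup (pr : Prime 5) (S : Space.Space.Instance 4 pr) where
    open Space.Space 4 pr
    open Instance S
    open RowShifts 4 pr S
    open Normalise 4 pr using (liftᴮ)
    open Preserving pr

    module FromLift (lift∈ : ∀ ρ → mem (liftᴮ ρ)) where

      lev-lift : ∀ ρ → Lev (liftᴮ ρ)
      lev-lift ρ = lev λ _ → refl

      record Mover (Z : F → Set) (y : F) : Set where
        field
          k     : Perm V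
          k∈    : mem k
          k-lev : Lev k
          fixes : ∀ a → Z a → ∀ x → to k (x , a) ≡ (x , a)
          x₀ x₁ : B
          x₀≢x₁ : x₀ ≢ x₁
          moves : to k (x₀ , y) ≡ (x₁ , y)

      carry : ∀ {Z y} → Mover Z y → ∀ x x' → ∃ λ k → mem k × Lev k × (∀ a → Z a → ∀ x → to k (x , a) ≡ (x , a)) × to k (x , y) ≡ (x' , y)
      carry {Z} {y} M x x' = go (x ≟ᴮ x')
        where
        open Mover M
        go : Dec (x ≡ x') → ∃ λ k → mem k × Lev k × (∀ a → Z a → ∀ x → to k (x , a) ≡ (x , a)) × to k (x , y) ≡ (x' , y)
        go (yes e) = idₚ , id∈ , lev (λ _ → refl) , (λ _ _ _ → refl) , cong (_, y) e
        go (no ne) = let (ρ , e , e') = moving₂ x₀≢x₁ ne in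
          liftᴮ ρ ∙ k ∙ liftᴮ ρ ⁻¹ , ∙∈ (lift∈ ρ) (∙∈ k∈ (⁻¹∈ (lift∈ ρ))) ,
          lev-∙ {liftᴮ ρ} (lev-lift ρ) (lev-∙ {k} k-lev (lev-⁻¹ {liftᴮ ρ} (lev-lift ρ))) ,
          (λ a Za t → trans (cong (to (liftᴮ ρ)) (fixes a Za _)) (cong (_, a) (to-from ρ t))) ,
          trans (cong (λ t → to (liftᴮ ρ) (to k (t , y))) (from-≡ ρ e)) (trans (cong (to (liftᴮ ρ)) moves) (cong (_, y) e'))

      module _ (mover : ∀ {a y} → y ≢ a → Mover (_≡ a) y) where

        mover₂ : ∀ {a b y} → y ≢ a → y ≢ b → Mover (λ l → l ≡ a ⊎ l ≡ b) y
        mover₂ {a} {b} {y} na nb = go (commutes-not (restrict M.k M.k-lev y) (restrict N.k N.k-lev y) {M.x₀} {N.x₀}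
            (λ e → M.x₀≢x₁ (trans (sym e) (cong proj₁ M.moves))) (λ e → N.x₀≢x₁ (trans (sym e) (cong proj₁ N.moves))))
          where
          module M = Mover (mover na)
          module N = Mover (mover nb)
          α β : Perm B
          α = restrict M.k M.k-lev y
          β = restrict N.k N.k-lev y
          go : (∃ λ ρ → ∃ λ v → to α (to (ρ ∙ β ∙ ρ ⁻¹) v) ≢ to (ρ ∙ β ∙ ρ ⁻¹) (to α v)) → Mover (λ l → l ≡ a ⊎ l ≡ b) y
          go (ρ , v , ne) = record
            { k = κ ; k∈ = ∙∈ M.k∈ (∙∈ N'∈ (∙∈ (⁻¹∈ M.k∈) (⁻¹∈ N'∈)))
            ; k-lev = lev-∙ {M.k} M.k-lev (lev-∙ {N'} N'-lev (lev-∙ {M.k ⁻¹} (lev-⁻¹ {M.k} M.k-lev) (lev-⁻¹ {N'} N'-lev)))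
            ; fixes = λ { l (inj₁ refl) x → fix-a x ; l (inj₂ refl) x → fix-b x }
            ; x₀ = to β' (to α v) ; x₁ = to α (to β' v) ; x₀≢x₁ = ne ∘ sym
            ; moves = trans (cong (to M.k ∘ to N' ∘ from M.k) (from-≡ N' (N'-at (to α v))))
                (trans (cong (to M.k ∘ to N') (from-≡ M.k (M-at v))) (trans (cong (to M.k) (N'-at v)) (M-at (to β' v)))) }
            where
            N' κ : Perm V
            N' = liftᴮ ρ ∙ N.k ∙ liftᴮ ρ ⁻¹
            κ = M.k ∙ N' ∙ M.k ⁻¹ ∙ N' ⁻¹
            β' : Perm B
            β' = ρ ∙ β ∙ ρ ⁻¹
            N'∈ : mem N'
            N'∈ = ∙∈ (lift∈ ρ) (∙∈ N.k∈ (⁻¹∈ (lift∈ ρ)))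
            N'-lev : Lev N'
            N'-lev = lev-∙ {liftᴮ ρ} (lev-lift ρ) (lev-∙ {N.k} N.k-lev (lev-⁻¹ {liftᴮ ρ} (lev-lift ρ)))
            M-at : ∀ x → to M.k (x , y) ≡ (to α x , y)
            M-at x = at-level M.k-lev x y
            N'-at : ∀ x → to N' (x , y) ≡ (to β' x , y)
            N'-at x = at-level N'-lev x y
            N'-fix : ∀ x → to N' (x , b) ≡ (x , b)
            N'-fix x = trans (cong (to (liftᴮ ρ)) (N.fixes b refl _)) (cong (_, b) (to-from ρ x))
            fix-a : ∀ x → to κ (x , a) ≡ (x , a)
            fix-a x = trans (cong (to M.k ∘ to N') (from-≡ M.k (trans (cong (to M.k) (at-level (lev-⁻¹ {N'} N'-lev) x a))
                (trans (M.fixes a refl _) (sym (at-level (lev-⁻¹ {N'} N'-lev) x a))))))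
              (trans (cong (to M.k) (to-from N' (x , a))) (M.fixes a refl x))
            fix-b : ∀ x → to κ (x , b) ≡ (x , b)
            fix-b x = trans (cong (to M.k ∘ to N' ∘ from M.k) (from-≡ N' (N'-fix x)))
              (trans (cong (to M.k ∘ to N') (at-level (lev-⁻¹ {M.k} M.k-lev) x b))
                (trans (cong (to M.k) (N'-fix _)) (trans (cong (to M.k) (sym (at-level (lev-⁻¹ {M.k} M.k-lev) x b))) (to-from M.k (x , b)))))

        level-preserving∈ : ∀ f → Lev f → mem f
        level-preserving∈ f f-lev = cl₃ f λ u v w → go u v w (proj₂ v ≟ᶠ proj₂ u) (proj₂ w ≟ᶠ proj₂ u) (proj₂ w ≟ᶠ proj₂ v)
          where
          record Partial (Z : F → Set) : Set where
            field
              k      : Perm V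
              k∈     : mem k
              k-lev  : Lev k
              agrees : ∀ x a → Z a → to k (x , a) ≡ to f (x , a)
          start : ∀ a → Partial (_≡ a)
          start a = record { k = liftᴮ (restrict f f-lev a) ; k∈ = lift∈ (restrict f f-lev a) ; k-lev = lev-lift (restrict f f-lev a)
                           ; agrees = λ { x _ refl → sym (at-level f-lev x a) } }
          extend : ∀ {Z y} (K : Partial Z) → Mover Z y → ∀ x → ∃ λ k → mem k × Lev k ×
                   (∀ v → to (Partial.k K) v ≡ to f v → Z (proj₂ v) → to k v ≡ to f v) × to k (x , y) ≡ to f (x , y)
          extend {Z} {y} K M x = finish (carry M (proj₁ (to K.k (x , y))) (proj₁ (to f (x , y))))
            where
            module K = Partial K
            finish : (∃ λ l → mem l × Lev l × (∀ r → Z r → ∀ x → to l (x , r) ≡ (x , r)) × to l (proj₁ (to K.k (x , y)) , y) ≡ (proj₁ (to f (x , y)) , y)) →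
                     ∃ λ k → mem k × Lev k × (∀ v → to K.k v ≡ to f v → Z (proj₂ v) → to k v ≡ to f v) × to k (x , y) ≡ to f (x , y)
            finish (l , l∈ , l-lev , fix , e) = l ∙ K.k , ∙∈ l∈ K.k∈ , lev-∙ {l} l-lev K.k-lev ,
              (λ v d Zv → trans (cong (to l) d) (trans (cong (to l) (at-level f-lev _ _)) (trans (fix _ Zv _) (sym (at-level f-lev _ _))))) ,
              trans (cong (to l) (at-level K.k-lev x y)) (trans e (sym (at-level f-lev x y)))
          Triple : V → V → V → Set
          Triple u v w = ∃ λ k → mem k × to k u ≡ to f u × to k v ≡ to f v × to k w ≡ to f w
          go : ∀ u v w → Dec (proj₂ v ≡ proj₂ u) → Dec (proj₂ w ≡ proj₂ u) → Dec (proj₂ w ≡ proj₂ v) → Triple u v w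
          go (x , a) (x' , b) (x″ , c) (yes e) (yes e') _ = let open Partial (start a) in
            k , k∈ , agrees x a refl , agrees x' b e , agrees x″ c e'
          go (x , a) (x' , b) (x″ , c) (yes e) (no n) _ = let (k , k∈ , _ , keep , d) = extend (start a) (mover n) x″ in
            k , k∈ , keep (x , a) (Partial.agrees (start a) x a refl) refl , keep (x' , b) (Partial.agrees (start a) x' b e) e , d
          go (x , a) (x' , b) (x″ , c) (no n) (yes e) _ = let (k , k∈ , _ , keep , d) = extend (start a) (mover n) x' in
            k , k∈ , keep (x , a) (Partial.agrees (start a) x a refl) refl , d , keep (x″ , c) (Partial.agrees (start a) x″ c e) e
          go (x , a) (x' , b) (x″ , c) (no n) (no _) (yes e) = let (k , k∈ , _ , keep , d) = extend (start b) (mover (n ∘ sym)) x in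
            k , k∈ , d , keep (x' , b) (Partial.agrees (start b) x' b refl) refl , keep (x″ , c) (Partial.agrees (start b) x″ c e) e
          go (x , a) (x' , b) (x″ , c) (no n) (no n') (no n″) = second (extend (start a) (mover n) x')
            where
            second : (∃ λ k → mem k × Lev k × (∀ v → to (Partial.k (start a)) v ≡ to f v → proj₂ v ≡ a → to k v ≡ to f v) ×
                     to k (x' , b) ≡ to f (x' , b)) → Triple (x , a) (x' , b) (x″ , c)
            second (k , k∈ , k-lev , keep , d) = third (carry (mover₂ n' n″) (proj₁ (to k (x″ , c))) (proj₁ (to f (x″ , c))))
              where
              third : (∃ λ l → mem l × Lev l × (∀ r → r ≡ a ⊎ r ≡ b → ∀ x → to l (x , r) ≡ (x , r)) ×
                       to l (proj₁ (to k (x″ , c)) , c) ≡ (proj₁ (to f (x″ , c)) , c)) → Triple (x , a) (x' , b) (x″ , c)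
              third (l , l∈ , l-lev , fix , e) = l ∙ k , ∙∈ l∈ k∈ ,
                stay a (inj₁ refl) x (keep (x , a) (Partial.agrees (start a) x a refl) refl) , stay b (inj₂ refl) x' d ,
                trans (cong (to l) (at-level k-lev x″ c)) (trans e (sym (at-level f-lev x″ c)))
                where
                stay : ∀ r → r ≡ a ⊎ r ≡ b → ∀ t → to k (t , r) ≡ to f (t , r) → to l (to k (t , r)) ≡ to f (t , r)
                stay r Zr t q = trans (cong (to l) (trans q (at-level f-lev t r))) (trans (fix r Zr _) (sym (at-level f-lev t r)))

module Involution where

  open import Data.Nat as ℕ using (ℕ; zero; suc)
  import Data.Nat.Properties as ℕP
  open import Data.Nat.Primality
  open import Data.Fin using (zero; suc; toℕ)
  import Data.Fin.Properties as FinP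
  open import Data.Product hiding (map; swap)
  open import Data.Sum using (_⊎_; inj₁; inj₂)
  open import Data.Empty
  open import Function using (_∘_)
  open import Relation.Nullary
  open import Relation.Nullary.Decidable using (_×-dec_; ¬?; decidable-stable)
  open import Relation.Binary.PropositionalEquality hiding (resp)
  import Relation.Binary.PropositionalEquality.Properties as ≡P
  open Count
  open Perms
  open Space
  open Stage2 using (e₂; module Normalise)
  open Shifts
  open Cycles
  open Transitive
  open Moving
  open Constant
  open Levels

  open Swap _≟ᴮ_

  module Involutive (pr : Prime 5) (S : Space.Space.Instance 4 pr) where
    open Space.Space 4 pr
    open Instance S
    open RowShifts 4 pr S
    open MovingRows pr S
    open ConstantShifts pr S
    open Odd 2≢0 using () renaming (two to double≢0)
    open Normalise 4 pr using (liftᴮ)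
    open Preserving pr
    open LevelGroup pr S

    module Given₂ (ψ : Perm V) (ψ∈ : ∀ v → mem (ψ ⁻¹ ∙ shift v ∙ ψ)) (R : RowAffine (ψ ⁻¹ ∙ z ∙ ψ))
                  (std : Standard (RowAffine.σ R)) (only-constants : ∀ u → T u → ∀ x x' → u x ≡ u x') where
      open Given ψ ψ∈ R std
      open Const ψ ψ∈ R std only-constants
      open FromLift lift∈

      b : B
      b = proj₁ (to ψ (e₁ , 0#)) ⊕ proj₁ (to ψ (0ᴮ , 0#))

      q : Perm V
      q = ψ ⁻¹ ∙ tᴮ b ∙ ψ

      q∈ : mem q
      q∈ = ψ∈ (b , 0#)

      q-invol : ∀ v → to q (to q v) ≡ v
      q-invol v = trans (cong (from ψ ∘ to (tᴮ b)) (to-from ψ _)) (trans (cong (from ψ) (go (to ψ v))) (from-to ψ v))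
        where
        go : ∀ v → (b , 0#) ⊞ ((b , 0#) ⊞ v) ≡ v
        go (x , y) = cong₂ _,_ (⊕-cancel b x) (trans (cong (0# +_) (+-identityˡ y)) (+-identityˡ y))

      q-g : ∀ v → to q (to g v) ≡ to g (to q v)
      q-g v = trans (cong (from ψ ∘ to (tᴮ b)) (to-from ψ _)) (trans (cong (from ψ) (go (to ψ v)))
          (cong (from ψ ∘ to z) (sym (to-from ψ _))))
        where
        go : ∀ v → (b , 0#) ⊞ ((0ᴮ , 1#) ⊞ v) ≡ (0ᴮ , 1#) ⊞ ((b , 0#) ⊞ v)
        go (x , y) = cong₂ _,_ (trans (cong (b ⊕_) (⊕-identityˡ x)) (sym (⊕-identityˡ (b ⊕ x))))
          (solve 1 (λ y → con (0 , 0) :+ (con (1 , 0) :+ y) := con (1 , 0) :+ (con (0 , 0) :+ y)) refl y)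

      q-iter : ∀ j v → to q (iter (to g) j v) ≡ iter (to g) j (to q v)
      q-iter zero    v = refl
      q-iter (suc j) v = trans (q-g _) (cong (to g) (q-iter j v))

      g-iter : ∀ j x y → iter (to g) j (x , y) ≡ (iter σ j x , ⟦ j ⟧ * mean + y)
      g-iter zero    x y = cong (x ,_) (solve 2 (λ s y → y := con (0 , 0) :* s :+ y) refl mean y)
      g-iter (suc j) x y = trans (cong (to g) (g-iter j x y)) (trans (g-form _ _) (cong (iter σ (suc j) x ,_)
        (trans (solve 3 (λ s j y → s :+ (j :* s :+ y) := (con (1 , 0) :+ j) :* s :+ y) refl mean ⟦ j ⟧ y)
          (cong (λ t → t * mean + y) (sym (⟦+⟧ 1 j))))))

      iter-fixed : ∀ {x} → σ x ≡ x → ∀ j → iter σ j x ≡ x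
      iter-fixed e zero    = refl
      iter-fixed e (suc j) = trans (cong σ (iter-fixed e j)) e

      index : F → F
      index y = y * proj₁ (inv mean≢0)

      index-mean : ∀ y → ⟦ toℕ (index y) ⟧ * mean ≡ y
      index-mean y = trans (cong (_* mean) (⟦toℕ⟧ _)) (trans (*-assoc y _ _) (trans (cong (y *_) (proj₂ (inv mean≢0))) (*-identityʳ y)))

      g-reaches : ∀ {x} → σ x ≡ x → ∀ y y' → iter (to g) (toℕ (index y)) (x , y') ≡ (x , y + y')
      g-reaches {x} e y y' = trans (g-iter (toℕ (index y)) x y') (cong₂ _,_ (iter-fixed e (toℕ (index y))) (cong (_+ y') (index-mean y)))

      D : F
      D = proj₂ (to q (0ᴮ , 0#))

      q-start : to q (0ᴮ , 0#) ≡ (e₁ , D)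
      q-start = cong (_, D) (trans (cong proj₁ along) (trans (cong proj₁ (g-iter j e₁ 0#)) (iter-fixed s1 j)))
        where
        j : ℕ
        j = toℕ (proj₂ (to ψ (0ᴮ , 0#)) + - proj₂ (to ψ (e₁ , 0#)))
        go : ∀ v w → (proj₁ v ⊕ proj₁ w , 0#) ⊞ w ≡ iter (to z) (toℕ (proj₂ w + - proj₂ v)) v
        go (x , y) (x' , y') = trans (cong₂ _,_ (⊕-cancelʳ x x')
          (trans (solve 2 (λ y w → con (0 , 0) :+ w := (w :+ :- y) :+ y) refl y y') (cong (_+ y) (sym (⟦toℕ⟧ _)))))
          (sym (Stage1.iter-z 4 pr (toℕ (y' + - y)) x y))
        along : to q (0ᴮ , 0#) ≡ iter (to g) j (e₁ , 0#)
        along = trans (cong (from ψ) (go (to ψ (e₁ , 0#)) (to ψ (0ᴮ , 0#)))) (sym (Stage1.iter-conj ψ z j (e₁ , 0#)))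

      q0 : ∀ y → to q (0ᴮ , y) ≡ (e₁ , y + D)
      q0 y = trans (cong (to q) (sym (trans (g-reaches s0 y 0#) (cong (0ᴮ ,_) (+-identityʳ y)))))
        (trans (q-iter (toℕ (index y)) _) (trans (cong (iter (to g) (toℕ (index y))) q-start) (g-reaches s1 y D)))

      q1 : ∀ y → to q (e₁ , y) ≡ (0ᴮ , y + - D)
      q1 y = trans (cong (to q) (sym (trans (q0 _) (cong (e₁ ,_) (solve 2 (λ y d → (y :+ :- d) :+ d := y) refl y D))))) (q-invol _)

      q-free : ∀ v → to q v ≢ v
      q-free v e = impossible (trans (sym q-start) (trans (cong (from ψ) (go (to ψ (0ᴮ , 0#)))) (from-to ψ _)))
        where
        impossible : ∀ {d} → ¬ (_≡_ {A = V} (e₁ , d) (0ᴮ , 0#))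
        impossible ()
        b≡0 : b ≡ 0ᴮ
        b≡0 = trans (sym (⊕-cancelʳ b _)) (trans (cong (_⊕ proj₁ (to ψ v)) (cong proj₁ (trans (sym (to-from ψ _)) (cong (to ψ) e))))
          (⊕-self (proj₁ (to ψ v))))
        go : ∀ w → (b , 0#) ⊞ w ≡ w
        go (x , y) = cong₂ _,_ (trans (cong (_⊕ x) b≡0) (⊕-identityˡ x)) (+-identityˡ y)

      q-row-e₁ : ∀ {v} → proj₁ (to q v) ≡ e₁ → proj₁ v ≡ 0ᴮ
      q-row-e₁ {v} e = cong proj₁ (trans (sym (q-invol v)) (trans (cong (λ x → to q (x , proj₂ (to q v))) e) (q1 _)))

      q-row-0 : ∀ {v} → proj₁ (to q v) ≡ 0ᴮ → proj₁ v ≡ e₁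
      q-row-0 {v} e = cong proj₁ (trans (sym (q-invol v)) (trans (cong (λ x → to q (x , proj₂ (to q v))) e) (q0 _)))

      Fused : Set
      Fused = ∃ λ x → ∃ λ x' → ∃ λ y → x ≢ 0ᴮ × x' ≢ 0ᴮ × proj₂ (to q (x , y)) ≢ proj₂ (to q (x' , y))

      fused? : Dec Fused
      fused? = FinB.∃? λ x → FinB.∃? λ x' → FinF.∃? λ y →
        ¬? (x ≟ᴮ 0ᴮ) ×-dec ¬? (x' ≟ᴮ 0ᴮ) ×-dec ¬? (proj₂ (to q (x , y)) ≟ᶠ proj₂ (to q (x' , y)))

      module Fuse {x x' y} (x≢0 : x ≢ 0ᴮ) (x'≢0 : x' ≢ 0ᴮ) (differ : proj₂ (to q (x , y)) ≢ proj₂ (to q (x' , y))) where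
        open Transitivity _≟ⱽ_ A

        ρ̂ : Perm V
        ρ̂ = liftᴮ (swap x x')

        k : Perm V
        k = q ∙ ρ̂ ∙ q

        k∈ : mem k
        k∈ = ∙∈ {q} {ρ̂ ∙ q} q∈ (∙∈ {ρ̂} {q} (lift∈ (swap x x')) q∈)

        FixesE₁ : Perm V → Set
        FixesE₁ k = ∀ w → Row e₁ w → to k w ≡ w

        k-fixes : FixesE₁ k
        k-fixes (_ , y) refl = trans (cong (to q ∘ to ρ̂) (q1 y)) (trans (cong (λ r → to q (r , y + - D)) (sw-other (x≢0 ∘ sym) (x'≢0 ∘ sym)))
          (trans (q0 _) (cong (e₁ ,_) (solve 2 (λ y d → (y :+ :- d) :+ d := y) refl y D))))

        u u' : B
        a a' : F
        u = proj₁ (to q (x , y))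
        a = proj₂ (to q (x , y))
        u' = proj₁ (to q (x' , y))
        a' = proj₂ (to q (x' , y))

        k-moves : to k (u , a) ≡ (u' , a')
        k-moves = trans (cong (to q ∘ to ρ̂) (q-invol (x , y))) (cong (λ r → to q (r , y)) (sw-a x x'))

        Reaches : F → Set
        Reaches t = ∀ w → w ≢ e₁ → ∃ λ l → mem l × FixesE₁ l × to l (u , a) ≡ (w , t)

        lift-swap-fixes : ∀ {v w} → v ≢ e₁ → w ≢ e₁ → FixesE₁ (liftᴮ (swap v w))
        lift-swap-fixes nv nw (_ , y) refl = cong (_, y) (sw-other (nv ∘ sym) (nw ∘ sym))

        u≢ : u ≢ e₁
        u≢ e = x≢0 (q-row-e₁ {x , y} e)
        u'≢ : u' ≢ e₁
        u'≢ e = x'≢0 (q-row-e₁ {x' , y} e)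

        begin : Reaches a
        begin w nw = liftᴮ (swap u w) , lift∈ (swap u w) , lift-swap-fixes u≢ nw , cong (_, a) (sw-a u w)

        advance : ∀ t → Reaches t → Reaches (t + (a' + - a))
        advance t r w nw = go (r u u≢)
          where
          sw' shifted : Perm V
          sw' = liftᴮ (swap u' w)
          shifted = shift (0ᴮ , t + - a) ∙ k ∙ shift (0ᴮ , - (t + - a))
          shifted∈ : mem shifted
          shifted∈ = ∙∈ {shift (0ᴮ , t + - a)} {k ∙ shift (0ᴮ , - (t + - a))} (sh∈ (0ᴮ , t + - a))
            (∙∈ {k} {shift (0ᴮ , - (t + - a))} k∈ (sh∈ (0ᴮ , - (t + - a))))
          shifted-fixes : FixesE₁ shifted
          shifted-fixes (_ , y) refl = trans (cong (to (shift (0ᴮ , t + - a))) (k-fixes (e₁ , - (t + - a) + y) refl))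
            (cong (e₁ ,_) (+-cancelˡ' (t + - a) y))
          shifted-moves : to shifted (u , t) ≡ (u' , t + (a' + - a))
          shifted-moves = trans (cong (to (shift (0ᴮ , t + - a)) ∘ to k) (cong₂ _,_ (⊕-identityˡ u)
              (solve 2 (λ t a → :- (t :+ :- a) :+ t := a) refl t a)))
            (trans (cong (to (shift (0ᴮ , t + - a))) k-moves) (cong₂ _,_ (⊕-identityˡ u')
              (solve 3 (λ t a b → (t :+ :- a) :+ b := t :+ (b :+ :- a)) refl t a a')))

          go : (∃ λ l → mem l × FixesE₁ l × to l (u , a) ≡ (u , t)) →
               ∃ λ l → mem l × FixesE₁ l × to l (u , a) ≡ (w , t + (a' + - a))
          go (l , l∈ , fix , e) = sw' ∙ shifted ∙ l ,
            ∙∈ {sw'} {shifted ∙ l} (lift∈ (swap u' w)) (∙∈ {shifted} {l} shifted∈ l∈) ,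
            (λ v ev → trans (cong (to sw' ∘ to shifted) (fix v ev))
              (trans (cong (to sw') (shifted-fixes v ev)) (lift-swap-fixes u'≢ nw v ev))) ,
            trans (cong (to sw' ∘ to shifted) e) (trans (cong (to sw') shifted-moves) (cong (_, t + (a' + - a)) (sw-a u' w)))

        multiples : ∀ j → Reaches (a + ⟦ j ⟧ * (a' + - a))
        multiples zero    = subst Reaches (solve 2 (λ a d → a := a :+ con (0 , 0) :* d) refl a (a' + - a)) begin
        multiples (suc j) = subst Reaches (trans (solve 3 (λ a j d → (a :+ j :* d) :+ d := a :+ (con (1 , 0) :+ j) :* d) refl a ⟦ j ⟧ (a' + - a))
          (cong (λ t → a + t * (a' + - a)) (sym (⟦+⟧ 1 j)))) (advance _ (multiples j))

        d≢0 : a' + - a ≢ 0#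
        d≢0 e = differ (trans (solve 2 (λ a b → a := b :+ :- (b :+ :- a)) refl a a') (trans (cong (λ t → a' + - t) e)
          (solve 1 (λ b → b :+ :- con (0 , 0) := b) refl a')))

        reach : ∀ t → Reaches t
        reach t = subst Reaches (trans (cong (λ s → a + s * (a' + - a)) (⟦toℕ⟧ j))
          (trans (solve 4 (λ a t i d → a :+ ((t :+ :- a) :* i) :* d := a :+ (t :+ :- a) :* (i :* d)) refl a t (proj₁ (inv d≢0)) (a' + - a))
            (trans (cong (λ s → a + (t + - a) * s) (proj₂ (inv d≢0))) (solve 2 (λ a t → a :+ (t :+ :- a) :* con (1 , 0) := t) refl a t))))
          (multiples (toℕ j))
          where
          j : F
          j = (t + - a) * proj₁ (inv d≢0)

        row-e₁ : TransOff (Row e₁)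
        row-e₁ = transOff (λ v → proj₁ v ≟ᴮ e₁) λ (v , s) (w , t) nv nw →
          let (l , l∈ , fix , e) = reach s v nv ; (l' , l'∈ , fix' , e') = reach t w nw in
          l' ∙ l ⁻¹ , ∙∈ l'∈ (⁻¹∈ l∈) , (λ r er → trans (cong (to l') (from-≡ l (fix r er))) (fix' r er)) ,
          trans (cong (to l') (from-≡ l e)) e'

        fuse-good : Good S
        fuse-good = row-off⇒good (respects (λ v e → trans (sym (⊕-cancel e₁ _)) (cong (e₁ ⊕_) e)) (λ v e → cong (e₁ ⊕_) e)
          (image {Row e₁} (shift (e₁ , 0#)) (sh∈ _) row-e₁))

      module Split (¬fused : ¬ Fused) where

        same : ∀ x x' y → x ≢ 0ᴮ → x' ≢ 0ᴮ → proj₂ (to q (x , y)) ≡ proj₂ (to q (x' , y))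
        same x x' y n n' = decidable-stable (_ ≟ᶠ _) λ ne → ¬fused (x , x' , y , n , n' , ne)

        off-0 : ∀ x y → x ≢ 0ᴮ → proj₂ (to q (x , y)) ≡ y + - D
        off-0 x y n = trans (same x e₁ y n (λ ())) (cong proj₂ (q1 y))

        D≡0 : D ≡ 0#
        D≡0 = decidable-stable (D ≟ᶠ 0#) λ ne → double≢0 ne (twice (trans (sym level₂) (cong proj₂ (q-invol (e₂ , 0#)))))
          where
          e₂≢e₁ : e₂ ≢ e₁
          e₂≢e₁ ()
          level₂ : proj₂ (to q (to q (e₂ , 0#))) ≡ (0# + - D) + - D
          level₂ = trans (off-0 (proj₁ (to q (e₂ , 0#))) (proj₂ (to q (e₂ , 0#))) (e₂≢e₁ ∘ q-row-0 {e₂ , 0#}))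
            (cong (_+ - D) (off-0 e₂ 0# (λ ())))
          twice : (0# + - D) + - D ≡ 0# → D + D ≡ 0#
          twice e = trans (solve 1 (λ d → d :+ d := :- ((con (0 , 0) :+ :- d) :+ :- d)) refl D)
            (trans (cong -_ e) (solve 0 (:- con (0 , 0) := con (0 , 0)) refl))

        q-lev : Lev q
        q-lev = lev λ (x , y) → go x y (x ≟ᴮ 0ᴮ)
          where
          go : ∀ x y → Dec (x ≡ 0ᴮ) → proj₂ (to q (x , y)) ≡ y
          go x y (no n)     = trans (off-0 x y n) (trans (cong (λ t → y + - t) D≡0) (solve 1 (λ y → y :+ :- con (0 , 0) := y) refl y))
          go _ y (yes refl) = trans (cong proj₂ (q0 y)) (trans (cong (y +_) D≡0) (+-identityʳ y))

        Q : F → Perm B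
        Q y = restrict q q-lev y

        q-at : ∀ x y → to q (x , y) ≡ (to (Q y) x , y)
        q-at x y = at-level q-lev x y

        Q-invol : ∀ y x → to (Q y) (to (Q y) x) ≡ x
        Q-invol y x = cong proj₁ (trans (cong (to q) (sym (q-at x y))) (q-invol (x , y)))

        f : B
        f = to (Q 0#) e₂

        f-general : ¬ Special f
        f-general (inj₁ e)        = bad (q-row-0 {e₂ , 0#} e)
          where
          bad : ¬ (e₂ ≡ e₁)
          bad ()
        f-general (inj₂ (inj₁ e)) = bad (q-row-e₁ {e₂ , 0#} e)
          where
          bad : ¬ (e₂ ≡ 0ᴮ)
          bad ()
        f-general (inj₂ (inj₂ e)) = q-free (e₂ , 0#) (trans (q-at e₂ 0#) (cong (_, 0#) e))

        Q-e₂ : ∀ y → to (Q y) e₂ ≡ iter σ (toℕ (index y)) f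
        Q-e₂ y = cong proj₁ (trans (cong (to q) (sym (trans (g-reaches s2 y 0#) (cong (e₂ ,_) (+-identityʳ y)))))
          (trans (q-iter j _) (trans (cong (iter (to g) j) (q-at e₂ 0#)) (g-iter j f 0#))))
          where
          j : ℕ
          j = toℕ (index y)

        Q-differs : ∀ {y} → y ≢ 0# → to (Q y) e₂ ≢ f
        Q-differs {y} ne e = f-general (fixed-special f (small-fixed {toℕ (index y)} {f} (positive (index y) index≢0)
            (FinP.toℕ<n (index y)) (trans (sym (Q-e₂ y)) e)))
          where
          open Counting.Cyclic (≡P.decSetoid _≟ᴮ_) pr σ (cong σ) period
          index≢0 : toℕ (index y) ≢ 0
          index≢0 d = ne (trans (sym (index-mean y)) (trans (cong (λ t → ⟦ t ⟧ * mean) d) (zeroˡ mean)))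
          positive : ∀ k → toℕ k ≢ 0 → 0 ℕ.< toℕ k
          positive k n = ℕP.n≢0⇒n>0 n

        mover : ∀ {a y} → y ≢ a → Mover (_≡ a) y
        mover {a} {y} ne = record
          { k = shift (0ᴮ , a) ∙ w ∙ shift (0ᴮ , - a)
          ; k∈ = moved∈
          ; k-lev = lev λ (x , t) → trans (cong (λ l → a + l) (level q-lev (to (Q 0#) (0ᴮ ⊕ x) , - a + t))) (+-cancelˡ' a t)
          ; fixes = λ { _ refl x → trans (moved x a) (cong (_, a) (trans (cong (λ t → to (Q t) (to (Q 0#) x)) (-‿inverseˡ a)) (Q-invol 0# x))) }
          ; x₀ = f ; x₁ = to (Q (- a + y)) e₂ ; x₀≢x₁ = Q-differs apart ∘ sym
          ; moves = trans (moved f y) (cong (λ t → to (Q (- a + y)) t , y) (Q-invol 0# e₂)) }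
          where
          w : Perm V
          w = q ∙ liftᴮ (Q 0#)
          w∈ : mem w
          w∈ = ∙∈ {q} {liftᴮ (Q 0#)} q∈ (lift∈ (Q 0#))
          moved∈ : mem (shift (0ᴮ , a) ∙ w ∙ shift (0ᴮ , - a))
          moved∈ = ∙∈ {shift (0ᴮ , a)} {w ∙ shift (0ᴮ , - a)} (sh∈ (0ᴮ , a)) (∙∈ {w} {shift (0ᴮ , - a)} w∈ (sh∈ (0ᴮ , - a)))
          moved : ∀ x t → to (shift (0ᴮ , a) ∙ w ∙ shift (0ᴮ , - a)) (x , t) ≡ (to (Q (- a + t)) (to (Q 0#) x) , t)
          moved x t = trans (cong (to (shift (0ᴮ , a))) (trans (cong (λ r → to q (to (Q 0#) r , - a + t)) (⊕-identityˡ x)) (q-at (to (Q 0#) x) (- a + t))))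
            (cong₂ _,_ (⊕-identityˡ _) (+-cancelˡ' a t))
          apart : - a + y ≢ 0#
          apart e = ne (trans (solve 2 (λ a y → y := a :+ (:- a :+ y)) refl a y) (trans (cong (a +_) e) (+-identityʳ a)))

        levels∈ : ∀ f → Lev f → mem f
        levels∈ = level-preserving∈ mover

      fused-or-levels : Good S ⊎ (∀ f → Lev f → mem f)
      fused-or-levels = go fused?
        where
        go : Dec Fused → Good S ⊎ (∀ f → Lev f → mem f)
        go (yes (x , x' , y , n , n' , d)) = inj₁ (Fuse.fuse-good n n' d)
        go (no ¬f) = inj₂ (Split.levels∈ ¬f)

module LevelAlign where

  open import Data.Nat as ℕ using (ℕ; zero; suc)
  open import Data.Nat.DivMod using (_%_; _/_; m≡m%n+[m/n]*n)
  open import Data.Nat.Primality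
  open import Data.Nat.Divisibility using (_∣?_)
  open import Data.Fin using (zero; suc; toℕ)
  open import Data.Product hiding (map; swap)
  open import Data.Sum using (_⊎_; inj₁; inj₂)
  open import Data.Empty
  open import Function using (_∘_)
  open import Relation.Nullary
  open import Relation.Nullary.Decidable using (map′; from-no; decidable-stable)
  open import Relation.Binary.PropositionalEquality hiding (resp)
  import Relation.Binary.PropositionalEquality.Properties as ≡P
  open Count
  open Perms
  open Space
  open Stage2 using (module Normalise)
  open Shifts
  open Cycles
  open Sylow using (coset-alternative)
  open Transitive
  open Moving
  open Constant
  open Levels
  open Involution

  open Swap _≟ᴮ_

  module LevelMaps (pr : Prime 5) where
    open Space.Space 4 pr
    open Preserving pr

    record LevelAffine (k : Perm V) : Set where
      constructor levelAffine
      field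
        a b : F
        leq : ∀ x y → proj₂ (to k (x , y)) ≡ a * y + b

    levelAffine-resp : ∀ {k l} → k ≗ₚ l → LevelAffine k → LevelAffine l
    levelAffine-resp e (levelAffine a b leq) = levelAffine a b λ x y → trans (cong proj₂ (sym (at e _))) (leq x y)

    levelAffine-∙ : ∀ {k l} → LevelAffine k → LevelAffine l → LevelAffine (k ∙ l)
    levelAffine-∙ {k} {l} (levelAffine a b leq) (levelAffine a' b' leq') = levelAffine (a * a') (a * b' + b) λ x y →
      trans (leq (proj₁ (to l (x , y))) (proj₂ (to l (x , y)))) (trans (cong (λ t → a * t + b) (leq' x y))
        (solve 5 (λ a a' y b' b → a :* (a' :* y :+ b') :+ b := (a :* a') :* y :+ (a :* b' :+ b)) refl a a' y b' b))

    slope≢0 : ∀ {k} (L : LevelAffine k) → LevelAffine.a L ≢ 0#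
    slope≢0 {k} (levelAffine a b leq) e = 1≢0 (trans (solve 2 (λ b o → o := (b :+ o) :+ :- b) refl b 1#)
        (trans (cong (_+ - b) (trans (sym (cong proj₂ (to-from k (0ᴮ , b + 1#)))) (flat (from k (0ᴮ , b + 1#))))) (-‿inverseʳ b)))
      where
      flat : ∀ v → proj₂ (to k v) ≡ b
      flat (x , y) = trans (leq x y) (trans (cong (λ t → t * y + b) e) (trans (cong (_+ b) (zeroˡ y)) (+-identityˡ b)))

    levelAffine-⁻¹ : ∀ {k} → LevelAffine k → LevelAffine (k ⁻¹)
    levelAffine-⁻¹ {k} L@(levelAffine a b leq) = levelAffine i (- (i * b)) λ x y →
        undo (proj₁ (from k (x , y))) (proj₂ (from k (x , y))) y (cong proj₂ (to-from k (x , y)))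
      where
      i : F
      i = proj₁ (inv (slope≢0 L))
      undo : ∀ x' y' y → proj₂ (to k (x' , y')) ≡ y → y' ≡ i * y + - (i * b)
      undo x' y' y e = trans (trans (sym (*-identityˡ y')) (cong (_* y') (sym (proj₂ (inv (slope≢0 L))))))
        (trans (solve 4 (λ i a y b → (i :* a) :* y := i :* (a :* y :+ b) :+ :- (i :* b)) refl i a y' b)
          (cong (λ t → i * t + - (i * b)) (trans (sym (leq x' y')) e)))

    levelAffine? : ∀ k → Dec (LevelAffine k)
    levelAffine? k = map′ (λ h → levelAffine a₀ b₀ λ x y → h (x , y)) back
        (FinV.∀? λ v → proj₂ (to k v) ≟ᶠ (a₀ * proj₂ v + b₀))
      where
      a₀ b₀ : F
      b₀ = proj₂ (to k (0ᴮ , 0#))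
      a₀ = proj₂ (to k (0ᴮ , 1#)) + - b₀
      back : LevelAffine k → ∀ v → proj₂ (to k v) ≡ a₀ * proj₂ v + b₀
      back (levelAffine a b leq) (x , y) = trans (leq x y)
        (trans (solve 3 (λ a y b → a :* y :+ b := (a :* con (1 , 0) :+ b :+ :- (a :* con (0 , 0) :+ b)) :* y :+ (a :* con (0 , 0) :+ b)) refl a y b)
          (cong₂ (λ s t → (s + - t) * y + t) (sym (leq 0ᴮ 1#)) (sym (leq 0ᴮ 0#))))

    lev⇒affine : ∀ {k} → Lev k → LevelAffine k
    lev⇒affine a = levelAffine 1# 0# λ x y → trans (level a (x , y)) (solve 1 (λ y → y := con (1 , 0) :* y :+ con (0 , 0)) refl y)

    LevelAffineGroup : Group V
    LevelAffineGroup = record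
      { mem = LevelAffine ; mem? = levelAffine? ; resp = levelAffine-resp ; id∈ = lev⇒affine (lev λ _ → refl)
      ; ∙∈ = levelAffine-∙ ; ⁻¹∈ = levelAffine-⁻¹ }

    iter-split : ∀ {A : Set} (f : A → A) i j x → iter f (i ℕ.+ j) x ≡ iter f i (iter f j x)
    iter-split f zero    j x = refl
    iter-split f (suc i) j x = cong f (iter-split f i j x)

    module Conjugate (K : Perm V) (L : LevelAffine (K ⁻¹ ∙ z ∙ K)) where
      open LevelAffine L

      κ : Perm V
      κ = K ⁻¹ ∙ z ∙ K

      κ-period : ∀ v → iter (to κ) 5 v ≡ v
      κ-period = Stage1.conj-period 4 pr K

      -- A level fixed by κ would carry a permutation of order five without fixed points, but five does not divide eight.
      no-fixed-level : ∀ y → a * y + b ≢ y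
      no-fixed-level y e = go (some-fixed allᴮ-distinct (λ {x} _ → ∈allᴮ _) (from-no (5 ∣? 8)))
        where
        f : B → B
        f x = proj₁ (to κ (x , y))
        κ-f : ∀ x → to κ (x , y) ≡ (f x , y)
        κ-f x = cong (f x ,_) (trans (leq x y) e)
        f-iter : ∀ j x → iter (to κ) j (x , y) ≡ (iter f j x , y)
        f-iter zero    x = refl
        f-iter (suc j) x = trans (cong (to κ) (f-iter j x)) (κ-f _)
        open Counting.Cyclic (≡P.decSetoid _≟ᴮ_) pr f (cong f) (λ x → cong proj₁ (trans (sym (f-iter 5 x)) (κ-period (x , y))))
        go : (∃ λ x → _ × f x ≡ x) → ⊥
        go (x , _ , d) = Stage1.conj-free 4 pr K (x , y) (trans (κ-f x) (cong (_, y) d))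

      a≡1 : a ≡ 1#
      a≡1 = decidable-stable (a ≟ᶠ 1#) λ ne → let (i , id) = inv (d≢0 ne) in no-fixed-level (i * b) (fixed i id)
        where
        d≢0 : a ≢ 1# → 1# + - a ≢ 0#
        d≢0 ne e = ne (trans (solve 1 (λ m → m := con (1 , 0) :+ :- (con (1 , 0) :+ :- m)) refl a)
          (trans (cong (λ t → 1# + - t) e) (solve 0 (con (1 , 0) :+ :- con (0 , 0) := con (1 , 0)) refl)))
        fixed : ∀ i → i * (1# + - a) ≡ 1# → a * (i * b) + b ≡ i * b
        fixed i id = trans (cong (a * (i * b) +_) (trans (sym (*-identityˡ b)) (cong (_* b) (sym id))))
          (solve 3 (λ m i c → m :* (i :* c) :+ i :* (con (1 , 0) :+ :- m) :* c := i :* c) refl a i b)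

      κ-level : ∀ v → proj₂ (to κ v) ≡ b + proj₂ v
      κ-level (x , y) = trans (leq x y) (trans (cong (λ t → t * y + b) a≡1) (solve 2 (λ y b → con (1 , 0) :* y :+ b := b :+ y) refl y b))

      b≢0 : b ≢ 0#
      b≢0 e = no-fixed-level 0# (trans (cong₂ (λ s t → s * 0# + t) a≡1 e) (solve 0 (con (1 , 0) :* con (0 , 0) :+ con (0 , 0) := con (0 , 0)) refl))

      level-iter : ∀ j v → proj₂ (iter (to κ) j v) ≡ ⟦ j ⟧ * b + proj₂ v
      level-iter zero    v = solve 2 (λ b y → y := con (0 , 0) :* b :+ y) refl b (proj₂ v)
      level-iter (suc j) v = trans (κ-level _) (trans (cong (b +_) (level-iter j v))
        (trans (solve 3 (λ b j y → b :+ (j :* b :+ y) := (con (1 , 0) :+ j) :* b :+ y) refl b ⟦ j ⟧ (proj₂ v))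
          (cong (λ t → t * b + proj₂ v) (sym (⟦+⟧ 1 j)))))

      iter-mod : ∀ j v → iter (to κ) j v ≡ iter (to κ) (toℕ ⟦ j ⟧) v
      iter-mod j v = trans (cong (λ t → iter (to κ) t v) (trans (m≡m%n+[m/n]*n j 5) (cong (ℕ._+ j / 5 ℕ.* 5) (sym (toℕ-⟦⟧ j)))))
        (trans (iter-split (to κ) (toℕ ⟦ j ⟧) _ v) (cong (iter (to κ) (toℕ ⟦ j ⟧)) (wraps (j / 5))))
        where
        wraps : ∀ m → iter (to κ) (m ℕ.* 5) v ≡ v
        wraps zero    = refl
        wraps (suc m) = trans (iter-split (to κ) 5 (m ℕ.* 5) v) (trans (κ-period _) (wraps m))

      steps : F → ℕ
      steps y = toℕ (y * proj₁ (inv b≢0))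

      steps-b : ∀ y → ⟦ steps y ⟧ * b ≡ y
      steps-b y = trans (cong (_* b) (⟦toℕ⟧ _)) (trans (*-assoc y _ _) (trans (cong (y *_) (proj₂ (inv b≢0))) (*-identityʳ y)))

      from-iter : ∀ j v → iter (from κ) j (iter (to κ) j v) ≡ v
      from-iter zero    v = refl
      from-iter (suc j) v = trans (cong (from κ) (sym (commutes j _))) (trans (from-to κ _) (from-iter j v))
        where
        commutes : ∀ j w → to κ (iter (from κ) j w) ≡ iter (from κ) j (to κ w)
        commutes zero    w = refl
        commutes (suc j) w = trans (to-from κ _) (trans (sym (from-to κ _)) (cong (from κ) (commutes j w)))

      to-iter : ∀ j v → iter (to κ) j (iter (from κ) j v) ≡ v
      to-iter zero    v = refl
      to-iter (suc j) v = trans (cong (to κ) (sym (commutes j _))) (trans (to-from κ _) (to-iter j v))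
        where
        commutes : ∀ j w → from κ (iter (to κ) j w) ≡ iter (to κ) j (from κ w)
        commutes zero    w = refl
        commutes (suc j) w = trans (from-to κ _) (trans (sym (to-from κ _)) (cong (to κ) (commutes j w)))

      level-from : ∀ j v → proj₂ v ≡ ⟦ j ⟧ * b → proj₂ (iter (from κ) j v) ≡ 0#
      level-from j v e = trans (solve 2 (λ s t → s := :- t :+ (t :+ s)) refl _ (⟦ j ⟧ * b))
        (trans (cong (- (⟦ j ⟧ * b) +_) (trans (sym (level-iter j (iter (from κ) j v))) (trans (cong proj₂ (to-iter j v)) e))) (-‿inverseˡ _))

      s-to s-from : V → V
      s-to (x , y) = iter (to κ) (steps y) (x , 0#)
      s-from (x , y) = proj₁ (iter (from κ) (steps y) (x , y)) , y

      s-level : ∀ v → proj₂ (s-to v) ≡ proj₂ v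
      s-level (x , y) = trans (level-iter (steps y) (x , 0#)) (trans (+-identityʳ _) (steps-b y))

      abstract
        s-inverse : ∀ v → s-to (s-from v) ≡ v
        s-inverse (x , y) = trans (cong (λ t → iter (to κ) (steps y) (proj₁ (iter (from κ) (steps y) (x , y)) , t))
          (sym (level-from (steps y) (x , y) (sym (steps-b y))))) (to-iter (steps y) (x , y))

        s-inverse' : ∀ v → s-from (s-to v) ≡ v
        s-inverse' (x , y) = trans (cong (λ t → proj₁ (iter (from κ) (steps t) (proj₁ (s-to (x , y)) , t)) , t) (s-level (x , y)))
          (trans (cong (λ t → proj₁ (iter (from κ) (steps y) (proj₁ (s-to (x , y)) , t)) , y) (sym (s-level (x , y))))
            (cong (λ v → proj₁ v , y) (from-iter (steps y) (x , 0#))))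

      s : Perm V
      s = perm s-to s-from s-inverse s-inverse'

      s-lev : Lev s
      s-lev = lev s-level

      steps-suc : ∀ y → steps (b + y) ≡ toℕ ⟦ suc (steps y) ⟧
      steps-suc y = cong toℕ (trans (trans (solve 3 (λ b y i → (b :+ y) :* i := i :* b :+ y :* i) refl b y (proj₁ (inv b≢0)))
        (cong₂ _+_ (proj₂ (inv b≢0)) (sym (⟦toℕ⟧ _)))) (sym (⟦+⟧ 1 (steps y))))

      s-step : ∀ x y → to s (x , b + y) ≡ to κ (to s (x , y))
      s-step x y = trans (cong (λ j → iter (to κ) j (x , 0#)) (steps-suc y)) (sym (iter-mod (suc (steps y)) (x , 0#)))

      straightened : RowAffine (K ∙ s)
      straightened = Stage1.straight⇒affine 4 pr (K ∙ s) (λ _ → b) (λ _ → b≢0) λ x y →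
        trans (cong (to K) (s-step x y)) (to-from K _)

  module LevelAligned (pr : Prime 5) (S : Space.Space.Instance 4 pr) where
    open Space.Space 4 pr
    open Instance S
    open RowShifts 4 pr S
    open Normalise 4 pr using (liftᴮ)
    open Preserving pr
    open LevelMaps pr

    module _ (levels∈ : ∀ f → Lev f → mem f) (only-constants : ∀ u → T u → ∀ x x' → u x ≡ u x') where

      lift-lev : ∀ ρ → Lev (liftᴮ ρ)
      lift-lev ρ = lev λ _ → refl

      row-affine⇒level-affine : ∀ {k} → mem k → RowAffine k → LevelAffine k
      row-affine⇒level-affine {k} k∈ R = levelAffine (m 0ᴮ) (c 0ᴮ) λ x y →
          trans (cong proj₂ (eq x y)) (cong₂ (λ s t → s * y + t) (m-const x) (c-const x 0ᴮ))
        where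
        open RowAffine R
        σₚ : Perm B
        σₚ = rowPerm R
        -- Comparing k with its composites by row permutations gives row shifts.
        w : Perm B → B → F
        w ρ x = proj₁ (inv (mult≢0 R x)) * (c (to ρ x) + - c x)
        m-const : ∀ x → m x ≡ m 0ᴮ
        m-const x = Odd.mult-invariant (MovingRows.2≢0 pr S) R k∈ x 0ᴮ λ (u , Tu , ne) → ne (only-constants u Tu x 0ᴮ)
        T-w : ∀ ρ → T (w ρ)
        T-w ρ = resp (pt λ (x , y) → from-≡ k (trans (eq x _) (sym (trans (cong (to (liftᴮ (σₚ ∙ ρ ⁻¹ ∙ σₚ ⁻¹))) (eq (to ρ x) y))
              (cong₂ _,_ (trans (cong (σ ∘ from ρ) (from-to σₚ (to ρ x))) (cong σ (from-to ρ x)))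
                (trans (cong₂ (λ s t → s * y + t) (trans (m-const (to ρ x)) (sym (m-const x))) refl) (absorb x (c (to ρ x)) y)))))))
          (∙∈ {k ⁻¹} {liftᴮ (σₚ ∙ ρ ⁻¹ ∙ σₚ ⁻¹) ∙ k ∙ liftᴮ ρ} (⁻¹∈ k∈)
            (∙∈ {liftᴮ (σₚ ∙ ρ ⁻¹ ∙ σₚ ⁻¹)} {k ∙ liftᴮ ρ} (levels∈ _ (lift-lev (σₚ ∙ ρ ⁻¹ ∙ σₚ ⁻¹))) (∙∈ {k} {liftᴮ ρ} k∈ (levels∈ _ (lift-lev ρ)))))
          where
          absorb : ∀ x c' y → m x * y + c' ≡ m x * (proj₁ (inv (mult≢0 R x)) * (c' + - c x) + y) + c x
          absorb x c' y = sym (trans (solve 5 (λ m i c' c y → m :* (i :* (c' :+ :- c) :+ y) :+ c := (i :* m) :* (c' :+ :- c) :+ (m :* y :+ c)) refl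
              (m x) (proj₁ (inv (mult≢0 R x))) c' (c x) y)
            (trans (cong (λ t → t * (c' + - c x) + (m x * y + c x)) (proj₂ (inv (mult≢0 R x))))
              (solve 3 (λ a c' c → con (1 , 0) :* (c' :+ :- c) :+ (a :+ c) := a :+ c') refl (m x * y) c' (c x))))
        c-const : ∀ x x' → c x ≡ c x'
        c-const x x' = go (avoid x x' x x)
          where
          ρ : Perm B
          ρ = swap x x'
          go : ∃ (Avoids x x' x x) → c x ≡ c x'
          go (t , t≢x , t≢x' , _) = sym (trans (solve 2 (λ a b → a := (a :+ :- b) :+ b) refl (c x') (c x))
              (trans (cong (_+ c x) vanishes) (+-identityˡ (c x))))
            where
            at-t : w ρ t ≡ 0#
            at-t = trans (cong (λ r → proj₁ (inv (mult≢0 R t)) * (c r + - c t)) (sw-other t≢x t≢x'))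
              (trans (cong (proj₁ (inv (mult≢0 R t)) *_) (-‿inverseʳ (c t))) (zeroʳ _))
            at-x : proj₁ (inv (mult≢0 R x)) * (c x' + - c x) ≡ 0#
            at-x = trans (cong (λ r → proj₁ (inv (mult≢0 R x)) * (c r + - c x)) (sym (sw-a x x')))
              (trans (only-constants (w ρ) (T-w ρ) x t) at-t)
            vanishes : c x' + - c x ≡ 0#
            vanishes = trans (sym (*-identityˡ _)) (trans (cong (_* (c x' + - c x)) (sym (trans (*-comm (m x) _) (proj₂ (inv (mult≢0 R x))))))
              (trans (*-assoc (m x) _ _) (trans (cong (m x *_) at-x) (zeroʳ (m x)))))

      Alternative : Set
      Alternative = (∃ λ k → mem k × LevelAffine (k ⁻¹ ∙ (φ ⁻¹ ∙ z ∙ φ) ∙ k)) ⊎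
                    (∃ λ k → mem k × ¬ LevelAffine k × LevelAffine (k ⁻¹ ∙ z ∙ k))

      alternative : Alternative
      alternative = coset-alternative _≟ⱽ_ allⱽ ∈allⱽ A LevelAffineGroup pr z (φ ⁻¹ ∙ z ∙ φ) (sh∈ (0ᴮ , 1#)) (sh'∈ (0ᴮ , 1#))
        (Stage1.z-period 4 pr) (Stage1.conj-period 4 pr φ)
        (levelAffine 1# 1# λ x y → solve 2 (λ o y → o :+ y := con (1 , 0) :* y :+ o) refl 1# y)

      level-aligned : Stage1.Aligned 4 pr S
      level-aligned = go alternative
        where
        go : Alternative → Stage1.Aligned 4 pr S
        go (inj₁ (k , k∈ , levelAffine a b leq)) = k ∙ C.s , ∙∈ {k} {C.s} k∈ (levels∈ C.s C.s-lev) ,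
            rowAffine-resp (pt λ _ → refl) C.straightened
          where module C = Conjugate (φ ∙ k) (levelAffine a b leq)
        go (inj₂ (k , k∈ , ¬L , L)) = ⊥-elim (¬L (levelAffine-resp (pt λ v → cong (to k) (to-from C.s v))
            (levelAffine-∙ {k ∙ C.s} {C.s ⁻¹} (row-affine⇒level-affine (∙∈ {k} {C.s} k∈ (levels∈ C.s C.s-lev)) C.straightened)
              (lev⇒affine (lev-⁻¹ {C.s} C.s-lev)))))
          where module C = Conjugate k L

open import Data.Nat as ℕ using (ℕ; suc; s≤s; z≤n)
import Data.Nat.Properties as ℕP
open import Data.Nat.DivMod using (m<n⇒m%n≡m)
open import Data.Nat.Primality using (Prime; prime[2]; ¬prime[0]; ¬prime[1]; prime?)
open import Data.Fin using (toℕ)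
open import Data.Product
open import Data.Sum using ([_,_]′)
open import Data.Empty
open import Function using (mk⇔; _∘_)
open import Relation.Nullary
open import Relation.Nullary.Decidable using (from-no)
open import Relation.Binary.PropositionalEquality hiding (resp)
open Perms
open Space
open Stage2 using (module Normalise)
open Shifts
open Cycles
open OddFinal using (module Final)
open TwoCase using (two-good)
open Reduce using (module Reduction)
open Counter
open Moving
open Constant
open Involution
open LevelAlign

module OddPrime (n : ℕ) (pr : Prime (suc n)) (2<p : 2 ℕ.< suc n) where
  open Space.Space n pr

  1+1≢0 : 1# + 1# ≢ 0#
  1+1≢0 e = impossible (trans (sym (m<n⇒m%n≡m 2<p)) (trans (sym (toℕ-⟦⟧ 2)) (trans (cong toℕ (trans (⟦+⟧ 1 1) e)) (toℕ-⟦⟧ 0))))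
    where
    impossible : ¬ (2 ≡ 0)
    impossible ()

  aligned-good : ∀ S → Stage1.Aligned n pr S → Good S
  aligned-good S (k , k∈ , R) =
    let (S' , nf , back) = Normalise.normalise n pr (right S k k∈) R in
    good-right S k k∈ (back (Final.Assemble.normal-good n pr 1+1≢0 S' nf))

module Five (pr : Prime 5) where
  open Space.Space 4 pr
  open OddPrime 4 pr (s≤s (s≤s (s≤s z≤n)))
  open Normalise 4 pr using (liftᴮ; hol-lift)

  standard-good : ∀ S ψ (ψ∈ : ∀ v → Instance.mem S (ψ ⁻¹ ∙ shift v ∙ ψ)) (R : RowAffine (ψ ⁻¹ ∙ z ∙ ψ)) →
                  Standard (RowAffine.σ R) → Good S
  standard-good S ψ ψ∈ R std = [ MovingRows.Given.separated⇒good pr S ψ ψ∈ R std , constant ]′ (MovingRows.Given.separated pr S ψ ψ∈ R std)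
    where
    constant : (∀ u → RowShifts.T 4 pr S u → ∀ x x' → u x ≡ u x') → Good S
    constant oc = [ (λ good → good) , (λ levels → aligned-good S (LevelAligned.level-aligned pr S levels oc)) ]′
      (Involutive.Given₂.fused-or-levels pr S ψ ψ∈ R std oc)

  moving-good : ∀ S → Stage1.RowMoving 4 pr S → Good S
  moving-good S (ψ , ψ∈ , R , x , ne) = good-both S β h (standard-good (both S β h) (ψ ∙ β) ψ'∈ R' std)
    where
    open RowAffine R
    open Instance S
    per = Stage1.row-period 4 pr ψ R
    θ' : Perm B
    θ' = FiveCycle.θ pr (rowPerm R) per ne
    β : Perm V
    β = liftᴮ θ'
    h : Hol β
    h = hol-lift θ' (FiveCycle.θ-translating pr (rowPerm R) per ne)
    ψ'∈ : ∀ v → Instance.mem (both S β h) ((ψ ∙ β) ⁻¹ ∙ shift v ∙ (ψ ∙ β))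
    ψ'∈ v = resp (pt λ w → sym (trans (to-from β _) (cong (λ u → from ψ (to (shift v) (to ψ u))) (to-from β w)))) (ψ∈ v)
    R' : RowAffine ((ψ ∙ β) ⁻¹ ∙ z ∙ (ψ ∙ β))
    R' = rowAffine (from θ' ∘ σ ∘ to θ') (m ∘ to θ') (c ∘ to θ') λ x y → cong (from β) (eq (to θ' x) y)
    std : Standard (from θ' ∘ σ ∘ to θ')
    std = FiveCycle.θ-standard pr (rowPerm R) per ne

  five-good : ∀ S → Good S
  five-good S = [ aligned-good S , moving-good S ]′ (Stage1.align-rows 4 pr S)

large-CI : ∀ n → Prime (suc n) → 8 ℕ.< suc n → IsCI-ColorTernary (suc n)
large-CI n pr 8<p = Reduction.good⇒CI n pr λ S →
  OddPrime.aligned-good n pr (ℕP.≤-trans (s≤s (s≤s (s≤s z≤n))) 8<p) S (Stage1.align-rows-large n pr 8<p S)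

theoremA : (p : ℕ) → Prime p → (IsCI-ColorTernary p ⇔ ((p ≢ 3) × (p ≢ 7)))
theoremA p pr = mk⇔
    (λ ci → (λ { refl → Three.not-CI-3 ci }) , (λ { refl → Seven.not-CI-7 ci }))
    (λ (n3 , n7) → CI p pr n3 n7)
  where
  CI : ∀ p → Prime p → p ≢ 3 → p ≢ 7 → IsCI-ColorTernary p
  CI 0 pr _  _  = ⊥-elim (¬prime[0] pr)
  CI 1 pr _  _  = ⊥-elim (¬prime[1] pr)
  CI 2 pr _  _  = Reduction.good⇒CI 1 prime[2] two-good
  CI 3 pr n3 _  = ⊥-elim (n3 refl)
  CI 4 pr _  _  = ⊥-elim (from-no (prime? 4) pr)
  CI 5 pr _  _  = Reduction.good⇒CI 4 pr (Five.five-good pr)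
  CI 6 pr _  _  = ⊥-elim (from-no (prime? 6) pr)
  CI 7 pr _  n7 = ⊥-elim (n7 refl)
  CI 8 pr _  _  = ⊥-elim (from-no (prime? 8) pr)
  CI (suc (suc (suc (suc (suc (suc (suc (suc (suc k))))))))) pr _ _ = large-CI _ pr (ℕP.m≤m+n 9 k)
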